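{- Let $r\geq 3$. Every quasi-linear, head-tail-mixing $r$-graph $F$ which admits the descriptive sequence $X X\cdots X Z Z Y Y\cdots Y$ (consisting of $r-2$ letters $X$, followed by two letters $Z$, followed by $r-2$ letters $Y$) satisfies $\pi_u(F)=1/4$.
   Context: An $r$-graph is an $r$-uniform hypergraph. For an $r$-graph $H$ and $S\subseteq V(H)$, $e(S)$ is the number of edges of $H$ inside $S$. $H$ is $(d,\varepsilon)$-dense if every $S\subseteq V(H)$ with $|S|\geq\varepsilon|V(H)|$ has $e(S)\geq(d-\varepsilon)\binom{|S|}{r}$. A sequence $(H_n)$ of $r$-graphs is locally $d$-dense if there are $\varepsilon_n\to0$ with each $H_n$ $(d,\varepsilon_n)$-dense and $|V(H_n)|\to\infty$. $\pi_u(F)$ is the maximum $d$ such that some locally $d$-dense sequence of $r$-graphs avoids $F$ as a subgraph. A hypergraph $H$ is quasi-linear if for every edge $e$ there is a unique other edge $f$ (its twin) with $|e\cap f|=2$, and every edge $f'\notin\{e,f\}$ satisfies $|e\cap f'|\leq1$. A descriptive sequence of order $k$ is a sequence $\sigma=(s_1,\dots,s_{2k-2})$ over $\{X,Y,Z\}$ with exactly $k-2$ letters $X$, $k-2$ letters $Y$ and two letters $Z$. Given a linearly ordered vertex set and two edges $e,f$ with $|e\cap f|=2$ and $|e|=|f|=k$, sort $e\cup f$ as $w_1\prec\dots\prec w_{2k-2}$; $\sigma$ describes $\{e,f\}$ if either ($s_i=X$ iff $w_i\in e\setminus f$, $s_i=Y$ iff $w_i\in f\setminus e$, $s_i=Z$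 iff $w_i\in e\cap f$) or the same holds with $e$ and $f$ swapped. A quasi-linear hypergraph admits $\sigma$ if there is a linear order of its vertex set in which every twin pair of edges is described by $\sigma$. Given a linear order on the vertices, the head of an edge is the set of its two smallest vertices and its tail is the set of its two largest vertices. A hypergraph is head-tail-mixing if for every linear order of its vertex set there exist edges $e,f$ such that the head of $e$ equals the tail of $f$. -}

module Defs where

open import Data.Nat using (ℕ; zero; suc; _≤_; _<ᵇ_; _≡ᵇ_; _∸_)
open import Data.Nat.Combinatorics using (_C_)
open import Data.Bool using (Bool; true; false; _∧_; if_then_else_)
open import Data.Fin using (Fin; toℕ)
open import Data.Fin.Subset using (Subset; _∈_; _∩_; _∪_; ∣_∣)
open import Data.Vec using (Vec; []; _∷_; lookup; tabulate)
open import Data.List using (List; []; _∷_; [_]; map; _++_; allFin; replicate; length; filter)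
open import Data.Bool.ListAction using (any)
open import Data.Maybe using (Maybe; just; nothing)
import Data.Sum
open import Data.Product using (Σ; _×_; ∃; ∃-syntax; _,_)
open import Data.Integer using (+_)
open import Data.Rational using (ℚ; 0ℚ; _/_; _*_; _-_) renaming (∣_∣ to ∣_∣ℚ; _≤_ to _≤ℚ_; _<_ to _<ℚ_)
open import Relation.Binary.PropositionalEquality using (_≡_; _≢_)
open import Relation.Nullary using (¬_)
open import Function.Definitions using (Injective)

record Hypergraph (n r : ℕ) : Set where
  field
    edge    : Subset n → Bool
    uniform : ∀ e → edge e ≡ true → ∣ e ∣ ≡ r
open Hypergraph public

IsEdge : ∀ {n r} → Hypergraph n r → Subset n → Set
IsEdge H e = edge H e ≡ true

allSubsets : (n : ℕ) → List (Subset n)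
allSubsets zero    = [ [] ]
allSubsets (suc n) = map (true ∷_) (allSubsets n) ++ map (false ∷_) (allSubsets n)

_⊆ᵇ_ : ∀ {n} → Subset n → Subset n → Bool
[]          ⊆ᵇ []       = true
(true  ∷ p) ⊆ᵇ (b ∷ q)  = b ∧ (p ⊆ᵇ q)
(false ∷ p) ⊆ᵇ (_ ∷ q)  = p ⊆ᵇ q

countᵇ : ∀ {A : Set} → (A → Bool) → List A → ℕ
countᵇ p []       = 0
countᵇ p (x ∷ xs) = if p x then suc (countᵇ p xs) else countᵇ p xs

edgesIn : ∀ {n r} → Hypergraph n r → Subset n → ℕ
edgesIn {n} H S = countᵇ (λ T → (T ⊆ᵇ S) ∧ edge H T) (allSubsets n)

ℕ→ℚ : ℕ → ℚ
ℕ→ℚ m = + m / 1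

Dense : ∀ {n r} → Hypergraph n r → ℚ → ℚ → Set
Dense {n} {r} H d ε =
  ∀ (S : Subset n) → ε * ℕ→ℚ n ≤ℚ ℕ→ℚ ∣ S ∣ →
    (d - ε) * ℕ→ℚ (∣ S ∣ C r) ≤ℚ ℕ→ℚ (edgesIn H S)

image : ∀ {k n} → (Fin k → Fin n) → Subset k → Subset n
image {k} φ e = tabulate (λ v → any (λ u → lookup e u ∧ (toℕ (φ u) ≡ᵇ toℕ v)) (allFin k))

_⊑_ : ∀ {k n r} → Hypergraph k r → Hypergraph n r → Set
_⊑_ {k} {n} F H = Σ (Fin k → Fin n) λ φ →
  Injective _≡_ _≡_ φ × (∀ e → IsEdge F e → IsEdge H (image φ e))

record LocallyDenseFree (r : ℕ) (d : ℚ) {k : ℕ} (F : Hypergraph k r) : Set where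
  field
    size    : ℕ → ℕ
    graph   : (m : ℕ) → Hypergraph (size m) r
    eps     : ℕ → ℚ
    eps→0   : ∀ (δ : ℚ) → 0ℚ <ℚ δ → ∃[ N ] (∀ m → N ≤ m → ∣ eps m ∣ℚ ≤ℚ δ)
    size→∞  : ∀ (M : ℕ) → ∃[ N ] (∀ m → N ≤ m → M ≤ size m)
    dense   : ∀ m → Dense (graph m) d (eps m)
    free    : ∀ m → ¬ (F ⊑ graph m)

UniformTuranDensityIs : ∀ {k} (r : ℕ) → Hypergraph k r → ℚ → Set
UniformTuranDensityIs r F d =
  LocallyDenseFree r d F × (∀ (d′ : ℚ) → d <ℚ d′ → ¬ LocallyDenseFree r d′ F)

LinearOrder : ℕ → Set
LinearOrder n = Σ (Fin n → Fin n) (Injective _≡_ _≡_)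

module _ {n : ℕ} (o : LinearOrder n) where
  private
    rk : Fin n → ℕ
    rk v = toℕ (Data.Product.proj₁ o v)

  below above : Fin n → Subset n
  below v = tabulate (λ u → rk u <ᵇ rk v)
  above v = tabulate (λ u → rk v <ᵇ rk u)

  rank : Subset n → Fin n → ℕ
  rank A v = ∣ below v ∩ A ∣

  head tail : Subset n → Subset n
  head e = tabulate (λ v → lookup e v ∧ (∣ below v ∩ e ∣ <ᵇ 2))
  tail e = tabulate (λ v → lookup e v ∧ (∣ above v ∩ e ∣ <ᵇ 2))

TwinPair : ∀ {n r} → Hypergraph n r → Subset n → Subset n → Set
TwinPair H e f = IsEdge H e × IsEdge H f × e ≢ f × ∣ e ∩ f ∣ ≡ 2

QuasiLinear : ∀ {n r} → Hypergraph n r → Set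
QuasiLinear {n} H = ∀ e → IsEdge H e →
  ∃[ f ] (TwinPair H e f ×
          (∀ f′ → IsEdge H f′ → f′ ≢ e → f′ ≢ f → ∣ e ∩ f′ ∣ ≤ 1))

data Letter : Set where
  X Y Z : Letter

_!!_ : ∀ {A : Set} → List A → ℕ → Maybe A
[]       !! _     = nothing
(x ∷ xs) !! zero  = just x
(x ∷ xs) !! suc i = xs !! i

letterOf : ∀ {n} → Subset n → Subset n → Fin n → Maybe Letter
letterOf e f v with lookup e v | lookup f v
... | true  | true  = just Z
... | true  | false = just X
... | false | true  = just Y
... | false | false = nothing

count : Letter → List Letter → ℕ
count X = countᵇ (λ { X → true ; _ → false })
count Y = countᵇ (λ { Y → true ; _ → false })
count Z = countᵇ (λ { Z → true ; _ → false })

IsDescriptive : ℕ → List Letter → Set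
IsDescriptive k σ = count X σ ≡ k ∸ 2 × count Y σ ≡ k ∸ 2 × count Z σ ≡ 2

DescribesOrdered : ∀ {n} → LinearOrder n → List Letter → Subset n → Subset n → Set
DescribesOrdered o σ e f =
  ∀ v → v ∈ (e ∪ f) → σ !! rank o (e ∪ f) v ≡ letterOf e f v

Describes : ∀ {n} → LinearOrder n → List Letter → Subset n → Subset n → Set
Describes o σ e f = DescribesOrdered o σ e f Data.Sum.⊎ DescribesOrdered o σ f e

Admits : ∀ {n r} → Hypergraph n r → List Letter → Set
Admits {n} H σ = ∃[ o ] (∀ e f → TwinPair H e f → Describes o σ e f)

XZZY : ℕ → List Letter
XZZY r = replicate (r ∸ 2) X ++ Z ∷ Z ∷ replicate (r ∸ 2) Y

HeadTailMixing : ∀ {n r} → Hypergraph n r → Set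
HeadTailMixing {n} H = ∀ (o : LinearOrder n) →
  ∃[ e ] ∃[ f ] (IsEdge H e × IsEdge H f × head o e ≡ tail o f)

{-# OPTIONS --safe #-}

-- Lower bound. Colour the pairs of vertices by a Hadamard matrix (between blocks of vertices) and let the
-- edges be the r-sets whose first two vertices form a red pair and whose last two vertices form a blue pair.
-- A copy of F would order V(F) so that all heads are red and all tails are blue, contradicting head-tail
-- mixing; by Parseval's identity, every set of linear size has edge density at least 1/4 - o(1).
--
-- Upper bound. Let H be d-dense with d > 1/4. By minimising an average cost over sub-boxes one finds large
-- parts such that, for all tuples of parts, the pairs of vertices between two of the parts split into bad ones,
-- whose links are sparse, and good ones, whose links are on average dense in every sub-box of the other parts.
-- By Ramsey's theorem one of two cases occurs for all I < j < K among many parts.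
-- (a) Many pairs between the parts j are good both as tails of edges from I and as heads of edges to K. Then
-- the pairs, and after them the edges of F, can be prescribed one at a time: an edge shares at most one vertex
-- with any other edge except its twin, so the conditions imposed so far restrict its vertices independently.
-- (b) Few pairs are good in both ways. Then the proportions p of good tails and q of good heads satisfy
-- p + q ≤ 1 + o(1); a second application of Ramsey's theorem makes q constant, so all tuples of parts have
-- edge density at most p q + o(1) ≤ 1/4 + o(1), and equally large subsets of the parts span too few edges.
--
-- The minimal boxes are chosen under a double negation, which is harmless since the upper bound is a negation.

module Submission where

-- Local density says nothing about individual pairs, and every condition imposed on an embedding
-- shrinks the sets from which its vertices are chosen. So the goodness of pairs has to persist in
-- sub-boxes. All such statements carry an error measured against the volume of the whole box:
-- sub-boxes of negligible volume then satisfy them trivially, and passing to parts smaller by a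
-- bounded factor costs only a bounded factor in the error. One number L sets the precision. Pair
-- densities are rounded to multiples of 1/L, and the link density separating bad pairs from good
-- ones is 1/L². Edges with a bad head or tail then have density O(1/L²), while each prescribed
-- condition retains a proportion of about 1/L² of the maps. After J conditions the proportion is at
-- least L^(-2J) - J/M′, where 1/M′ is the error per condition; this dictates M′, and M exceeds it
-- by what regularity loses. The number of parts comes from Ramsey's theorem and depends on L and F
-- but not on M, so the shrinking factor can be chosen last, before n.

open import Defs
open import Data.Bool using (Bool; true; false; _∧_; _∨_; not; if_then_else_)
open import Data.Bool.ListAction using (any)
import Data.Bool.Properties as Boolₚ
open import Data.Empty using (⊥; ⊥-elim)
open import Data.Fin as Fin using (Fin; zero; suc; splitAt; _↑ˡ_; _↑ʳ_)
import Data.Fin.Properties as Finₚ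
open import Data.Fin.Subset as Subset using (Subset; ∣_∣; _∩_; _∪_) renaming (⊥ to ∅)
import Data.Fin.Subset.Properties as Subsetₚ
open import Data.Integer as ℤ using (ℤ; +_)
import Data.Integer.Properties as ℤₚ
import Data.Integer.Tactic.RingSolver as ℤSolver
open import Data.List as List using (List; []; _∷_; _++_; length; map; filterᵇ; concat; allFin; cartesianProduct; cartesianProductWith)
open import Data.List.Membership.DecPropositional using () renaming (_∈?_ to member?)
open import Data.List.Membership.Propositional using (_∈_; _∉_)
open import Data.List.Membership.Propositional.Properties using (∈-allFin; ∈-cartesianProductWith⁺; ∈-cartesianProduct⁺; ∈-map⁺; ∈-map⁻; ∈-++⁺ˡ; ∈-++⁺ʳ; ∈-++⁻)
import Data.List.Properties as Listₚ
import Data.List.Relation.Binary.Permutation.Propositional as Perm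
open import Data.List.Relation.Binary.Permutation.Propositional using (_↭_; ↭-refl; ↭-sym; ↭-trans; prep; swap)
import Data.List.Relation.Binary.Permutation.Propositional.Properties as Permₚ
import Data.List.Relation.Binary.Permutation.Setoid.Properties as Permₛ
open import Data.List.Relation.Binary.Sublist.Propositional using (_⊆_; []; _∷_; _∷ʳ_; ⊆-refl; ⊆-trans; minimum)
import Data.List.Relation.Binary.Sublist.Propositional.Properties as Sublistₚ
open import Data.List.Relation.Unary.All as AllL using (All; []; _∷_)
import Data.List.Relation.Unary.All.Properties as AllLₚ
open import Data.List.Relation.Unary.AllPairs as AllPairs using (AllPairs; []; _∷_)
import Data.List.Relation.Unary.AllPairs.Properties as AllPairsₚ
open import Data.List.Relation.Unary.Any using (here; there)
import Data.List.Relation.Unary.Linked.Properties as Linkedₚ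
open import Data.List.Relation.Unary.Unique.Propositional using () renaming (Unique to Uniqueˡ)
import Data.List.Relation.Unary.Unique.Propositional.Properties as Uniqueₚ
import Data.List.Sort
open import Data.Maybe using (just; nothing)
open import Data.Nat using (ℕ; zero; suc; _+_; _*_; _∸_; _^_; _≤_; _<_; z≤n; s≤s; NonZero; >-nonZero; >-nonZero⁻¹; ≢-nonZero; _≡ᵇ_; _<ᵇ_)
open import Data.Nat.Combinatorics using (_C_; nCk+nC[k+1]≡[n+1]C[k+1]; nCn≡1)
import Data.Nat.DivMod as ℕDiv
open import Data.Nat.Properties
open import Data.Nat.Tactic.RingSolver using (solve-∀)
open import Data.Product using (Σ; ∃; _×_; _,_; proj₁; proj₂)
open import Data.Rational as ℚ using (ℚ; 0ℚ; 1ℚ; mkℚ; toℚᵘ; _/_) renaming (∣_∣ to ∣_∣ℚ; _≤_ to _≤ℚ_; _<_ to _<ℚ_)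
import Data.Rational.Properties as ℚₚ
import Data.Rational.Unnormalised as ℚᵘ
import Data.Rational.Unnormalised.Properties as ℚᵘₚ
open import Data.Sum using (_⊎_; inj₁; inj₂)
open import Data.Unit using (⊤; tt)
open import Data.Vec as Vec using (Vec; []; _∷_; lookup; toList; _[_]≔_)
import Data.Vec.Properties as Vecₚ
open import Data.Vec.Relation.Binary.Pointwise.Inductive using (Pointwise; []; _∷_)
open import Data.Vec.Relation.Unary.All as AllV using ([]; _∷_)
import Data.Vec.Relation.Unary.All.Properties as AllVₚ
open import Data.Vec.Relation.Unary.AllPairs using ([]; _∷_)
open import Data.Vec.Relation.Unary.Unique.Propositional using (Unique)
open import Function using (_∘_; it)
open import Function.Definitions using (Injective)
open import Relation.Binary.Definitions using (tri<; tri≈; tri>)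
import Relation.Binary.Construct.On as On
open import Relation.Binary.PropositionalEquality
open import Relation.Nullary using (¬_; Dec; yes; no; does)

-- Sums over lists and boxes

-- Linear arithmetic: the hypothesis a + r + s ≡ b + l is an identity for the ring solver.
lin≤ : ∀ {a b l r} (s : ℕ) → l ≤ r → a + r + s ≡ b + l → a ≤ b
lin≤ {a} {b} {l} {r} s l≤r eq = +-cancelʳ-≤ r a b (begin
  a + r      ≤⟨ m≤m+n (a + r) s ⟩
  a + r + s  ≡⟨ eq ⟩
  b + l      ≤⟨ +-monoʳ-≤ b l≤r ⟩
  b + r      ∎)
  where open ≤-Reasoning

𝟙 : Bool → ℕ
𝟙 true  = 1
𝟙 false = 0

𝟙-∧ : ∀ a b → 𝟙 (a ∧ b) ≡ 𝟙 a * 𝟙 b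
𝟙-∧ true  b = sym (+-identityʳ (𝟙 b))
𝟙-∧ false b = refl

𝟙≤1 : ∀ a → 𝟙 a ≤ 1
𝟙≤1 true  = ≤-refl
𝟙≤1 false = z≤n

module _ {A : Set} where

  Σˡ : List A → (A → ℕ) → ℕ
  Σˡ []       f = 0
  Σˡ (x ∷ xs) f = f x + Σˡ xs f

  Σˡ-cong : ∀ xs {f g} → (∀ a → f a ≡ g a) → Σˡ xs f ≡ Σˡ xs g
  Σˡ-cong []       e = refl
  Σˡ-cong (x ∷ xs) e = cong₂ _+_ (e x) (Σˡ-cong xs e)

  Σˡ-mono : ∀ xs {f g} → (∀ a → f a ≤ g a) → Σˡ xs f ≤ Σˡ xs g
  Σˡ-mono []       e = z≤n
  Σˡ-mono (x ∷ xs) e = +-mono-≤ (e x) (Σˡ-mono xs e)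

  Σˡ-+ : ∀ xs f g → Σˡ xs (λ a → f a + g a) ≡ Σˡ xs f + Σˡ xs g
  Σˡ-+ []       f g = refl
  Σˡ-+ (x ∷ xs) f g rewrite Σˡ-+ xs f g = lem (f x) (g x) (Σˡ xs f) (Σˡ xs g)
    where
    lem : ∀ a b c d → a + b + (c + d) ≡ a + c + (b + d)
    lem = solve-∀

  Σˡ-*ˡ : ∀ xs c f → Σˡ xs (λ a → c * f a) ≡ c * Σˡ xs f
  Σˡ-*ˡ []       c f = sym (*-zeroʳ c)
  Σˡ-*ˡ (x ∷ xs) c f rewrite Σˡ-*ˡ xs c f = sym (*-distribˡ-+ c (f x) (Σˡ xs f))

  Σˡ-*ʳ : ∀ xs c f → Σˡ xs (λ a → f a * c) ≡ Σˡ xs f * c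
  Σˡ-*ʳ []       c f = refl
  Σˡ-*ʳ (x ∷ xs) c f rewrite Σˡ-*ʳ xs c f = sym (*-distribʳ-+ c (f x) (Σˡ xs f))

  Σˡ-const : ∀ xs c → Σˡ xs (λ _ → c) ≡ length xs * c
  Σˡ-const []       c = refl
  Σˡ-const (x ∷ xs) c = cong (λ z → c + z) (Σˡ-const xs c)

  Σˡ-filter : ∀ (u : A → Bool) xs f → Σˡ (filterᵇ u xs) f ≡ Σˡ xs (λ a → 𝟙 (u a) * f a)
  Σˡ-filter u []       f = refl
  Σˡ-filter u (x ∷ xs) f with u x
  ... | true  rewrite Σˡ-filter u xs f = cong (_+ Σˡ xs (λ a → 𝟙 (u a) * f a)) (sym (+-identityʳ (f x)))
  ... | false = Σˡ-filter u xs f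

  Σˡ-split : ∀ (u : A → Bool) xs f → Σˡ xs f ≡ Σˡ (filterᵇ u xs) f + Σˡ (filterᵇ (not ∘ u) xs) f
  Σˡ-split u []       f = refl
  Σˡ-split u (x ∷ xs) f with u x
  ... | true  rewrite Σˡ-split u xs f = sym (+-assoc (f x) _ _)
  ... | false rewrite Σˡ-split u xs f = lem (f x) (Σˡ (filterᵇ u xs) f) _
    where
    lem : ∀ a b c → a + (b + c) ≡ b + (a + c)
    lem = solve-∀

  filterᵇ-∧ : ∀ (u v : A → Bool) xs → filterᵇ u (filterᵇ v xs) ≡ filterᵇ (λ a → v a ∧ u a) xs
  filterᵇ-∧ u v []       = refl
  filterᵇ-∧ u v (x ∷ xs) with v x
  ... | false = filterᵇ-∧ u v xs
  ... | true  with u x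
  ...   | true  = cong (x ∷_) (filterᵇ-∧ u v xs)
  ...   | false = filterᵇ-∧ u v xs

  filterᵇ-true : ∀ xs → filterᵇ (λ (_ : A) → true) xs ≡ xs
  filterᵇ-true []       = refl
  filterᵇ-true (x ∷ xs) = cong (x ∷_) (filterᵇ-true xs)

  length-filterᵇ-split : ∀ (u : A → Bool) xs →
    length xs ≡ length (filterᵇ u xs) + length (filterᵇ (not ∘ u) xs)
  length-filterᵇ-split u []       = refl
  length-filterᵇ-split u (x ∷ xs) with u x
  ... | true  = cong suc (length-filterᵇ-split u xs)
  ... | false = trans (cong suc (length-filterᵇ-split u xs)) (sym (+-suc _ _))

  infix 4 _⊴_
  -- A Boolean selection instead of a sublist: the entries not selected form such a selection again,
  -- and the predicate can be moved into a summand as an indicator.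
  record _⊴_ (W V : List A) : Set where
    constructor selected
    field
      keep    : A → Bool
      isFilter : W ≡ filterᵇ keep V

  ⊴-refl : ∀ {V} → V ⊴ V
  ⊴-refl {V} = selected (λ _ → true) (sym (filterᵇ-true V))

  ⊴-filter : ∀ u V → filterᵇ u V ⊴ V
  ⊴-filter u V = selected u refl

  ⊴-trans : ∀ {U W V} → U ⊴ W → W ⊴ V → U ⊴ V
  ⊴-trans {V = V} (selected u refl) (selected v refl) = selected _ (filterᵇ-∧ u v V)

  ⊴-length : ∀ {W V} → W ⊴ V → length W ≤ length V
  ⊴-length {V = V} (selected u refl) rewrite length-filterᵇ-split u V = m≤m+n _ _

Σˡ-swap : ∀ {A B : Set} (xs : List A) (ys : List B) (f : A → B → ℕ) →
  Σˡ xs (λ a → Σˡ ys (f a)) ≡ Σˡ ys (λ b → Σˡ xs (λ a → f a b))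
Σˡ-swap []       ys f = sym (trans (Σˡ-const ys 0) (*-zeroʳ (length ys)))
Σˡ-swap (x ∷ xs) ys f rewrite Σˡ-swap xs ys f = sym (Σˡ-+ ys (f x) (λ b → Σˡ xs (λ a → f a b)))

Σˡ-map : ∀ {A B : Set} (g : A → B) xs f → Σˡ (map g xs) f ≡ Σˡ xs (f ∘ g)
Σˡ-map g []       f = refl
Σˡ-map g (x ∷ xs) f = cong (λ z → f (g x) + z) (Σˡ-map g xs f)

module _ {A : Set} where

  Sum : ∀ {s} → Vec (List A) s → (Vec A s → ℕ) → ℕ
  Sum []       F = F []
  Sum (V ∷ Vs) F = Σˡ V (λ a → Sum Vs (λ v → F (a ∷ v)))

  vol : ∀ {s} → Vec (List A) s → ℕ
  vol []       = 1
  vol (V ∷ Vs) = length V * vol Vs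

  Sum-cong : ∀ {s} (Vs : Vec (List A) s) {F G} → (∀ v → F v ≡ G v) → Sum Vs F ≡ Sum Vs G
  Sum-cong []       e = e []
  Sum-cong (V ∷ Vs) e = Σˡ-cong V (λ a → Sum-cong Vs (λ v → e (a ∷ v)))

  Sum-mono : ∀ {s} (Vs : Vec (List A) s) {F G} → (∀ v → F v ≤ G v) → Sum Vs F ≤ Sum Vs G
  Sum-mono []       e = e []
  Sum-mono (V ∷ Vs) e = Σˡ-mono V (λ a → Sum-mono Vs (λ v → e (a ∷ v)))

  Sum-+ : ∀ {s} (Vs : Vec (List A) s) F G → Sum Vs (λ v → F v + G v) ≡ Sum Vs F + Sum Vs G
  Sum-+ []       F G = refl
  Sum-+ (V ∷ Vs) F G =
    trans (Σˡ-cong V (λ a → Sum-+ Vs (λ v → F (a ∷ v)) (λ v → G (a ∷ v)))) (Σˡ-+ V _ _)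

  Sum-*ˡ : ∀ {s} (Vs : Vec (List A) s) c F → Sum Vs (λ v → c * F v) ≡ c * Sum Vs F
  Sum-*ˡ []       c F = refl
  Sum-*ˡ (V ∷ Vs) c F = trans (Σˡ-cong V (λ a → Sum-*ˡ Vs c (λ v → F (a ∷ v)))) (Σˡ-*ˡ V c _)

  Sum-const : ∀ {s} (Vs : Vec (List A) s) c → Sum Vs (λ _ → c) ≡ vol Vs * c
  Sum-const []       c = sym (+-identityʳ c)
  Sum-const (V ∷ Vs) c = begin
    Σˡ V (λ _ → Sum Vs (λ _ → c)) ≡⟨ Σˡ-cong V (λ _ → Sum-const Vs c) ⟩
    Σˡ V (λ _ → vol Vs * c)       ≡⟨ Σˡ-const V _ ⟩
    length V * (vol Vs * c)       ≡⟨ *-assoc (length V) (vol Vs) c ⟨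
    length V * vol Vs * c         ∎
    where open ≡-Reasoning

  Sum-1 : ∀ {s} (Vs : Vec (List A) s) → Sum Vs (λ _ → 1) ≡ vol Vs
  Sum-1 Vs = trans (Sum-const Vs 1) (*-identityʳ (vol Vs))

  Sum-≤vol : ∀ {s} (Vs : Vec (List A) s) {F} → (∀ v → F v ≤ 1) → Sum Vs F ≤ vol Vs
  Sum-≤vol Vs e = ≤-trans (Sum-mono Vs e) (≤-reflexive (Sum-1 Vs))

  Sum-swap : ∀ {B : Set} {s} (Vs : Vec (List A) s) (xs : List B) (F : B → Vec A s → ℕ) →
    Sum Vs (λ v → Σˡ xs (λ a → F a v)) ≡ Σˡ xs (λ a → Sum Vs (F a))
  Sum-swap []       xs F = refl
  Sum-swap (V ∷ Vs) xs F =
    trans (Σˡ-cong V (λ b → Sum-swap Vs xs (λ a v → F a (b ∷ v)))) (Σˡ-swap V xs _)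

  infix 4 _⊴ᵛ_
  data _⊴ᵛ_ : ∀ {s} → Vec (List A) s → Vec (List A) s → Set where
    []  : [] ⊴ᵛ []
    _∷_ : ∀ {s U V} {Us Vs : Vec (List A) s} → U ⊴ V → Us ⊴ᵛ Vs → (U ∷ Us) ⊴ᵛ (V ∷ Vs)

  ⊴ᵛ-refl : ∀ {s} (V : Vec (List A) s) → V ⊴ᵛ V
  ⊴ᵛ-refl []      = []
  ⊴ᵛ-refl (V ∷ Vs) = ⊴-refl ∷ ⊴ᵛ-refl Vs

  ⊴ᵛ-trans : ∀ {s} {U W V : Vec (List A) s} → U ⊴ᵛ W → W ⊴ᵛ V → U ⊴ᵛ V
  ⊴ᵛ-trans []       []       = []
  ⊴ᵛ-trans (p ∷ ps) (q ∷ qs) = ⊴-trans p q ∷ ⊴ᵛ-trans ps qs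

  ⊴ᵛ-vol : ∀ {s} {U V : Vec (List A) s} → U ⊴ᵛ V → vol U ≤ vol V
  ⊴ᵛ-vol []       = ≤-refl
  ⊴ᵛ-vol (p ∷ ps) = *-mono-≤ (⊴-length p) (⊴ᵛ-vol ps)

  -- The part of V outside U is the disjoint union of s boxes, obtained by shrinking the coordinates one after another.
  upper-from-lower : ∀ {s} (V : Vec (List A) s) F c E E₀ →
    (∀ U → U ⊴ᵛ V → c * vol U ≤ Sum U F + E) → Sum V F ≤ c * vol V + E₀ →
    ∀ U → U ⊴ᵛ V → Sum U F ≤ c * vol U + (s * E + E₀)
  upper-from-lower [] F c E E₀ low up [] _ = up
  upper-from-lower {suc s} (V ∷ Vs) F c E E₀ low up (U ∷ Us) (selected u refl ∷ us) = begin
    Sum (U ∷ Us) F                    ≡⟨ Sum-swap Us U (λ a v → F (a ∷ v)) ⟨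
    Sum Us F′                         ≤⟨ upper-from-lower Vs F′ (c * length U) E (E + E₀) low′ up′ Us us ⟩
    c * length U * vol Us + (s * E + (E + E₀))  ≡⟨ lem c (length U) (vol Us) s E E₀ ⟩
    c * vol (U ∷ Us) + (suc s * E + E₀) ∎
    where
    open ≤-Reasoning
    U′ = filterᵇ (not ∘ u) V
    F′ : Vec A _ → ℕ
    F′ v = Σˡ U (λ a → F (a ∷ v))
    lem : ∀ c l v s e e₀ → c * l * v + (s * e + (e + e₀)) ≡ c * (l * v) + (e + s * e + e₀)
    lem = solve-∀
    low′ : ∀ Us → Us ⊴ᵛ Vs → c * length U * vol Us ≤ Sum Us F′ + E
    low′ Us p = begin
      c * length U * vol Us    ≡⟨ *-assoc c (length U) (vol Us) ⟩
      c * vol (U ∷ Us)         ≤⟨ low (U ∷ Us) (⊴-filter u V ∷ p) ⟩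
      Sum (U ∷ Us) F + E       ≡⟨ cong (_+ E) (Sum-swap Us U (λ a v → F (a ∷ v))) ⟨
      Sum Us F′ + E            ∎
    up′ : Sum Vs F′ ≤ c * length U * vol Vs + (E + E₀)
    up′ = lin≤ 0 (+-mono-≤ (low (U′ ∷ Vs) (⊴-filter _ V ∷ ⊴ᵛ-refl Vs)) up) (begin-equality
      Sum Vs F′ + (Sum (U′ ∷ Vs) F + E + (c * (length V * vol Vs) + E₀)) + 0
        ≡⟨ cong₂ (λ x y → x + (Sum (U′ ∷ Vs) F + E + (c * (y * vol Vs) + E₀)) + 0)
             (Sum-swap Vs U (λ a v → F (a ∷ v))) (length-filterᵇ-split u V) ⟩
      Sum (U ∷ Vs) F + (Sum (U′ ∷ Vs) F + E + (c * ((length U + length U′) * vol Vs) + E₀)) + 0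
        ≡⟨ lem₁ (Sum (U ∷ Vs) F) (Sum (U′ ∷ Vs) F) c (length U) (length U′) (vol Vs) E E₀ ⟩
      c * length U * vol Vs + (E + E₀) + (c * (length U′ * vol Vs) + (Sum (U ∷ Vs) F + Sum (U′ ∷ Vs) F))
        ≡⟨ cong (λ x → c * length U * vol Vs + (E + E₀) + (c * (length U′ * vol Vs) + x))
             (Σˡ-split u V (λ a → Sum Vs (λ v → F (a ∷ v)))) ⟨
      c * length U * vol Vs + (E + E₀) + (c * vol (U′ ∷ Vs) + Sum (V ∷ Vs) F) ∎)
      where
      lem₁ : ∀ a b c l l′ v e e₀ →
        a + (b + e + (c * ((l + l′) * v) + e₀)) + 0 ≡ c * l * v + (e + e₀) + (c * (l′ * v) + (a + b))
      lem₁ = solve-∀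

-- Minimal boxes: separation and regularity

¬¬-lem : ∀ (P : Set) → ¬ ¬ (P ⊎ ¬ P)
¬¬-lem P k = k (inj₂ (λ p → k (inj₁ p)))

module _ {A : Set} where

  infix 4 _≼[_]_
  -- Every side, and not just the volume, keeps the proportion 1/κ: a part belongs to many tuples
  -- and has to stay large in all of them.
  data _≼[_]_ : ∀ {s} → Vec (List A) s → ℕ → Vec (List A) s → Set where
    []  : ∀ {κ} → [] ≼[ κ ] []
    _∷_ : ∀ {s κ U V} {Us Vs : Vec (List A) s} →
          U ⊴ V × length V ≤ κ * length U → Us ≼[ κ ] Vs → (U ∷ Us) ≼[ κ ] (V ∷ Vs)

  ≼-refl : ∀ {s} (V : Vec (List A) s) → V ≼[ 1 ] V
  ≼-refl []       = []
  ≼-refl (V ∷ Vs) = (⊴-refl , m≤m+n _ _) ∷ ≼-refl Vs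

  ≼-trans : ∀ {s B κ} {U W V : Vec (List A) s} → U ≼[ B ] W → W ≼[ κ ] V → U ≼[ κ * B ] V
  ≼-trans []               []               = []
  ≼-trans {B = B} {κ} (_∷_ {U = U} (p , p′) ps) (_∷_ {U = W} {V} (q , q′) qs) =
    (⊴-trans p q , (begin
      length V           ≤⟨ q′ ⟩
      κ * length W       ≤⟨ *-monoʳ-≤ κ p′ ⟩
      κ * (B * length U) ≡⟨ *-assoc κ B _ ⟨
      κ * B * length U   ∎)) ∷ ≼-trans ps qs
    where open ≤-Reasoning

  ≼-mono : ∀ {s B κ} {U V : Vec (List A) s} → B ≤ κ → U ≼[ B ] V → U ≼[ κ ] V
  ≼-mono B≤C []             = []
  ≼-mono B≤C ((p , p′) ∷ q) = (p , ≤-trans p′ (*-monoˡ-≤ _ B≤C)) ∷ ≼-mono B≤C q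

  ≼⇒⊴ : ∀ {s κ} {U V : Vec (List A) s} → U ≼[ κ ] V → U ⊴ᵛ V
  ≼⇒⊴ []            = []
  ≼⇒⊴ ((p , _) ∷ q) = p ∷ ≼⇒⊴ q

  ≼-vol : ∀ {s κ} {U V : Vec (List A) s} → U ≼[ κ ] V → vol V ≤ κ ^ s * vol U
  ≼-vol []                              = ≤-refl
  ≼-vol {suc s} {κ} (_∷_ {U = U} {V} {Us} {Vs} (_ , p) q) = begin
    length V * vol Vs                   ≤⟨ *-mono-≤ p (≼-vol q) ⟩
    κ * length U * (κ ^ s * vol Us)     ≡⟨ lem κ (length U) (κ ^ s) (vol Us) ⟩
    κ * κ ^ s * (length U * vol Us)     ∎
    where
    open ≤-Reasoning
    lem : ∀ c l d v → c * l * (d * v) ≡ c * d * (l * v)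
    lem = solve-∀

  -- If one side of `U` is shorter than 1/N of the corresponding side of `V`, this alone makes the
  -- volume small. Estimates with error `vol V` / N are then automatic, so the descent only has to
  -- compare boxes shrunk by at most N.
  large-or-negligible : ∀ {s} N {U V : Vec (List A) s} → U ⊴ᵛ V → U ≼[ N ] V ⊎ vol U * N ≤ vol V
  large-or-negligible N []       = inj₁ []
  large-or-negligible N (_∷_ {U = U} {V} {Us} {Vs} p ps) with length V ≤? N * length U | large-or-negligible N ps
  ... | yes q | inj₁ r = inj₁ ((p , q) ∷ r)
  ... | yes q | inj₂ r = inj₂ (≤-trans (≤-reflexive (*-assoc (length U) (vol Us) N)) (*-mono-≤ (⊴-length p) r))
  ... | no ¬q | _      = inj₂ (begin
      length U * vol Us * N   ≡⟨ lem (length U) (vol Us) N ⟩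
      N * length U * vol Us   ≤⟨ *-mono-≤ (<⇒≤ (≰⇒> ¬q)) (⊴ᵛ-vol ps) ⟩
      length V * vol Vs       ∎)
    where
    open ≤-Reasoning
    lem : ∀ a b c → a * b * c ≡ c * a * b
    lem = solve-∀

  module Descent {s} {I : Set} (f : I → Vec A s → ℕ) (K N : ℕ) .{{_ : NonZero N}} where

    -- In units of `K`, the mean of `f ι` over `V` is at most k / N.
    Level : Vec (List A) s → ℕ → I → Set
    Level V k ι = N * Sum V (f ι) ≤ k * (vol V * K)

    record Minimal (V : Vec (List A) s) : Set where
      constructor minimal
      field
        box   : Vec (List A) s
        small : box ≼[ N ^ N ] V
        level : ℕ
        arg   : I
        upper : ∀ U → U ⊴ᵛ box → N * Sum U (f arg) ≤ level * (vol U * K) + s * (vol box * K)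
        lower : ∀ ι U → U ⊴ᵛ box → level * (vol U * K) ≤ N * Sum U (f ι) + vol box * K

    -- As long as some index has, on some sub-box shrunk by at most N, a mean one level lower, the
    -- descent passes to it. The level starts at N and cannot become negative, whence at most N
    -- steps and the factor `N ^ N`. Where no step is possible, the means of all indices on all
    -- sub-boxes are bounded below, and `upper-from-lower` turns this into an upper bound for the
    -- chosen index.
    minimise : ∀ V → (∃ λ ι → Sum V (f ι) ≤ vol V * K) → ¬ ¬ Minimal V
    minimise V₀ (ι , le) fail = go N V₀ ι ≤-refl initial (≼-mono (^-monoʳ-≤ N {0} {N ∸ N} z≤n) (≼-refl V₀))
      where
      open ≤-Reasoning
      initial : Level V₀ N ι
      initial = *-monoʳ-≤ N le
      finish : ∀ {k V ι} → k ≤ N → Level V k ι → V ≼[ N ^ N ] V₀ →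
        (∀ ι U → U ≼[ N ] V → k * (vol U * K) ≤ N * Sum U (f ι) + vol U * K) → ⊥
      finish {k} {V} {ι₀} k≤N lev V≼ low = fail (minimal V V≼ k ι₀ up low′)
        where
        low′ : ∀ ι U → U ⊴ᵛ V → k * (vol U * K) ≤ N * Sum U (f ι) + vol V * K
        low′ ι U p with large-or-negligible N p
        ... | inj₁ q = ≤-trans (low ι U q) (+-monoʳ-≤ (N * Sum U (f ι)) (*-monoˡ-≤ K (⊴ᵛ-vol p)))
        ... | inj₂ q = begin
          k * (vol U * K)   ≤⟨ *-monoˡ-≤ (vol U * K) k≤N ⟩
          N * (vol U * K)   ≡⟨ *-assoc N _ K ⟨
          N * vol U * K     ≡⟨ cong (_* K) (*-comm N (vol U)) ⟩
          vol U * N * K     ≤⟨ *-monoˡ-≤ K q ⟩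
          vol V * K         ≤⟨ m≤n+m _ _ ⟩
          N * Sum U (f ι) + vol V * K ∎
        swp : ∀ k K v → k * K * v ≡ k * (v * K)
        swp = solve-∀
        up : ∀ U → U ⊴ᵛ V → N * Sum U (f ι₀) ≤ k * (vol U * K) + s * (vol V * K)
        up U p = begin
          N * Sum U (f ι₀)             ≡⟨ Sum-*ˡ U N (f ι₀) ⟨
          Sum U (λ v → N * f ι₀ v)     ≤⟨ upper-from-lower V (λ v → N * f ι₀ v) (k * K) (vol V * K) 0
            (λ U q → begin
              k * K * vol U                            ≡⟨ swp k K (vol U) ⟩
              k * (vol U * K)                          ≤⟨ low′ ι₀ U q ⟩
              N * Sum U (f ι₀) + vol V * K             ≡⟨ cong (_+ vol V * K) (Sum-*ˡ U N (f ι₀)) ⟨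
              Sum U (λ v → N * f ι₀ v) + vol V * K     ∎)
            (begin
              Sum V (λ v → N * f ι₀ v)     ≡⟨ Sum-*ˡ V N (f ι₀) ⟩
              N * Sum V (f ι₀)             ≤⟨ lev ⟩
              k * (vol V * K)              ≡⟨ swp k K (vol V) ⟨
              k * K * vol V                ≡⟨ +-identityʳ _ ⟨
              k * K * vol V + 0            ∎) U p ⟩
          k * K * vol U + (s * (vol V * K) + 0)  ≡⟨ cong₂ _+_ (swp k K (vol U)) (+-identityʳ _) ⟩
          k * (vol U * K) + s * (vol V * K) ∎
      Worse : ℕ → Vec (List A) s → Set
      Worse k V = Σ I λ ι → Σ (Vec (List A) s) λ U → U ≼[ N ] V × Level U k ι
      go : ∀ k V ι → k ≤ N → Level V k ι → V ≼[ N ^ (N ∸ k) ] V₀ → ⊥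
      -- At level 0 the lower bound holds trivially.
      go zero    V ι k≤N lev V≼ = finish {0} z≤n lev V≼ (λ _ _ _ → z≤n)
      go (suc k) V ι k≤N lev V≼ = ¬¬-lem (Worse k V) λ
        { (inj₁ (ι′ , U , U≼ , lev′)) → go k U ι′ (<⇒≤ k≤N) lev′
            (subst (U ≼[_] V₀) (trans (*-comm (N ^ (N ∸ suc k)) N) (cong (N ^_) (sym (+-∸-assoc 1 k≤N)))) (≼-trans U≼ V≼))
        ; (inj₂ none) → finish k≤N lev (≼-mono (^-monoʳ-≤ N (m∸n≤m N (suc k))) V≼) λ ι U U≼ → begin
            vol U * K + k * (vol U * K)     ≡⟨ +-comm (vol U * K) _ ⟩
            k * (vol U * K) + vol U * K     ≤⟨ +-monoˡ-≤ (vol U * K) (<⇒≤ (≰⇒> (λ l → none (ι , U , U≼ , l)))) ⟩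
            N * Sum U (f ι) + vol U * K     ∎ }

  Sum₂ : ∀ {s} → List A → List A → Vec (List A) s → (A → A → Vec A s → ℕ) → ℕ
  Sum₂ Z₁ Z₂ V g = Σˡ Z₁ λ a → Σˡ Z₂ λ b → Sum V (g a b)

  Sum₂-+ : ∀ {s} Z₁ Z₂ (V : Vec (List A) s) f g →
    Sum₂ Z₁ Z₂ V (λ a b v → f a b v + g a b v) ≡ Sum₂ Z₁ Z₂ V f + Sum₂ Z₁ Z₂ V g
  Sum₂-+ Z₁ Z₂ V f g = trans
    (Σˡ-cong Z₁ (λ a → trans (Σˡ-cong Z₂ (λ b → Sum-+ V (f a b) (g a b))) (Σˡ-+ Z₂ _ _)))
    (Σˡ-+ Z₁ _ _)

  Sum₂-*ˡ : ∀ {s} Z₁ Z₂ (V : Vec (List A) s) c f →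
    Sum₂ Z₁ Z₂ V (λ a b v → c * f a b v) ≡ c * Sum₂ Z₁ Z₂ V f
  Sum₂-*ˡ Z₁ Z₂ V c f = trans
    (Σˡ-cong Z₁ (λ a → trans (Σˡ-cong Z₂ (λ b → Sum-*ˡ V c (f a b))) (Σˡ-*ˡ Z₂ c _)))
    (Σˡ-*ˡ Z₁ c _)

  Sum₂-cong : ∀ {s} Z₁ Z₂ (V : Vec (List A) s) {f g} → (∀ a b v → f a b v ≡ g a b v) →
    Sum₂ Z₁ Z₂ V f ≡ Sum₂ Z₁ Z₂ V g
  Sum₂-cong Z₁ Z₂ V e = Σˡ-cong Z₁ (λ a → Σˡ-cong Z₂ (λ b → Sum-cong V (e a b)))

  Sum₂-filter : ∀ {s} (w₁ w₂ : A → Bool) Z₁ Z₂ (V : Vec (List A) s) (p : A → A → Vec A s → Bool) →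
    Sum₂ (filterᵇ w₁ Z₁) (filterᵇ w₂ Z₂) V (λ a b v → 𝟙 (p a b v)) ≡
    Sum₂ Z₁ Z₂ V (λ a b v → 𝟙 (w₁ a ∧ (w₂ b ∧ p a b v)))
  Sum₂-filter w₁ w₂ Z₁ Z₂ V p = trans (Σˡ-filter w₁ Z₁ _) (Σˡ-cong Z₁ λ a →
    trans (cong (𝟙 (w₁ a) *_) (trans (Σˡ-filter w₂ Z₂ _) (Σˡ-cong Z₂ λ b →
      trans (sym (Sum-*ˡ V (𝟙 (w₂ b)) _)) (Sum-cong V λ v → sym (𝟙-∧ (w₂ b) _)))))
    (trans (sym (Σˡ-*ˡ Z₂ (𝟙 (w₁ a)) _)) (Σˡ-cong Z₂ λ b →
      trans (sym (Sum-*ˡ V (𝟙 (w₁ a)) _)) (Sum-cong V λ v → sym (𝟙-∧ (w₁ a) _)))))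

  Sum-Σ₂ : ∀ {s} Z₁ Z₂ (V : Vec (List A) s) g →
    Sum V (λ v → Σˡ Z₁ λ a → Σˡ Z₂ λ b → g a b v) ≡ Sum₂ Z₁ Z₂ V g
  Sum-Σ₂ Z₁ Z₂ V g = trans (Sum-swap V Z₁ _) (Σˡ-cong Z₁ λ a → Sum-swap V Z₂ _)

  -- Up to an error 1/M, the pairs in B have link density below 1/D in every sub-box of V,
  -- and the pairs outside B have, on average, link density at least 1/D in every sub-box.
  record Separates {s} (D M : ℕ) (E : A → A → Vec A s → Bool) (B : A → A → Bool)
                   (Z₁ Z₂ : List A) (V : Vec (List A) s) : Set where
    field
      good : ∀ U → U ⊴ᵛ V → (u : A → A → Bool) → (∀ a b → u a b ≡ true → B a b ≡ false) →
        M * Sum₂ Z₁ Z₂ U (λ a b _ → 𝟙 (u a b)) ≤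
        M * (D * Sum₂ Z₁ Z₂ U (λ a b v → 𝟙 (u a b ∧ E a b v))) + vol (Z₁ ∷ Z₂ ∷ V)
      bad  : ∀ U → U ⊴ᵛ V → (u : A → A → Bool) → (∀ a b → u a b ≡ true → B a b ≡ true) →
        M * (D * Sum₂ Z₁ Z₂ U (λ a b v → 𝟙 (u a b ∧ E a b v))) ≤
        M * Sum₂ Z₁ Z₂ U (λ a b _ → 𝟙 (u a b)) + vol (Z₁ ∷ Z₂ ∷ V)

  -- The pair (V, B) minimises the average of the cost: D times the link density on B, and 1 off B.
  separation : ∀ {s} D M .{{_ : NonZero M}} (E : A → A → Vec A s → Bool) Z₁ Z₂ V →
    let N = suc s * M in
    ¬ ¬ (∃ λ V′ → V′ ≼[ N ^ N ] V × ∃ λ B → Separates D M E B Z₁ Z₂ V′)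
  separation {s} D M E Z₁ Z₂ V fail = minimise V initial λ mn →
    fail (Minimal.box mn , Minimal.small mn , Minimal.arg mn , record { good = gd mn ; bad = bd mn })
    where
    open ≤-Reasoning
    -- In units of the volume times `K`, the errors of `upper` and `lower` are s and 1; with suc s ·
    -- M levels they add up to 1/M.
    N = suc s * M
    instance _ = m*n≢0 (suc s) M
    K = length Z₁ * length Z₂
    cost : (A → A → Bool) → A → A → Vec A s → ℕ
    cost B a b v = if B a b then D * 𝟙 (E a b v) else 1
    f : (A → A → Bool) → Vec A s → ℕ
    f B v = Σˡ Z₁ λ a → Σˡ Z₂ λ b → cost B a b v
    open Descent f K N
    initial : ∃ λ B → Sum V (f B) ≤ vol V * K
    initial = (λ _ _ → false) , ≤-reflexive (trans
      (Sum-cong V (λ v → trans (Σˡ-cong Z₁ (λ a → trans (Σˡ-const Z₂ 1) (*-identityʳ _))) (Σˡ-const Z₁ _)))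
      (Sum-const V K))
    vol₂ : ∀ W → length Z₁ * (length Z₂ * W) ≡ W * K
    vol₂ W = trans (sym (*-assoc (length Z₁) _ W)) (*-comm _ W)
    module _ (mn : Minimal V) where
      open Minimal mn renaming (box to V′; level to k; arg to B)
      combine : ∀ U → U ⊴ᵛ V′ → ∀ B′ x y → Sum U (f B′) + x ≡ Sum U (f B) + y →
        M * x ≤ M * y + vol (Z₁ ∷ Z₂ ∷ V′)
      combine U p B′ x y eq = *-cancelˡ-≤ (suc s) (lin≤ 0 (+-mono-≤ (lower B′ U p) (upper U p)) (begin-equality
        suc s * (M * x) + (N * F′ + W + (kv + s * W)) + 0 ≡⟨ lem₁ s M x F′ W kv ⟩
        suc s * M * (F′ + x) + suc s * W + kv             ≡⟨ cong (λ z → N * z + suc s * W + kv) eq ⟩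
        suc s * M * (F + y) + suc s * W + kv              ≡⟨ lem₂ s M y F W kv ⟩
        suc s * (M * y + W) + (kv + N * F)                ≡⟨ cong (λ z → suc s * (M * y + z) + (kv + N * F)) (vol₂ (vol V′)) ⟨
        suc s * (M * y + vol (Z₁ ∷ Z₂ ∷ V′)) + (kv + N * F) ∎))
        where
        F = Sum U (f B) ; F′ = Sum U (f B′) ; W = vol V′ * K ; kv = k * (vol U * K)
        lem₁ : ∀ s M x F W kv → suc s * (M * x) + (suc s * M * F + W + (kv + s * W)) + 0 ≡
          suc s * M * (F + x) + suc s * W + kv
        lem₁ = solve-∀
        lem₂ : ∀ s M y F W kv → suc s * M * (F + y) + suc s * W + kv ≡
          suc s * (M * y + W) + (kv + suc s * M * F)
        lem₂ = solve-∀
      transfer : ∀ U B′ g₁ g₂ → (∀ a b v → cost B′ a b v + g₁ a b v ≡ cost B a b v + g₂ a b v) →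
        Sum U (f B′) + Sum₂ Z₁ Z₂ U g₁ ≡ Sum U (f B) + Sum₂ Z₁ Z₂ U g₂
      transfer U B′ g₁ g₂ e = begin-equality
        Sum U (f B′) + Sum₂ Z₁ Z₂ U g₁               ≡⟨ cong (_+ Sum₂ Z₁ Z₂ U g₁) (Sum-Σ₂ Z₁ Z₂ U (cost B′)) ⟩
        Sum₂ Z₁ Z₂ U (cost B′) + Sum₂ Z₁ Z₂ U g₁     ≡⟨ Sum₂-+ Z₁ Z₂ U (cost B′) g₁ ⟨
        Sum₂ Z₁ Z₂ U (λ a b v → cost B′ a b v + g₁ a b v) ≡⟨ Sum₂-cong Z₁ Z₂ U e ⟩
        Sum₂ Z₁ Z₂ U (λ a b v → cost B a b v + g₂ a b v) ≡⟨ Sum₂-+ Z₁ Z₂ U (cost B) g₂ ⟩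
        Sum₂ Z₁ Z₂ U (cost B) + Sum₂ Z₁ Z₂ U g₂      ≡⟨ cong (_+ Sum₂ Z₁ Z₂ U g₂) (Sum-Σ₂ Z₁ Z₂ U (cost B)) ⟨
        Sum U (f B) + Sum₂ Z₁ Z₂ U g₂                ∎
      gd : ∀ U → U ⊴ᵛ V′ → (u : A → A → Bool) → (∀ a b → u a b ≡ true → B a b ≡ false) →
        M * Sum₂ Z₁ Z₂ U (λ a b _ → 𝟙 (u a b)) ≤
        M * (D * Sum₂ Z₁ Z₂ U (λ a b v → 𝟙 (u a b ∧ E a b v))) + vol (Z₁ ∷ Z₂ ∷ V′)
      gd U p u off = subst (λ z → M * Sum₂ Z₁ Z₂ U (λ a b _ → 𝟙 (u a b)) ≤ M * z + vol (Z₁ ∷ Z₂ ∷ V′))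
        (Sum₂-*ˡ Z₁ Z₂ U D _)
        (combine U p B′ _ _ (transfer U B′ (λ a b _ → 𝟙 (u a b)) (λ a b v → D * 𝟙 (u a b ∧ E a b v)) pt))
        where
        -- Declaring the pairs of `u` bad changes the cost on them from 1 to D times the link
        -- indicator; by minimality this gains nothing beyond the error.
        B′ : A → A → Bool
        B′ a b = u a b ∨ B a b
        pt : ∀ a b v → cost B′ a b v + 𝟙 (u a b) ≡ cost B a b v + D * 𝟙 (u a b ∧ E a b v)
        pt a b v with u a b in eq
        ... | true  rewrite off a b eq = +-comm (D * 𝟙 (E a b v)) 1
        ... | false = cong (λ z → cost B a b v + z) (sym (*-zeroʳ D))
      bd : ∀ U → U ⊴ᵛ V′ → (u : A → A → Bool) → (∀ a b → u a b ≡ true → B a b ≡ true) →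
        M * (D * Sum₂ Z₁ Z₂ U (λ a b v → 𝟙 (u a b ∧ E a b v))) ≤
        M * Sum₂ Z₁ Z₂ U (λ a b _ → 𝟙 (u a b)) + vol (Z₁ ∷ Z₂ ∷ V′)
      bd U p u on = subst (λ z → M * z ≤ M * Sum₂ Z₁ Z₂ U (λ a b _ → 𝟙 (u a b)) + vol (Z₁ ∷ Z₂ ∷ V′))
        (Sum₂-*ˡ Z₁ Z₂ U D _)
        (combine U p B′ _ _ (transfer U B′ (λ a b v → D * 𝟙 (u a b ∧ E a b v)) (λ a b _ → 𝟙 (u a b)) pt))
        where
        -- Conversely, declaring the pairs of `u` good replaces D times the link indicator by 1.
        B′ : A → A → Bool
        B′ a b = not (u a b) ∧ B a b
        pt : ∀ a b v → cost B′ a b v + D * 𝟙 (u a b ∧ E a b v) ≡ cost B a b v + 𝟙 (u a b)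
        pt a b v with u a b in eq
        ... | true  rewrite on a b eq = +-comm 1 (D * 𝟙 (E a b v))
        ... | false = cong (λ z → cost B a b v + z) (*-zeroʳ D)

  rescale-error : ∀ c .{{_ : NonZero c}} {M x y W W′} → W ≤ c * W′ →
    c * M * x ≤ c * M * y + W → M * x ≤ M * y + W′
  rescale-error c {M} {x} {y} {W} {W′} le h = *-cancelˡ-≤ c (begin
    c * (M * x)           ≡⟨ *-assoc c M x ⟨
    c * M * x             ≤⟨ h ⟩
    c * M * y + W         ≤⟨ +-mono-≤ (≤-reflexive (*-assoc c M y)) le ⟩
    c * (M * y) + c * W′  ≡⟨ *-distribˡ-+ c _ W′ ⟨
    c * (M * y + W′)      ∎)
    where open ≤-Reasoning

  -- Trivial if x ≤ y; otherwise the excess x - y, multiplied by the smaller `M`, is still at most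
  -- `W`.
  coarsen-error : ∀ {M M′ x y W} → M ≤ M′ → M′ * x ≤ M′ * y + W → M * x ≤ M * y + W
  coarsen-error {M} {M′} {x} {y} {W} M≤M′ h with ≤-total x y
  ... | inj₁ x≤y = ≤-trans (*-monoʳ-≤ M x≤y) (m≤m+n _ W)
  ... | inj₂ y≤x = begin
    M * x                       ≡⟨ cong (M *_) (m+[n∸m]≡n y≤x) ⟨
    M * (y + (x ∸ y))           ≡⟨ *-distribˡ-+ M y _ ⟩
    M * y + M * (x ∸ y)         ≤⟨ +-monoʳ-≤ (M * y) (≤-trans (*-monoˡ-≤ (x ∸ y) M≤M′) excess) ⟩
    M * y + W                   ∎
    where
    open ≤-Reasoning
    excess : M′ * (x ∸ y) ≤ W
    excess = +-cancelˡ-≤ (M′ * y) _ _ (begin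
      M′ * y + M′ * (x ∸ y)     ≡⟨ *-distribˡ-+ M′ y _ ⟨
      M′ * (y + (x ∸ y))        ≡⟨ cong (M′ *_) (m+[n∸m]≡n y≤x) ⟩
      M′ * x                    ≤⟨ h ⟩
      M′ * y + W                ∎)

  separates-mono : ∀ {s D M M′ E B Z₁ Z₂} {V : Vec (List A) s} → M ≤ M′ →
    Separates D M′ E B Z₁ Z₂ V → Separates D M E B Z₁ Z₂ V
  separates-mono M≤M′ sep = record
    { good = λ U p u off → coarsen-error M≤M′ (good U p u off)
    ; bad  = λ U p u on → coarsen-error M≤M′ (bad U p u on) }
    where open Separates sep

  -- `Separates` lets only the link box vary, but `u` is arbitrary: intersecting it with the
  -- predicates that select `Z₁′` and `Z₂′` simulates smaller sets of pairs. The factor κ^(2+s)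
  -- compensates for the smaller volume in the error term.
  separates-≼ : ∀ {s D M κ} .{{_ : NonZero κ}} {E B Z₁ Z₂ Z₁′ Z₂′} {V V′ : Vec (List A) s} →
    (Z₁′ ∷ Z₂′ ∷ V′) ≼[ κ ] (Z₁ ∷ Z₂ ∷ V) →
    Separates D (κ ^ (2 + s) * M) E B Z₁ Z₂ V → Separates D M E B Z₁′ Z₂′ V′
  separates-≼ {s} {D} {M} {κ} {E} {B} {Z₁} {Z₂} {V = V} {V′} Z≼@((selected w₁ refl , _) ∷ (selected w₂ refl , _) ∷ V≼) sep =
    record
    { good = λ U p u off → rescale-error (κ ^ (2 + s)) (≼-vol Z≼)
        (subst₂ (λ x y → κ ^ (2 + s) * M * x ≤ κ ^ (2 + s) * M * (D * y) + vol (Z₁ ∷ Z₂ ∷ V)) (sym (pull₁ U u)) (sym (pull₂ U u))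
          (Separates.good sep U (⊴ᵛ-trans p (≼⇒⊴ V≼)) (λ a b → w₁ a ∧ (w₂ b ∧ u a b)) (λ a b e → off a b (inner a b u e))))
    ; bad  = λ U p u on → rescale-error (κ ^ (2 + s)) (≼-vol Z≼)
        (subst₂ (λ x y → κ ^ (2 + s) * M * (D * y) ≤ κ ^ (2 + s) * M * x + vol (Z₁ ∷ Z₂ ∷ V)) (sym (pull₁ U u)) (sym (pull₂ U u))
          (Separates.bad sep U (⊴ᵛ-trans p (≼⇒⊴ V≼)) (λ a b → w₁ a ∧ (w₂ b ∧ u a b)) (λ a b e → on a b (inner a b u e)))) }
    where
    instance _ = m^n≢0 κ (2 + s)
    inner : ∀ a b (u : A → A → Bool) → w₁ a ∧ (w₂ b ∧ u a b) ≡ true → u a b ≡ true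
    inner a b u e with w₁ a | w₂ b
    ... | true | true = e
    pull₁ : ∀ U (u : A → A → Bool) → Sum₂ (filterᵇ w₁ Z₁) (filterᵇ w₂ Z₂) U (λ a b _ → 𝟙 (u a b)) ≡
      Sum₂ Z₁ Z₂ U (λ a b _ → 𝟙 (w₁ a ∧ (w₂ b ∧ u a b)))
    pull₁ U u = Sum₂-filter w₁ w₂ Z₁ Z₂ U (λ a b _ → u a b)
    pull₂ : ∀ U (u : A → A → Bool) → Sum₂ (filterᵇ w₁ Z₁) (filterᵇ w₂ Z₂) U (λ a b v → 𝟙 (u a b ∧ E a b v)) ≡
      Sum₂ Z₁ Z₂ U (λ a b v → 𝟙 ((w₁ a ∧ (w₂ b ∧ u a b)) ∧ E a b v))
    pull₂ U u = trans (Sum₂-filter w₁ w₂ Z₁ Z₂ U (λ a b v → u a b ∧ E a b v))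
      (Sum₂-cong Z₁ Z₂ U (λ a b v → cong 𝟙 (assoc₃ (w₁ a) (w₂ b) (u a b) (E a b v))))
      where
      assoc₃ : ∀ p q r t → p ∧ (q ∧ (r ∧ t)) ≡ (p ∧ (q ∧ r)) ∧ t
      assoc₃ true  true  r t = refl
      assoc₃ true  false r t = refl
      assoc₃ false q     r t = refl

  -- Density `num` / `den` in the sense of the cut norm: the error `vol V` / M is absolute, so that
  -- small sub-boxes are unconstrained.
  record Regular {s} (M : ℕ) (g : Vec A s → Bool) (V : Vec (List A) s) : Set where
    field
      num den : ℕ
      {{den≢0}} : NonZero den
      upper : ∀ U → U ⊴ᵛ V → M * (den * Sum U (𝟙 ∘ g)) ≤ M * (num * vol U) + den * vol V
      lower : ∀ U → U ⊴ᵛ V → M * (num * vol U) ≤ M * (den * Sum U (𝟙 ∘ g)) + den * vol V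

  -- The descent with a single index and the indicator of `g` as cost: a box whose sub-boxes cannot
  -- have a noticeably smaller density has, by complements, nearly the same density in all of them.
  regularity : ∀ {s} M .{{_ : NonZero M}} (g : Vec A s → Bool) V →
    let N = suc s * M in
    ¬ ¬ (∃ λ V′ → V′ ≼[ N ^ N ] V × Regular M g V′)
  regularity {s} M g V fail = minimise V (tt , subst (Sum V (𝟙 ∘ g) ≤_) (sym (*-identityʳ _)) (Sum-≤vol V (λ v → 𝟙≤1 (g v)))) λ mn →
    let open Minimal mn in
    fail (box , small , record
      { num = level ; den = N ; den≢0 = nz
      ; upper = λ U p → up U (vol U) (vol box) level
          (subst₂ (λ x y → N * Sum U (𝟙 ∘ g) ≤ level * x + s * y) (*-identityʳ _) (*-identityʳ _) (upper U p))
      ; lower = λ U p → lo (Sum U (𝟙 ∘ g)) (vol U) (vol box) level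
          (subst₂ (λ x y → level * x ≤ N * Sum U (𝟙 ∘ g) + y) (*-identityʳ _) (*-identityʳ _) (lower tt U p)) })
    where
    open ≤-Reasoning
    N = suc s * M
    nz = m*n≢0 (suc s) M
    instance _ = nz
    open Descent {s = s} {I = ⊤} (λ _ v → 𝟙 (g v)) 1 N
    up : ∀ U x w k → N * Sum U (𝟙 ∘ g) ≤ k * x + s * w →
      M * (N * Sum U (𝟙 ∘ g)) ≤ M * (k * x) + N * w
    up U x w k h = begin
      M * (N * Sum U (𝟙 ∘ g))     ≤⟨ *-monoʳ-≤ M h ⟩
      M * (k * x + s * w)         ≡⟨ *-distribˡ-+ M (k * x) _ ⟩
      M * (k * x) + M * (s * w)   ≤⟨ +-monoʳ-≤ (M * (k * x)) (≤-trans (m≤n+m (M * (s * w)) (M * w)) (≤-reflexive (lem M s w))) ⟩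
      M * (k * x) + N * w ∎
      where
      lem : ∀ M s w → M * w + M * (s * w) ≡ suc s * M * w
      lem = solve-∀
    lo : ∀ y x w k → k * x ≤ N * y + w → M * (k * x) ≤ M * (N * y) + N * w
    lo y x w k h = begin
      M * (k * x)           ≤⟨ *-monoʳ-≤ M h ⟩
      M * (N * y + w)       ≡⟨ *-distribˡ-+ M (N * y) w ⟩
      M * (N * y) + M * w   ≤⟨ +-monoʳ-≤ (M * (N * y)) (*-monoˡ-≤ w (m≤m+n M (s * M))) ⟩
      M * (N * y) + N * w   ∎

  regular-≼ : ∀ {s M κ} .{{_ : NonZero κ}} {g} {V V′ : Vec (List A) s} → V′ ≼[ κ ] V →
    Regular (κ ^ s * M) g V → Regular M g V′
  regular-≼ {s} {M} {κ} {g} {V} {V′} V≼ reg = record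
    { num = num ; den = den
    ; upper = λ U p → rescale-error (κ ^ s) err (upper U (⊴ᵛ-trans p (≼⇒⊴ V≼)))
    ; lower = λ U p → rescale-error (κ ^ s) err (lower U (⊴ᵛ-trans p (≼⇒⊴ V≼))) }
    where
    open Regular reg
    instance _ = m^n≢0 κ s
    lem : ∀ c d w → c * (d * w) ≡ d * (c * w)
    lem = solve-∀
    err : den * vol V ≤ κ ^ s * (den * vol V′)
    err = ≤-trans (*-monoʳ-≤ den (≼-vol V≼)) (≤-reflexive (lem den (κ ^ s) (vol V′)))

  regular-mono : ∀ {s M M′ g} {V : Vec (List A) s} → M ≤ M′ → Regular M′ g V → Regular M g V
  regular-mono M≤M′ reg = record
    { num = num ; den = den
    ; upper = λ U p → coarsen-error M≤M′ (upper U p)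
    ; lower = λ U p → coarsen-error M≤M′ (lower U p) }
    where open Regular reg

-- Regularising all tuples of parts simultaneously

module _ {A : Set} where

  upd : ∀ {k s} → Vec A k → Vec (Fin k) s → Vec A s → Vec A k
  upd φ []       []       = φ
  upd φ (c ∷ cs) (a ∷ as) = upd (φ [ c ]≔ a) cs as

  lookup-upd-∉ : ∀ {k s} (φ : Vec A k) (cs : Vec (Fin k) s) as {v} → AllV.All (v ≢_) cs →
    lookup (upd φ cs as) v ≡ lookup φ v
  lookup-upd-∉ φ []       []       []         = refl
  lookup-upd-∉ φ (c ∷ cs) (a ∷ as) (v≢c ∷ ps) =
    trans (lookup-upd-∉ (φ [ c ]≔ a) cs as ps) (Vecₚ.lookup∘updateAt′ _ c v≢c φ)

  map-lookup-upd-∉ : ∀ {k s q} (φ : Vec A k) (cs : Vec (Fin k) s) as (ds : Vec (Fin k) q) →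
    AllV.All (λ d → AllV.All (d ≢_) cs) ds → Vec.map (lookup (upd φ cs as)) ds ≡ Vec.map (lookup φ) ds
  map-lookup-upd-∉ φ cs as []       []       = refl
  map-lookup-upd-∉ φ cs as (d ∷ ds) (p ∷ ps) =
    cong₂ _∷_ (lookup-upd-∉ φ cs as p) (map-lookup-upd-∉ φ cs as ds ps)

  map-lookup-upd : ∀ {k s} (φ : Vec A k) {cs : Vec (Fin k) s} as → Unique cs →
    Vec.map (lookup (upd φ cs as)) cs ≡ as
  map-lookup-upd φ {[]}     []       []       = refl
  map-lookup-upd φ {c ∷ cs} (a ∷ as) (p ∷ ps) = cong₂ _∷_
    (trans (lookup-upd-∉ (φ [ c ]≔ a) cs as p) (Vecₚ.lookup∘update c φ a))
    (map-lookup-upd (φ [ c ]≔ a) as ps)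

module _ {A : Set} where

  ≼-update : ∀ {k κ} .{{_ : NonZero κ}} (V : Vec (List A) k) c {W} →
    W ⊴ lookup V c → length (lookup V c) ≤ κ * length W → (V [ c ]≔ W) ≼[ κ ] V
  ≼-update {κ = κ} (V ∷ Vs) zero    p q = (p , q) ∷ ≼-mono (>-nonZero⁻¹ κ) (≼-refl Vs)
  ≼-update {κ = κ} (V ∷ Vs) (suc c) p q = (⊴-refl , m≤n*m _ κ) ∷ ≼-update Vs c p q

  ≼-upd : ∀ {k s κ} .{{_ : NonZero κ}} (V : Vec (List A) k) {cs : Vec (Fin k) s} {Ws} → Unique cs →
    Ws ≼[ κ ] Vec.map (lookup V) cs → upd V cs Ws ≼[ κ ^ s ] V
  ≼-upd V {[]} {[]} [] [] = ≼-refl V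
  ≼-upd {s = suc s} {κ} V {c ∷ cs} {W ∷ Ws} (p ∷ ps) ((q , q′) ∷ qs) =
    ≼-trans (≼-upd (V [ c ]≔ W) ps (subst (Ws ≼[ κ ]_) (sym same) qs)) (≼-update V c q q′)
    where
    same : Vec.map (lookup (V [ c ]≔ W)) cs ≡ Vec.map (lookup V) cs
    same = map-lookup-upd-∉ V (c ∷ []) (W ∷ []) cs (AllV.map (λ c≢d → (c≢d ∘ sym) ∷ []) p)

  ≼-lookup : ∀ {k κ} {V W : Vec (List A) k} → W ≼[ κ ] V → ∀ i →
    lookup W i ⊴ lookup V i × length (lookup V i) ≤ κ * length (lookup W i)
  ≼-lookup (p ∷ ps) zero    = p
  ≼-lookup (p ∷ ps) (suc i) = ≼-lookup ps i

  ≼-select : ∀ {k s κ} {V W : Vec (List A) k} → W ≼[ κ ] V → (cs : Vec (Fin k) s) →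
    Vec.map (lookup W) cs ≼[ κ ] Vec.map (lookup V) cs
  ≼-select p []       = []
  ≼-select p (c ∷ cs) = ≼-lookup p c ∷ ≼-select p cs

module Requirements (Ctx : Set) (A : Ctx → Set) (t : ℕ) where

  Requirement : Set₁
  Requirement = (x : Ctx) → ℕ → Vec (List (A x)) t → Set

  -- The constants are chosen before the context, which contains the number of vertices and the
  -- relations on them, so they are uniform in n. `inherit` says that a more precise version of a
  -- requirement survives later shrinking; this allows requirements to be met one after another.
  record Robust (Q : Requirement) : Set where
    field
      reach   : ∀ M .{{_ : NonZero M}} → ∃ λ κ → NonZero κ ×
                (∀ x V → ¬ ¬ (∃ λ V′ → V′ ≼[ κ ] V × Q x M V′))
      inherit : ∀ M κ .{{_ : NonZero M}} .{{_ : NonZero κ}} → ∃ λ M′ → NonZero M′ ×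
                (∀ x V V′ → V′ ≼[ κ ] V → Q x M′ V → Q x M V′)
      mono    : ∀ {x M M′ V} → M ≤ M′ → Q x M′ V → Q x M V

  open Robust

  robust-⊤ : Robust (λ _ _ _ → ⊤)
  robust-⊤ = record
    { reach   = λ M → 1 , _ , λ x V k → k (V , ≼-refl V , tt)
    ; inherit = λ M κ → 1 , _ , λ _ _ _ _ _ → tt
    ; mono    = λ _ _ → tt }

  robust-map : ∀ {P Q : Requirement} → (∀ {x M V} → P x M V → Q x M V) →
    (∀ {x M V} → Q x M V → P x M V) → Robust P → Robust Q
  robust-map f g rp = record
    { reach   = λ M → let κ , nz , h = reach rp M in
                  κ , nz , λ x V k → h x V (λ (V′ , p , q) → k (V′ , p , f q))
    ; inherit = λ M κ → let M′ , nz , h = inherit rp M κ in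
                  M′ , nz , λ x V V′ p q → f (h x V V′ p (g q))
    ; mono    = λ M≤M′ q → f (mono rp M≤M′ (g q)) }

  -- The constants are found in the order opposite to that of the shrinking: first the factor for
  -- `Q`, then the precision of `P` that survives it, then the factor for this precision.
  robust-× : ∀ {P Q : Requirement} → Robust P → Robust Q → Robust (λ x M V → P x M V × Q x M V)
  robust-× {P} {Q} rp rq = record
    { reach = reach′ ; inherit = inherit′
    ; mono = λ M≤M′ (p , q) → mono rp M≤M′ p , mono rq M≤M′ q }
    where
    reach′ : ∀ M .{{_ : NonZero M}} → ∃ λ κ → NonZero κ ×
      (∀ x V → ¬ ¬ (∃ λ V′ → V′ ≼[ κ ] V × (P x M V′ × Q x M V′)))
    reach′ M {{nz}} with reach rq M
    ... | C₂ , nz₂ , h₂ with inherit rp M C₂ {{nz}} {{nz₂}}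
    ... | M′ , nz′ , i with reach rp M′ {{nz′}}
    ... | C₁ , nz₁ , h₁ = C₁ * C₂ , m*n≢0 C₁ C₂ {{nz₁}} {{nz₂}} , λ x V k →
      h₁ x V λ (V₁ , p₁ , q₁) → h₂ x V₁ λ (V₂ , p₂ , q₂) →
      k (V₂ , ≼-trans p₂ p₁ , i x V₁ V₂ p₂ q₁ , q₂)
    inherit′ : ∀ M κ .{{_ : NonZero M}} .{{_ : NonZero κ}} → ∃ λ M′ → NonZero M′ ×
      (∀ x V V′ → V′ ≼[ κ ] V → P x M′ V × Q x M′ V → P x M V′ × Q x M V′)
    inherit′ M κ with inherit rp M κ | inherit rq M κ
    ... | M₁ , nz₁ , h₁ | M₂ , nz₂ , h₂ = M₁ + M₂ , >-nonZero (<-≤-trans (>-nonZero⁻¹ M₁ {{nz₁}}) (m≤m+n M₁ M₂)) ,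
      λ x V V′ V≼ (p , q) → h₁ x V V′ V≼ (mono rp (m≤m+n M₁ M₂) p) , h₂ x V V′ V≼ (mono rq (m≤n+m M₂ M₁) q)

  robust-∈ : ∀ {I : Set} {Q : I → Requirement} → (∀ i → Robust (Q i)) →
    (is : List I) → Robust (λ x M V → ∀ i → i ∈ is → Q i x M V)
  robust-∈ r []       = robust-map (λ _ _ ()) (λ _ → tt) robust-⊤
  robust-∈ {Q = Q} r (i ∷ is) = robust-map
    (λ { (q , qs) .i (here refl) → q ; (q , qs) j (there m) → qs j m })
    (λ h → h i (here refl) , λ j m → h j (there m))
    (robust-× (r i) (robust-∈ r is))

allVecs : ∀ {A : Set} → List A → ∀ s → List (Vec A s)
allVecs xs zero    = [] ∷ []
allVecs xs (suc s) = cartesianProductWith _∷_ xs (allVecs xs s)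

∈-allVecs : ∀ {t s} (v : Vec (Fin t) s) → v ∈ allVecs (allFin t) s
∈-allVecs []      = here refl
∈-allVecs (i ∷ v) = ∈-cartesianProductWith⁺ _∷_ (∈-allFin i) (∈-allVecs v)

module _ {A : Set} where

  SeparatesAt : ∀ {t s} (D M : ℕ) (E : A → A → Vec A s → Bool) (B : A → A → Bool) →
    Vec (Fin t) (2 + s) → Vec (List A) t → Set
  SeparatesAt D M E B (i ∷ j ∷ p) V =
    Separates D M E B (lookup V i) (lookup V j) (Vec.map (lookup V) p)

  pairs : (A → A → Bool) → Vec A 2 → Bool
  pairs g (a ∷ b ∷ []) = g a b

  separatesAt-≼ : ∀ {t s D M κ} .{{_ : NonZero κ}} {E B} {V V′ : Vec (List A) t}
    (p : Vec (Fin t) (2 + s)) → V′ ≼[ κ ] V →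
    SeparatesAt D (κ ^ (2 + s) * M) E B p V → SeparatesAt D M E B p V′
  separatesAt-≼ (i ∷ j ∷ p) V≼ sep = separates-≼ (≼-select V≼ (i ∷ j ∷ p)) sep

module _ (t s D : ℕ) where

  private
    X₁ : Set
    X₁ = Σ ℕ λ n → Fin n → Fin n → Vec (Fin n) s → Bool

  module R₁ = Requirements X₁ (λ x → Fin (proj₁ x)) t

  -- Only the parts of the link are shrunk. Since the entries of `p` are distinct, the first two
  -- parts stay fixed and the set `B` found for them still fits.
  robust-separation : ∀ p → R₁.Robust (λ (n , E) M V → Unique p → ∃ λ B → SeparatesAt D M E B p V)
  robust-separation p@(i ∷ j ∷ I) = record
    { reach   = λ M → let instance _ = m*n≢0 (suc s) M
                          N = suc s * M
                          instance _ = m^n≢0 N N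
                in (N ^ N) ^ s , m^n≢0 (N ^ N) s , reach′ M
    ; inherit = λ M κ → let instance _ = m^n≢0 κ (2 + s) in κ ^ (2 + s) * M , m*n≢0 (κ ^ (2 + s)) M ,
                  λ x V V′ V≼ q un → let B , sep = q un in B , separatesAt-≼ p V≼ sep
    ; mono    = λ M≤M′ q un → let B , sep = q un in B , separates-mono M≤M′ sep }
    where
    reach′ : ∀ M .{{_ : NonZero M}} ((n , E) : X₁) V →
      let N = suc s * M in
      ¬ ¬ (∃ λ V′ → V′ ≼[ (N ^ N) ^ s ] V × (Unique p → ∃ λ B → SeparatesAt D M E B p V′))
    reach′ M (n , E) V fail = ¬¬-lem (Unique p) λ
      { (inj₂ ¬un) → fail (V , ≼-mono (>-nonZero⁻¹ _ {{m^n≢0 (N ^ N) s}}) (≼-refl V) , ⊥-elim ∘ ¬un)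
      ; (inj₁ un@((_ ∷ i∉I) ∷ j∉I ∷ unI)) →
          separation D M E (lookup V i) (lookup V j) (Vec.map (lookup V) I) λ (W , W≼ , B , sep) →
          fail (upd V I W , ≼-upd V unI W≼ , λ _ → B , subst₂ (λ Zs U → Separates D M E B (proj₁ Zs) (proj₂ Zs) U)
            (sym (cong₂ _,_ (lookup-upd-∉ V I W i∉I) (lookup-upd-∉ V I W j∉I))) (sym (map-lookup-upd V W unI)) sep) }
      where
      N = suc s * M
      instance _ = m*n≢0 (suc s) M
      instance _ = m^n≢0 N N

module _ (t : ℕ) {I : Set} (ends : I → Vec (Fin t) 2) where

  private
    X₂ : Set
    X₂ = Σ ℕ λ n → I → Fin n → Fin n → Bool

  module R₂ = Requirements X₂ (λ x → Fin (proj₁ x)) t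

  robust-regularity : ∀ i → R₂.Robust (λ (n , g) M V → Unique (ends i) →
    Regular M (pairs (g i)) (Vec.map (lookup V) (ends i)))
  robust-regularity i = record
    { reach   = λ M → let instance _ = m*n≢0 3 M
                          N = 3 * M
                          instance _ = m^n≢0 N N
                in (N ^ N) ^ 2 , m^n≢0 (N ^ N) 2 , reach′ M
    ; inherit = λ M κ → let instance _ = m^n≢0 κ 2 in κ ^ 2 * M , m*n≢0 (κ ^ 2) M ,
                  λ x V V′ V≼ q un → regular-≼ (≼-select V≼ (ends i)) (q un)
    ; mono    = λ M≤M′ q un → regular-mono M≤M′ (q un) }
    where
    reach′ : ∀ M .{{_ : NonZero M}} ((n , g) : X₂) V →
      let N = 3 * M in
      ¬ ¬ (∃ λ V′ → V′ ≼[ (N ^ N) ^ 2 ] V ×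
        (Unique (ends i) → Regular M (pairs (g i)) (Vec.map (lookup V′) (ends i))))
    reach′ M (n , g) V fail = ¬¬-lem (Unique (ends i)) λ
      { (inj₂ ¬un) → fail (V , ≼-mono (>-nonZero⁻¹ _ {{m^n≢0 (N ^ N) 2}}) (≼-refl V) , ⊥-elim ∘ ¬un)
      ; (inj₁ un)  → regularity M (pairs (g i)) (Vec.map (lookup V) (ends i)) λ (W , W≼ , reg) →
          fail (upd V (ends i) W , ≼-upd V un W≼ ,
            λ _ → subst (Regular M (pairs (g i))) (sym (map-lookup-upd V W un)) reg) }
      where
      N = 3 * M
      instance _ = m*n≢0 3 M
      instance _ = m^n≢0 N N

firstTwo : ∀ {A : Set} {s} → Vec A (2 + s) → Vec A 2
firstTwo (i ∷ j ∷ _) = i ∷ j ∷ []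

neither : ∀ {A : Set} → (A → A → Bool) → (A → A → Bool) → A → A → Bool
neither B B′ a b = not (B a b) ∧ not (B′ a b)

-- In an index p the first two entries are the parts of the pair, the remaining ones the parts of its link.
record Regularised {t s n : ℕ} (D M : ℕ) (E : Fin n → Fin n → Vec (Fin n) s → Bool)
                   (V : Vec (List (Fin n)) t) : Set where
  field
    bad       : Vec (Fin t) (2 + s) → Fin n → Fin n → Bool
    separates : ∀ p → Unique p → SeparatesAt D M E (bad p) p V
    regular   : ∀ p q → Unique (firstTwo p) →
                Regular M (pairs (neither (bad p) (bad q))) (Vec.map (lookup V) (firstTwo p))

-- Two rounds, since the relations to be regularised are made of the bad sets produced by
-- separation. The first round aims at a precision higher by `C₂ ^ (2 + s)`, the loss caused by the
-- second.
regularise : ∀ t s D M .{{_ : NonZero M}} → ∃ λ κ → NonZero κ ×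
  (∀ n (E : Fin n → Fin n → Vec (Fin n) s → Bool) (V : Vec (List (Fin n)) t) → ¬ ¬ (∃ λ V′ → V′ ≼[ κ ] V × Regularised D M E V′))
regularise t s D M = result
  where
  P = Vec (Fin t) (2 + s)
  ps : List P
  ps = allVecs (allFin t) (2 + s)
  every : ∀ p → p ∈ ps
  every = ∈-allVecs
  module R₁′ = R₁ t s D
  module R₂′ = R₂ t {P × P} (firstTwo ∘ proj₁)
  result : ∃ λ κ → NonZero κ × (∀ n (E : Fin n → Fin n → Vec (Fin n) s → Bool) (V : Vec (List (Fin n)) t) →
    ¬ ¬ (∃ λ V′ → V′ ≼[ κ ] V × Regularised D M E V′))
  result with R₂′.Robust.reach (R₂′.robust-∈ (robust-regularity t (firstTwo ∘ proj₁)) (cartesianProduct ps ps)) M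
  ... | C₂ , nz₂ , h₂ with R₁′.Robust.reach (R₁′.robust-∈ (robust-separation t s D) ps)
                            (C₂ ^ (2 + s) * M) {{m*n≢0 (C₂ ^ (2 + s)) M {{m^n≢0 C₂ (2 + s) {{nz₂}}}}}}
  ... | C₁ , nz₁ , h₁ = C₁ * C₂ , m*n≢0 C₁ C₂ {{nz₁}} {{nz₂}} , λ n E V fail →
    h₁ (n , E) V λ (V₁ , V₁≼ , sep) →
    -- `bad` has to be a total function, so all tuples are first classified as distinct or not,
    -- which the double negation permits for finitely many; tuples with a repeated entry get no bad
    -- pairs.
    ¬¬-choice ps (λ p → ¬¬-lem (Unique p)) λ unique? →
    let bad = λ p → choose (unique? p (every p)) (sep p (every p)) in
    h₂ (n , λ (p , q) → neither (bad p) (bad q)) V₁ λ (V₂ , V₂≼ , reg) →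
    fail (V₂ , ≼-trans V₂≼ V₁≼ , record
      { bad = bad
      ; separates = λ p un → separatesAt-≼ {{nz₂}} p V₂≼ (chosen (unique? p (every p)) (sep p (every p)) un)
      ; regular = λ p q un → reg (p , q) (∈-cartesianProduct⁺ (every p) (every q)) un })
    where
    ¬¬-choice : ∀ {A : Set} {Q : A → Set} (xs : List A) → (∀ x → ¬ ¬ Q x) → ¬ ¬ (∀ x → x ∈ xs → Q x)
    ¬¬-choice []       h k = k (λ _ ())
    ¬¬-choice (x ∷ xs) h k = h x λ q → ¬¬-choice xs h λ qs →
      k λ { .x (here refl) → q ; y (there m) → qs y m }
    choose : ∀ {U A : Set} {S : (A → A → Bool) → Set} → U ⊎ ¬ U → (U → ∃ S) → A → A → Bool
    choose (inj₁ u) f = proj₁ (f u)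
    choose (inj₂ _) f = λ _ _ → false
    chosen : ∀ {U A : Set} {S : (A → A → Bool) → Set} (d : U ⊎ ¬ U) (f : U → ∃ S) → U → S (choose {U} {A} {S} d f)
    chosen (inj₁ u) f _ = proj₂ (f u)
    chosen (inj₂ n) f u = ⊥-elim (n u)

-- Ramsey's theorem

-- Only tuples in the order of the list count: the roles of I, j and K in the colourings depend on
-- the order of the parts.
Homogeneous : ∀ {A : Set} {s c} → (Vec A s → Fin c) → Fin c → List A → Set
Homogeneous {s = s} f c₀ xs = ∀ (v : Vec _ s) → toList v ⊆ xs → f v ≡ c₀

homogeneous-⊆ : ∀ {A : Set} {s c} {f : Vec A s → Fin c} {c₀ xs ys} →
  ys ⊆ xs → Homogeneous f c₀ xs → Homogeneous f c₀ ys
homogeneous-⊆ p h v q = h v (⊆-trans q p)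

-- The intermediate stage of the Erdős-Rado argument: the colour of a tuple depends only on its
-- first entry. Keeping the entries of one frequent colour then yields a homogeneous list.
data EndHomogeneous {A : Set} {s c} (f : Vec A (suc s) → Fin c) : List A → Set where
  []  : EndHomogeneous f []
  _∷_ : ∀ {x xs} → (∃ λ c₀ → Homogeneous (λ v → f (x ∷ v)) c₀ xs) →
        EndHomogeneous f xs → EndHomogeneous f (x ∷ xs)

data Monochromatic {A : Set} {s c} (f : Vec A (suc s) → Fin c) (c₀ : Fin c) : List A → Set where
  []  : Monochromatic f c₀ []
  _∷_ : ∀ {x xs} → Homogeneous (λ v → f (x ∷ v)) c₀ xs →
        Monochromatic f c₀ xs → Monochromatic f c₀ (x ∷ xs)

monochromatic⇒homogeneous : ∀ {A : Set} {s c} {f : Vec A (suc s) → Fin c} {c₀ xs} →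
  Monochromatic f c₀ xs → Homogeneous f c₀ xs
monochromatic⇒homogeneous (h ∷ m) (x ∷ v) (refl ∷ p) = h v p
monochromatic⇒homogeneous (h ∷ m) (x ∷ v) (_ ∷ʳ p)   = monochromatic⇒homogeneous m (x ∷ v) p

module _ {A : Set} {s c : ℕ} {f : Vec A (suc s) → Fin c} where

  colourClass : ∀ {xs} → EndHomogeneous f xs → (c₀ : Fin c) →
    Σ (List A) λ ys → ys ⊆ xs × Monochromatic f c₀ ys
  colourClass []                   c₀ = [] , [] , []
  colourClass (_∷_ {x} (d , h) e) c₀ with colourClass e c₀ | d Finₚ.≟ c₀
  ... | ys , p , m | yes refl = x ∷ ys , refl ∷ p , homogeneous-⊆ {f = λ v → f (x ∷ v)} p h ∷ m
  ... | ys , p , m | no _     = ys , x ∷ʳ p , m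

  classSize : ∀ {xs} → EndHomogeneous f xs → Fin c → ℕ
  classSize e c₀ = length (proj₁ (colourClass e c₀))

  ∈⇒≤Σˡ : ∀ {B : Set} {xs : List B} {x} (g : B → ℕ) → x ∈ xs → g x ≤ Σˡ xs g
  ∈⇒≤Σˡ g (here refl) = m≤m+n _ _
  ∈⇒≤Σˡ {xs = y ∷ _} g (there p) = ≤-trans (∈⇒≤Σˡ g p) (m≤n+m _ (g y))

  classes-cover : ∀ {xs} (e : EndHomogeneous f xs) → length xs ≤ Σˡ (allFin c) (classSize e)
  classes-cover []                          = z≤n
  classes-cover (_∷_ {x} {xs} (d , h) e) = begin
    suc (length xs)                                              ≤⟨ s≤s (classes-cover e) ⟩
    1 + Σˡ (allFin c) (classSize e)                              ≤⟨ +-monoˡ-≤ _ one ⟩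
    Σˡ (allFin c) hit + Σˡ (allFin c) (classSize e)              ≡⟨ Σˡ-+ (allFin c) hit (classSize e) ⟨
    Σˡ (allFin c) (λ c₀ → hit c₀ + classSize e c₀)               ≤⟨ Σˡ-mono (allFin c) step ⟩
    Σˡ (allFin c) (classSize (_∷_ {x = x} (d , h) e))            ∎
    where
    open ≤-Reasoning
    hit : Fin c → ℕ
    hit c₀ = 𝟙 (does (d Finₚ.≟ c₀))
    one : 1 ≤ Σˡ (allFin c) hit
    one with ∈⇒≤Σˡ hit (∈-allFin d)
    ... | q with d Finₚ.≟ d
    ...   | yes _  = q
    ...   | no d≢d = ⊥-elim (d≢d refl)
    step : ∀ c₀ → hit c₀ + classSize e c₀ ≤ classSize (_∷_ {x = x} (d , h) e) c₀
    step c₀ with colourClass e c₀ | d Finₚ.≟ c₀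
    ... | ys , p , m | yes refl = ≤-refl
    ... | ys , p , m | no _     = ≤-refl

pigeonhole : ∀ {A : Set} {s c} {f : Vec A (suc s) → Fin (suc c)} m {xs} (e : EndHomogeneous f xs) →
  suc c * m ≤ length xs → ∃ λ c₀ → m ≤ classSize e c₀
pigeonhole {c = c} m {xs} e le with Finₚ.any? (λ c₀ → m ≤? classSize e c₀)
... | yes p = p
... | no ¬p = ⊥-elim (<-irrefl refl (begin-strict
    Σˡ (allFin (suc c)) (classSize e)                  <⟨ m≤m+n _ _ ⟩
    suc (Σˡ (allFin (suc c)) (classSize e)) + c        ≡⟨ +-suc _ c ⟨
    Σˡ (allFin (suc c)) (classSize e) + suc c          ≡⟨ cong (λ z → Σˡ (allFin (suc c)) (classSize e) + z) ones ⟨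
    Σˡ (allFin (suc c)) (classSize e) + Σˡ (allFin (suc c)) (λ _ → 1) ≡⟨ Σˡ-+ (allFin (suc c)) (classSize e) (λ _ → 1) ⟨
    Σˡ (allFin (suc c)) (λ c₀ → classSize e c₀ + 1)    ≤⟨ Σˡ-mono (allFin (suc c)) (λ c₀ → small c₀) ⟩
    Σˡ (allFin (suc c)) (λ _ → m)                      ≡⟨ Σˡ-const (allFin (suc c)) m ⟩
    length (allFin (suc c)) * m                        ≡⟨ cong (_* m) (Listₚ.length-tabulate {n = suc c} (λ i → i)) ⟩
    suc c * m                                          ≤⟨ le ⟩
    length xs                                          ≤⟨ classes-cover e ⟩
    Σˡ (allFin (suc c)) (classSize e)                  ∎))
  where
  open ≤-Reasoning
  ones : Σˡ (allFin (suc c)) (λ _ → 1) ≡ suc c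
  ones = trans (Σˡ-const (allFin (suc c)) 1) (trans (*-identityʳ _) (Listₚ.length-tabulate {n = suc c} (λ i → i)))
  small : ∀ c₀ → classSize e c₀ + 1 ≤ m
  small c₀ = subst (_≤ m) (+-comm 1 _) (≰⇒> (λ q → ¬p (c₀ , q)))

mutual
  ramseyBound : (s c m : ℕ) → ℕ
  ramseyBound zero    c m = m
  ramseyBound (suc s) c m = endBound s c (suc c * m)

  endBound : (s c m : ℕ) → ℕ
  endBound s c zero    = 0
  endBound s c (suc m) = suc (ramseyBound s c (endBound s c m))

mutual
  ramsey : ∀ {A : Set} s c m (f : Vec A s → Fin (suc c)) xs → ramseyBound s c m ≤ length xs →
    ∃ λ ys → ys ⊆ xs × m ≤ length ys × ∃ λ c₀ → Homogeneous f c₀ ys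
  ramsey zero    c m f xs le = xs , ⊆-refl , le , f [] , λ { [] _ → refl }
  ramsey (suc s) c m f xs le with endHomogeneous s c (suc c * m) f xs le
  ... | ys , ys⊆xs , le′ , e with pigeonhole m e le′
  ... | c₀ , le″ with colourClass e c₀
  ... | zs , zs⊆ys , mono = zs , ⊆-trans zs⊆ys ys⊆xs , le″ , c₀ , monochromatic⇒homogeneous mono

  endHomogeneous : ∀ {A : Set} s c m (f : Vec A (suc s) → Fin (suc c)) xs → endBound s c m ≤ length xs →
    ∃ λ ys → ys ⊆ xs × m ≤ length ys × EndHomogeneous f ys
  endHomogeneous s c zero    f xs       le       = [] , Sublistₚ.[]⊆-universal xs , z≤n , []

  endHomogeneous s c (suc m) f (x ∷ xs) (s≤s le)
    with ramsey s c (endBound s c m) (λ v → f (x ∷ v)) xs le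
  ... | ys , ys⊆xs , le′ , c₀ , hom with endHomogeneous s c m f ys le′
  ... | zs , zs⊆ys , le″ , e = x ∷ zs , refl ∷ ⊆-trans zs⊆ys ys⊆xs , s≤s le″ ,
        (c₀ , homogeneous-⊆ {f = λ v → f (x ∷ v)} zs⊆ys hom) ∷ e

-- Counting edges by sublists and transversals

-- The sum over all r-element sublists, split as in Pascal's rule according to whether the first
-- entry is used; a constant summand therefore gives a binomial coefficient.
pick : ∀ {A : Set} r → List A → (Vec A r → ℕ) → ℕ
pick zero    xs       F = F []
pick (suc r) []       F = 0
pick (suc r) (x ∷ xs) F = pick r xs (λ v → F (x ∷ v)) + pick (suc r) xs F

private
  -- v τ^(r-1) bounds the number of r-element sublists, out of τ entries, with an entry among v
  -- given ones. For r = 0 there are none.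
  shift : ℕ → ℕ → ℕ → ℕ
  shift zero    v τ = 0
  shift (suc r) v τ = v * τ ^ r

module _ {A : Set} where

  pick-cong-⊆ : ∀ r (xs : List A) {F G} → (∀ v → toList v ⊆ xs → F v ≡ G v) → pick r xs F ≡ pick r xs G
  pick-cong-⊆ zero    xs       e = e [] (minimum xs)
  pick-cong-⊆ (suc r) []       e = refl
  pick-cong-⊆ (suc r) (x ∷ xs) e = cong₂ _+_
    (pick-cong-⊆ r xs (λ v p → e (x ∷ v) (refl ∷ p))) (pick-cong-⊆ (suc r) xs (λ v p → e v (x ∷ʳ p)))

  pick-mono-⊆ : ∀ r (xs : List A) {F G} → (∀ v → toList v ⊆ xs → F v ≤ G v) → pick r xs F ≤ pick r xs G
  pick-mono-⊆ zero    xs       e = e [] (minimum xs)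
  pick-mono-⊆ (suc r) []       e = z≤n
  pick-mono-⊆ (suc r) (x ∷ xs) e = +-mono-≤
    (pick-mono-⊆ r xs (λ v p → e (x ∷ v) (refl ∷ p))) (pick-mono-⊆ (suc r) xs (λ v p → e v (x ∷ʳ p)))

  pick-cong : ∀ r (xs : List A) {F G} → (∀ v → F v ≡ G v) → pick r xs F ≡ pick r xs G
  pick-cong r xs e = pick-cong-⊆ r xs (λ v _ → e v)

  pick-+ : ∀ r (xs : List A) F G → pick r xs (λ v → F v + G v) ≡ pick r xs F + pick r xs G
  pick-+ zero    xs       F G = refl
  pick-+ (suc r) []       F G = refl
  pick-+ (suc r) (x ∷ xs) F G = trans
    (cong₂ _+_ (pick-+ r xs _ _) (pick-+ (suc r) xs F G))
    (lem (pick r xs (λ v → F (x ∷ v))) (pick r xs (λ v → G (x ∷ v))) _ _)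
    where
    lem : ∀ a b c d → a + b + (c + d) ≡ a + c + (b + d)
    lem = solve-∀

  pick-*ˡ : ∀ r (xs : List A) c F → pick r xs (λ v → c * F v) ≡ c * pick r xs F
  pick-*ˡ zero    xs       c F = refl
  pick-*ˡ (suc r) []       c F = sym (*-zeroʳ c)
  pick-*ˡ (suc r) (x ∷ xs) c F = trans (cong₂ _+_ (pick-*ˡ r xs c _) (pick-*ˡ (suc r) xs c F))
    (sym (*-distribˡ-+ c (pick r xs (λ v → F (x ∷ v))) _))

  pick-0 : ∀ r (xs : List A) → pick r xs (λ _ → 0) ≡ 0
  pick-0 zero    xs       = refl
  pick-0 (suc r) []       = refl
  pick-0 (suc r) (x ∷ xs) = cong₂ _+_ (pick-0 r xs) (pick-0 (suc r) xs)

  pick-Σˡ : ∀ {B : Set} r (xs : List A) (ys : List B) (F : B → Vec A r → ℕ) →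
    pick r xs (λ v → Σˡ ys (λ b → F b v)) ≡ Σˡ ys (λ b → pick r xs (F b))
  pick-Σˡ r xs []       F = pick-0 r xs
  pick-Σˡ r xs (y ∷ ys) F = trans (pick-+ r xs (F y) _) (cong (λ z → pick r xs (F y) + z) (pick-Σˡ r xs ys F))

  pick-const : ∀ r (xs : List A) c → pick r xs (λ _ → c) ≡ (length xs C r) * c
  pick-const zero    xs       c = sym (+-identityʳ c)
  pick-const (suc r) []       c = refl
  pick-const (suc r) (x ∷ xs) c = begin
    pick r xs (λ _ → c) + pick (suc r) xs (λ _ → c)      ≡⟨ cong₂ _+_ (pick-const r xs c) (pick-const (suc r) xs c) ⟩
    (length xs C r) * c + (length xs C suc r) * c        ≡⟨ *-distribʳ-+ c (length xs C r) _ ⟨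
    (length xs C r + length xs C suc r) * c              ≡⟨ cong (_* c) (nCk+nC[k+1]≡[n+1]C[k+1] (length xs) r) ⟩
    (suc (length xs) C suc r) * c                        ∎
    where open ≡-Reasoning

  pick-≤^ : ∀ r (xs : List A) {F} → (∀ v → F v ≤ 1) → pick r xs F ≤ length xs ^ r
  pick-≤^ zero    xs       h = h []
  pick-≤^ (suc r) []       h = z≤n
  pick-≤^ (suc r) (x ∷ xs) h = +-mono-≤
    (≤-trans (pick-≤^ r xs (λ v → h (x ∷ v))) (^-monoˡ-≤ r (n≤1+n (length xs))))
    (≤-trans (pick-≤^ (suc r) xs h) (*-monoʳ-≤ (length xs) (^-monoˡ-≤ r (n≤1+n (length xs)))))

  pick-++ʳ : ∀ r (xs ys : List A) F → pick r ys F ≤ pick r (xs ++ ys) F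
  pick-++ʳ zero    xs       ys F = ≤-refl
  pick-++ʳ (suc r) []       ys F = ≤-refl
  pick-++ʳ (suc r) (x ∷ xs) ys F = ≤-trans (pick-++ʳ (suc r) xs ys F) (m≤n+m _ _)

  pick-split-≥ : ∀ r (xs ys : List A) F →
    Σˡ xs (λ a → pick r ys (λ v → F (a ∷ v))) + pick (suc r) ys F ≤ pick (suc r) (xs ++ ys) F
  pick-split-≥ r []       ys F = ≤-refl
  pick-split-≥ r (x ∷ xs) ys F = ≤-trans (≤-reflexive (+-assoc (pick r ys (λ v → F (x ∷ v))) _ _))
    (+-mono-≤ (pick-++ʳ r xs ys _) (pick-split-≥ r xs ys F))

  pick-++-≤ : ∀ r (xs ys : List A) τ {F} → (∀ v → F v ≤ 1) → length xs + length ys ≤ τ →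
    pick r (xs ++ ys) F ≤ pick r ys F + shift r (length xs) τ
  pick-++-≤ zero    xs       ys τ h l = m≤m+n _ 0
  pick-++-≤ (suc r) []       ys τ h l = m≤m+n _ 0
  pick-++-≤ (suc r) (x ∷ xs) ys τ {F} h l = begin
    pick r (xs ++ ys) (λ v → F (x ∷ v)) + pick (suc r) (xs ++ ys) F
      ≤⟨ +-mono-≤ (≤-trans (pick-≤^ r (xs ++ ys) (λ v → h (x ∷ v))) (^-monoˡ-≤ r l′))
                  (pick-++-≤ (suc r) xs ys τ h (≤-trans (n≤1+n _) l)) ⟩
    τ ^ r + (pick (suc r) ys F + length xs * τ ^ r)  ≡⟨ lem (τ ^ r) (pick (suc r) ys F) (length xs * τ ^ r) ⟩
    pick (suc r) ys F + (τ ^ r + length xs * τ ^ r)  ∎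
    where
    open ≤-Reasoning
    l′ : length (xs ++ ys) ≤ τ
    l′ = ≤-trans (≤-reflexive (Listₚ.length-++ xs)) (≤-trans (n≤1+n _) l)
    lem : ∀ a b c → a + (b + c) ≡ b + (a + c)
    lem = solve-∀

  -- The sublists missed by the first two terms have two entries in `xs`: at most |xs|² choices for
  -- these and τ^(r-1) for the others.
  pick-split-≤ : ∀ r (xs ys : List A) τ {F} → (∀ v → F v ≤ 1) → length xs + length ys ≤ τ →
    pick (suc r) (xs ++ ys) F ≤
    Σˡ xs (λ a → pick r ys (λ v → F (a ∷ v))) + pick (suc r) ys F + shift r (length xs * length xs) τ
  pick-split-≤ r []       ys τ h l = m≤m+n _ _
  pick-split-≤ r (x ∷ xs) ys τ {F} h l = begin
    pick r (xs ++ ys) (λ v → F (x ∷ v)) + pick (suc r) (xs ++ ys) F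
      ≤⟨ +-mono-≤ (pick-++-≤ r xs ys τ (λ v → h (x ∷ v)) l′) (pick-split-≤ r xs ys τ h l′) ⟩
    P + shift r n τ + (S + R + shift r (n * n) τ)    ≡⟨ lem P S R (shift r n τ) (shift r (n * n) τ) ⟩
    P + S + R + (shift r n τ + shift r (n * n) τ)    ≤⟨ +-monoʳ-≤ (P + S + R) (sq r) ⟩
    P + S + R + shift r (suc n * suc n) τ            ∎
    where
    open ≤-Reasoning
    n = length xs
    P = pick r ys (λ v → F (x ∷ v))
    S = Σˡ xs (λ a → pick r ys (λ v → F (a ∷ v)))
    R = pick (suc r) ys F
    l′ = ≤-trans (n≤1+n _) l
    lem : ∀ p s r a b → p + a + (s + r + b) ≡ p + s + r + (a + b)
    lem = solve-∀
    sq : ∀ r → shift r n τ + shift r (n * n) τ ≤ shift r (suc n * suc n) τ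
    sq zero    = z≤n
    sq (suc r) = ≤-trans (m≤m+n _ ((1 + n) * τ ^ r)) (≤-reflexive (lem₂ n (τ ^ r)))
      where
      lem₂ : ∀ n t → n * t + n * n * t + (1 + n) * t ≡ suc n * suc n * t
      lem₂ = solve-∀

private
  -- A bound for the sublists with two entries in the same list of length at most q, chosen so as to
  -- be closed under the recursion, which `loss-step` verifies.
  loss : ℕ → ℕ → ℕ → ℕ
  loss zero    q τ = 0
  loss (suc r) q τ = r * (q * τ ^ r)

  loss-step : ∀ r {v q τ′ τ} → v ≤ q → v + τ′ ≤ τ →
    v * loss r q τ′ + loss (suc r) q τ′ + shift r (v * v) τ ≤ loss (suc r) q τ
  loss-step zero    {v} {q} {τ′} {τ} v≤q l = ≤-reflexive (lem v)
    where
    lem : ∀ v → v * 0 + 0 + 0 ≡ 0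
    lem = solve-∀
  loss-step (suc r) {v} {q} {τ′} {τ} v≤q l = begin
    v * (r * (q * τ′ ^ r)) + suc r * (q * (τ′ * τ′ ^ r)) + v * v * τ ^ r
      ≤⟨ +-mono-≤ (+-mono-≤ (*-monoʳ-≤ v (*-monoʳ-≤ r (*-monoʳ-≤ q pw)))
                            (*-monoʳ-≤ (suc r) (*-monoʳ-≤ q (*-monoʳ-≤ τ′ pw))))
                  (*-monoˡ-≤ (τ ^ r) (*-monoʳ-≤ v v≤q)) ⟩
    v * (r * (q * τ ^ r)) + suc r * (q * (τ′ * τ ^ r)) + v * q * τ ^ r ≡⟨ lem v r q τ′ (τ ^ r) ⟩
    suc r * (q * ((v + τ′) * τ ^ r))   ≤⟨ *-monoʳ-≤ (suc r) (*-monoʳ-≤ q (*-monoˡ-≤ (τ ^ r) l)) ⟩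
    suc r * (q * (τ * τ ^ r))          ∎
    where
    open ≤-Reasoning
    pw : τ′ ^ r ≤ τ ^ r
    pw = ^-monoˡ-≤ r (≤-trans (m≤n+m τ′ v) l)
    lem : ∀ v r q t p → v * (r * (q * p)) + suc r * (q * (t * p)) + v * q * p ≡ suc r * (q * ((v + t) * p))
    lem = solve-∀

module _ {A : Set} where

  -- Sums over transversals: r vertices from distinct members of Ls.
  Trans : ∀ r → List (List A) → (Vec A r → ℕ) → ℕ
  Trans r Ls F = pick r Ls (λ Us → Sum Us F)

  Trans-∷ : ∀ r V Ls F →
    Trans (suc r) (V ∷ Ls) F ≡ Σˡ V (λ a → Trans r Ls (λ v → F (a ∷ v))) + Trans (suc r) Ls F
  Trans-∷ r V Ls F = cong (_+ Trans (suc r) Ls F) (pick-Σˡ r Ls V (λ a Us → Sum Us (λ v → F (a ∷ v))))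

  Trans≤pick : ∀ r Ls F → Trans r Ls F ≤ pick r (concat Ls) F
  Trans≤pick zero    Ls       F = ≤-refl
  Trans≤pick (suc r) []       F = z≤n
  Trans≤pick (suc r) (V ∷ Ls) F = begin
    Trans (suc r) (V ∷ Ls) F                                            ≡⟨ Trans-∷ r V Ls F ⟩
    Σˡ V (λ a → Trans r Ls (λ v → F (a ∷ v))) + Trans (suc r) Ls F      ≤⟨ +-mono-≤ (Σˡ-mono V (λ a → Trans≤pick r Ls _)) (Trans≤pick (suc r) Ls F) ⟩
    Σˡ V (λ a → pick r (concat Ls) (λ v → F (a ∷ v))) + pick (suc r) (concat Ls) F ≤⟨ pick-split-≥ r V (concat Ls) F ⟩
    pick (suc r) (concat (V ∷ Ls)) F                                    ∎
    where open ≤-Reasoning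

  private
    pick≤Trans+loss : ∀ r q Ls {F} → (∀ v → F v ≤ 1) → All (λ L → length L ≤ q) Ls →
      pick r (concat Ls) F ≤ Trans r Ls F + loss r q (length (concat Ls))
    pick≤Trans+loss zero    q Ls       h []       = m≤m+n _ 0
    pick≤Trans+loss zero    q Ls       h (_ ∷ _)  = m≤m+n _ 0
    pick≤Trans+loss (suc r) q []       h []       = z≤n
    pick≤Trans+loss (suc r) q (V ∷ Ls) {F} h (v≤q ∷ ls) = begin
      pick (suc r) (V ++ concat Ls) F
        ≤⟨ pick-split-≤ r V (concat Ls) τ h (≤-reflexive (sym (Listₚ.length-++ V))) ⟩
      Σˡ V (λ a → pick r (concat Ls) (λ v → F (a ∷ v))) + pick (suc r) (concat Ls) F + sh
        ≤⟨ +-monoˡ-≤ sh (+-mono-≤ (Σˡ-mono V (λ a → pick≤Trans+loss r q Ls (λ v → h (a ∷ v)) ls))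
                                  (pick≤Trans+loss (suc r) q Ls h ls)) ⟩
      Σˡ V (λ a → Trans r Ls (λ v → F (a ∷ v)) + loss r q τ′) + (Trans (suc r) Ls F + loss (suc r) q τ′) + sh
        ≡⟨ cong (λ z → z + (Trans (suc r) Ls F + loss (suc r) q τ′) + sh)
             (trans (Σˡ-+ V _ _) (cong (λ z → S + z) (Σˡ-const V _))) ⟩
      S + length V * loss r q τ′ + (Trans (suc r) Ls F + loss (suc r) q τ′) + sh
        ≡⟨ lem S (length V * loss r q τ′) (Trans (suc r) Ls F) (loss (suc r) q τ′) sh ⟩
      S + Trans (suc r) Ls F + (length V * loss r q τ′ + loss (suc r) q τ′ + sh)
        ≤⟨ +-mono-≤ (≤-reflexive (sym (Trans-∷ r V Ls F)))
             (loss-step r v≤q (≤-reflexive (sym (Listₚ.length-++ V)))) ⟩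
      Trans (suc r) (V ∷ Ls) F + loss (suc r) q τ ∎
      where
      open ≤-Reasoning
      τ  = length (V ++ concat Ls)
      τ′ = length (concat Ls)
      sh = shift r (length V * length V) τ
      S  = Σˡ V (λ a → Trans r Ls (λ v → F (a ∷ v)))
      lem : ∀ s a t b c → s + a + (t + b) + c ≡ s + t + (a + b + c)
      lem = solve-∀

  -- The error counts the r-sets with two elements in the same member of Ls.
  pick≤Trans : ∀ r q Ls {F} → (∀ v → F v ≤ 1) → All (λ L → length L ≤ q) Ls →
    pick (suc r) (concat Ls) F ≤ Trans (suc r) Ls F + r * (q * length (concat Ls) ^ r)
  pick≤Trans r q Ls h ls = pick≤Trans+loss (suc r) q Ls h ls

  vol-const : ∀ {r} q (Us : Vec (List A) r) {Ls} → toList Us ⊆ Ls → All (λ L → length L ≡ q) Ls → vol Us ≡ q ^ r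
  vol-const q []       p          ls        = refl
  vol-const q (U ∷ Us) (refl ∷ p) (l ∷ ls)  = cong₂ _*_ l (vol-const q Us p ls)
  vol-const q (U ∷ Us) (_ ∷ʳ p)   (_ ∷ ls)  = vol-const q (U ∷ Us) p ls

  -- Double counting over random transversals: a transversal of all m parts restricts to a uniformly
  -- distributed tuple in each of the `m C r` choices of r parts, so a bound b/a for the density of
  -- each choice bounds the expected total.
  sum-pick-≤ : ∀ {m} r (Vs : Vec (List A) m) F a b →
    (∀ (Us : Vec (List A) r) → toList Us ⊆ toList Vs → a * Sum Us F ≤ b * vol Us) →
    a * Sum Vs (λ x → pick r (toList x) F) ≤ b * ((m C r) * vol Vs)
  sum-pick-≤ {m} zero Vs F a b h = begin
    a * Sum Vs (λ _ → F [])     ≡⟨ cong (a *_) (Sum-const Vs (F [])) ⟩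
    a * (vol Vs * F [])         ≡⟨ lem a (vol Vs) (F []) ⟩
    vol Vs * (a * F [])         ≤⟨ *-monoʳ-≤ (vol Vs) (h [] (minimum _)) ⟩
    vol Vs * (b * 1)            ≡⟨ lem₂ (vol Vs) b ⟩
    b * (1 * vol Vs)            ∎
    where
    open ≤-Reasoning
    lem : ∀ a v f → a * (v * f) ≡ v * (a * f)
    lem = solve-∀
    lem₂ : ∀ v b → v * (b * 1) ≡ b * (1 * v)
    lem₂ = solve-∀
  sum-pick-≤ (suc r) [] F a b h = ≤-trans (≤-reflexive (*-zeroʳ a)) z≤n
  sum-pick-≤ {suc m} (suc r) (V ∷ Vs) F a b h = begin
    a * Σˡ V (λ y → Sum Vs (λ x → pick r (toList x) (λ v → F (y ∷ v)) + pick (suc r) (toList x) F))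
      ≡⟨ cong (a *_) (trans (Σˡ-cong V (λ y → Sum-+ Vs _ _)) (Σˡ-+ V _ _)) ⟩
    a * (Σˡ V (λ y → Sum Vs (λ x → pick r (toList x) (λ v → F (y ∷ v)))) + Σˡ V (λ _ → R))
      ≡⟨ cong (a *_) (cong₂ _+_ (trans (sym (Sum-swap Vs V _)) (Sum-cong Vs (λ x → sym (pick-Σˡ r (toList x) V _)))) (Σˡ-const V R)) ⟩
    a * (Sum Vs (λ x → pick r (toList x) Fⱽ) + length V * R)
      ≡⟨ lem₁ a (Sum Vs (λ x → pick r (toList x) Fⱽ)) (length V) R ⟩
    a * Sum Vs (λ x → pick r (toList x) Fⱽ) + length V * (a * R)
      ≤⟨ +-mono-≤ (sum-pick-≤ r Vs Fⱽ a (b * length V) h′)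
                  (*-monoʳ-≤ (length V) (sum-pick-≤ (suc r) Vs F a b (λ Us p → h Us (V ∷ʳ p)))) ⟩
    b * length V * ((m C r) * vol Vs) + length V * (b * ((m C suc r) * vol Vs))
      ≡⟨ lem₂ b (length V) (m C r) (m C suc r) (vol Vs) ⟩
    b * ((m C r + m C suc r) * (length V * vol Vs))
      ≡⟨ cong (λ z → b * (z * (length V * vol Vs))) (nCk+nC[k+1]≡[n+1]C[k+1] m r) ⟩
    b * ((suc m C suc r) * (length V * vol Vs)) ∎
    where
    open ≤-Reasoning
    R = Sum Vs (λ x → pick (suc r) (toList x) F)
    Fⱽ : Vec A r → ℕ
    Fⱽ v = Σˡ V (λ y → F (y ∷ v))
    lem₁ : ∀ a s l r → a * (s + l * r) ≡ a * s + l * (a * r)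
    lem₁ = solve-∀
    lem₂ : ∀ b l c d v → b * l * (c * v) + l * (b * (d * v)) ≡ b * ((c + d) * (l * v))
    lem₂ = solve-∀
    h′ : ∀ Us → toList Us ⊆ toList Vs → a * Sum Us Fⱽ ≤ b * length V * vol Us
    h′ Us p = begin
      a * Sum Us Fⱽ               ≡⟨ cong (a *_) (Sum-swap Us V _) ⟩
      a * Sum (V ∷ Us) F          ≤⟨ h (V ∷ Us) (refl ∷ p) ⟩
      b * (length V * vol Us)     ≡⟨ *-assoc b (length V) (vol Us) ⟨
      b * length V * vol Us       ∎

  -- Each r-tuple from distinct parts extends to q^(m-r) full transversals; multiplying by q^r
  -- avoids the difference of exponents.
  Trans-equal : ∀ {m} r q (Qs : Vec (List A) m) F → All (λ L → length L ≡ q) (toList Qs) →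
    q ^ m * Trans r (toList Qs) F ≡ q ^ r * Sum Qs (λ x → pick r (toList x) F)
  Trans-equal {m} zero q Qs F ls = begin
    q ^ m * F []                ≡⟨ cong (_* F []) (vol-const q Qs ⊆-refl ls) ⟨
    vol Qs * F []               ≡⟨ Sum-const Qs (F []) ⟨
    Sum Qs (λ _ → F [])         ≡⟨ +-identityʳ _ ⟨
    1 * Sum Qs (λ _ → F [])     ∎
    where open ≡-Reasoning
  Trans-equal (suc r) q [] F ls = sym (*-zeroʳ (q ^ suc r))
  Trans-equal {suc m} (suc r) q (Q ∷ Qs) F (l ∷ ls) = begin
    q * q ^ m * (pick r (toList Qs) (λ Us → Σˡ Q (λ y → Sum Us (λ v → F (y ∷ v)))) + Trans (suc r) (toList Qs) F)
      ≡⟨ cong (λ z → q * q ^ m * (z + Trans (suc r) (toList Qs) F)) (pick-cong r (toList Qs) (λ Us → sym (Sum-swap Us Q _))) ⟩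
    q * q ^ m * (Trans r (toList Qs) Fᵠ + Trans (suc r) (toList Qs) F)
      ≡⟨ lem₁ q (q ^ m) (Trans r (toList Qs) Fᵠ) _ ⟩
    q * (q ^ m * Trans r (toList Qs) Fᵠ) + q * (q ^ m * Trans (suc r) (toList Qs) F)
      ≡⟨ cong₂ (λ y z → q * y + q * z) (Trans-equal r q Qs Fᵠ ls) (Trans-equal (suc r) q Qs F ls) ⟩
    q * (q ^ r * Sum Qs (λ x → pick r (toList x) Fᵠ)) + q * (q ^ suc r * R)
      ≡⟨ lem₂ q (q ^ r) (Sum Qs (λ x → pick r (toList x) Fᵠ)) R ⟩
    q * q ^ r * (Sum Qs (λ x → pick r (toList x) Fᵠ) + q * R)
      ≡⟨ cong (q * q ^ r *_) (cong₂ _+_ (trans (Sum-cong Qs (λ x → pick-Σˡ r (toList x) Q _)) (Sum-swap Qs Q _))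
           (trans (cong (_* R) (sym l)) (sym (Σˡ-const Q R)))) ⟩
    q * q ^ r * (Σˡ Q (λ y → Sum Qs (λ x → pick r (toList x) (λ v → F (y ∷ v)))) + Σˡ Q (λ _ → R))
      ≡⟨ cong (q * q ^ r *_) (sym (trans (Σˡ-cong Q (λ y → Sum-+ Qs _ _)) (Σˡ-+ Q _ _))) ⟩
    q * q ^ r * Sum (Q ∷ Qs) (λ x → pick (suc r) (toList x) F) ∎
    where
    open ≡-Reasoning
    R = Sum Qs (λ x → pick (suc r) (toList x) F)
    Fᵠ : Vec A r → ℕ
    Fᵠ v = Σˡ Q (λ y → F (y ∷ v))
    lem₁ : ∀ q p s t → q * p * (s + t) ≡ q * (p * s) + q * (p * t)
    lem₁ = solve-∀
    lem₂ : ∀ q p s r → q * (p * s) + q * (q * p * r) ≡ q * p * (s + q * r)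
    lem₂ = solve-∀

C-mono : ∀ r {m n} → m ≤ n → (m C r) ≤ (n C r)
C-mono r {m} {n} m≤n = begin
  m C r                             ≡⟨ cong (_C r) (Listₚ.length-replicate m) ⟨
  length ys C r                     ≡⟨ picks ys ⟨
  pick r ys (λ _ → 1)               ≤⟨ pick-++ʳ r xs ys _ ⟩
  pick r (xs ++ ys) (λ _ → 1)       ≡⟨ picks (xs ++ ys) ⟩
  length (xs ++ ys) C r             ≡⟨ cong (_C r) (trans (Listₚ.length-++ xs)
                                         (cong₂ _+_ (Listₚ.length-replicate (n ∸ m)) (Listₚ.length-replicate m))) ⟩
  (n ∸ m + m) C r                   ≡⟨ cong (_C r) (m∸n+n≡m m≤n) ⟩
  n C r                             ∎
  where
  open ≤-Reasoning
  xs = List.replicate (n ∸ m) 0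
  ys = List.replicate m 0
  picks : ∀ zs → pick r zs (λ _ → 1) ≡ length zs C r
  picks zs = trans (pick-const r zs 1) (*-identityʳ _)

-- Among m disjoint blocks of q points each, the r-sets with at most one point in every block are
-- some of all r-sets.
C-* : ∀ m q r → (m C r) * q ^ r ≤ (m * q) C r
C-* m q r = begin
  (m C r) * q ^ r                       ≡⟨ cong (λ z → (z C r) * q ^ r) (Listₚ.length-replicate m) ⟨
  (length Ls C r) * q ^ r               ≡⟨ pick-const r Ls (q ^ r) ⟨
  pick r Ls (λ _ → q ^ r)               ≡⟨ pick-cong-⊆ r Ls (λ Us p → trans (sym (vol-const q Us p (ls m))) (sym (Sum-1 Us))) ⟩
  Trans r Ls (λ _ → 1)                  ≤⟨ Trans≤pick r Ls (λ _ → 1) ⟩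
  pick r (concat Ls) (λ _ → 1)          ≡⟨ trans (pick-const r (concat Ls) 1) (*-identityʳ _) ⟩
  length (concat Ls) C r                ≡⟨ cong (_C r) (len m) ⟩
  (m * q) C r                           ∎
  where
  open ≤-Reasoning
  Ls = List.replicate m (List.replicate q 0)
  ls : ∀ m → All (λ L → length L ≡ q) (List.replicate m (List.replicate q 0))
  ls zero    = []
  ls (suc m) = Listₚ.length-replicate q ∷ ls m
  len : ∀ m → length (concat (List.replicate m (List.replicate q 0))) ≡ m * q
  len zero    = refl
  len (suc m) = trans (Listₚ.length-++ (List.replicate q 0)) (cong₂ _+_ (Listₚ.length-replicate q) (len m))

^≤C : ∀ r c → c ^ r ≤ (r * c) C r
^≤C r c = ≤-trans (≤-reflexive (sym (trans (cong (_* c ^ r) (nCn≡1 r)) (+-identityʳ _)))) (C-* r c r)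

-- Subsets as increasing lists

elems : ∀ {n} → Subset n → List (Fin n)
elems []          = []
elems (true  ∷ S) = zero ∷ map suc (elems S)
elems (false ∷ S) = map suc (elems S)

setOf : ∀ {n} → List (Fin n) → Subset n
setOf []       = ∅
setOf (x ∷ xs) = setOf xs [ x ]≔ true

length-elems : ∀ {n} (S : Subset n) → length (elems S) ≡ ∣ S ∣
length-elems []          = refl
length-elems (true  ∷ S) = cong suc (trans (Listₚ.length-map suc (elems S)) (length-elems S))
length-elems (false ∷ S) = trans (Listₚ.length-map suc (elems S)) (length-elems S)

setOf-suc : ∀ {n} (xs : List (Fin n)) → setOf (map suc xs) ≡ false ∷ setOf xs
setOf-suc []       = refl
setOf-suc (x ∷ xs) rewrite setOf-suc xs = refl

⊆-map⁻ : ∀ {A B : Set} (f : A → B) xs {ys} → ys ⊆ map f xs → ∃ λ zs → zs ⊆ xs × ys ≡ map f zs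
⊆-map⁻ f []       []         = [] , [] , refl
⊆-map⁻ f (x ∷ xs) (refl ∷ p) with ⊆-map⁻ f xs p
... | zs , q , refl = x ∷ zs , refl ∷ q , refl
⊆-map⁻ f (x ∷ xs) (_ ∷ʳ p)   with ⊆-map⁻ f xs p
... | zs , q , refl = zs , x ∷ʳ q , refl

elems-setOf : ∀ {n} (S : Subset n) {xs} → xs ⊆ elems S → elems (setOf xs) ≡ xs
elems-setOf []          []         = refl
elems-setOf (true  ∷ S) (refl ∷ p) with ⊆-map⁻ suc (elems S) p
... | ys , q , refl rewrite setOf-suc ys = cong (λ zs → zero ∷ map suc zs) (elems-setOf S q)
elems-setOf (true  ∷ S) (_ ∷ʳ p)   with ⊆-map⁻ suc (elems S) p
... | ys , q , refl rewrite setOf-suc ys = cong (map suc) (elems-setOf S q)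
elems-setOf (false ∷ S) p          with ⊆-map⁻ suc (elems S) p
... | ys , q , refl rewrite setOf-suc ys = cong (map suc) (elems-setOf S q)

allFin≡elems : ∀ n → allFin n ≡ elems (Vec.replicate n true)
allFin≡elems zero    = refl
allFin≡elems (suc n) = cong (zero ∷_) (trans (sym (Listₚ.map-tabulate (λ i → i) suc)) (cong (map suc) (allFin≡elems n)))

setOf-elems : ∀ {n} (S : Subset n) → setOf (elems S) ≡ S
setOf-elems []          = refl
setOf-elems (true  ∷ S) rewrite setOf-suc (elems S) = cong (true ∷_) (setOf-elems S)
setOf-elems (false ∷ S) rewrite setOf-suc (elems S) = cong (false ∷_) (setOf-elems S)

module _ {A : Set} where

  countᵇ-cong : ∀ {p q : A → Bool} (xs : List A) → (∀ x → p x ≡ q x) → countᵇ p xs ≡ countᵇ q xs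
  countᵇ-cong []       e = refl
  countᵇ-cong {p} {q} (x ∷ xs) e rewrite e x | countᵇ-cong {p} {q} xs e = refl

  countᵇ-++ : ∀ (p : A → Bool) xs ys → countᵇ p (xs ++ ys) ≡ countᵇ p xs + countᵇ p ys
  countᵇ-++ p []       ys = refl
  countᵇ-++ p (x ∷ xs) ys with p x
  ... | true  = cong suc (countᵇ-++ p xs ys)
  ... | false = countᵇ-++ p xs ys

  countᵇ-map : ∀ {B : Set} (p : B → Bool) (f : A → B) xs → countᵇ p (map f xs) ≡ countᵇ (p ∘ f) xs
  countᵇ-map p f []       = refl
  countᵇ-map p f (x ∷ xs) rewrite countᵇ-map p f xs = refl

  countᵇ-false : ∀ {p : A → Bool} xs → (∀ x → p x ≡ false) → countᵇ p xs ≡ 0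
  countᵇ-false []       e = refl
  countᵇ-false (x ∷ xs) e rewrite e x = countᵇ-false xs e

  pick-map : ∀ {B : Set} r (f : A → B) xs F → pick r (map f xs) F ≡ pick r xs (λ v → F (Vec.map f v))
  pick-map zero    f xs       F = refl
  pick-map (suc r) f []       F = refl
  pick-map (suc r) f (x ∷ xs) F = cong₂ _+_ (pick-map r f xs _) (pick-map (suc r) f xs F)

toList-map : ∀ {A B : Set} {r} (f : A → B) (v : Vec A r) → toList (Vec.map f v) ≡ map f (toList v)
toList-map f []      = refl
toList-map f (x ∷ v) = cong (f x ∷_) (toList-map f v)

-- The size condition is kept apart from `E`, which is arbitrary: in the recursion on the first
-- vertex the size drops by one when this vertex is taken.
count-pick : ∀ n r (S : Subset n) (E : Subset n → Bool) →
  countᵇ (λ T → (T ⊆ᵇ S) ∧ ((∣ T ∣ ≡ᵇ r) ∧ E T)) (allSubsets n) ≡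
  pick r (elems S) (λ v → 𝟙 (E (setOf (toList v))))
count-pick zero zero    [] E with E []
... | true  = refl
... | false = refl
count-pick zero (suc r) [] E = refl
count-pick (suc n) r (s ∷ S) E = begin
  countᵇ P (map (true ∷_) (allSubsets n) ++ map (false ∷_) (allSubsets n))
    ≡⟨ countᵇ-++ P (map (true ∷_) (allSubsets n)) _ ⟩
  countᵇ P (map (true ∷_) (allSubsets n)) + countᵇ P (map (false ∷_) (allSubsets n))
    ≡⟨ cong₂ _+_ (countᵇ-map P (true ∷_) (allSubsets n))
         (trans (countᵇ-map P (false ∷_) (allSubsets n)) (count-pick n r S (λ T → E (false ∷ T)))) ⟩
  countᵇ (λ T → P (true ∷ T)) (allSubsets n) + pick r (elems S) (λ v → 𝟙 (E (false ∷ setOf (toList v))))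
    ≡⟨ cong (λ z → countᵇ (λ T → P (true ∷ T)) (allSubsets n) + z)
         (trans (pick-cong r (elems S) (λ v → cong (λ T → 𝟙 (E T)) (sym (setOf-map v)))) (sym (pick-map r suc (elems S) F))) ⟩
  countᵇ (λ T → P (true ∷ T)) (allSubsets n) + pick r (map suc (elems S)) F
    ≡⟨ first s r refl refl ⟩
  pick r (elems (s ∷ S)) F ∎
  where
  open ≡-Reasoning
  P : Subset (suc n) → Bool
  P T = (T ⊆ᵇ (s ∷ S)) ∧ ((∣ T ∣ ≡ᵇ r) ∧ E T)
  F : ∀ {r} → Vec (Fin (suc n)) r → ℕ
  F v = 𝟙 (E (setOf (toList v)))
  setOf-map : ∀ {r} (v : Vec (Fin n) r) → setOf (toList (Vec.map suc v)) ≡ false ∷ setOf (toList v)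
  setOf-map v = trans (cong setOf (toList-map suc v)) (setOf-suc (toList v))
  ∧-false : ∀ b → b ∧ false ≡ false
  ∧-false true  = refl
  ∧-false false = refl
  first : ∀ s′ r′ → s′ ≡ s → r′ ≡ r →
    countᵇ (λ T → P (true ∷ T)) (allSubsets n) + pick r (map suc (elems S)) F ≡ pick r (elems (s ∷ S)) F
  first false r′      refl refl = cong (_+ pick r (map suc (elems S)) F) (countᵇ-false (allSubsets n) (λ T → refl))
  first true  zero    refl refl = cong (_+ F []) (countᵇ-false (allSubsets n) (λ T → ∧-false (T ⊆ᵇ S)))
  first true  (suc r) refl refl = cong (_+ pick (suc r) (map suc (elems S)) F)
    (trans (count-pick n r S (λ T → E (true ∷ T)))
      (trans (pick-cong r (elems S) (λ v → cong (λ T → 𝟙 (E T)) (sym (cong (_[ zero ]≔ true) (setOf-map v)))))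
        (sym (pick-map r suc (elems S) (λ v → F (zero ∷ v))))))

edgesIn-pick : ∀ {n r} (H : Hypergraph n r) S →
  edgesIn H S ≡ pick r (elems S) (λ v → 𝟙 (edge H (setOf (toList v))))
edgesIn-pick {n} {r} H S = trans
  (countᵇ-cong (allSubsets n) (λ T → cong ((T ⊆ᵇ S) ∧_) (size T)))
  (count-pick n r S (edge H))
  where
  ≡ᵇ-refl : ∀ n → (n ≡ᵇ n) ≡ true
  ≡ᵇ-refl zero    = refl
  ≡ᵇ-refl (suc n) = ≡ᵇ-refl n
  size : ∀ T → edge H T ≡ (∣ T ∣ ≡ᵇ r) ∧ edge H T
  size T with edge H T in eq
  ... | true  rewrite uniform H T eq | ≡ᵇ-refl r = refl
  ... | false with ∣ T ∣ ≡ᵇ r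
  ...   | true  = refl
  ...   | false = refl

-- Edge densities of tuples of parts

module _ {A : Set} (f : A → ℕ) where

  -- An entry at least as large as the mean of the later ones may be dropped; otherwise it is kept,
  -- and the removal takes place further on.
  remove-heavy : ∀ x V → ∃ λ W → W ⊆ x ∷ V × length W ≡ length V ×
    suc (length V) * Σˡ W f ≤ length V * Σˡ (x ∷ V) f
  remove-heavy x []          = [] , x ∷ʳ [] , refl , z≤n
  remove-heavy x (y ∷ V) with remove-heavy y V | Σˡ (y ∷ V) f ≤? suc (length V) * f x
  ... | W , W⊆ , lw , le | yes heavy = y ∷ V , x ∷ʳ ⊆-refl , refl ,
        lin≤ 0 heavy (lem (suc (length V)) (Σˡ (y ∷ V) f) (f x))
    where
    lem : ∀ v s x → suc v * s + v * x + 0 ≡ v * (x + s) + s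
    lem = solve-∀
  ... | W , W⊆ , lw , le | no light = x ∷ W , refl ∷ W⊆ , cong suc lw ,
        *-cancelˡ-≤ v (lin≤ 0 (+-mono-≤ (*-monoʳ-≤ (suc v) le) (<⇒≤ (≰⇒> light)))
          (lem (length V) (Σˡ W f) (Σˡ (y ∷ V) f) (f x)))
    where
    v = suc (length V)
    lem : ∀ w sW sV x →
      suc w * (suc (suc w) * (x + sW)) + (suc (suc w) * (w * sV) + sV) + 0 ≡
      suc w * (suc w * (x + sV)) + (suc (suc w) * (suc w * sW) + suc w * x)
    lem = solve-∀

  thin : ∀ d q V → length V ≡ d + q → ∃ λ Q → Q ⊆ V × length Q ≡ q × length V * Σˡ Q f ≤ q * Σˡ V f
  thin zero    q V       l = V , ⊆-refl , l , ≤-reflexive (cong (_* Σˡ V f) l)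
  thin (suc d) zero (x ∷ V) l = [] , minimum _ , refl , ≤-reflexive (*-zeroʳ (suc (length V)))
  thin (suc d) (suc q) (x ∷ V) l with remove-heavy x V
  ... | W , W⊆ , lw , le with thin d (suc q) W (trans lw (suc-injective l))
  ... | Q , Q⊆ , lq , le′ = Q , ⊆-trans Q⊆ W⊆ , lq , *-cancelˡ-≤ w (begin
      w * (suc (length V) * Σˡ Q f)        ≡⟨ lem w (suc (length V)) (Σˡ Q f) ⟩
      suc (length V) * (w * Σˡ Q f)        ≤⟨ *-monoʳ-≤ (suc (length V)) le′ ⟩
      suc (length V) * (suc q * Σˡ W f)    ≡⟨ lem (suc (length V)) (suc q) (Σˡ W f) ⟩
      suc q * (suc (length V) * Σˡ W f)    ≤⟨ *-monoʳ-≤ (suc q) le ⟩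
      suc q * (length V * Σˡ (x ∷ V) f)    ≡⟨ cong (λ z → suc q * (z * Σˡ (x ∷ V) f)) lw ⟨
      suc q * (w * Σˡ (x ∷ V) f)           ≡⟨ lem (suc q) w (Σˡ (x ∷ V) f) ⟩
      w * (suc q * Σˡ (x ∷ V) f)           ∎)
    where
    open ≤-Reasoning
    w = length W
    instance _ = >-nonZero (<-≤-trans (s≤s z≤n) (≤-reflexive (sym (trans lw (trans (suc-injective l) (+-suc d q))))))
    lem : ∀ a b c → a * (b * c) ≡ b * (a * c)
    lem = solve-∀

-- A derandomised choice of q entries in every part: the parts are thinned one after another, each
-- with respect to the sum of `ℓ` over all the others, thinned or not, and the mean of `ℓ` never
-- increases.
equalise : ∀ {A : Set} {m} q (Vs : Vec (List A) m) (ℓ : Vec A m → ℕ) → All (λ V → q ≤ length V) (toList Vs) →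
  ∃ λ Qs → Pointwise _⊆_ Qs Vs × All (λ Q → length Q ≡ q) (toList Qs) × vol Vs * Sum Qs ℓ ≤ q ^ m * Sum Vs ℓ
equalise q []       ℓ []         = [] , [] , [] , ≤-refl
equalise {m = suc m} q (V ∷ Vs) ℓ (q≤V ∷ ls) with equalise q Vs (λ as → Σˡ V (λ a → ℓ (a ∷ as))) ls
... | Qs , Qs⊆ , lqs , le with thin (λ a → Sum Qs (λ as → ℓ (a ∷ as))) (length V ∸ q) q V (sym (m∸n+n≡m q≤V))
... | Q , Q⊆ , lq , le′ = Q ∷ Qs , Q⊆ ∷ Qs⊆ , lq ∷ lqs , (begin
    length V * vol Vs * Sum (Q ∷ Qs) ℓ        ≡⟨ lem (length V) (vol Vs) (Sum (Q ∷ Qs) ℓ) ⟩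
    vol Vs * (length V * Sum (Q ∷ Qs) ℓ)      ≤⟨ *-monoʳ-≤ (vol Vs) le′ ⟩
    vol Vs * (q * Sum (V ∷ Qs) ℓ)             ≡⟨ lem₂ (vol Vs) q (Sum (V ∷ Qs) ℓ) ⟩
    q * (vol Vs * Sum (V ∷ Qs) ℓ)             ≡⟨ cong (λ z → q * (vol Vs * z)) (Sum-swap Qs V (λ a as → ℓ (a ∷ as))) ⟨
    q * (vol Vs * Sum Qs (λ as → Σˡ V (λ a → ℓ (a ∷ as)))) ≤⟨ *-monoʳ-≤ q le ⟩
    q * (q ^ m * Sum Vs (λ as → Σˡ V (λ a → ℓ (a ∷ as))))  ≡⟨ cong (λ z → q * (q ^ m * z)) (Sum-swap Vs V (λ a as → ℓ (a ∷ as))) ⟩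
    q * (q ^ m * Sum (V ∷ Vs) ℓ)              ≡⟨ *-assoc q (q ^ m) _ ⟨
    q * q ^ m * Sum (V ∷ Vs) ℓ                ∎)
  where
  open ≤-Reasoning
  lem : ∀ a b c → a * b * c ≡ b * (a * c)
  lem = solve-∀
  lem₂ : ∀ a b c → a * (b * c) ≡ b * (a * c)
  lem₂ = solve-∀

insert₂ : ∀ {A : Set} {s} → A → Vec A (2 + s) → Vec A (3 + s)
insert₂ a (y ∷ z ∷ v) = y ∷ z ∷ a ∷ v

-- Moves the last two entries to the front, so that the tail of an edge takes the place of its head.
rotate : ∀ {A : Set} {s} → Vec A (2 + s) → Vec A (2 + s)
rotate (a ∷ b ∷ [])    = a ∷ b ∷ []
rotate (a ∷ b ∷ c ∷ v) = insert₂ a (rotate (b ∷ c ∷ v))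

rotate-↭ : ∀ {A : Set} {s} (v : Vec A (2 + s)) → toList (rotate v) ↭ toList v
rotate-↭ (a ∷ b ∷ [])    = ↭-refl
rotate-↭ (a ∷ b ∷ c ∷ v) = ↭-trans (insert-↭ a (rotate (b ∷ c ∷ v))) (prep a (rotate-↭ (b ∷ c ∷ v)))
  where
  insert-↭ : ∀ {s} a (w : Vec _ (2 + s)) → toList (insert₂ a w) ↭ a ∷ toList w
  insert-↭ a (y ∷ z ∷ w) = ↭-trans (prep y (swap z a ↭-refl)) (swap y a ↭-refl)

map-rotate : ∀ {A B : Set} {s} (f : A → B) (v : Vec A (2 + s)) → Vec.map f (rotate v) ≡ rotate (Vec.map f v)
map-rotate f (a ∷ b ∷ [])    = refl
map-rotate f (a ∷ b ∷ c ∷ v) = trans (map-insert a (rotate (b ∷ c ∷ v))) (cong (insert₂ (f a)) (map-rotate f (b ∷ c ∷ v)))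
  where
  map-insert : ∀ {s} a (w : Vec _ (2 + s)) → Vec.map f (insert₂ a w) ≡ insert₂ (f a) (Vec.map f w)
  map-insert a (y ∷ z ∷ w) = refl

Sum-rotate : ∀ {A : Set} {s} (V : Vec (List A) (2 + s)) F → Sum (rotate V) F ≡ Sum V (λ v → F (rotate v))
Sum-rotate (A ∷ B ∷ [])      F = refl
Sum-rotate (A ∷ B ∷ D ∷ V) F = trans (Sum-insert (rotate (B ∷ D ∷ V)))
  (Σˡ-cong A (λ a → Sum-rotate (B ∷ D ∷ V) (λ w → F (insert₂ a w))))
  where
  Sum-insert : ∀ W → Sum (insert₂ A W) F ≡ Σˡ A (λ a → Sum W (λ w → F (insert₂ a w)))
  Sum-insert (P ∷ Q ∷ W) = trans (Σˡ-cong P (λ y → Σˡ-swap Q A _)) (Σˡ-swap P A _)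

vol-rotate : ∀ {A : Set} {s} (V : Vec (List A) (2 + s)) → vol (rotate V) ≡ vol V
vol-rotate V = trans (sym (Sum-1 (rotate V))) (trans (Sum-rotate V (λ _ → 1)) (Sum-1 V))

4xy≤[x+y]² : ∀ x y → 4 * (x * y) ≤ (x + y) * (x + y)
4xy≤[x+y]² x y with ≤-total x y
... | inj₁ x≤y = begin
    4 * (x * y)               ≡⟨ cong (λ z → 4 * (x * z)) (m+[n∸m]≡n x≤y) ⟨
    4 * (x * (x + k))         ≤⟨ m≤m+n _ (k * k) ⟩
    4 * (x * (x + k)) + k * k ≡⟨ lem x k ⟩
    (x + (x + k)) * (x + (x + k)) ≡⟨ cong (λ z → (x + z) * (x + z)) (m+[n∸m]≡n x≤y) ⟩
    (x + y) * (x + y)         ∎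
  where
  open ≤-Reasoning
  k = y ∸ x
  lem : ∀ x k → 4 * (x * (x + k)) + k * k ≡ (x + (x + k)) * (x + (x + k))
  lem = solve-∀
... | inj₂ y≤x = begin
    4 * (x * y)               ≡⟨ cong (λ z → 4 * (z * y)) (m+[n∸m]≡n y≤x) ⟨
    4 * ((y + k) * y)         ≤⟨ m≤m+n _ (k * k) ⟩
    4 * ((y + k) * y) + k * k ≡⟨ lem y k ⟩
    (y + k + y) * (y + k + y) ≡⟨ cong (λ z → (z + y) * (z + y)) (m+[n∸m]≡n y≤x) ⟩
    (x + y) * (x + y)         ∎
  where
  open ≤-Reasoning
  k = x ∸ y
  lem : ∀ y k → 4 * ((y + k) * y) + k * k ≡ (y + k + y) * (y + k + y)
  lem = solve-∀

module _ {A : Set} where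

  firstPair : ∀ {s} → (A → A → Bool) → Vec A (2 + s) → Bool
  firstPair g (a ∷ b ∷ _) = g a b

  firstPair-insert : ∀ {s} g a (w : Vec A (2 + s)) → firstPair g (insert₂ a w) ≡ firstPair g w
  firstPair-insert g a (y ∷ z ∷ w) = refl

  Sum-firstPair : ∀ {s} g (V : Vec (List A) (2 + s)) → Sum V (λ v → 𝟙 (firstPair g v)) ≡
    vol (Vec.drop 2 V) * Sum (firstTwo V) (𝟙 ∘ pairs g)
  Sum-firstPair g (P ∷ Q ∷ W) = begin
    Σˡ P (λ y → Σˡ Q (λ z → Sum W (λ _ → 𝟙 (g y z))))
      ≡⟨ Σˡ-cong P (λ y → Σˡ-cong Q (λ z → Sum-const W (𝟙 (g y z)))) ⟩
    Σˡ P (λ y → Σˡ Q (λ z → vol W * 𝟙 (g y z)))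
      ≡⟨ Σˡ-cong P (λ y → Σˡ-*ˡ Q (vol W) _) ⟩
    Σˡ P (λ y → vol W * Σˡ Q (λ z → 𝟙 (g y z)))
      ≡⟨ Σˡ-*ˡ P (vol W) _ ⟩
    vol W * Σˡ P (λ y → Σˡ Q (λ z → 𝟙 (g y z))) ∎
    where open ≡-Reasoning

  vol-firstTwo : ∀ {s} (V : Vec (List A) (2 + s)) → vol V ≡ vol (Vec.drop 2 V) * vol (firstTwo V)
  vol-firstTwo (P ∷ Q ∷ W) = lem (length P) (length Q) (vol W)
    where
    lem : ∀ y z w → y * (z * w) ≡ w * (y * (z * 1))
    lem = solve-∀

  bad-edges-sparse : ∀ {s D M} .{{_ : NonZero M}} {E : A → A → Vec A s → Bool} {B Z₁ Z₂ V} → Separates D M E B Z₁ Z₂ V →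
    D * Sum₂ Z₁ Z₂ V (λ a b v → 𝟙 (B a b ∧ E a b v)) ≤ 2 * vol (Z₁ ∷ Z₂ ∷ V)
  bad-edges-sparse {D = D} {M} {E} {B} {Z₁} {Z₂} {V} sep = *-cancelˡ-≤ M (begin
    M * (D * Sum₂ Z₁ Z₂ V (λ a b v → 𝟙 (B a b ∧ E a b v)))   ≤⟨ Separates.bad sep V (⊴ᵛ-refl V) B (λ a b e → e) ⟩
    M * Sum₂ Z₁ Z₂ V (λ a b _ → 𝟙 (B a b)) + W               ≤⟨ +-mono-≤ (*-monoʳ-≤ M (Sum-≤vol (Z₁ ∷ Z₂ ∷ V) {λ { (a ∷ b ∷ _) → 𝟙 (B a b) }} (λ { (a ∷ b ∷ _) → 𝟙≤1 (B a b) }))) (m≤n*m W M) ⟩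
    M * W + M * W                                            ≡⟨ lem M W ⟩
    M * (2 * W)                                              ∎)
    where
    open ≤-Reasoning
    W = vol (Z₁ ∷ Z₂ ∷ V)
    lem : ∀ m w → m * w + m * w ≡ m * (2 * w)
    lem = solve-∀

  -- Turns regularity at the exact density into an upper bound at the rounded density (b + 1) / L.
  regular-upper : ∀ {s M L b} .{{_ : NonZero L}} {g : Vec A s → Bool} {V} → 2 * (L * L) ≤ M → Regular M g V →
    L * Sum V (𝟙 ∘ g) ≤ suc b * vol V →
    ∀ U → U ⊴ᵛ V → L * L * Sum U (𝟙 ∘ g) ≤ L * suc b * vol U + vol V
  regular-upper {M = M} {L} {b} {g} {V} le reg dens U p with vol V ≟ 0
  ... | yes v≡0 = subst (λ z → L * L * z ≤ L * suc b * vol U + vol V) (sym S≡0) (≤-trans (≤-reflexive (*-zeroʳ (L * L))) z≤n)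
    where
    S≡0 : Sum U (𝟙 ∘ g) ≡ 0
    S≡0 = n≤0⇒n≡0 (≤-trans (Sum-≤vol U (λ v → 𝟙≤1 (g v))) (≤-trans (⊴ᵛ-vol p) (≤-reflexive v≡0)))
  ... | no v≢0 = *-cancelˡ-≤ (2 * den) (begin
      2 * den * (L * L * S)                                  ≡⟨ lem₁ den L S ⟩
      2 * (L * L) * (den * S)                                ≤⟨ upper U p ⟩
      2 * (L * L) * (num * vol U) + den * vol V              ≡⟨ cong (_+ den * vol V) (*-assoc (2 * (L * L)) num (vol U)) ⟨
      2 * (L * L) * num * vol U + den * vol V                ≤⟨ +-monoˡ-≤ (den * vol V) (*-monoˡ-≤ (vol U) density) ⟩
      den * (2 * (L * suc b) + 1) * vol U + den * vol V      ≡⟨ lem₂ den (L * suc b) (vol U) (vol V) ⟩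
      2 * den * (L * suc b * vol U) + (den * vol U + den * vol V) ≤⟨ +-monoʳ-≤ (2 * den * (L * suc b * vol U)) (+-monoˡ-≤ (den * vol V) (*-monoʳ-≤ den (⊴ᵛ-vol p))) ⟩
      2 * den * (L * suc b * vol U) + (den * vol V + den * vol V) ≡⟨ lem₃ den (L * suc b * vol U) (vol V) ⟩
      2 * den * (L * suc b * vol U + vol V)                  ∎)
    where
    open ≤-Reasoning
    open Regular (regular-mono le reg)
    instance _ = ≢-nonZero v≢0
    instance _ = m*n≢0 2 den
    S = Sum U (𝟙 ∘ g)
    T = Sum V (𝟙 ∘ g)
    lem₁ : ∀ d l s → 2 * d * (l * l * s) ≡ 2 * (l * l) * (d * s)
    lem₁ = solve-∀
    lem₂ : ∀ d c u v → d * (2 * c + 1) * u + d * v ≡ 2 * d * (c * u) + (d * u + d * v)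
    lem₂ = solve-∀
    lem₃ : ∀ d c v → 2 * d * c + (d * v + d * v) ≡ 2 * d * (c + v)
    lem₃ = solve-∀
    lem₄ : ∀ l d t v → 2 * (l * l) * (d * t) + d * v ≡ d * (2 * l * (l * t)) + d * v
    lem₄ = solve-∀
    lem₅ : ∀ l d b v → d * (2 * l * (b * v)) + d * v ≡ d * (2 * (l * b) + 1) * v
    lem₅ = solve-∀
    density : 2 * (L * L) * num ≤ den * (2 * (L * suc b) + 1)
    density = *-cancelʳ-≤ _ _ (vol V) (begin
      2 * (L * L) * num * vol V                   ≡⟨ *-assoc (2 * (L * L)) num (vol V) ⟩
      2 * (L * L) * (num * vol V)                 ≤⟨ lower V (⊴ᵛ-refl V) ⟩
      2 * (L * L) * (den * T) + den * vol V       ≡⟨ lem₄ L den T (vol V) ⟩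
      den * (2 * L * (L * T)) + den * vol V       ≤⟨ +-monoˡ-≤ (den * vol V) (*-monoʳ-≤ den (*-monoʳ-≤ (2 * L) dens)) ⟩
      den * (2 * L * (suc b * vol V)) + den * vol V ≡⟨ lem₅ L den (suc b) (vol V) ⟩
      den * (2 * (L * suc b) + 1) * vol V         ∎)

module _ {A : Set} {s : ℕ} (gQ gP : A → A → Bool) (V₁ V₂ : List A) (K : Vec (List A) (1 + s)) (L b d : ℕ) where

  private
    V : Vec (List A) (3 + s)
    V = V₁ ∷ V₂ ∷ K
    GP = Sum V (λ v → 𝟙 (firstPair gP (rotate v)))

  -- The first vertex is summed using the regularity of gQ, since the tail condition only restricts the other ones.
  mixed-edges-sparse :
    (∀ U → U ⊴ᵛ V₁ ∷ V₂ ∷ [] → L * L * Sum U (𝟙 ∘ pairs gQ) ≤ L * suc b * vol U + vol (V₁ ∷ V₂ ∷ [])) →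
    L * GP ≤ suc d * vol V →
    L * L * Sum V (λ v → 𝟙 (firstPair gQ v ∧ firstPair gP (rotate v))) ≤ suc b * (suc d * vol V) + vol V
  mixed-edges-sparse regQ densP = begin
    L * L * Sum V F                                 ≡⟨ cong (L * L *_) (sym (Sum-Σ₂ V₁ V₂ K (λ a b w → F (a ∷ b ∷ w)))) ⟩
    L * L * Sum K F′                                ≡⟨ Sum-*ˡ K (L * L) F′ ⟨
    Sum K (λ w → L * L * F′ w)                      ≤⟨ Sum-mono K inner ⟩
    Sum K (λ w → L * suc b * (length V₁ * (length (U w) * 1)) + W₂) ≡⟨ Sum-+ K _ _ ⟩
    Sum K (λ w → L * suc b * (length V₁ * (length (U w) * 1))) + Sum K (λ _ → W₂)
      ≡⟨ cong₂ _+_ (trans (Sum-*ˡ K (L * suc b) _) (cong (L * suc b *_) tails)) (trans (Sum-const K W₂) (sym (vol-firstTwo V))) ⟩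
    L * suc b * GP + vol V                          ≡⟨ cong (_+ vol V) (lem L (suc b) GP) ⟩
    suc b * (L * GP) + vol V                        ≤⟨ +-monoˡ-≤ _ (*-monoʳ-≤ (suc b) densP) ⟩
    suc b * (suc d * vol V) + vol V                 ∎
    where
    open ≤-Reasoning
    W₂ = vol (V₁ ∷ V₂ ∷ [])
    F : Vec A (3 + s) → ℕ
    F v = 𝟙 (firstPair gQ v ∧ firstPair gP (rotate v))
    F′ : Vec A (1 + s) → ℕ
    F′ w = Σˡ V₁ λ a → Σˡ V₂ λ b → F (a ∷ b ∷ w)
    late : A → Vec A (1 + s) → Bool
    late b w = firstPair gP (rotate (b ∷ w))
    U : Vec A (1 + s) → List A
    U w = filterᵇ (λ b → late b w) V₂
    rot : ∀ a b w → firstPair gP (rotate (a ∷ b ∷ w)) ≡ late b w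
    rot a b (c ∷ w) = firstPair-insert gP a (rotate (b ∷ c ∷ w))
    lem : ∀ l b g → l * b * g ≡ b * (l * g)
    lem = solve-∀
    inner : ∀ w → L * L * F′ w ≤ L * suc b * (length V₁ * (length (U w) * 1)) + W₂
    inner w = subst (λ z → L * L * z ≤ L * suc b * (length V₁ * (length (U w) * 1)) + W₂)
      (Σˡ-cong V₁ λ a → trans (Σˡ-filter (λ b → late b w) V₂ _) (Σˡ-cong V₂ λ b →
        trans (*-comm (𝟙 (late b w)) (𝟙 (gQ a b))) (trans (sym (𝟙-∧ (gQ a b) (late b w)))
          (cong (λ z → 𝟙 (gQ a b ∧ z)) (sym (rot a b w))))))
      (regQ (V₁ ∷ U w ∷ []) (⊴-refl ∷ ⊴-filter _ V₂ ∷ []))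
    tails : Sum K (λ w → length V₁ * (length (U w) * 1)) ≡ GP
    tails = begin-equality
      Sum K (λ w → length V₁ * (length (U w) * 1))
        ≡⟨ Sum-cong K (λ w → trans (sym (Σˡ-const V₁ _)) (Σˡ-cong V₁ λ a → trans (sym (Σˡ-const (U w) 1))
             (trans (Σˡ-filter (λ b → late b w) V₂ _) (Σˡ-cong V₂ λ b →
               trans (*-identityʳ _) (cong 𝟙 (sym (rot a b w))))))) ⟩
      Sum K (λ w → Σˡ V₁ λ a → Σˡ V₂ λ b → 𝟙 (firstPair gP (rotate (a ∷ b ∷ w)))) ≡⟨ Sum-Σ₂ V₁ V₂ K _ ⟩
      GP ∎

module _ {A : Set} (E : List A → Bool) (E-↭ : ∀ {xs ys} → xs ↭ ys → E xs ≡ E ys) where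

  link : ∀ {s} → A → A → Vec A s → Bool
  link a b v = E (a ∷ b ∷ toList v)

  firstLink : ∀ {s} → (A → A → Bool) → Vec A (2 + s) → Bool
  firstLink B (a ∷ b ∷ v) = B a b ∧ link a b v

  firstLink-rotate : ∀ {s} B (v : Vec A (2 + s)) → firstLink B (rotate v) ≡ firstPair B (rotate v) ∧ E (toList v)
  firstLink-rotate B v with rotate v in eq
  ... | a ∷ b ∷ w = cong (B a b ∧_) (trans (cong (E ∘ toList) (sym eq)) (E-↭ (rotate-↭ v)))

  -- An edge has a bad head, or a bad tail, or both a good head and a good tail.
  edge-classes : ∀ p q e → 𝟙 e ≤ 𝟙 (p ∧ e) + 𝟙 (q ∧ e) + 𝟙 (not p ∧ not q)
  edge-classes true  q     e     = ≤-trans (m≤m+n (𝟙 e) _) (m≤m+n _ 0)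
  edge-classes false true  e     = m≤m+n (𝟙 e) 0
  edge-classes false false e     = 𝟙≤1 e

  module _ {s M L b d : ℕ} .{{_ : NonZero L}} .{{_ : NonZero M}} (L≡ : b + d ≡ L) (M≥ : 2 * (L * L) ≤ M)
           (B B̂ : A → A → Bool) (V₁ V₂ : List A) (K : Vec (List A) (1 + s)) where

    private
      V : Vec (List A) (3 + s)
      V = V₁ ∷ V₂ ∷ K
      W = vol V
      B̄ B̂̄ : A → A → Bool
      B̄ a b = not (B a b)
      B̂̄ a b = not (B̂ a b)

    -- Edges with a bad head or a bad tail have density at most 2/L² each, the others at most
    -- ((b+1)(d+1) + 1)/L², and 4(b+1)(d+1) ≤ (L+2)². In 28, the summand 4 comes from the linear
    -- term of (L+2)², and 24 collects the constants 8 + 8 + 4 + 4.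
    tuple-sparse : Separates (L * L) M link B V₁ V₂ K →
      (∀ {Z₁ Z₂ I} → rotate V ≡ Z₁ ∷ Z₂ ∷ I → Separates (L * L) M link B̂ Z₁ Z₂ I) →
      Regular M (pairs B̄) (V₁ ∷ V₂ ∷ []) →
      L * Sum (V₁ ∷ V₂ ∷ []) (𝟙 ∘ pairs B̄) ≤ suc b * vol (V₁ ∷ V₂ ∷ []) →
      L * Sum (firstTwo (rotate V)) (𝟙 ∘ pairs B̂̄) ≤ suc d * vol (firstTwo (rotate V)) →
      4 * L * Sum V (λ v → 𝟙 (E (toList v))) ≤ (L + 28) * W
    tuple-sparse sepQ sepP regQ densQ densP = *-cancelˡ-≤ L (begin
      L * (4 * L * Sum V (λ v → 𝟙 (E (toList v))))         ≤⟨ *-monoʳ-≤ L (*-monoʳ-≤ (4 * L) split) ⟩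
      L * (4 * L * (T₁ + T₂ + T₃))                         ≡⟨ lem₁ L T₁ T₂ T₃ ⟩
      4 * (L * L * T₁) + 4 * (L * L * T₂) + 4 * (L * L * T₃) ≤⟨ +-mono-≤ (+-mono-≤ (*-monoʳ-≤ 4 t₁) (*-monoʳ-≤ 4 t₂)) (*-monoʳ-≤ 4 t₃) ⟩
      4 * (2 * W) + 4 * (2 * W) + 4 * (suc b * (suc d * W) + W) ≡⟨ lem₂ (suc b) (suc d) W ⟩
      4 * (suc b * suc d) * W + 20 * W                     ≤⟨ +-monoˡ-≤ (20 * W) (*-monoˡ-≤ W (4xy≤[x+y]² (suc b) (suc d))) ⟩
      (suc b + suc d) * (suc b + suc d) * W + 20 * W       ≡⟨ cong (λ z → z * z * W + 20 * W) (trans (lem₃ b d) (cong (λ z → 2 + z) L≡)) ⟩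
      (2 + L) * (2 + L) * W + 20 * W                       ≡⟨ lem₄ L W ⟩
      L * ((L + 4) * W) + 24 * W                           ≤⟨ +-monoʳ-≤ (L * ((L + 4) * W)) (m≤n*m (24 * W) L) ⟩
      L * ((L + 4) * W) + L * (24 * W)                     ≡⟨ lem₅ L W ⟩
      L * ((L + 28) * W)                                   ∎)
      where
      open ≤-Reasoning
      f₀ f₁ f₂ f₃ : Vec A (3 + s) → ℕ
      f₀ v = 𝟙 (E (toList v))
      f₁ v = 𝟙 (firstLink B v)
      f₂ v = 𝟙 (firstLink B̂ (rotate v))
      f₃ v = 𝟙 (firstPair B̄ v ∧ firstPair B̂̄ (rotate v))
      T₁ = Sum V f₁
      T₂ = Sum V f₂
      T₃ = Sum V f₃
      lem₁ : ∀ l a b c → l * (4 * l * (a + b + c)) ≡ 4 * (l * l * a) + 4 * (l * l * b) + 4 * (l * l * c)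
      lem₁ = solve-∀
      lem₂ : ∀ b d w → 4 * (2 * w) + 4 * (2 * w) + 4 * (b * (d * w) + w) ≡ 4 * (b * d) * w + 20 * w
      lem₂ = solve-∀
      lem₃ : ∀ b d → suc b + suc d ≡ 2 + (b + d)
      lem₃ = solve-∀
      lem₄ : ∀ l w → (2 + l) * (2 + l) * w + 20 * w ≡ l * ((l + 4) * w) + 24 * w
      lem₄ = solve-∀
      lem₅ : ∀ l w → l * ((l + 4) * w) + l * (24 * w) ≡ l * ((l + 28) * w)
      lem₅ = solve-∀
      complement : ∀ (g : A → A → Bool) {s} (v : Vec A (2 + s)) → firstPair (λ a b → not (g a b)) v ≡ not (firstPair g v)
      complement g (a ∷ b ∷ v) = refl
      split : Sum V (λ v → 𝟙 (E (toList v))) ≤ T₁ + T₂ + T₃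
      split = begin
        Sum V f₀                         ≤⟨ Sum-mono V {f₀} {λ v → f₁ v + f₂ v + f₃ v} (λ { v@(a ∷ b ∷ w) → ≤-trans
              (edge-classes (B a b) (firstPair B̂ (rotate v)) (E (toList v)))
              (≤-reflexive (cong₂ (λ x y → f₁ v + 𝟙 x + 𝟙 (firstPair B̄ v ∧ y))
                (sym (firstLink-rotate B̂ v)) (sym (complement B̂ (rotate v))))) }) ⟩
        Sum V (λ v → f₁ v + f₂ v + f₃ v) ≡⟨ trans (Sum-+ V (λ v → f₁ v + f₂ v) f₃) (cong (_+ T₃) (Sum-+ V f₁ f₂)) ⟩
        T₁ + T₂ + T₃ ∎
      t₁ : L * L * T₁ ≤ 2 * W
      t₁ = bad-edges-sparse sepQ
      rotated : ∀ R → (∀ {Z₁ Z₂ I} → R ≡ Z₁ ∷ Z₂ ∷ I → Separates (L * L) M link B̂ Z₁ Z₂ I) →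
        L * L * Sum R (λ v → 𝟙 (firstLink B̂ v)) ≤ 2 * vol R
      rotated (Z₁ ∷ Z₂ ∷ I) sep = bad-edges-sparse (sep refl)
      t₂ : L * L * T₂ ≤ 2 * W
      t₂ = subst₂ (λ x y → L * L * x ≤ 2 * y) (Sum-rotate V _) (vol-rotate V) (rotated (rotate V) sepP)
      t₃ : L * L * T₃ ≤ suc b * (suc d * W) + W
      t₃ = mixed-edges-sparse B̄ B̂̄ V₁ V₂ K L b d (regular-upper M≥ regQ densQ) (begin
        L * Sum V (λ v → 𝟙 (firstPair B̂̄ (rotate v)))      ≡⟨ cong (L *_) (trans (sym (Sum-rotate V _)) (Sum-firstPair B̂̄ (rotate V))) ⟩
        L * (vol I * S)                                   ≡⟨ lem₆ L (vol I) S ⟩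
        vol I * (L * S)                                   ≤⟨ *-monoʳ-≤ (vol I) densP ⟩
        vol I * (suc d * vol (firstTwo (rotate V)))       ≡⟨ lem₆ (vol I) (suc d) _ ⟩
        suc d * (vol I * vol (firstTwo (rotate V)))       ≡⟨ cong (suc d *_) (trans (sym (vol-firstTwo (rotate V))) (vol-rotate V)) ⟩
        suc d * W                                         ∎)
        where
        I = Vec.drop 2 (rotate V)
        S = Sum (firstTwo (rotate V)) (𝟙 ∘ pairs B̂̄)
        lem₆ : ∀ a b c → a * (b * c) ≡ b * (a * c)
        lem₆ = solve-∀

-- The sparse case

uniqueˡ-⊆ : ∀ {A : Set} {xs ys : List A} → ys ⊆ xs → Uniqueˡ xs → Uniqueˡ ys
uniqueˡ-⊆ []         []       = []
uniqueˡ-⊆ (_ ∷ʳ p)   (_ ∷ us) = uniqueˡ-⊆ p us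
uniqueˡ-⊆ (refl ∷ p) (u ∷ us) = Sublistₚ.All-resp-⊆ p u ∷ uniqueˡ-⊆ p us

uniqueˡ⇒unique : ∀ {A : Set} {s} (v : Vec A s) → Uniqueˡ (toList v) → Unique v
uniqueˡ⇒unique []      []       = []
uniqueˡ⇒unique (x ∷ v) (u ∷ us) = AllVₚ.toList⁻ u ∷ uniqueˡ⇒unique v us

uniqueˡ-↭ : ∀ {A : Set} {xs ys : List A} → xs ↭ ys → Uniqueˡ xs → Uniqueˡ ys
uniqueˡ-↭ {A} p = Permₛ.Unique-resp-↭ (setoid A) (Perm.↭⇒↭ₛ p)

setOf-↭ : ∀ {n} {xs ys : List (Fin n)} → xs ↭ ys → setOf xs ≡ setOf ys
setOf-↭ Perm.refl          = refl
setOf-↭ (prep x p)         = cong (_[ x ]≔ true) (setOf-↭ p)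
setOf-↭ (swap x y p)       = trans (cong (λ T → T [ y ]≔ true [ x ]≔ true) (setOf-↭ p)) (exchange _ x y)
  where
  exchange : ∀ T x y → T [ y ]≔ true [ x ]≔ true ≡ T [ x ]≔ true [ y ]≔ true
  exchange T x y with x Finₚ.≟ y
  ... | yes refl = refl
  ... | no x≢y   = Vecₚ.[]≔-commutes T y x (x≢y ∘ sym)
setOf-↭ (Perm.trans p q)   = trans (setOf-↭ p) (setOf-↭ q)

regular-cong : ∀ {A : Set} {s M} {g g′ : Vec A s → Bool} {V} → (∀ v → g v ≡ g′ v) → Regular M g V → Regular M g′ V
regular-cong {M = M} {g} {g′} {V} e reg = record
  { num = num ; den = den
  ; upper = λ U p → subst (λ z → M * (den * z) ≤ M * (num * vol U) + den * vol V) (same U) (upper U p)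
  ; lower = λ U p → subst (λ z → M * (num * vol U) ≤ M * (den * z) + den * vol V) (same U) (lower U p) }
  where
  open Regular reg
  same : ∀ U → Sum U (𝟙 ∘ g) ≡ Sum U (𝟙 ∘ g′)
  same U = Sum-cong U (λ v → cong 𝟙 (e v))

rotate-init : ∀ {A : Set} {s} (p : Vec A (2 + s)) {y z I} → rotate p ≡ y ∷ z ∷ I →
  toList p ≡ toList I ++ y ∷ z ∷ []
rotate-init (a ∷ b ∷ [])    refl = refl
rotate-init (a ∷ b ∷ c ∷ p) e with rotate (b ∷ c ∷ p) in eq
rotate-init (a ∷ b ∷ c ∷ p) refl | y ∷ z ∷ I = cong (a ∷_) (rotate-init (b ∷ c ∷ p) eq)

⊆-map⁻ᵛ : ∀ {A B : Set} (f : A → B) xs {s} (v : Vec B s) → toList v ⊆ map f xs →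
  ∃ λ w → toList w ⊆ xs × v ≡ Vec.map f w
⊆-map⁻ᵛ f []       []      p = [] , [] , refl
⊆-map⁻ᵛ f (x ∷ xs) []      p = [] , minimum _ , refl
⊆-map⁻ᵛ f (x ∷ xs) (_ ∷ v) (refl ∷ p) with ⊆-map⁻ᵛ f xs v p
... | w , q , refl = x ∷ w , refl ∷ q , refl
⊆-map⁻ᵛ f (x ∷ xs) (y ∷ v) (_ ∷ʳ p) with ⊆-map⁻ᵛ f xs (y ∷ v) p
... | w , q , eq = w , x ∷ʳ q , eq

concat-⊆ : ∀ {A : Set} {m} {Us Vs : Vec (List A) m} → Pointwise _⊆_ Us Vs → concat (toList Us) ⊆ concat (toList Vs)
concat-⊆ []       = []
concat-⊆ (p ∷ ps) = Sublistₚ.++⁺ p (concat-⊆ ps)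

length-concat : ∀ {A : Set} q (Ls : List (List A)) → All (λ L → length L ≡ q) Ls → length (concat Ls) ≡ length Ls * q
length-concat q []       []       = refl
length-concat q (L ∷ Ls) (l ∷ ls) = trans (Listₚ.length-++ L) (cong₂ _+_ l (length-concat q Ls ls))

neither-𝟙 : ∀ x y → 𝟙 (not x) + 𝟙 (not y) ≤ 1 + 𝟙 (not x ∧ not y)
neither-𝟙 true  true  = z≤n
neither-𝟙 true  false = ≤-refl
neither-𝟙 false true  = ≤-refl
neither-𝟙 false false = ≤-refl

module PairDensities {t s n D M : ℕ} {E : Fin n → Fin n → Vec (Fin n) s → Bool} {V : Vec (List (Fin n)) t}
                     (R : Regularised D M E V) where

  open Regularised R public

  headBox : Vec (Fin t) (2 + s) → Vec (List (Fin n)) 2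
  headBox p = Vec.map (lookup V) (firstTwo p)

  good : Vec (Fin t) (2 + s) → Fin n → Fin n → Bool
  good p a b = not (bad p a b)

  goodPairs : Vec (Fin t) (2 + s) → ℕ
  goodPairs p = Sum (headBox p) (𝟙 ∘ pairs (good p))

  commonPairs : Vec (Fin t) (2 + s) → Vec (Fin t) (2 + s) → ℕ
  commonPairs p q = Sum (headBox p) (𝟙 ∘ pairs (neither (bad p) (bad q)))

module Sparse {n s t : ℕ} (H : Hypergraph n (3 + s)) where

  E : List (Fin n) → Bool
  E xs = edge H (setOf xs)

  E-↭ : ∀ {xs ys} → xs ↭ ys → E xs ≡ E ys
  E-↭ p = cong (edge H) (setOf-↭ p)

  module _ {L M : ℕ} .{{_ : NonZero L}} .{{_ : NonZero M}} (M≥ : 2 * (L * L) ≤ M)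
           {V : Vec (List (Fin n)) t} (R : Regularised {s = suc s} (L * L) M (link E E-↭) V)
           {m} (P : Vec (Fin t) m) (end : Vec (Fin t) (suc s)) (unique : Uniqueˡ (toList P ++ toList end))
           where

    open PairDensities R

    module _ (small : ∀ I j₁ j₂ K → toList I ++ toList (j₁ ∷ j₂ ∷ K) ⊆ toList P ++ toList end →
                      L * commonPairs (j₁ ∷ j₂ ∷ I) (j₁ ∷ j₂ ∷ K) ≤ vol (headBox (j₁ ∷ j₂ ∷ K)))
             {b d : ℕ} (b+d : b + d ≡ L)
             (level-lower : ∀ p → toList p ⊆ toList P ++ toList end → b * vol (headBox p) ≤ L * goodPairs p)
             (level-upper : ∀ p → toList p ⊆ toList P ++ toList end → L * goodPairs p ≤ suc b * vol (headBox p))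
             where

      open ≤-Reasoning

      -- The parts `end` lie behind all of `P`, so a pair used as a tail, even in the last two parts
      -- of `P`, is also a possible head of edges into `end`. Few pairs are good in both ways and at
      -- least a proportion b/L is good as heads, which leaves at most (L - b + 1)/L for the tails.
      tail-density : ∀ I j₁ j₂ → toList I ++ j₁ ∷ j₂ ∷ [] ⊆ toList P →
        L * goodPairs (j₁ ∷ j₂ ∷ I) ≤ suc d * vol (headBox (j₁ ∷ j₂ ∷ I))
      tail-density I j₁ j₂ sub = lin≤ 0 (+-mono-≤ (+-mono-≤ cover (small I j₁ j₂ end sub′))
          (level-lower (j₁ ∷ j₂ ∷ end) (⊆-trans (Sublistₚ.++⁺ˡ (toList I) ⊆-refl) sub′)))
          (trans (cong (λ z → L * S + (z * W + L * Cm + W + L * G) + 0) (sym b+d)) (lem (L * S) (L * G) W (L * Cm) b d))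
        where
        box = headBox (j₁ ∷ j₂ ∷ I)
        W   = vol box
        S   = goodPairs (j₁ ∷ j₂ ∷ I)
        G   = goodPairs (j₁ ∷ j₂ ∷ end)
        Cm  = commonPairs (j₁ ∷ j₂ ∷ I) (j₁ ∷ j₂ ∷ end)
        sub′ : toList I ++ toList (j₁ ∷ j₂ ∷ end) ⊆ toList P ++ toList end
        sub′ = subst (_⊆ toList P ++ toList end) (Listₚ.++-assoc (toList I) (j₁ ∷ j₂ ∷ []) (toList end)) (Sublistₚ.++⁺ sub ⊆-refl)
        f g h : Vec (Fin n) 2 → ℕ
        f = 𝟙 ∘ pairs (good (j₁ ∷ j₂ ∷ I))
        g = 𝟙 ∘ pairs (good (j₁ ∷ j₂ ∷ end))
        h = 𝟙 ∘ pairs (neither (bad (j₁ ∷ j₂ ∷ I)) (bad (j₁ ∷ j₂ ∷ end)))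
        cover : L * S + L * G ≤ L * W + L * Cm
        cover = begin
          L * S + L * G                     ≡⟨ *-distribˡ-+ L S G ⟨
          L * (S + G)                       ≡⟨ cong (L *_) (Sum-+ box f g) ⟨
          L * Sum box (λ v → f v + g v)     ≤⟨ *-monoʳ-≤ L (Sum-mono box {λ v → f v + g v} {λ v → 1 + h v} λ { (x ∷ y ∷ []) → neither-𝟙 (bad (j₁ ∷ j₂ ∷ I) x y) _ }) ⟩
          L * Sum box (λ v → 1 + h v)       ≡⟨ cong (L *_) (trans (Sum-+ box (λ _ → 1) h) (cong (_+ Cm) (Sum-1 box))) ⟩
          L * (W + Cm)                      ≡⟨ *-distribˡ-+ L W Cm ⟩
          L * W + L * Cm                    ∎
        lem : ∀ x g w c b d → x + ((b + d) * w + c + w + g) + 0 ≡ suc d * w + (x + g + c + b * w)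
        lem = solve-∀

      box-sparse : ∀ (p : Vec (Fin t) (3 + s)) → toList p ⊆ toList P →
        4 * L * Sum (Vec.map (lookup V) p) (λ v → 𝟙 (E (toList v))) ≤ (L + 28) * vol (Vec.map (lookup V) p)
      box-sparse p@(i ∷ j ∷ K) sub = tuple-sparse E E-↭ {b = b} {d} b+d M≥ (bad p) (bad (rotate p)) _ _ _
        (separates p uniqueₚ) tailSep
        -- `regular` speaks of pairs good for two indices; with both equal to `p` it covers the
        -- pairs good for `p`.
        (regular-cong (λ { (x ∷ y ∷ []) → Boolₚ.∧-idem (not (bad p x y)) }) (regular p p ((i≢j ∷ []) ∷ [] ∷ [])))
        (level-upper p (Sublistₚ.++⁺ʳ (toList end) sub)) tailDens
        where
        uniqueˡₚ : Uniqueˡ (toList p)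
        uniqueˡₚ = uniqueˡ-⊆ (Sublistₚ.++⁺ʳ (toList end) sub) unique
        uniqueₚ : Unique p
        uniqueₚ = uniqueˡ⇒unique p uniqueˡₚ
        uniqueᵣ : Unique (rotate p)
        uniqueᵣ = uniqueˡ⇒unique (rotate p) (uniqueˡ-↭ (Perm.↭-sym (rotate-↭ p)) uniqueˡₚ)
        i≢j : i ≢ j
        i≢j with uniqueₚ
        ... | (q ∷ _) ∷ _ = q
        tailSep : ∀ {Z₁ Z₂ I} → rotate (Vec.map (lookup V) p) ≡ Z₁ ∷ Z₂ ∷ I → Separates (L * L) M (link E E-↭) (bad (rotate p)) Z₁ Z₂ I
        tailSep eq with rotate p | map-rotate (lookup V) p | separates (rotate p) uniqueᵣ
        ... | y ∷ z ∷ I | eq′ | sep with trans (sym eq) (sym eq′)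
        ...   | refl = sep
        tailDens : L * Sum (firstTwo (rotate (Vec.map (lookup V) p))) (𝟙 ∘ pairs (good (rotate p))) ≤
          suc d * vol (firstTwo (rotate (Vec.map (lookup V) p)))
        tailDens with rotate p in eq | map-rotate (lookup V) p
        ... | y ∷ z ∷ I | eq′ rewrite sym eq′ = tail-density I y z (subst (_⊆ toList P) (rotate-init p eq) sub)

      module _ (q : ℕ) .{{_ : NonZero q}} (q≤ : ∀ i → q ≤ length (lookup V i)) where

        private
          Vs = Vec.map (lookup V) P
          r = 3 + s
          F : Vec (Fin n) r → ℕ
          F v = 𝟙 (E (toList v))
          ℓ : Vec (Fin n) m → ℕ
          ℓ x = pick r (toList x) F
          long : ∀ {k} (p : Vec (Fin t) k) → All (λ W → q ≤ length W) (toList (Vec.map (lookup V) p))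
          long []      = []
          long (i ∷ p) = q≤ i ∷ long p
          vol≥ : ∀ {k} (p : Vec (Fin t) k) → 1 ≤ vol (Vec.map (lookup V) p)
          vol≥ []      = ≤-refl
          vol≥ (i ∷ p) = *-mono-≤ (≤-trans (>-nonZero⁻¹ q) (q≤ i)) (vol≥ p)

        -- The sparseness of tuples of parts is relative to their volumes. Thinned to the same size
        -- q, all tuples have weight q^r, so their total is comparable with `m C r`; the second
        -- error term counts the sets with two vertices in one part.
        sparse-set : concat (toList (Vec.map (lookup V) P)) ⊆ allFin n →
          ∃ λ S → ∣ S ∣ ≡ m * q ×
            4 * L * edgesIn H S ≤ (L + 28) * ((m C r) * q ^ r) + 4 * L * ((2 + s) * (q * (m * q) ^ (2 + s)))
        sparse-set sub with equalise q Vs ℓ (long P)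
        ... | Qs , Qs⊆ , lens , le = S , sizeS , (begin
            4 * L * edgesIn H S                              ≡⟨ cong (4 * L *_) (trans (edgesIn-pick H S) (cong (λ xs → pick r xs F) elemsS)) ⟩
            4 * L * pick r (concat (toList Qs)) F            ≤⟨ *-monoʳ-≤ (4 * L) (pick≤Trans (2 + s) q (toList Qs) (λ v → 𝟙≤1 (E (toList v))) (AllL.map ≤-reflexive lens)) ⟩
            4 * L * (Tr + (2 + s) * (q * length (concat (toList Qs)) ^ (2 + s))) ≡⟨ cong (λ z → 4 * L * (Tr + (2 + s) * (q * z ^ (2 + s)))) len ⟩
            4 * L * (Tr + error)                             ≡⟨ *-distribˡ-+ (4 * L) Tr error ⟩
            4 * L * Tr + 4 * L * error                       ≤⟨ +-monoˡ-≤ (4 * L * error) transversal ⟩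
            (L + 28) * ((m C r) * q ^ r) + 4 * L * error     ∎)
          where
          S = setOf (concat (toList Qs))
          Tr = Trans r (toList Qs) F
          error = (2 + s) * (q * (m * q) ^ (2 + s))
          len : length (concat (toList Qs)) ≡ m * q
          len = trans (length-concat q (toList Qs) lens) (cong (_* q) (Vecₚ.length-toList Qs))
          elemsS : elems S ≡ concat (toList Qs)
          elemsS = elems-setOf (Vec.replicate n true) (subst (concat (toList Qs) ⊆_) (allFin≡elems n) (⊆-trans (concat-⊆ Qs⊆) sub))
          sizeS : ∣ S ∣ ≡ m * q
          sizeS = trans (sym (length-elems S)) (trans (cong length elemsS) len)
          boxes : ∀ (Us : Vec (List (Fin n)) r) → toList Us ⊆ toList Vs → 4 * L * Sum Us F ≤ (L + 28) * vol Us
          boxes Us p with ⊆-map⁻ᵛ (lookup V) (toList P) Us (subst (toList Us ⊆_) (toList-map (lookup V) P) p)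
          ... | w , w⊆ , refl = box-sparse w w⊆
          instance
            _ = >-nonZero (vol≥ P)
            _ = m^n≢0 q m
          transversal : 4 * L * Tr ≤ (L + 28) * ((m C r) * q ^ r)
          transversal = *-cancelˡ-≤ (vol Vs * q ^ m) {{m*n≢0 (vol Vs) (q ^ m)}} (begin
            vol Vs * q ^ m * (4 * L * Tr)                    ≡⟨ lem₁ (vol Vs) (q ^ m) (4 * L) Tr ⟩
            4 * L * vol Vs * (q ^ m * Tr)                    ≡⟨ cong (4 * L * vol Vs *_) (Trans-equal r q Qs F lens) ⟩
            4 * L * vol Vs * (q ^ r * Sum Qs ℓ)              ≡⟨ lem₂ (4 * L) (vol Vs) (q ^ r) (Sum Qs ℓ) ⟩
            4 * L * q ^ r * (vol Vs * Sum Qs ℓ)              ≤⟨ *-monoʳ-≤ (4 * L * q ^ r) le ⟩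
            4 * L * q ^ r * (q ^ m * Sum Vs ℓ)               ≡⟨ lem₃ (4 * L) (q ^ r) (q ^ m) (Sum Vs ℓ) ⟩
            q ^ r * q ^ m * (4 * L * Sum Vs ℓ)               ≤⟨ *-monoʳ-≤ (q ^ r * q ^ m) (sum-pick-≤ r Vs F (4 * L) (L + 28) boxes) ⟩
            q ^ r * q ^ m * ((L + 28) * ((m C r) * vol Vs))  ≡⟨ lem₄ (q ^ r) (q ^ m) (L + 28) (m C r) (vol Vs) ⟩
            vol Vs * q ^ m * ((L + 28) * ((m C r) * q ^ r))  ∎)
            where
            lem₁ : ∀ v q l t → v * q * (l * t) ≡ l * v * (q * t)
            lem₁ = solve-∀
            lem₂ : ∀ l v q s → l * v * (q * s) ≡ l * q * (v * s)
            lem₂ = solve-∀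
            lem₃ : ∀ l a b s → l * a * (b * s) ≡ a * b * (l * s)
            lem₃ = solve-∀
            lem₄ : ∀ a b l c v → a * b * (l * (c * v)) ≡ v * b * (l * (c * a))
            lem₄ = solve-∀

-- Prescribing conditions one at a time

allᵛ : ∀ {A : Set} {s} → Vec (A → Bool) s → Vec A s → Bool
allᵛ []       []      = true
allᵛ (u ∷ us) (a ∷ v) = u a ∧ allᵛ us v

restrict : ∀ {A : Set} {s} → Vec (A → Bool) s → Vec (List A) s → Vec (List A) s
restrict []       []       = []
restrict (u ∷ us) (V ∷ Vs) = filterᵇ u V ∷ restrict us Vs

restrict-⊴ : ∀ {A : Set} {s} (us : Vec (A → Bool) s) V → restrict us V ⊴ᵛ V
restrict-⊴ []       []       = []
restrict-⊴ (u ∷ us) (V ∷ Vs) = ⊴-filter u V ∷ restrict-⊴ us Vs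

Sum-restrict : ∀ {A : Set} {s} (us : Vec (A → Bool) s) V F →
  Sum (restrict us V) F ≡ Sum V (λ v → 𝟙 (allᵛ us v) * F v)
Sum-restrict []       []       F = sym (+-identityʳ (F []))
Sum-restrict (u ∷ us) (V ∷ Vs) F = trans (Σˡ-filter u V _) (Σˡ-cong V λ a → trans
  (cong (𝟙 (u a) *_) (Sum-restrict us Vs (λ v → F (a ∷ v))))
  (trans (sym (Sum-*ˡ Vs (𝟙 (u a)) _)) (Sum-cong Vs λ v → trans
    (sym (*-assoc (𝟙 (u a)) (𝟙 (allᵛ us v)) _)) (cong (_* F (a ∷ v)) (sym (𝟙-∧ (u a) (allᵛ us v)))))))

always : ∀ {A : Set} s → Vec (A → Bool) s
always zero    = []
always (suc s) = (λ _ → true) ∷ always s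

allᵛ-always : ∀ {A : Set} {s} (v : Vec A s) → allᵛ (always s) v ≡ true
allᵛ-always []      = refl
allᵛ-always (_ ∷ v) = allᵛ-always v

both : ∀ {A : Set} {s} → Vec (A → Bool) s → Vec (A → Bool) s → Vec (A → Bool) s
both = Vec.zipWith (λ u u′ a → u a ∧ u′ a)

∧-interchange : ∀ a b c d → (a ∧ b) ∧ (c ∧ d) ≡ (a ∧ c) ∧ (b ∧ d)
∧-interchange false b c     d = refl
∧-interchange true  b true  d = refl
∧-interchange true  b false d = Boolₚ.∧-zeroʳ b

allᵛ-both : ∀ {A : Set} {s} (us us′ : Vec (A → Bool) s) v → allᵛ (both us us′) v ≡ allᵛ us v ∧ allᵛ us′ v
allᵛ-both []       []         []      = refl
allᵛ-both (u ∷ us) (u′ ∷ us′) (a ∷ v) = trans (cong ((u a ∧ u′ a) ∧_) (allᵛ-both us us′ v))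
  (∧-interchange (u a) (u′ a) (allᵛ us v) (allᵛ us′ v))

module Embedding {A : Set} {k : ℕ} (w : Vec (List A) k) where

  Test : Set
  Test = Vec A k → Bool

  -- Replacing one coordinate of a uniformly random map by an independent choice from the same part
  -- leaves the distribution unchanged.
  resample₁ : ∀ {k} (w : Vec (List A) k) i F →
    Sum w (λ φ → Σˡ (lookup w i) (λ a → F (φ [ i ]≔ a))) ≡ length (lookup w i) * Sum w F
  resample₁ (V ∷ Vs) zero    F = trans (Σˡ-const V _) (cong (length V *_) (Sum-swap Vs V (λ a φ → F (a ∷ φ))))
  resample₁ (V ∷ Vs) (suc i) F = trans (Σˡ-cong V (λ b → resample₁ Vs i (λ φ → F (b ∷ φ)))) (Σˡ-*ˡ V (length (lookup Vs i)) _)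

  at : ∀ {s} → Vec (Fin k) s → Vec (List A) s
  at = Vec.map (lookup w)

  resample : ∀ {s} (c : Vec (Fin k) s) F →
    Sum w (λ φ → Sum (at c) (λ v → F (upd φ c v))) ≡ vol (at c) * Sum w F
  resample []      F = sym (+-identityʳ _)
  resample (i ∷ c) F = trans (resample₁ w i (λ φ → Sum (at c) (λ v → F (upd φ c v))))
    (trans (cong (length (lookup w i) *_) (resample c F)) (sym (*-assoc (length (lookup w i)) _ _)))

  -- Demanding `f` in addition to `Q` costs at most a factor D in probability, up to an error 1/M.
  Insertable : ℕ → ℕ → Test → Test → Set
  Insertable M D Q f = M * Sum w (𝟙 ∘ Q) ≤ M * (D * Sum w (λ φ → 𝟙 (Q φ ∧ f φ))) + vol w

  -- By resampling, it suffices to verify the inequality for the coordinates in `c` alone, with all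
  -- others fixed arbitrarily.
  insertable-locally : ∀ {s M D} (c : Vec (Fin k) s) .{{_ : NonZero (vol (at c))}} (Q f : Test) →
    (∀ φ → M * Sum (at c) (λ v → 𝟙 (Q (upd φ c v))) ≤
           M * (D * Sum (at c) (λ v → 𝟙 (Q (upd φ c v) ∧ f (upd φ c v)))) + vol (at c)) →
    Insertable M D Q f
  insertable-locally {M = M} {D} c Q f h = *-cancelˡ-≤ (vol (at c)) (begin
    vol (at c) * (M * Sum w (𝟙 ∘ Q))                        ≡⟨ lem₁ (vol (at c)) M _ ⟩
    M * (vol (at c) * Sum w (𝟙 ∘ Q))                        ≡⟨ cong (M *_) (resample c (𝟙 ∘ Q)) ⟨
    M * Sum w SQ                                            ≡⟨ Sum-*ˡ w M SQ ⟨
    Sum w (λ φ → M * SQ φ)                                  ≤⟨ Sum-mono w h ⟩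
    Sum w (λ φ → M * (D * SQf φ) + vol (at c))              ≡⟨ Sum-+ w _ _ ⟩
    Sum w (λ φ → M * (D * SQf φ)) + Sum w (λ _ → vol (at c)) ≡⟨ cong₂ _+_ (trans (Sum-*ˡ w M _) (cong (M *_) (Sum-*ˡ w D SQf))) (Sum-const w _) ⟩
    M * (D * Sum w SQf) + vol w * vol (at c)                ≡⟨ cong (λ z → M * (D * z) + vol w * vol (at c)) (resample c (λ φ → 𝟙 (Q φ ∧ f φ))) ⟩
    M * (D * (vol (at c) * Sum w (λ φ → 𝟙 (Q φ ∧ f φ)))) + vol w * vol (at c) ≡⟨ lem₂ M D (vol (at c)) _ (vol w) ⟩
    vol (at c) * (M * (D * Sum w (λ φ → 𝟙 (Q φ ∧ f φ))) + vol w) ∎)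
    where
    open ≤-Reasoning
    SQ SQf : Vec A k → ℕ
    SQ φ = Sum (at c) (λ v → 𝟙 (Q (upd φ c v)))
    SQf φ = Sum (at c) (λ v → 𝟙 (Q (upd φ c v) ∧ f (upd φ c v)))
    lem₁ : ∀ a b c → a * (b * c) ≡ b * (a * c)
    lem₁ = solve-∀
    lem₂ : ∀ m d v s w → m * (d * (v * s)) + w * v ≡ v * (m * (d * s) + w)
    lem₂ = solve-∀

  DependsOn : List (Fin k) → Test → Set
  DependsOn ds f = ∀ φ ψ → (∀ {d} → d ∈ ds → lookup φ d ≡ lookup ψ d) → f φ ≡ f ψ

  lookup-upd-cong : ∀ {s} (φ ψ : Vec A k) (c : Vec (Fin k) s) v {d} → lookup φ d ≡ lookup ψ d →
    lookup (upd φ c v) d ≡ lookup (upd ψ c v) d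
  lookup-upd-cong φ ψ []      []      e = e
  lookup-upd-cong φ ψ (i ∷ c) (a ∷ v) {d} e = lookup-upd-cong (φ [ i ]≔ a) (ψ [ i ]≔ a) c v {d} step
    where
    step : lookup (φ [ i ]≔ a) d ≡ lookup (ψ [ i ]≔ a) d
    step with d Finₚ.≟ i
    ... | yes refl = trans (Vecₚ.lookup∘update i φ a) (sym (Vecₚ.lookup∘update i ψ a))
    ... | no d≢i   = trans (Vecₚ.lookup∘update′ d≢i φ a) (trans e (sym (Vecₚ.lookup∘update′ d≢i ψ a)))

  lookup-update-∉ : ∀ (φ : Vec A k) {i a ds d} → i ∉ ds → d ∈ ds → lookup (φ [ i ]≔ a) d ≡ lookup φ d
  lookup-update-∉ φ {i} {a} i∉ds d∈ds = Vecₚ.lookup∘update′ (λ { refl → i∉ds d∈ds }) φ a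

  untouched : ∀ {s ds f} → DependsOn ds f → (φ : Vec A k) (c : Vec (Fin k) s) (v : Vec A s) →
    AllV.All (_∉ ds) c → f (upd φ c v) ≡ f φ
  untouched dep φ []      []      []       = refl
  untouched dep φ (i ∷ c) (a ∷ v) (p ∷ ps) =
    trans (untouched dep (φ [ i ]≔ a) c v ps) (dep _ _ (lookup-update-∉ φ p))

  data AtMostOne (ds : List (Fin k)) : ∀ {s} → Vec (Fin k) s → Set where
    []   : AtMostOne ds []
    skip : ∀ {s i} {c : Vec (Fin k) s} → i ∉ ds → AtMostOne ds c → AtMostOne ds (i ∷ c)
    only : ∀ {s i} {c : Vec (Fin k) s} → AllV.All (_∉ ds) c → AtMostOne ds (i ∷ c)

  -- Once all other coordinates are fixed, Q restricts those in c independently of each other.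
  Splits : ∀ {s} → Vec (Fin k) s → Test → Set
  Splits {s} c Q = ∀ φ → Σ Bool λ κ → Σ (Vec (A → Bool) s) λ us → ∀ v → Q (upd φ c v) ≡ κ ∧ allᵛ us v

  splits : ∀ {s ds f} → DependsOn ds f → {c : Vec (Fin k) s} → AtMostOne ds c → Splits c f
  splits {f = f} dep []             φ = f φ , [] , λ { [] → sym (Boolₚ.∧-identityʳ (f φ)) }
  splits {f = f} dep {i ∷ c} (skip i∉ amo) φ with splits dep amo φ
  ... | κ , us , e = κ , (λ _ → true) ∷ us , λ { (a ∷ v) →
        trans (dep _ _ (λ d∈ → lookup-upd-cong (φ [ i ]≔ a) φ c v (lookup-update-∉ φ i∉ d∈))) (e v) }
  splits {suc s} {f = f} dep {i ∷ c} (only ps) φ = true , (λ a → f (φ [ i ]≔ a)) ∷ always s , λ { (a ∷ v) →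
        trans (untouched dep (φ [ i ]≔ a) c v ps)
          (sym (trans (cong (f (φ [ i ]≔ a) ∧_) (allᵛ-always v)) (Boolₚ.∧-identityʳ _))) }

  conj : List Test → Test
  conj []       φ = true
  conj (f ∷ fs) φ = conj fs φ ∧ f φ

  splits-conj : ∀ {s} {c : Vec (Fin k) s} {fs} → All (Splits c) fs → Splits c (conj fs)
  splits-conj {s} []       φ = true , always s , λ v → sym (allᵛ-always v)
  splits-conj {c = c} (p ∷ ps) φ with splits-conj {c = c} ps φ | p φ
  ... | κ , us , e | κ′ , us′ , e′ = κ ∧ κ′ , both us us′ , λ v → trans (cong₂ _∧_ (e v) (e′ v))
        (trans (∧-interchange κ (allᵛ us v) κ′ (allᵛ us′ v)) (cong ((κ ∧ κ′) ∧_) (sym (allᵛ-both us us′ v))))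

  -- With the other coordinates fixed, either `Q` fails throughout, or the values of the coordinates
  -- in `c` that satisfy it form a sub-box, to which the lower bound `low` applies.
  insert-regular : ∀ {s M D} (c : Vec (Fin k) s) .{{_ : NonZero (vol (at c))}} → Unique c → (g : Vec A s → Bool) →
    (∀ U → U ⊴ᵛ at c → M * vol U ≤ M * (D * Sum U (𝟙 ∘ g)) + vol (at c)) →
    ∀ {Q} → Splits c Q → Insertable M D Q (λ φ → g (Vec.map (lookup φ) c))
  insert-regular {M = M} {D} c un g low {Q} sp = insertable-locally {M = M} {D} c Q (λ φ → g (Vec.map (lookup φ) c)) λ φ → local φ (sp φ)
    where
    local : ∀ φ → (Σ Bool λ κ → Σ (Vec (A → Bool) _) λ us → ∀ v → Q (upd φ c v) ≡ κ ∧ allᵛ us v) →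
      M * Sum (at c) (λ v → 𝟙 (Q (upd φ c v))) ≤
      M * (D * Sum (at c) (λ v → 𝟙 (Q (upd φ c v) ∧ g (Vec.map (lookup (upd φ c v)) c)))) + vol (at c)
    local φ (false , us , e) = ≤-trans (≤-reflexive (trans (cong (M *_)
      (trans (Sum-cong (at c) (λ v → cong 𝟙 (e v))) (trans (Sum-const (at c) 0) (*-zeroʳ (vol (at c)))))) (*-zeroʳ M))) z≤n
    local φ (true , us , e) = subst₂ (λ x y → M * x ≤ M * (D * y) + vol (at c))
      (trans (sym (Sum-1 (restrict us (at c)))) (trans (Sum-restrict us (at c) (λ _ → 1))
        (Sum-cong (at c) (λ v → trans (*-identityʳ _) (cong 𝟙 (sym (e v)))))))
      (trans (Sum-restrict us (at c) (𝟙 ∘ g)) (Sum-cong (at c) (λ v → trans (sym (𝟙-∧ (allᵛ us v) (g v)))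
        (cong 𝟙 (cong₂ _∧_ (sym (e v)) (cong g (sym (map-lookup-upd φ v un))))))))
      (low (restrict us (at c)) (restrict-⊴ us (at c)))

  -- As `Splits`, but with an arbitrary relation between the first two coordinates. `Separates`
  -- tolerates this because its set `u` of pairs is arbitrary, and twins require it because they
  -- share a pair.
  Splits₂ : ∀ {s} → Fin k → Fin k → Vec (Fin k) s → Test → Set
  Splits₂ {s} y z c Q = ∀ φ → Σ (A → A → Bool) λ u → Σ (Vec (A → Bool) s) λ us →
    ∀ a b v → Q (upd φ (y ∷ z ∷ c) (a ∷ b ∷ v)) ≡ u a b ∧ allᵛ us v

  -- Either ds is the twin of the edge (y, z, c), or it shares at most one vertex with it.
  data Compatible (ds : List (Fin k)) (y z : Fin k) {s} (c : Vec (Fin k) s) : Set where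
    off-link : AllV.All (_∉ ds) c → Compatible ds y z c
    off-pair : y ∉ ds → z ∉ ds → AtMostOne ds c → Compatible ds y z c

  splits₂ : ∀ {s ds f y z} → DependsOn ds f → {c : Vec (Fin k) s} → Compatible ds y z c → Splits₂ y z c f
  splits₂ {s} {f = f} {y} {z} dep {c} (off-link ps) φ = (λ a b → f (φ [ y ]≔ a [ z ]≔ b)) , always s , λ a b v →
    trans (untouched dep (φ [ y ]≔ a [ z ]≔ b) c v ps)
      (sym (trans (cong (f (φ [ y ]≔ a [ z ]≔ b) ∧_) (allᵛ-always v)) (Boolₚ.∧-identityʳ _)))
  splits₂ {f = f} {y} {z} dep {c} (off-pair y∉ z∉ amo) φ with splits dep amo φ
  ... | κ , us , e = (λ _ _ → κ) , us , λ a b v → trans (dep _ _ (λ {d} d∈ →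
        lookup-upd-cong (φ [ y ]≔ a [ z ]≔ b) φ c v {d} (trans (lookup-update-∉ (φ [ y ]≔ a) z∉ d∈) (lookup-update-∉ φ y∉ d∈)))) (e v)

  splits₂-conj : ∀ {s y z} {c : Vec (Fin k) s} {fs} → All (Splits₂ y z c) fs → Splits₂ y z c (conj fs)
  splits₂-conj []       φ = (λ _ _ → true) , always _ , λ a b v → sym (allᵛ-always v)
  splits₂-conj {y = y} {z} {c} (p ∷ ps) φ with splits₂-conj {y = y} {z} {c} ps φ | p φ
  ... | u , us , e | u′ , us′ , e′ = (λ a b → u a b ∧ u′ a b) , both us us′ , λ a b v → trans (cong₂ _∧_ (e a b v) (e′ a b v))
        (trans (∧-interchange (u a b) (allᵛ us v) (u′ a b) (allᵛ us′ v)) (cong ((u a b ∧ u′ a b) ∧_) (sym (allᵛ-both us us′ v))))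

  insert-edge : ∀ {s M D B} (y z : Fin k) (c : Vec (Fin k) s) .{{_ : NonZero (vol (at (y ∷ z ∷ c)))}} → Unique (y ∷ z ∷ c) →
    (E : A → A → Vec A s → Bool) → Separates D M E B (lookup w y) (lookup w z) (at c) →
    ∀ {Q} → Splits₂ y z c Q → (∀ φ → Q φ ≡ true → B (lookup φ y) (lookup φ z) ≡ false) →
    Insertable M D Q (λ φ → E (lookup φ y) (lookup φ z) (Vec.map (lookup φ) c))
  insert-edge {M = M} {D} {B} y z c un E sep {Q} sp good = insertable-locally {M = M} {D} (y ∷ z ∷ c) Q f λ φ → local φ (sp φ)
    where
    Z₁ = lookup w y
    Z₂ = lookup w z
    f : Test
    f φ = E (lookup φ y) (lookup φ z) (Vec.map (lookup φ) c)
    local : ∀ φ → (Σ (A → A → Bool) λ u → Σ (Vec (A → Bool) _) λ us → ∀ a b v → Q (upd φ (y ∷ z ∷ c) (a ∷ b ∷ v)) ≡ u a b ∧ allᵛ us v) →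
      M * Sum₂ Z₁ Z₂ (at c) (λ a b v → 𝟙 (Q (upd φ (y ∷ z ∷ c) (a ∷ b ∷ v)))) ≤
      M * (D * Sum₂ Z₁ Z₂ (at c) (λ a b v → 𝟙 (Q (upd φ (y ∷ z ∷ c) (a ∷ b ∷ v)) ∧ f (upd φ (y ∷ z ∷ c) (a ∷ b ∷ v))))) + vol (at (y ∷ z ∷ c))
    local φ (u , us , e) = subst₂ (λ x t → M * x ≤ M * (D * t) + vol (at (y ∷ z ∷ c)))
      (trans (restricted (λ a b _ → 𝟙 (u′ a b))) (Sum₂-cong Z₁ Z₂ (at c) λ a b v →
        trans (sym (𝟙-∧ (allᵛ us v) (u′ a b))) (cong 𝟙 (sym (e′ a b v)))))
      (trans (restricted (λ a b v → 𝟙 (u′ a b ∧ E a b v))) (Sum₂-cong Z₁ Z₂ (at c) λ a b v →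
        trans (sym (𝟙-∧ (allᵛ us v) _)) (cong 𝟙 (trans (sym (Boolₚ.∧-assoc (allᵛ us v) (u′ a b) _))
          (cong₂ _∧_ (sym (e′ a b v)) (sym (f-upd a b v)))))))
      (Separates.good sep (restrict us (at c)) (restrict-⊴ us (at c)) u′ off)
      where
      -- `good` asks for a set of pairs without bad ones. Removing the bad pairs from `u` does not
      -- change the condition on maps, because `Q` already implies that the pair is good.
      u′ : A → A → Bool
      u′ a b = u a b ∧ not (B a b)
      off : ∀ a b → u′ a b ≡ true → B a b ≡ false
      off a b t with u a b | B a b
      ... | true | false = refl
      restricted : ∀ g → Sum₂ Z₁ Z₂ (restrict us (at c)) g ≡ Sum₂ Z₁ Z₂ (at c) (λ a b v → 𝟙 (allᵛ us v) * g a b v)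
      restricted g = Σˡ-cong Z₁ λ a → Σˡ-cong Z₂ λ b → Sum-restrict us (at c) (g a b)
      entries : ∀ a b v → Vec.map (lookup (upd φ (y ∷ z ∷ c) (a ∷ b ∷ v))) (y ∷ z ∷ c) ≡ a ∷ b ∷ v
      entries a b v = map-lookup-upd φ (a ∷ b ∷ v) un
      f-upd : ∀ a b v → f (upd φ (y ∷ z ∷ c) (a ∷ b ∷ v)) ≡ E a b v
      f-upd a b v with lookup (upd φ (y ∷ z ∷ c) (a ∷ b ∷ v)) y | lookup (upd φ (y ∷ z ∷ c) (a ∷ b ∷ v)) z
                     | Vec.map (lookup (upd φ (y ∷ z ∷ c) (a ∷ b ∷ v))) c | entries a b v
      ... | _ | _ | _ | refl = refl
      e′ : ∀ a b v → Q (upd φ (y ∷ z ∷ c) (a ∷ b ∷ v)) ≡ allᵛ us v ∧ u′ a b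
      e′ a b v with Q (upd φ (y ∷ z ∷ c) (a ∷ b ∷ v)) in eqQ | e a b v
      ... | false | q rewrite Boolₚ.∧-comm (allᵛ us v) (u a b ∧ not (B a b))
                            | Boolₚ.∧-assoc (u a b) (not (B a b)) (allᵛ us v)
                            | Boolₚ.∧-comm (not (B a b)) (allᵛ us v)
                            | sym (Boolₚ.∧-assoc (u a b) (allᵛ us v) (not (B a b))) | sym q = refl
      ... | true  | q with u a b | allᵛ us v | trans (cong₂ B (sym (cong Vec.head (entries a b v))) (sym (cong (Vec.head ∘ Vec.tail) (entries a b v)))) (good _ eqQ)
      ...   | true | true | eqB rewrite eqB = refl

  -- The proportion of maps satisfying `Q` is at least D^(-j) - j/M.
  Chain : ℕ → ℕ → ℕ → Test → Set
  Chain M D j Q = M * vol w ≤ D ^ j * (M * Sum w (𝟙 ∘ Q) + j * vol w)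

  chain-start : ∀ {M D} → Chain M D 0 (conj [])
  chain-start {M} = ≤-reflexive (trans (cong (M *_) (sym (Sum-1 w))) (lem (M * Sum w (λ _ → 1))))
    where
    lem : ∀ x → x ≡ 1 * (x + 0)
    lem = solve-∀

  chain-step : ∀ {M D} .{{_ : NonZero D}} {j fs f} → Insertable M D (conj fs) f → Chain M D j (conj fs) → Chain M D (suc j) (conj (f ∷ fs))
  chain-step {M} {D} {j} {fs} {f} ins ch = begin
    M * W                                      ≤⟨ ch ⟩
    D ^ j * (M * S + j * W)                    ≤⟨ *-monoʳ-≤ (D ^ j) (+-mono-≤ ins (≤-refl {j * W})) ⟩
    D ^ j * (M * (D * S′) + W + j * W)         ≡⟨ lem₁ (D ^ j) M D S′ W j ⟩
    D * D ^ j * (M * S′) + D ^ j * (suc j * W) ≤⟨ +-monoʳ-≤ (D * D ^ j * (M * S′)) (*-monoˡ-≤ (suc j * W) (m≤n*m (D ^ j) D)) ⟩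
    D * D ^ j * (M * S′) + D * D ^ j * (suc j * W) ≡⟨ *-distribˡ-+ (D * D ^ j) (M * S′) _ ⟨
    D * D ^ j * (M * S′ + suc j * W)           ∎
    where
    open ≤-Reasoning
    W = vol w
    S = Sum w (𝟙 ∘ conj fs)
    S′ = Sum w (𝟙 ∘ conj (f ∷ fs))
    lem₁ : ∀ p m d s w j → p * (m * (d * s) + w + j * w) ≡ d * p * (m * s) + p * (suc j * w)
    lem₁ = solve-∀

  Σˡ-positive : ∀ {B : Set} (xs : List B) (f : B → ℕ) → 1 ≤ Σˡ xs f → ∃ λ x → x ∈ xs × 1 ≤ f x
  Σˡ-positive (x ∷ xs) f le with f x in eq
  ... | suc m = x , here refl , ≤-trans (s≤s z≤n) (≤-reflexive (sym eq))
  ... | zero  with Σˡ-positive xs f le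
  ...   | y , y∈ , p = y , there y∈ , p

  Sum-positive : ∀ {k} (w : Vec (List A) k) (Q : Vec A k → Bool) → 1 ≤ Sum w (𝟙 ∘ Q) →
    ∃ λ φ → Pointwise _∈_ φ w × Q φ ≡ true
  Sum-positive []       Q le with Q [] in eq
  ... | true = [] , [] , eq
  Sum-positive (V ∷ Vs) Q le with Σˡ-positive V _ le
  ... | a , a∈ , le′ with Sum-positive Vs (λ φ → Q (a ∷ φ)) le′
  ... | φ , φ∈ , q = a ∷ φ , a∈ ∷ φ∈ , q

  chain-end : ∀ {M D j Q} .{{_ : NonZero (vol w)}} → D ^ j * j < M → Chain M D j Q →
    ∃ λ φ → Pointwise _∈_ φ w × Q φ ≡ true
  chain-end {M} {D} {j} {Q} M> ch with Sum w (𝟙 ∘ Q) in eq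
  ... | suc m = Sum-positive w Q (≤-trans (s≤s z≤n) (≤-reflexive (sym eq)))
  ... | zero  = ⊥-elim (<⇒≱ M> (*-cancelʳ-≤ M _ (vol w) (≤-trans ch (≤-reflexive (lem (D ^ j) M j (vol w))))))
    where
    lem : ∀ p m j w → p * (m * 0 + j * w) ≡ p * j * w
    lem = solve-∀

-- Prescribing all twin edges

-- Two edges z₁ z₂ xs and z₁ z₂ ys sharing a pair, with the sets of bad pairs of their respective links.
record Twins (A : Set) (k s : ℕ) : Set where
  field
    z₁ z₂   : Fin k
    xs ys   : Vec (Fin k) s
    Bx By   : A → A → Bool
  edgeX edgeY : Vec (Fin k) (2 + s)
  edgeX = z₁ ∷ z₂ ∷ xs
  edgeY = z₁ ∷ z₂ ∷ ys

module TwinEmbedding {A : Set} {k : ℕ} (w : Vec (List A) k) (nonempty : ∀ v → NonZero (length (lookup w v)))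
                     {s : ℕ} (M D : ℕ) .{{_ : NonZero D}} (E : List A → Bool) where

  open Embedding w

  private
    T = Twins A k s
    _∈?_ : (v : Fin k) (ds : List (Fin k)) → Dec (v ∈ ds)
    _∈?_ = member? Finₚ._≟_

  vol-at : ∀ {q} (c : Vec (Fin k) q) → NonZero (vol (at c))
  vol-at []      = _
  vol-at (i ∷ c) = m*n≢0 _ _ {{nonempty i}} {{vol-at c}}

  isLink : A → A → Vec A s → Bool
  isLink a b v = E (a ∷ b ∷ toList v)

  record Placed (τ : T) : Set where
    open Twins τ
    field
      uniqueX : Unique edgeX
      uniqueY : Unique edgeY
      xs∉Y    : AllV.All (_∉ toList edgeY) xs
      sepX    : Separates D M isLink Bx (lookup w z₁) (lookup w z₂) (at xs)
      sepY    : Separates D M isLink By (lookup w z₁) (lookup w z₂) (at ys)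
      dense   : ∀ U → U ⊴ᵛ at (z₁ ∷ z₂ ∷ []) →
                M * vol U ≤ M * (D * Sum U (𝟙 ∘ pairs (neither Bx By))) + vol (at (z₁ ∷ z₂ ∷ []))

  MeetOnce : List (Fin k) → List (Fin k) → Set
  MeetOnce c ds = ∀ {u v} → u ∈ c → v ∈ c → u ∈ ds → v ∈ ds → u ≡ v

  record Apart (τ σ : T) : Set where
    private
      module τ = Twins τ
      module σ = Twins σ
    field
      XX : MeetOnce (toList τ.edgeX) (toList σ.edgeX)
      XY : MeetOnce (toList τ.edgeX) (toList σ.edgeY)
      YX : MeetOnce (toList τ.edgeY) (toList σ.edgeX)
      YY : MeetOnce (toList τ.edgeY) (toList σ.edgeY)

  apart-sym : ∀ {τ σ} → Apart τ σ → Apart σ τ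
  apart-sym p = record
    { XX = λ u v u′ v′ → XX u′ v′ u v ; XY = λ u v u′ v′ → YX u′ v′ u v
    ; YX = λ u v u′ v′ → XY u′ v′ u v ; YY = λ u v u′ v′ → YY u′ v′ u v }
    where open Apart p

  ∉-all : ∀ {q} (c : Vec (Fin k) q) {ds} → (∀ {v} → v ∈ toList c → v ∉ ds) → AllV.All (_∉ ds) c
  ∉-all []      h = []
  ∉-all (i ∷ c) h = h (here refl) ∷ ∉-all c (λ p → h (there p))

  ≢-all : ∀ {q} {i : Fin k} {c : Vec (Fin k) q} → AllV.All (i ≢_) c → ∀ {v} → v ∈ toList c → i ≢ v
  ≢-all {c = _ ∷ _} (p ∷ ps) (here refl) = p
  ≢-all {c = _ ∷ _} (p ∷ ps) (there q)   = ≢-all ps q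

  atMostOne : ∀ {q} {c : Vec (Fin k) q} {ds} → Unique c → MeetOnce (toList c) ds → AtMostOne ds c
  atMostOne {c = []}    []       h = []
  atMostOne {c = i ∷ c} {ds} (u ∷ us) h with i ∈? ds
  ... | yes i∈ = only (∉-all c (λ v∈c v∈ds → ≢-all u v∈c (h (here refl) (there v∈c) i∈ v∈ds)))
  ... | no i∉  = skip i∉ (atMostOne us (λ p q → h (there p) (there q)))

  compatible : ∀ {q y z} {c : Vec (Fin k) q} {ds} → Unique (y ∷ z ∷ c) → MeetOnce (toList (y ∷ z ∷ c)) ds →
    Compatible ds y z c
  compatible {y = y} {z} {c} {ds} ((_ ∷ y∉c) ∷ z∉c ∷ us) h with y ∈? ds | z ∈? ds
  ... | yes y∈ | _      = off-link (∉-all c (λ v∈c v∈ds → ≢-all y∉c v∈c (h (here refl) (there (there v∈c)) y∈ v∈ds)))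
  ... | no _   | yes z∈ = off-link (∉-all c (λ v∈c v∈ds → ≢-all z∉c v∈c (h (there (here refl)) (there (there v∈c)) z∈ v∈ds)))
  ... | no y∉  | no z∉  = off-pair y∉ z∉ (atMostOne us (λ p q → h (there (there p)) (there (there q))))

  meet-⊆ : ∀ {c c′ ds ds′} → (∀ {v} → v ∈ c′ → v ∈ c) → (∀ {v} → v ∈ ds′ → v ∈ ds) → MeetOnce c ds → MeetOnce c′ ds′
  meet-⊆ f g h p q p′ q′ = h (f p) (f q) (g p′) (g q′)

  pair⊆ : ∀ {y z : Fin k} {c : List (Fin k)} {v} → v ∈ y ∷ z ∷ [] → v ∈ y ∷ z ∷ c
  pair⊆ (here p)         = here p
  pair⊆ (there (here p)) = there (here p)

  module Tests (τ : T) where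
    open Twins τ
    pairTest testX testY : Test
    pairTest φ = pairs (neither Bx By) (Vec.map (lookup φ) (z₁ ∷ z₂ ∷ []))
    testX φ = isLink (lookup φ z₁) (lookup φ z₂) (Vec.map (lookup φ) xs)
    testY φ = isLink (lookup φ z₁) (lookup φ z₂) (Vec.map (lookup φ) ys)

  open Tests

  module _ (τ : T) where
    open Twins τ

    pairTest-depends : DependsOn (z₁ ∷ z₂ ∷ []) (pairTest τ)
    pairTest-depends φ ψ e = cong₂ (neither Bx By) (e (here refl)) (e (there (here refl)))

    map-cong-∈ : ∀ {q} (φ ψ : Vec A k) (c : Vec (Fin k) q) → (∀ {d} → d ∈ toList c → lookup φ d ≡ lookup ψ d) →
      Vec.map (lookup φ) c ≡ Vec.map (lookup ψ) c
    map-cong-∈ φ ψ []      e = refl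
    map-cong-∈ φ ψ (i ∷ c) e = cong₂ _∷_ (e (here refl)) (map-cong-∈ φ ψ c (λ p → e (there p)))

    testX-depends : DependsOn (toList edgeX) (testX τ)
    testX-depends φ ψ e = cong (E ∘ toList) (map-cong-∈ φ ψ edgeX e)

    testY-depends : DependsOn (toList edgeY) (testY τ)
    testY-depends φ ψ e = cong (E ∘ toList) (map-cong-∈ φ ψ edgeY e)

  pairTests : List T → List Test
  pairTests = map pairTest

  -- The head of the list is the condition imposed last. The pairs of all `τs` come first, so that
  -- an edge is imposed only when its pair is known to be good; `σs` lists the twins whose edges
  -- have been imposed.
  allTests : List T → List T → List Test
  allTests τs []       = pairTests τs
  allTests τs (σ ∷ σs) = testX σ ∷ testY σ ∷ allTests τs σs

  chain-pairs : ∀ τs → All Placed τs → AllPairs Apart τs → Chain M D (length τs) (conj (pairTests τs))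
  chain-pairs []       []       []         = chain-start {M} {D}
  chain-pairs (τ ∷ τs) (p ∷ ps) (ap ∷ aps) = chain-step {M} {D} {j = length τs} {pairTests τs} {pairTest τ}
    (insert-regular {M = M} {D} c {{vol-at c}} ((z₁≢z₂ ∷ []) ∷ [] ∷ []) (pairs (neither Bx By)) dense {conj (pairTests τs)}
      (splits-conj {c = c} (AllLₚ.map⁺ (AllL.map split ap))))
    (chain-pairs τs ps aps)
    where
    open Twins τ
    open Placed p
    c = z₁ ∷ z₂ ∷ []
    z₁≢z₂ : z₁ ≢ z₂
    z₁≢z₂ with uniqueX
    ... | (q ∷ _) ∷ _ = q
    split : ∀ {σ} → Apart τ σ → Splits c (pairTest σ)
    split {σ} q = splits (pairTest-depends σ) (atMostOne ((z₁≢z₂ ∷ []) ∷ [] ∷ []) (meet-⊆ pair⊆ pair⊆ (Apart.XX q)))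

  conj-true : ∀ {fs f} φ → f ∈ fs → conj fs φ ≡ true → f φ ≡ true
  conj-true {f ∷ fs} φ (here refl) e with conj fs φ | f φ
  ... | true | true = refl
  conj-true {f ∷ fs} φ (there p)   e with conj fs φ in eq
  ... | true = conj-true {fs} φ p eq

  pair∈tests : ∀ τs σs {f} → f ∈ pairTests τs → f ∈ allTests τs σs
  pair∈tests τs []       p = p
  pair∈tests τs (σ ∷ σs) p = there (there (pair∈tests τs σs p))

  module _ (τs : List T) (placed : ∀ {τ} → τ ∈ τs → Placed τ)
           (apart : ∀ {τ σ} → τ ∈ τs → σ ∈ τs → τ ≡ σ ⊎ Apart τ σ) where

    good-pair : ∀ {τ σs} fs → τ ∈ τs → (∀ {f} → f ∈ allTests τs σs → f ∈ fs) → ∀ φ → conj fs φ ≡ true →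
      neither (Twins.Bx τ) (Twins.By τ) (lookup φ (Twins.z₁ τ)) (lookup φ (Twins.z₂ τ)) ≡ true
    good-pair {τ} {σs} fs τ∈ sub φ e = conj-true {fs} φ (sub (pair∈tests τs σs (∈-map⁺ pairTest τ∈))) e

    pair-compatible : ∀ {τ σ q} {c : Vec (Fin k) q} → Unique (Twins.z₁ τ ∷ Twins.z₂ τ ∷ c) →
      (∀ {σ} → Apart τ σ → MeetOnce (toList (Twins.z₁ τ ∷ Twins.z₂ τ ∷ c)) (toList (Twins.edgeX σ))) →
      τ ≡ σ ⊎ Apart τ σ → Compatible (Twins.z₁ σ ∷ Twins.z₂ σ ∷ []) (Twins.z₁ τ) (Twins.z₂ τ) c
    pair-compatible {τ} {c = c} ((_ ∷ z₁∉) ∷ z₂∉ ∷ _) m (inj₁ refl) = off-link (∉-all c λ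
      { v∈ (here refl) → ≢-all z₁∉ v∈ refl ; v∈ (there (here refl)) → ≢-all z₂∉ v∈ refl })
    pair-compatible un m (inj₂ ap) = compatible un (meet-⊆ (λ p → p) pair⊆ (m ap))

    -- Twins are the only edges that share two vertices. What they share is `z₁` and `z₂`, so the
    -- test of one twin constrains only the first two coordinates of the other; the tests of all
    -- other twins meet its vertices at most once.
    chain-all : ∀ σs → (∀ {σ} → σ ∈ σs → σ ∈ τs) → AllPairs Apart σs → Chain M D (length τs) (conj (pairTests τs)) →
      ∃ λ j → j ≤ length τs + 2 * length σs × Chain M D j (conj (allTests τs σs))
    chain-all [] sub [] ch = length τs , m≤m+n _ 0 , ch
    chain-all (τ ∷ σs) sub (ap ∷ aps) ch with chain-all σs (λ p → sub (there p)) aps ch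
    ... | j , j≤ , ch′ = suc (suc j) , bound ,
      chain-step {M} {D} {j = suc j} {testY τ ∷ allTests τs σs} {testX τ}
        (insert-edge {M = M} {D} {Bx} z₁ z₂ xs {{vol-at edgeX}} uniqueX isLink sepX {conj (testY τ ∷ allTests τs σs)}
          (splits₂-conj {y = z₁} {z₂} {xs} {testY τ ∷ allTests τs σs} (splits₂ {f = testY τ} {y = z₁} {z = z₂} (testY-depends τ) (off-link xs∉Y)
            ∷ splitAll xs uniqueX Apart.XX Apart.XX Apart.XY σs ap))
          (λ φ e → first _ _ (good-pair {τ} {σs} (testY τ ∷ allTests τs σs) τ∈ there φ e)))
        (chain-step {M} {D} {j = j} {allTests τs σs} {testY τ}
          (insert-edge {M = M} {D} {By} z₁ z₂ ys {{vol-at edgeY}} uniqueY isLink sepY {conj (allTests τs σs)}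
            (splits₂-conj {y = z₁} {z₂} {ys} (splitAll ys uniqueY Apart.YX Apart.YX Apart.YY σs ap))
            (λ φ e → second _ _ (good-pair {τ} {σs} (allTests τs σs) τ∈ (λ p → p) φ e)))
          ch′)
      where
      τ∈ : τ ∈ τs
      τ∈ = sub (here refl)
      open Twins τ
      open Placed (placed τ∈)
      bound : suc (suc j) ≤ length τs + 2 * suc (length σs)
      bound = ≤-trans (s≤s (s≤s j≤)) (≤-reflexive (lem (length τs) (length σs)))
        where
        lem : ∀ a b → 2 + (a + 2 * b) ≡ a + 2 * suc b
        lem = solve-∀
      first : ∀ x y → not x ∧ not y ≡ true → x ≡ false
      first false y e = refl
      second : ∀ x y → not x ∧ not y ≡ true → y ≡ false
      second false false e = refl
      splitAll : ∀ (c : Vec (Fin k) s) → Unique (z₁ ∷ z₂ ∷ c) →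
        (∀ {σ} → Apart τ σ → MeetOnce (toList (z₁ ∷ z₂ ∷ c)) (toList (Twins.edgeX σ))) →
        (∀ {σ} → Apart τ σ → MeetOnce (toList (z₁ ∷ z₂ ∷ c)) (toList (Twins.edgeX σ))) →
        (∀ {σ} → Apart τ σ → MeetOnce (toList (z₁ ∷ z₂ ∷ c)) (toList (Twins.edgeY σ))) →
        ∀ σs → All (Apart τ) σs → All (Splits₂ z₁ z₂ c) (allTests τs σs)
      splitAll c un m mX mY []       []       = AllLₚ.map⁺ (AllL.tabulate λ {σ} σ∈ →
        splits₂ {f = pairTest σ} (pairTest-depends σ) (pair-compatible {τ} {σ} un m (apart τ∈ σ∈)))
      splitAll c un m mX mY (σ ∷ σs) (a ∷ as) =
        splits₂ {f = testX σ} (testX-depends σ) (compatible un (mX a)) ∷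
        splits₂ {f = testY σ} (testY-depends σ) (compatible un (mY a)) ∷ splitAll c un m mX mY σs as

  apart-or-equal : ∀ {τs} → AllPairs Apart τs → ∀ {τ σ} → τ ∈ τs → σ ∈ τs → τ ≡ σ ⊎ Apart τ σ
  apart-or-equal (ap ∷ aps) (here refl) (here refl) = inj₁ refl
  apart-or-equal (ap ∷ aps) (here refl) (there q)   = inj₂ (AllL.lookup ap q)
  apart-or-equal (ap ∷ aps) (there p)   (here refl) = inj₂ (apart-sym (AllL.lookup ap p))
  apart-or-equal (ap ∷ aps) (there p)   (there q)   = apart-or-equal aps p q

  testX∈ : ∀ τs σs {τ} → τ ∈ σs → testX τ ∈ allTests τs σs
  testX∈ τs (σ ∷ σs) (here refl) = here refl
  testX∈ τs (σ ∷ σs) (there p)   = there (there (testX∈ τs σs p))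

  testY∈ : ∀ τs σs {τ} → τ ∈ σs → testY τ ∈ allTests τs σs
  testY∈ τs (σ ∷ σs) (here refl) = there (here refl)
  testY∈ τs (σ ∷ σs) (there p)   = there (there (testY∈ τs σs p))

  embed-twins : ∀ τs → All Placed τs → AllPairs Apart τs →
    (let J = length τs + 2 * length τs in D ^ J * J < M) →
    ∃ λ φ → Pointwise _∈_ φ w × (∀ {τ} → τ ∈ τs → testX τ φ ≡ true × testY τ φ ≡ true)
  embed-twins τs ps aps M> with chain-all τs (AllL.lookup ps) (apart-or-equal aps) τs (λ p → p) aps (chain-pairs τs ps aps)
  ... | j , j≤ , ch with chain-end {M} {D} {j} {conj (allTests τs τs)} {{vol≢0 w nonempty}}
                          (≤-<-trans (*-mono-≤ (^-monoʳ-≤ D j≤) j≤) M>) ch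
    where
    vol≢0 : ∀ {q} (v : Vec (List A) q) → (∀ i → NonZero (length (lookup v i))) → NonZero (vol v)
    vol≢0 []      h = _
    vol≢0 (V ∷ v) h = m*n≢0 _ _ {{h zero}} {{vol≢0 v (h ∘ suc)}}
  ... | φ , φ∈ , e = φ , φ∈ , λ {τ} τ∈ →
        conj-true {allTests τs τs} φ (testX∈ τs τs τ∈) e , conj-true {allTests τs τs} φ (testY∈ τs τs τ∈) e

-- Twin edges of an ordered quasi-linear hypergraph

∧-true : ∀ {a b} → a ∧ b ≡ true → a ≡ true × b ≡ true
∧-true {true} {true} _ = refl , refl

true-ext : ∀ {a b} → (a ≡ true → b ≡ true) → (b ≡ true → a ≡ true) → a ≡ b
true-ext {true}  {b}     f g = sym (f refl)
true-ext {false} {false} f g = refl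
true-ext {false} {true}  f g = g refl

subset-ext : ∀ {n} {p q : Subset n} → (∀ v → lookup p v ≡ true → lookup q v ≡ true) →
  (∀ v → lookup q v ≡ true → lookup p v ≡ true) → p ≡ q
subset-ext {p = []}    {[]}    f g = refl
subset-ext {p = a ∷ p} {b ∷ q} f g = cong₂ _∷_ (true-ext (f zero) (g zero)) (subset-ext (f ∘ suc) (g ∘ suc))

module _ {A : Set} where

  ∈-filterᵇ⁺ : ∀ (p : A → Bool) {x xs} → x ∈ xs → p x ≡ true → x ∈ filterᵇ p xs
  ∈-filterᵇ⁺ p {x} {y ∷ xs} (here refl) e with p x
  ... | true = here refl
  ∈-filterᵇ⁺ p {x} {y ∷ xs} (there m)   e with p y
  ... | true  = there (∈-filterᵇ⁺ p m e)
  ... | false = ∈-filterᵇ⁺ p m e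

  ∈-filterᵇ⁻ : ∀ (p : A → Bool) {x} xs → x ∈ filterᵇ p xs → x ∈ xs × p x ≡ true
  ∈-filterᵇ⁻ p (y ∷ xs) m with p y in eq
  ∈-filterᵇ⁻ p (y ∷ xs) (here refl) | true = here refl , eq
  ∈-filterᵇ⁻ p (y ∷ xs) (there m)   | true with ∈-filterᵇ⁻ p xs m
  ... | m′ , e = there m′ , e
  ∈-filterᵇ⁻ p (y ∷ xs) m           | false with ∈-filterᵇ⁻ p xs m
  ... | m′ , e = there m′ , e

  filterᵇ-none : ∀ (p : A → Bool) {xs} → (∀ {x} → x ∈ xs → p x ≡ true → ⊥) → filterᵇ p xs ≡ []
  filterᵇ-none p {[]}     h = refl
  filterᵇ-none p {x ∷ xs} h with p x in eq
  ... | true  = ⊥-elim (h (here refl) eq)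
  ... | false = filterᵇ-none p (λ m → h (there m))

  -- Once the traversal reaches the first entry of `L`, sortedness excludes further entries selected
  -- by `p`. Applied twice, this arranges the X-, Z- and Y-vertices of a twin pair in one increasing
  -- list.
  filterᵇ-++-⊆ : ∀ (f : A → ℕ) (p : A → Bool) {vs L} → AllPairs (λ u v → f u < f v) vs → L ⊆ vs →
    (∀ {u v} → p u ≡ true → v ∈ L → f u < f v) → filterᵇ p vs ++ L ⊆ vs
  filterᵇ-++-⊆ f p []       []       h = []
  filterᵇ-++-⊆ f p {v ∷ vs} (a ∷ as) (.v ∷ʳ s) h with p v
  ... | true  = refl ∷ filterᵇ-++-⊆ f p as s h
  ... | false = v ∷ʳ filterᵇ-++-⊆ f p as s h
  filterᵇ-++-⊆ f p {v ∷ vs} {v ∷ L} (a ∷ as) (refl ∷ s) h = subst (λ z → z ++ v ∷ L ⊆ v ∷ vs)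
    (sym (filterᵇ-none p λ
      { (here refl) e → <-irrefl refl (h e (here refl))
      ; (there m)   e → <-asym (h e (here refl)) (AllL.lookup a m) }))
    (refl ∷ s)

  toVec : ∀ {n} (l : List A) → length l ≡ n → ∃ λ (v : Vec A n) → toList v ≡ l
  toVec l refl = Vec.fromList l , Vecₚ.toList∘fromList l

  any⁺ : ∀ (p : A → Bool) {x xs} → x ∈ xs → p x ≡ true → any p xs ≡ true
  any⁺ p {x} (here refl) e rewrite e = refl
  any⁺ p {x} {y ∷ xs} (there m) e with p y
  ... | true  = refl
  ... | false = any⁺ p m e

  any⁻ : ∀ (p : A → Bool) xs → any p xs ≡ true → ∃ λ x → x ∈ xs × p x ≡ true
  any⁻ p (x ∷ xs) e with p x in eq
  ... | true  = x , here refl , eq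
  ... | false with any⁻ p xs e
  ...   | y , m , e′ = y , there m , e′

lookup-setOf⁺ : ∀ {n} {xs : List (Fin n)} {v} → v ∈ xs → lookup (setOf xs) v ≡ true
lookup-setOf⁺ {xs = x ∷ xs} (here refl) = Vecₚ.lookup∘update x (setOf xs) true
lookup-setOf⁺ {xs = x ∷ xs} {v} (there m) with v Finₚ.≟ x
... | yes refl = Vecₚ.lookup∘update x (setOf xs) true
... | no v≢x   = trans (Vecₚ.lookup∘update′ v≢x (setOf xs) true) (lookup-setOf⁺ m)

lookup-setOf⁻ : ∀ {n} (xs : List (Fin n)) {v} → lookup (setOf xs) v ≡ true → v ∈ xs
lookup-setOf⁻ []       {v} e with trans (sym e) (Vecₚ.lookup-replicate v false)
... | ()
lookup-setOf⁻ (x ∷ xs) {v} e with v Finₚ.≟ x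
... | yes refl = here refl
... | no v≢x   = there (lookup-setOf⁻ xs (trans (sym (Vecₚ.lookup∘update′ v≢x (setOf xs) true)) e))

toℕ-≡ᵇ⁺ : ∀ {n} {i j : Fin n} → i ≡ j → (Fin.toℕ i ≡ᵇ Fin.toℕ j) ≡ true
toℕ-≡ᵇ⁺ {i = zero}  refl = refl
toℕ-≡ᵇ⁺ {i = suc i} refl = toℕ-≡ᵇ⁺ {i = i} refl

toℕ-≡ᵇ⁻ : ∀ {n} {i j : Fin n} → (Fin.toℕ i ≡ᵇ Fin.toℕ j) ≡ true → i ≡ j
toℕ-≡ᵇ⁻ {i = zero}  {zero}  e = refl
toℕ-≡ᵇ⁻ {i = suc i} {suc j} e = cong suc (toℕ-≡ᵇ⁻ e)

module _ {k n} (φ : Fin k → Fin n) (e : Subset k) where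

  private
    hits : Fin n → Fin k → Bool
    hits v u = lookup e u ∧ (Fin.toℕ (φ u) ≡ᵇ Fin.toℕ v)

  lookup-image⁺ : ∀ {u} → lookup e u ≡ true → lookup (image φ e) (φ u) ≡ true
  lookup-image⁺ {u} p = trans (Vecₚ.lookup∘tabulate (λ v → any (hits v) (allFin k)) (φ u))
    (any⁺ (hits (φ u)) (∈-allFin u) (cong₂ _∧_ p (toℕ-≡ᵇ⁺ {i = φ u} refl)))

  lookup-image⁻ : ∀ {v} → lookup (image φ e) v ≡ true → ∃ λ u → lookup e u ≡ true × φ u ≡ v
  lookup-image⁻ {v} p with any⁻ (hits v) (allFin k) (trans (sym (Vecₚ.lookup∘tabulate (λ v → any (hits v) (allFin k)) v)) p)
  ... | u , _ , h with ∧-true h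
  ... | h₁ , h₂ = u , h₁ , toℕ-≡ᵇ⁻ h₂

  image-setOf : ∀ (c : List (Fin k)) → (∀ {u} → u ∈ c → lookup e u ≡ true) → (∀ {u} → lookup e u ≡ true → u ∈ c) →
    image φ e ≡ setOf (map φ c)
  image-setOf c into onto = subset-ext
    (λ v p → let u , q , eq = lookup-image⁻ p in
      subst (λ z → lookup (setOf (map φ c)) z ≡ true) eq (lookup-setOf⁺ (∈-map⁺ φ (onto q))))
    (λ v p → let u , q , eq = ∈-map⁻ φ (lookup-setOf⁻ (map φ c) p) in
      subst (λ z → lookup (image φ e) z ≡ true) (sym eq) (lookup-image⁺ (into q)))

∣∣≥1 : ∀ {n} {p : Subset n} {u} → lookup p u ≡ true → 1 ≤ ∣ p ∣
∣∣≥1 {p = true  ∷ p} {zero}  e = s≤s z≤n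
∣∣≥1 {p = true  ∷ p} {suc u} e = s≤s z≤n
∣∣≥1 {p = false ∷ p} {suc u} e = ∣∣≥1 {p = p} e

∣∣≥2 : ∀ {n} {p : Subset n} {u v} → lookup p u ≡ true → lookup p v ≡ true → u ≢ v → 2 ≤ ∣ p ∣
∣∣≥2 {p = _     ∷ p} {zero}  {zero}  e e′ u≢v = ⊥-elim (u≢v refl)
∣∣≥2 {p = true  ∷ p} {zero}  {suc v} e e′ u≢v = s≤s (∣∣≥1 {p = p} e′)
∣∣≥2 {p = true  ∷ p} {suc u} {zero}  e e′ u≢v = s≤s (∣∣≥1 {p = p} e)
∣∣≥2 {p = true  ∷ p} {suc u} {suc v} e e′ u≢v = s≤s (∣∣≥1 {p = p} e)
∣∣≥2 {p = false ∷ p} {suc u} {suc v} e e′ u≢v = ∣∣≥2 {p = p} e e′ (u≢v ∘ cong suc)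

lookup-∩ : ∀ {n} (p q : Subset n) v → lookup (p ∩ q) v ≡ lookup p v ∧ lookup q v
lookup-∩ p q v = Vecₚ.lookup-zipWith _∧_ v p q

∣∩∣≤1⇒≡ : ∀ {n} {p q : Subset n} {u v} → ∣ p ∩ q ∣ ≤ 1 →
  lookup p u ≡ true → lookup p v ≡ true → lookup q u ≡ true → lookup q v ≡ true → u ≡ v
∣∩∣≤1⇒≡ {p = p} {q} {u} {v} le pu pv qu qv with u Finₚ.≟ v
... | yes u≡v = u≡v
... | no u≢v  = ⊥-elim (<⇒≱ (∣∣≥2 {p = p ∩ q} (trans (lookup-∩ p q u) (cong₂ _∧_ pu qu)) (trans (lookup-∩ p q v) (cong₂ _∧_ pv qv)) u≢v) le)

-- For the order X < Z < Y the sequence `XZZY` is monotone. Hence the letters of two vertices, if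
-- different, determine their order without any computation of ranks.
letterLevel : Letter → ℕ
letterLevel X = 0
letterLevel Z = 1
letterLevel Y = 2

NonDecreasing : List Letter → Set
NonDecreasing = AllPairs (λ a b → letterLevel a ≤ letterLevel b)

!!-∈ : ∀ {A : Set} (xs : List A) i {a} → xs !! i ≡ just a → a ∈ xs
!!-∈ (x ∷ xs) zero    refl = here refl
!!-∈ (x ∷ xs) (suc i) e    = there (!!-∈ xs i e)

!!-mono : ∀ {xs} → NonDecreasing xs → ∀ {i j a b} → i ≤ j → xs !! i ≡ just a → xs !! j ≡ just b →
  letterLevel a ≤ letterLevel b
!!-mono {x ∷ xs} (p ∷ ps) {zero}  {zero}  i≤j refl refl = ≤-refl
!!-mono {x ∷ xs} (p ∷ ps) {zero}  {suc j} i≤j refl e    = AllL.lookup p (!!-∈ xs j e)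
!!-mono {x ∷ xs} (p ∷ ps) {suc i} {suc j} (s≤s i≤j) e e′ = !!-mono ps i≤j e e′

replicate-nonDecreasing : ∀ n a → NonDecreasing (List.replicate n a)
replicate-nonDecreasing zero    a = []
replicate-nonDecreasing (suc n) a = AllLₚ.replicate⁺ n ≤-refl ∷ replicate-nonDecreasing n a

XZZY-nonDecreasing : ∀ r → NonDecreasing (XZZY r)
XZZY-nonDecreasing r = AllPairsₚ.++⁺ (replicate-nonDecreasing (r ∸ 2) X)
  ((≤-refl ∷ AllLₚ.replicate⁺ (r ∸ 2) (s≤s z≤n)) ∷ AllLₚ.replicate⁺ (r ∸ 2) (s≤s z≤n) ∷ replicate-nonDecreasing (r ∸ 2) Y)
  (AllLₚ.replicate⁺ (r ∸ 2) (AllL.universal (λ _ → z≤n) _))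

<ᵇ-trans-≤ : ∀ a {b c} → b ≤ c → (a <ᵇ b) ≡ true → (a <ᵇ c) ≡ true
<ᵇ-trans-≤ zero    (s≤s le) e = refl
<ᵇ-trans-≤ (suc a) (s≤s le) e = <ᵇ-trans-≤ a le e

module TwinShapes {k s : ℕ} (F : Hypergraph k (3 + s)) (o : LinearOrder k) where

  place : Fin k → ℕ
  place v = Fin.toℕ (proj₁ o v)

  place-injective : ∀ {u v} → place u ≡ place v → u ≡ v
  place-injective e = proj₂ o (Finₚ.toℕ-injective e)

  private
    byPlace = On.decTotalOrder (Finₚ.≤-decTotalOrder k) (proj₁ o)
    module Sort = Data.List.Sort byPlace

  vs : List (Fin k)
  vs = Sort.sort (allFin k)

  vs-↭ : vs ↭ allFin k
  vs-↭ = Sort.sort-↭ (allFin k)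

  ∈-vs : ∀ v → v ∈ vs
  ∈-vs v = Permₚ.∈-resp-↭ (Perm.↭-sym vs-↭) (∈-allFin v)

  vs-unique : Uniqueˡ vs
  vs-unique = uniqueˡ-↭ (Perm.↭-sym vs-↭) (Uniqueₚ.allFin⁺ k)

  vs-sorted : AllPairs (λ u v → place u < place v) vs
  vs-sorted = strict (Linkedₚ.Linked⇒AllPairs ≤-trans (Sort.sort-↗ (allFin k))) vs-unique
    where
    strict : ∀ {xs} → AllPairs (λ u v → place u ≤ place v) xs → Uniqueˡ xs → AllPairs (λ u v → place u < place v) xs
    strict []       []       = []
    strict (a ∷ as) (u ∷ us) = AllL.zipWith (λ (le , ne) → ≤∧≢⇒< le (λ e → ne (place-injective e))) (a , u) ∷ strict as us

  length-filter : ∀ (p : Subset k) → length (filterᵇ (lookup p) vs) ≡ ∣ p ∣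
  length-filter p = trans (Permₚ.↭-length (Permₚ.filter-↭ _ vs-↭)) (card p)
    where
    filterᵇ-map : ∀ {A B : Set} (q : B → Bool) (f : A → B) xs → length (filterᵇ q (map f xs)) ≡ length (filterᵇ (q ∘ f) xs)
    filterᵇ-map q f []       = refl
    filterᵇ-map q f (x ∷ xs) with q (f x)
    ... | true  = cong suc (filterᵇ-map q f xs)
    ... | false = filterᵇ-map q f xs
    card : ∀ {n} (p : Subset n) → length (filterᵇ (lookup p) (allFin n)) ≡ ∣ p ∣
    card []              = refl
    card {suc n} (b ∷ p) with b
    ... | true  = cong suc (trans (cong (length ∘ filterᵇ (lookup (true ∷ p))) (sym (Listₚ.map-tabulate (λ i → i) suc)))
                    (trans (filterᵇ-map (lookup (true ∷ p)) suc (allFin n)) (card p)))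
    ... | false = trans (cong (length ∘ filterᵇ (lookup (false ∷ p))) (sym (Listₚ.map-tabulate (λ i → i) suc)))
                    (trans (filterᵇ-map (lookup (false ∷ p)) suc (allFin n)) (card p))

  rank-mono : ∀ A {u v} → place v ≤ place u → rank o A v ≤ rank o A u
  rank-mono A {u} {v} le = Subsetₚ.p⊆q⇒∣p∣≤∣q∣ {p = below o v ∩ A} {below o u ∩ A} λ {x} x∈ → Vecₚ.lookup⇒[]= x _
    (trans (lookup-∩ (below o u) A x) (step x (trans (sym (lookup-∩ (below o v) A x)) (Vecₚ.[]=⇒lookup x∈))))
    where
    step : ∀ x → lookup (below o v) x ∧ lookup A x ≡ true → lookup (below o u) x ∧ lookup A x ≡ true
    step x e with ∧-true {lookup (below o v) x} e
    ... | e₁ , e₂ = cong₂ _∧_ (trans (Vecₚ.lookup∘tabulate _ x)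
          (<ᵇ-trans-≤ (place x) le (trans (sym (Vecₚ.lookup∘tabulate _ x)) e₁))) e₂

  letterOf≡ : ∀ {e f : Subset k} {v a b} → lookup e v ≡ a → lookup f v ≡ b →
    letterOf e f v ≡ (if a then (if b then just Z else just X) else (if b then just Y else nothing))
  letterOf≡ {e} {f} {v} refl refl with lookup e v | lookup f v
  ... | true  | true  = refl
  ... | true  | false = refl
  ... | false | true  = refl
  ... | false | false = refl

  -- The pair `z₁`, `z₂` is the tail of `e` and the head of `f`: in the order, `xs` precedes it and
  -- `ys` follows it. Both edges are written with the pair in front, so that the rest is a member of
  -- its link.
  record Shape : Set where
    field
      e f    : Subset k
      twins  : TwinPair F e f
      z₁ z₂  : Fin k
      xs ys  : Vec (Fin k) (suc s)
      sorted : toList xs ++ z₁ ∷ z₂ ∷ toList ys ⊆ vs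
      X⊆e    : ∀ {v} → v ∈ z₁ ∷ z₂ ∷ toList xs → lookup e v ≡ true
      e⊆X    : ∀ {v} → lookup e v ≡ true → v ∈ z₁ ∷ z₂ ∷ toList xs
      Y⊆f    : ∀ {v} → v ∈ z₁ ∷ z₂ ∷ toList ys → lookup f v ≡ true
      f⊆Y    : ∀ {v} → lookup f v ≡ true → v ∈ z₁ ∷ z₂ ∷ toList ys
      xs∌f   : ∀ {v} → v ∈ toList xs → lookup f v ≡ false

  shape : ∀ e f → TwinPair F e f → DescribesOrdered o (XZZY (3 + s)) e f → ∃ λ (σ : Shape) → Shape.e σ ≡ e × Shape.f σ ≡ f
  shape e f tp@(e∈F , f∈F , e≢f , two) desc = build (toVec _ lenZ) (toVec _ lenX) (toVec _ lenY)
    where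
    onlyX both′ onlyY : Fin k → Bool
    onlyX v = lookup e v ∧ not (lookup f v)
    both′ v = lookup e v ∧ lookup f v
    onlyY v = lookup f v ∧ not (lookup e v)
    length-cong : ∀ {p q : Fin k → Bool} xs → (∀ v → p v ≡ q v) → length (filterᵇ p xs) ≡ length (filterᵇ q xs)
    length-cong []       h = refl
    length-cong {p} {q} (x ∷ xs) h with p x | q x | h x
    ... | true  | true  | _ = cong suc (length-cong xs h)
    ... | false | false | _ = length-cong xs h
    lenZ : length (filterᵇ both′ vs) ≡ 2
    lenZ = trans (length-cong vs (λ v → sym (lookup-∩ e f v))) (trans (length-filter (e ∩ f)) two)
    remainder : ∀ (a b : Subset k) → ∣ a ∣ ≡ 3 + s → length (filterᵇ (λ v → lookup a v ∧ lookup b v) vs) ≡ 2 →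
      length (filterᵇ (λ v → lookup a v ∧ not (lookup b v)) vs) ≡ suc s
    remainder a b sz l = +-cancelˡ-≡ 2 _ _ (begin
      2 + length (filterᵇ (λ v → lookup a v ∧ not (lookup b v)) vs)
        ≡⟨ cong₂ _+_ (sym l) refl ⟩
      length (filterᵇ (λ v → lookup a v ∧ lookup b v) vs) + length (filterᵇ (λ v → lookup a v ∧ not (lookup b v)) vs)
        ≡⟨ cong₂ (λ x y → length x + length y) (filterᵇ-∧ (lookup b) (lookup a) vs) (filterᵇ-∧ (not ∘ lookup b) (lookup a) vs) ⟨
      length (filterᵇ (lookup b) (filterᵇ (lookup a) vs)) + length (filterᵇ (not ∘ lookup b) (filterᵇ (lookup a) vs))
        ≡⟨ length-filterᵇ-split (lookup b) (filterᵇ (lookup a) vs) ⟨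
      length (filterᵇ (lookup a) vs) ≡⟨ length-filter a ⟩
      ∣ a ∣                          ≡⟨ sz ⟩
      2 + suc s                      ∎)
      where open ≡-Reasoning
    lenX : length (filterᵇ onlyX vs) ≡ suc s
    lenX = remainder e f (uniform F e e∈F) lenZ
    lenY : length (filterᵇ onlyY vs) ≡ suc s
    lenY = remainder f e (uniform F f f∈F) (trans (length-cong vs (λ v → Boolₚ.∧-comm (lookup f v) (lookup e v))) lenZ)
    -- Otherwise the rank of `v` would be at most that of `u`, contrary to the monotonicity of the
    -- sequence.
    before : ∀ {u v a b} → u Subset.∈ (e ∪ f) → v Subset.∈ (e ∪ f) → letterOf e f u ≡ just a → letterOf e f v ≡ just b →
      letterLevel a < letterLevel b → place u < place v
    before {u} {v} u∈ v∈ eu ev lt with place v ≤? place u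
    ... | no ¬le = ≰⇒> ¬le
    ... | yes le = ⊥-elim (<⇒≱ lt (!!-mono (XZZY-nonDecreasing (3 + s)) (rank-mono (e ∪ f) le) (trans (desc v v∈) ev) (trans (desc u u∈) eu)))
    e⊆∪ : ∀ {v} → lookup e v ≡ true → v Subset.∈ (e ∪ f)
    e⊆∪ {v} p = Subsetₚ.p⊆p∪q f (Vecₚ.lookup⇒[]= v e p)
    f⊆∪ : ∀ {v} → lookup f v ≡ true → v Subset.∈ (e ∪ f)
    f⊆∪ {v} p = Subsetₚ.q⊆p∪q e f (Vecₚ.lookup⇒[]= v f p)
    not-true : ∀ {a} → not a ≡ true → a ≡ false
    not-true {false} _ = refl
    isX : ∀ {v} → onlyX v ≡ true → letterOf e f v ≡ just X
    isX {v} p with ∧-true p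
    ... | p₁ , p₂ = letterOf≡ {e} {f} p₁ (not-true p₂)
    isZ : ∀ {v} → both′ v ≡ true → letterOf e f v ≡ just Z
    isZ {v} p with ∧-true p
    ... | p₁ , p₂ = letterOf≡ {e} {f} p₁ p₂
    isY : ∀ {v} → onlyY v ≡ true → letterOf e f v ≡ just Y
    isY {v} p with ∧-true p
    ... | p₁ , p₂ = letterOf≡ {e} {f} (not-true p₂) p₁
    sub : filterᵇ onlyX vs ++ (filterᵇ both′ vs ++ filterᵇ onlyY vs) ⊆ vs
    sub = filterᵇ-++-⊆ place onlyX vs-sorted
      (filterᵇ-++-⊆ place both′ vs-sorted (Sublistₚ.filter-⊆ _ vs) λ {u} {v} p m → let _ , q = ∈-filterᵇ⁻ onlyY vs m in
        before (e⊆∪ (proj₁ (∧-true p))) (f⊆∪ (proj₁ (∧-true q))) (isZ p) (isY q) (s≤s (s≤s z≤n)))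
      λ {u} {v} p m → later p (∈-++⁻ (filterᵇ both′ vs) m)
      where
      later : ∀ {u v} → onlyX u ≡ true → v ∈ filterᵇ both′ vs ⊎ v ∈ filterᵇ onlyY vs → place u < place v
      later p (inj₁ m) = let _ , q = ∈-filterᵇ⁻ both′ vs m in
        before (e⊆∪ (proj₁ (∧-true p))) (e⊆∪ (proj₁ (∧-true q))) (isX p) (isZ q) (s≤s z≤n)
      later p (inj₂ m) = let _ , q = ∈-filterᵇ⁻ onlyY vs m in
        before (e⊆∪ (proj₁ (∧-true p))) (f⊆∪ (proj₁ (∧-true q))) (isX p) (isY q) (s≤s z≤n)
    build : (∃ λ (v : Vec (Fin k) 2) → toList v ≡ filterᵇ both′ vs) →
            (∃ λ (v : Vec (Fin k) (suc s)) → toList v ≡ filterᵇ onlyX vs) →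
            (∃ λ (v : Vec (Fin k) (suc s)) → toList v ≡ filterᵇ onlyY vs) →
            ∃ λ (σ : Shape) → Shape.e σ ≡ e × Shape.f σ ≡ f
    build (a ∷ b ∷ [] , eqZ) (xs , eqX) (ys , eqY) = record
      { e = e ; f = f ; twins = tp ; z₁ = a ; z₂ = b ; xs = xs ; ys = ys
      ; sorted = subst (_⊆ vs) (cong₂ _++_ (sym eqX) (cong₂ _++_ (sym eqZ) (sym eqY))) sub
      ; X⊆e = λ m → onX (∈-++⁻ (a ∷ b ∷ []) m)
      ; e⊆X = λ {v} p → toX v p (lookup f v) refl
      ; Y⊆f = λ m → onY (∈-++⁻ (a ∷ b ∷ []) m)
      ; f⊆Y = λ {v} p → toY v p (lookup e v) refl
      ; xs∌f = λ m → not-true (proj₂ (∧-true (inX m))) } , refl , refl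
      where
      inX : ∀ {v} → v ∈ toList xs → onlyX v ≡ true
      inX m = proj₂ (∈-filterᵇ⁻ onlyX vs (subst (_ ∈_) eqX m))
      inY : ∀ {v} → v ∈ toList ys → onlyY v ≡ true
      inY m = proj₂ (∈-filterᵇ⁻ onlyY vs (subst (_ ∈_) eqY m))
      inZ : ∀ {v} → v ∈ a ∷ b ∷ [] → both′ v ≡ true
      inZ m = proj₂ (∈-filterᵇ⁻ both′ vs (subst (_ ∈_) eqZ m))
      onX : ∀ {v} → v ∈ a ∷ b ∷ [] ⊎ v ∈ toList xs → lookup e v ≡ true
      onX (inj₁ m) = proj₁ (∧-true (inZ m))
      onX (inj₂ m) = proj₁ (∧-true (inX m))
      onY : ∀ {v} → v ∈ a ∷ b ∷ [] ⊎ v ∈ toList ys → lookup f v ≡ true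
      onY {v} (inj₁ m) = proj₂ (∧-true {lookup e v} (inZ m))
      onY (inj₂ m) = proj₁ (∧-true (inY m))
      Z⁺ : ∀ v → both′ v ≡ true → v ∈ a ∷ b ∷ []
      Z⁺ v p = subst (v ∈_) (sym eqZ) (∈-filterᵇ⁺ both′ (∈-vs v) p)
      toX : ∀ v → lookup e v ≡ true → ∀ c → lookup f v ≡ c → v ∈ a ∷ b ∷ toList xs
      toX v p true  q = ∈-++⁺ˡ (Z⁺ v (cong₂ _∧_ p q))
      toX v p false q = ∈-++⁺ʳ (a ∷ b ∷ []) (subst (v ∈_) (sym eqX) (∈-filterᵇ⁺ onlyX (∈-vs v) (cong₂ (λ x y → x ∧ not y) p q)))
      toY : ∀ v → lookup f v ≡ true → ∀ c → lookup e v ≡ c → v ∈ a ∷ b ∷ toList ys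
      toY v p true  q = ∈-++⁺ˡ (Z⁺ v (cong₂ _∧_ q p))
      toY v p false q = ∈-++⁺ʳ (a ∷ b ∷ []) (subst (v ∈_) (sym eqY) (∈-filterᵇ⁺ onlyY (∈-vs v) (cong₂ (λ x y → x ∧ not y) p q)))

  _≟ˢ_ : (p q : Subset k) → Dec (p ≡ q)
  _≟ˢ_ = Vecₚ.≡-dec Boolₚ._≟_

  twin-sym : ∀ {e f} → TwinPair F e f → TwinPair F f e
  twin-sym {e} {f} (p , q , ne , two) = q , p , ne ∘ sym , trans (cong ∣_∣ (Subsetₚ.∩-comm f e)) two

  module _ (ql : QuasiLinear F) where

    twin-unique : ∀ {e f f′} → TwinPair F e f → TwinPair F e f′ → f ≡ f′
    twin-unique {e} {f} {f′} tp tp′ with ql e (proj₁ tp)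
    ... | g , _ , others = trans (is-g tp) (sym (is-g tp′))
      where
      is-g : ∀ {h} → TwinPair F e h → h ≡ g
      is-g {h} (_ , h∈ , e≢h , two) with h ≟ˢ g
      ... | yes h≡g = h≡g
      ... | no h≢g  = ⊥-elim (<⇒≱ (s≤s (s≤s z≤n)) (subst (_≤ 1) two (others h h∈ (e≢h ∘ sym) h≢g)))

    meet≤1 : ∀ {e f g} → TwinPair F e f → IsEdge F g → g ≢ e → g ≢ f → ∣ e ∩ g ∣ ≤ 1
    meet≤1 {e} {f} {g} tp g∈ g≢e g≢f with ql e (proj₁ tp)
    ... | h , tp′ , others = others g g∈ g≢e (λ g≡h → g≢f (trans g≡h (twin-unique tp′ tp)))

    Separate : Shape → Shape → Set
    Separate σ τ = (Shape.e σ ≢ Shape.e τ × Shape.e σ ≢ Shape.f τ) × (Shape.f σ ≢ Shape.e τ × Shape.f σ ≢ Shape.f τ)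

    Covers : Shape → Subset k → Set
    Covers τ g = g ≡ Shape.e τ ⊎ g ≡ Shape.f τ

    -- By uniqueness of twins, two twin pairs with one edge in common consist of the same two edges;
    -- so one edge not covered by `τ` keeps both edges of `σ` away from `τ`.
    new-separate : ∀ (σ τ : Shape) {g} → Covers σ g → ¬ Covers τ g → Separate σ τ
    new-separate σ τ (inj₁ refl) ¬c = ((λ p → ¬c (inj₁ p)) , (λ p → ¬c (inj₂ p))) ,
      (λ { p → ¬c (inj₂ (twin-unique (twin-sym (Shape.twins σ)) (subst (λ z → TwinPair F z (Shape.f τ)) (sym p) (Shape.twins τ)))) }) ,
      (λ { p → ¬c (inj₁ (twin-unique (twin-sym (Shape.twins σ)) (subst (λ z → TwinPair F z (Shape.e τ)) (sym p) (twin-sym (Shape.twins τ))))) })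
    new-separate σ τ (inj₂ refl) ¬c =
      ((λ { p → ¬c (inj₂ (twin-unique (Shape.twins σ) (subst (λ z → TwinPair F z (Shape.f τ)) (sym p) (Shape.twins τ)))) }) ,
      (λ { p → ¬c (inj₁ (twin-unique (Shape.twins σ) (subst (λ z → TwinPair F z (Shape.e τ)) (sym p) (twin-sym (Shape.twins τ))))) })) ,
      ((λ p → ¬c (inj₁ p)) , (λ p → ¬c (inj₂ p)))

    module _ (adm : ∀ e f → TwinPair F e f → Describes o (XZZY (3 + s)) e f) where

      shape-of : ∀ g → IsEdge F g → ∃ λ σ → Covers σ g
      shape-of g g∈ with ql g g∈
      ... | f , tp , _ with adm g f tp
      ...   | inj₁ d = let σ , p , _ = shape g f tp d in σ , inj₁ (sym p)
      ...   | inj₂ d = let σ , _ , p = shape f g (twin-sym tp) d in σ , inj₂ (sym p)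

      covered? : ∀ g (τs : List Shape) → (∃ λ τ → τ ∈ τs × Covers τ g) ⊎ All (λ τ → ¬ Covers τ g) τs
      covered? g []       = inj₂ []
      covered? g (τ ∷ τs) with g ≟ˢ Shape.e τ | g ≟ˢ Shape.f τ | covered? g τs
      ... | yes p | _     | _ = inj₁ (τ , here refl , inj₁ p)
      ... | no _  | yes p | _ = inj₁ (τ , here refl , inj₂ p)
      ... | no p  | no q  | inj₁ (σ , m , c) = inj₁ (σ , there m , c)
      ... | no p  | no q  | inj₂ ps = inj₂ ((λ { (inj₁ e) → p e ; (inj₂ e) → q e }) ∷ ps)

      -- Each twin pair must be listed only once, because a pair is not apart from a copy of itself;
      -- hence the test whether an edge is already covered.
      shapes-of : ∀ (gs : List (Subset k)) → ∃ λ (τs : List Shape) → AllPairs Separate τs ×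
        (∀ {g} → g ∈ gs → IsEdge F g → ∃ λ τ → τ ∈ τs × Covers τ g)
      shapes-of []       = [] , [] , λ ()
      shapes-of (g ∷ gs) with shapes-of gs | edge F g in eq
      ... | τs , ap , cov | false = τs , ap , λ { (here refl) g∈ → ⊥-elim (false≢true (trans (sym eq) g∈)) ; (there m) g∈ → cov m g∈ }
        where
        false≢true : false ≢ true
        false≢true ()
      ... | τs , ap , cov | true with covered? g τs
      ...   | inj₁ c   = τs , ap , λ { (here refl) _ → c ; (there m) g∈ → cov m g∈ }
      ...   | inj₂ ¬cs with shape-of g eq
      ...     | σ , c = σ ∷ τs , AllL.map (λ {τ} ¬c → new-separate σ τ c ¬c) ¬cs ∷ ap ,
                λ { (here refl) _ → σ , here refl , c ; (there m) g∈ → let τ , m′ , c′ = cov m g∈ in τ , there m′ , c′ }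

      ∈-allSubsets : ∀ {n} (g : Subset n) → g ∈ allSubsets n
      ∈-allSubsets []          = here refl
      ∈-allSubsets (true  ∷ g) = ∈-++⁺ˡ (∈-map⁺ (true ∷_) (∈-allSubsets g))
      ∈-allSubsets (false ∷ g) = ∈-++⁺ʳ (map (true ∷_) (allSubsets _)) (∈-map⁺ (false ∷_) (∈-allSubsets g))

      all-shapes : ∃ λ (τs : List Shape) → AllPairs Separate τs × (∀ {g} → IsEdge F g → ∃ λ τ → τ ∈ τs × Covers τ g)
      all-shapes with shapes-of (allSubsets k)
      ... | τs , ap , cov = τs , ap , λ {g} → cov (∈-allSubsets g)

-- The dense case

module _ {A : Set} where

  ⊴⇒⊆ : ∀ {V W : List A} → W ⊴ V → W ⊆ V
  ⊴⇒⊆ {V} (selected u refl) = Sublistₚ.filter-⊆ _ V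

  ≼⇒pointwise-⊆ : ∀ {s κ} {V W : Vec (List A) s} → W ≼[ κ ] V → Pointwise _⊆_ W V
  ≼⇒pointwise-⊆ []             = []
  ≼⇒pointwise-⊆ ((p , _) ∷ ps) = ⊴⇒⊆ p ∷ ≼⇒pointwise-⊆ ps

  chunks : ∀ t → ℕ → List A → Vec (List A) t
  chunks zero    a xs = []
  chunks (suc t) a xs = List.take a xs ∷ chunks t a (List.drop a xs)

  concat-chunks : ∀ t a xs → concat (toList (chunks t a xs)) ⊆ xs
  concat-chunks zero    a xs = minimum xs
  concat-chunks (suc t) a xs = subst (List.take a xs ++ concat (toList (chunks t a (List.drop a xs))) ⊆_)
    (Listₚ.take++drop≡id a xs) (Sublistₚ.++⁺ (⊆-refl {x = List.take a xs}) (concat-chunks t a (List.drop a xs)))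

  length-chunks : ∀ t a xs → t * a ≤ length xs → ∀ i → length (lookup (chunks t a xs) i) ≡ a
  length-chunks (suc t) a xs le zero    = trans (Listₚ.length-take a xs) (m≤n⇒m⊓n≡m (≤-trans (m≤m+n a (t * a)) le))
  length-chunks (suc t) a xs le (suc i) = length-chunks t a (List.drop a xs)
    (≤-trans (≤-reflexive (sym (m+n∸m≡n a (t * a)))) (≤-trans (∸-monoˡ-≤ a le) (≤-reflexive (sym (Listₚ.length-drop a xs))))) i

  concat-mono-⊆ : ∀ {Ls Ms : List (List A)} → Ls ⊆ Ms → concat Ls ⊆ concat Ms
  concat-mono-⊆ []         = []
  concat-mono-⊆ (M ∷ʳ p)   = Sublistₚ.++⁺ˡ M (concat-mono-⊆ p)
  concat-mono-⊆ (refl ∷ p) = Sublistₚ.++⁺ ⊆-refl (concat-mono-⊆ p)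

  ++-disjoint : ∀ xs {ys : List A} → Uniqueˡ (xs ++ ys) → ∀ {x} → x ∈ xs → x ∈ ys → ⊥
  ++-disjoint (x ∷ xs) (u ∷ us) (here refl) q = AllL.lookup u (∈-++⁺ʳ xs q) refl
  ++-disjoint (x ∷ xs) (u ∷ us) (there p)   q = ++-disjoint xs us p q

  lookup⊆concat : ∀ {t} (V : Vec (List A) t) i {x} → x ∈ lookup V i → x ∈ concat (toList V)
  lookup⊆concat (V ∷ Vs) zero    m = ∈-++⁺ˡ m
  lookup⊆concat (V ∷ Vs) (suc i) m = ∈-++⁺ʳ V (lookup⊆concat Vs i m)

  parts-disjoint : ∀ {t} (V : Vec (List A) t) → Uniqueˡ (concat (toList V)) → ∀ i j {x} →
    x ∈ lookup V i → x ∈ lookup V j → i ≡ j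
  parts-disjoint (V ∷ Vs) un zero    zero    p q = refl
  parts-disjoint (V ∷ Vs) un zero    (suc j) p q = ⊥-elim (++-disjoint V un p (lookup⊆concat Vs j q))
  parts-disjoint (V ∷ Vs) un (suc i) zero    p q = ⊥-elim (++-disjoint V un q (lookup⊆concat Vs i p))
  parts-disjoint (V ∷ Vs) un (suc i) (suc j) p q =
    cong suc (parts-disjoint Vs (uniqueˡ-⊆ (Sublistₚ.++⁺ˡ V ⊆-refl) un) i j p q)

assign : ∀ {k} {B : Set} (vs : List (Fin k)) → Uniqueˡ vs → (P : List B) → length vs ≤ length P → (Fin k → B) →
  ∃ λ (p : Fin k → B) → map p vs ⊆ P
assign []       un       P       le d = d , minimum P
assign (v ∷ vs) (u ∷ us) (b ∷ P) (s≤s le) d with assign vs us P le d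
... | p , p⊆ = p′ , subst (_⊆ b ∷ P) (cong₂ _∷_ (sym at-v) (sym off-v)) (refl ∷ p⊆)
  where
  p′ : _ → _
  p′ x with x Finₚ.≟ v
  ... | yes _ = b
  ... | no _  = p x
  at-v : p′ v ≡ b
  at-v with v Finₚ.≟ v
  ... | yes _ = refl
  ... | no ne = ⊥-elim (ne refl)
  off : ∀ xs → All (v ≢_) xs → map p′ xs ≡ map p xs
  off []       []       = refl
  off (x ∷ xs) (q ∷ qs) with x Finₚ.≟ v
  ... | yes refl = ⊥-elim (q refl)
  ... | no _     = cong (p x ∷_) (off xs qs)
  off-v : map p′ vs ≡ map p vs
  off-v = off vs u

roundDown : ∀ L {x v} → x ≤ L * v → ∃ λ b → b ≤ L × b * v ≤ x × x ≤ suc b * v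
roundDown zero    {x} {v} le = 0 , z≤n , z≤n , ≤-trans le z≤n
roundDown (suc L) {x} {v} le with x ≤? L * v
... | yes p = let b , q , r = roundDown L p in b , ≤-trans q (n≤1+n L) , r
... | no ¬p = L , n≤1+n L , <⇒≤ (≰⇒> ¬p) , le

-- Regularity is used for `V`, to bound `num` / `den` from below, and for `U`; each use costs L ·
-- `den` · `vol V`, and the factor 2 L in the precision pays for both. The resulting factor L is
-- weakened to L · L, the constant of the separation, so that all conditions lose the same factor.
dense-regular : ∀ {A : Set} {s M L} .{{_ : NonZero M}} .{{_ : NonZero L}} {g : Vec A s → Bool} {V} → Regular (2 * L * M) g V →
  vol V ≤ L * Sum V (𝟙 ∘ g) → ∀ U → U ⊴ᵛ V → M * vol U ≤ M * (L * L * Sum U (𝟙 ∘ g)) + vol V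
dense-regular {M = M} {L} {g} {V} reg big U p with vol V ≟ 0
... | yes v≡0 = ≤-trans (≤-reflexive (trans (cong (M *_) (n≤0⇒n≡0 (≤-trans (⊴ᵛ-vol p) (≤-reflexive v≡0)))) (*-zeroʳ M))) z≤n
... | no v≢0 = *-cancelˡ-≤ (2 * L * den) (begin
    2 * L * den * (M * vol U)                          ≡⟨ lem₁ L den M (vol U) ⟩
    2 * L * M * den * vol U                            ≤⟨ *-monoˡ-≤ (vol U) density ⟩
    L * (2 * L * M * num + den) * vol U                ≡⟨ lem₂ L (2 * L * M) num den (vol U) ⟩
    L * (2 * L * M * (num * vol U)) + L * (den * vol U) ≤⟨ +-mono-≤ (*-monoʳ-≤ L (lower U p)) (*-monoʳ-≤ L (*-monoʳ-≤ den (⊴ᵛ-vol p))) ⟩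
    L * (2 * L * M * (den * S) + den * vol V) + L * (den * vol V) ≡⟨ lem₃ L M den S (vol V) ⟩
    2 * L * den * (M * (L * S) + vol V)                ≤⟨ *-monoʳ-≤ (2 * L * den) (+-monoˡ-≤ (vol V) (*-monoʳ-≤ M (*-monoˡ-≤ S (m≤m*n L L)))) ⟩
    2 * L * den * (M * (L * L * S) + vol V)            ∎)
  where
  open ≤-Reasoning
  open Regular reg
  S = Sum U (𝟙 ∘ g)
  T = Sum V (𝟙 ∘ g)
  instance
    _ = ≢-nonZero v≢0
    _ = m*n≢0 2 L
    _ = m*n≢0 (2 * L) den
  lem₁ : ∀ l d m u → 2 * l * d * (m * u) ≡ 2 * l * m * d * u
  lem₁ = solve-∀
  lem₂ : ∀ l m n d u → l * (m * n + d) * u ≡ l * (m * (n * u)) + l * (d * u)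
  lem₂ = solve-∀
  lem₃ : ∀ l m d s v → l * (2 * l * m * (d * s) + d * v) + l * (d * v) ≡ 2 * l * d * (m * (l * s) + v)
  lem₃ = solve-∀
  lem₄ : ∀ l m d t → 2 * l * m * d * (l * t) ≡ l * (2 * l * m * (d * t))
  lem₄ = solve-∀
  lem₅ : ∀ l m n d v → l * (m * (n * v) + d * v) ≡ l * (m * n + d) * v
  lem₅ = solve-∀
  density : 2 * L * M * den ≤ L * (2 * L * M * num + den)
  density = *-cancelʳ-≤ _ _ (vol V) (begin
    2 * L * M * den * vol V                        ≤⟨ *-monoʳ-≤ (2 * L * M * den) big ⟩
    2 * L * M * den * (L * T)                      ≡⟨ lem₄ L M den T ⟩
    L * (2 * L * M * (den * T))                    ≤⟨ *-monoʳ-≤ L (upper V (⊴ᵛ-refl V)) ⟩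
    L * (2 * L * M * (num * vol V) + den * vol V)  ≡⟨ lem₅ L (2 * L * M) num den (vol V) ⟩
    L * (2 * L * M * num + den) * vol V            ∎)

module Upper {k s : ℕ} (F : Hypergraph k (3 + s)) (o : LinearOrder k) (ql : QuasiLinear F)
             (adm : ∀ e f → TwinPair F e f → Describes o (XZZY (3 + s)) e f) where

  open TwinShapes F o

  shapes : ∃ λ (τs : List Shape) → AllPairs (Separate ql) τs × (∀ {g} → IsEdge F g → ∃ λ τ → τ ∈ τs × Covers ql τ g)
  shapes = all-shapes ql adm

  -- For each twin pair, one condition on the common pair and one on each of the two edges.
  steps : ℕ
  steps = length (proj₁ shapes) + 2 * length (proj₁ shapes)

  module _ {n t L M M′ : ℕ} .{{_ : NonZero L}} .{{_ : NonZero M}} .{{_ : NonZero M′}}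
           (M≥ : 2 * L * M′ ≤ M) (M′≤M : M′ ≤ M) (M′> : (L * L) ^ steps * steps < M′)
           (H : Hypergraph n (3 + s)) {V : Vec (List (Fin n)) t} where

    private
      D = L * L
      instance
        D≢0 : NonZero D
        D≢0 = m*n≢0 L L

    open Sparse {n} {s} {t} H using (E; E-↭)

    module _ (R : Regularised {s = suc s} D M (link E E-↭) V)
             (nonempty : ∀ i → NonZero (length (lookup V i)))
             (disjoint : ∀ i j {x} → x ∈ lookup V i → x ∈ lookup V j → i ≡ j) where

      open PairDensities R

      module Large {ps : List (Fin t)} (uniqueₚ : Uniqueˡ ps)
               (large : ∀ I j₁ j₂ K → toList I ++ toList (j₁ ∷ j₂ ∷ K) ⊆ ps →
                        vol (headBox (j₁ ∷ j₂ ∷ K)) ≤ L * commonPairs (j₁ ∷ j₂ ∷ I) (j₁ ∷ j₂ ∷ K))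
               (p : Fin k → Fin t) (p⊆ : map p vs ⊆ ps) where

        w : Vec (List (Fin n)) k
        w = Vec.tabulate (lookup V ∘ p)

        lookup-w : ∀ v → lookup w v ≡ lookup V (p v)
        lookup-w = Vecₚ.lookup∘tabulate (lookup V ∘ p)

        nonempty-w : ∀ v → NonZero (length (lookup w v))
        nonempty-w v = subst (NonZero ∘ length) (sym (lookup-w v)) (nonempty (p v))

        open Embedding w using (at)
        open TwinEmbedding w nonempty-w {suc s} M′ D {{D≢0}} E

        at-w : ∀ {q} (c : Vec (Fin k) q) → at c ≡ Vec.map (lookup V) (Vec.map p c)
        at-w []      = refl
        at-w (v ∷ c) = cong₂ _∷_ (lookup-w v) (at-w c)

        unique-map : Uniqueˡ (map p vs)
        unique-map = uniqueˡ-⊆ p⊆ uniqueₚ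

        p-injective : ∀ {u v} → p u ≡ p v → u ≡ v
        p-injective {u} {v} e = go unique-map (∈-vs u) (∈-vs v)
          where
          go : ∀ {xs} → Uniqueˡ (map p xs) → u ∈ xs → v ∈ xs → u ≡ v
          go (_ ∷ _)  (here refl) (here refl) = refl
          go (a ∷ as) (here refl) (there m)   = ⊥-elim (AllL.lookup a (∈-map⁺ p m) e)
          go (a ∷ as) (there m)   (here refl) = ⊥-elim (AllL.lookup a (∈-map⁺ p m) (sym e))
          go (a ∷ as) (there m)   (there m′)  = go as m m′

        module _ (σ : Shape) where
          open Shape σ

          indexX indexY : Vec (Fin t) (2 + suc s)
          indexX = Vec.map p (z₁ ∷ z₂ ∷ xs)
          indexY = Vec.map p (z₁ ∷ z₂ ∷ ys)

          twinsOf : Twins (Fin n) k (suc s)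
          twinsOf = record { z₁ = z₁ ; z₂ = z₂ ; xs = xs ; ys = ys ; Bx = bad indexX ; By = bad indexY }

          sortedP : toList (Vec.map p xs) ++ toList indexY ⊆ ps
          sortedP = ⊆-trans (subst (_⊆ map p vs)
            (trans (Listₚ.map-++ p (toList xs) _) (cong₂ _++_ (sym (toList-map p xs)) (cong (λ z → p z₁ ∷ p z₂ ∷ z) (sym (toList-map p ys)))))
            (Sublistₚ.map⁺ p sorted)) p⊆

          private
            rearrange : ∀ {B : Set} (as : List B) b c ds → as ++ b ∷ c ∷ ds ↭ b ∷ c ∷ as ++ ds
            rearrange as b c ds = ↭-trans (Permₚ.shift b as (c ∷ ds)) (prep b (Permₚ.shift c as ds))

            unique-both : Uniqueˡ (toList xs ++ z₁ ∷ z₂ ∷ toList ys)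
            unique-both = uniqueˡ-⊆ sorted vs-unique

          unique-X : Unique (z₁ ∷ z₂ ∷ xs)
          unique-X = uniqueˡ⇒unique _ (uniqueˡ-⊆ (refl ∷ refl ∷ Sublistₚ.++⁺ʳ (toList ys) ⊆-refl)
            (uniqueˡ-↭ (rearrange (toList xs) z₁ z₂ (toList ys)) unique-both))

          unique-Y : Unique (z₁ ∷ z₂ ∷ ys)
          unique-Y = uniqueˡ⇒unique _ (uniqueˡ-⊆ (Sublistₚ.++⁺ˡ (toList xs) ⊆-refl) unique-both)

          unique-p : ∀ {q} {c : Vec (Fin k) q} → Unique c → Unique (Vec.map p c)
          unique-p {c = []}    []       = []
          unique-p {c = v ∷ c} (u ∷ us) = lift u ∷ unique-p us
            where
            lift : ∀ {q} {d : Vec (Fin k) q} → AllV.All (v ≢_) d → AllV.All (p v ≢_) (Vec.map p d)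
            lift []       = []
            lift (a ∷ as) = (a ∘ p-injective) ∷ lift as

          private
            avoid : ∀ {q} (c : Vec (Fin k) q) {ds : List (Fin k)} (g : Subset k) → (∀ {v} → v ∈ toList c → lookup g v ≡ false) →
              (∀ {v} → v ∈ ds → lookup g v ≡ true) → AllV.All (_∉ ds) c
            avoid []      g f h = []
            avoid (v ∷ c) g f h = (λ m → true≢false (trans (sym (h m)) (f (here refl)))) ∷ avoid c g (λ m → f (there m)) h
              where
              true≢false : true ≢ false
              true≢false ()

            separation-at : ∀ (c : Vec (Fin k) (suc s)) → Unique (z₁ ∷ z₂ ∷ c) →
              Separates D M′ isLink (bad (Vec.map p (z₁ ∷ z₂ ∷ c))) (lookup w z₁) (lookup w z₂) (at c)
            separation-at c un = moved (lookup-w z₁) (lookup-w z₂) (at-w c) (separates-mono M′≤M (separates (Vec.map p (z₁ ∷ z₂ ∷ c)) (unique-p un)))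
              where
              moved : ∀ {B Z₁ Z₂ Z₁′ Z₂′ W W′} → Z₁ ≡ Z₁′ → Z₂ ≡ Z₂′ → W ≡ W′ →
                Separates D M′ isLink B Z₁′ Z₂′ W′ → Separates D M′ isLink B Z₁ Z₂ W
              moved refl refl refl sep = sep

          placed : Placed twinsOf
          placed = record
            { uniqueX = unique-X ; uniqueY = unique-Y
            ; xs∉Y = avoid xs f xs∌f Y⊆f
            ; sepX = separation-at xs unique-X
            ; sepY = separation-at ys unique-Y
            ; dense = subst (λ box → ∀ U → U ⊴ᵛ box → M′ * vol U ≤ M′ * (D * Sum U (𝟙 ∘ pairs (neither (bad indexX) (bad indexY)))) + vol box)
                (sym (at-w (z₁ ∷ z₂ ∷ [])))
                (dense-regular {M = M′} {L} (regular-mono M≥ (regular indexX indexY firstTwo-unique))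
                  -- The parts of `xs` precede and those of `ys` follow the parts of the pair, as
                  -- required of I and K.
                  (large (Vec.map p xs) (p z₁) (p z₂) (Vec.map p ys) sortedP)) }
            where
            firstTwo-unique : Unique (p z₁ ∷ p z₂ ∷ [])
            firstTwo-unique with unique-p unique-X
            ... | (a ∷ _) ∷ _ = (a ∷ []) ∷ [] ∷ []

        meets : ∀ {g h : Subset k} {cs ds} → (∀ {v} → v ∈ cs → lookup g v ≡ true) → (∀ {v} → v ∈ ds → lookup h v ≡ true) →
          ∣ g ∩ h ∣ ≤ 1 → MeetOnce cs ds
        meets {g} {h} f f′ le u∈ v∈ u∈′ v∈′ = ∣∩∣≤1⇒≡ {p = g} {h} le (f u∈) (f v∈) (f′ u∈′) (f′ v∈′)

        apart : ∀ {σ τ} → Separate ql σ τ → Apart (twinsOf σ) (twinsOf τ)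
        apart {σ} {τ} ((ee , ef) , (fe , ff)) = record
          { XX = meets {σ.e} {τ.e} σ.X⊆e τ.X⊆e (meet≤1 ql σ.twins eτ (ee ∘ sym) (fe ∘ sym))
          ; XY = meets {σ.e} {τ.f} σ.X⊆e τ.Y⊆f (meet≤1 ql σ.twins fτ (ef ∘ sym) (ff ∘ sym))
          ; YX = meets {σ.f} {τ.e} σ.Y⊆f τ.X⊆e (meet≤1 ql (twin-sym σ.twins) eτ (fe ∘ sym) (ee ∘ sym))
          ; YY = meets {σ.f} {τ.f} σ.Y⊆f τ.Y⊆f (meet≤1 ql (twin-sym σ.twins) fτ (ff ∘ sym) (ef ∘ sym)) }
          where
          module σ = Shape σ
          module τ = Shape τ
          eτ = proj₁ τ.twins
          fτ = proj₁ (proj₂ τ.twins)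

        private
          τs = proj₁ shapes

        embedded : F ⊑ H
        embedded with embed-twins (map twinsOf τs) (AllLₚ.map⁺ (AllL.universal placed τs))
                        (AllPairsₚ.map⁺ (AllPairs.map (λ {σ} {τ} → apart {σ} {τ}) (proj₁ (proj₂ shapes))))
                        (subst (λ l → D ^ (l + 2 * l) * (l + 2 * l) < M′) (sym (Listₚ.length-map twinsOf τs)) M′>)
        ... | φ , φ∈ , tests = lookup φ , injective , edges
          where
          pointwise : ∀ {q} {φ : Vec (Fin n) q} {w} → Pointwise _∈_ φ w → ∀ v → lookup φ v ∈ lookup w v
          pointwise (m ∷ ms) zero    = m
          pointwise (m ∷ ms) (suc v) = pointwise ms v
          inPart : ∀ v → lookup φ v ∈ lookup V (p v)
          inPart v = subst (lookup φ v ∈_) (lookup-w v) (pointwise φ∈ v)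
          injective : Injective _≡_ _≡_ (lookup φ)
          injective {u} {v} e = p-injective (disjoint (p u) (p v) (inPart u) (subst (_∈ lookup V (p v)) (sym e) (inPart v)))
          realised : ∀ (g : Subset k) z₁ z₂ (c : Vec (Fin k) (suc s)) → (∀ {v} → v ∈ z₁ ∷ z₂ ∷ toList c → lookup g v ≡ true) →
            (∀ {v} → lookup g v ≡ true → v ∈ z₁ ∷ z₂ ∷ toList c) →
            isLink (lookup φ z₁) (lookup φ z₂) (Vec.map (lookup φ) c) ≡ true → IsEdge H (image (lookup φ) g)
          realised g z₁ z₂ c into onto t = trans (cong (edge H) (trans (image-setOf (lookup φ) g (z₁ ∷ z₂ ∷ toList c) into onto)
            (cong (λ xs → setOf (lookup φ z₁ ∷ lookup φ z₂ ∷ xs)) (sym (toList-map (lookup φ) c))))) t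
          edges : ∀ g → IsEdge F g → IsEdge H (image (lookup φ) g)
          edges g g∈ with proj₂ (proj₂ shapes) g∈
          ... | σ , σ∈ , inj₁ refl = realised g _ _ (Shape.xs σ) (Shape.X⊆e σ) (Shape.e⊆X σ) (proj₁ (tests (∈-map⁺ twinsOf σ∈)))
          ... | σ , σ∈ , inj₂ refl = realised g _ _ (Shape.ys σ) (Shape.Y⊆f σ) (Shape.f⊆Y σ) (proj₂ (tests (∈-map⁺ twinsOf σ∈)))

-- The upper bound, with natural numbers

^-* : ∀ n a b → (a * b) ^ n ≡ a ^ n * b ^ n
^-* zero    a b = refl
^-* (suc n) a b = trans (cong (a * b *_) (^-* n a b)) (lem a b (a ^ n) (b ^ n))
  where
  lem : ∀ a b c d → a * b * (c * d) ≡ a * c * (b * d)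
  lem = solve-∀

-- With `m` parts the sets with two vertices in one part become negligible; the `suc s` further
-- parts are the links of the last pairs. `t₂` parts contain m + suc s parts of constant level, and
-- `t` parts contain k + t₂ parts of one colour, enough for embedding F as well as for the sparse
-- case.
module UpperBound {k s : ℕ} (F : Hypergraph k (3 + s)) (o : LinearOrder k) (ql : QuasiLinear F)
             (adm : ∀ e f → TwinPair F e f → Describes o (XZZY (3 + s)) e f)
             {L M M′ c m t₂ t : ℕ} .{{_ : NonZero L}} .{{_ : NonZero M}} .{{_ : NonZero M′}} .{{_ : NonZero t}}
             (M≥ : 2 * L * M′ ≤ M) (M′≤M : M′ ≤ M) (M′> : (L * L) ^ Upper.steps F o ql adm * Upper.steps F o ql adm < M′)
             (M≥2L² : 2 * (L * L) ≤ M) (c≡ : c ≡ L * ((2 + s) * (3 + s) ^ (2 + s))) (m≡ : m ≡ (3 + s) * c)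
             (t₂≥ : ramseyBound (2 + suc s) L (m + suc s) ≤ t₂)
             (t≥ : ramseyBound (suc s + (2 + suc s)) 1 (k + t₂) ≤ t) where

  open TwinShapes F o
  open Upper F o ql adm

  private
    r = 3 + s
    D = L * L

  c≢0 : NonZero c
  c≢0 = subst NonZero (sym c≡) (m*n≢0 L _ {{it}} {{m*n≢0 (2 + s) (r ^ (2 + s)) {{it}} {{m^n≢0 r (2 + s)}}}})

  m≢0 : NonZero m
  m≢0 = subst NonZero (sym m≡) (m*n≢0 r c {{_}} {{c≢0}})

  module _ {n : ℕ} (H : Hypergraph n r) {V : Vec (List (Fin n)) t} where

    open Sparse {n} {s} {t} H using (E; E-↭; sparse-set)

    module Ramseyed (R : Regularised {s = suc s} D M (link E E-↭) V) where

      open PairDensities R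

      -- Colour 0 stands for few common pairs, colour 1 for many.
      isLarge : Vec (Fin t) (suc s) → Vec (Fin t) (2 + suc s) → Fin 2
      isLarge I (j₁ ∷ j₂ ∷ K) with L * commonPairs (j₁ ∷ j₂ ∷ I) (j₁ ∷ j₂ ∷ K) ≤? vol (headBox (j₁ ∷ j₂ ∷ K))
      ... | yes _ = zero
      ... | no _  = suc zero

      colour₁ : Vec (Fin t) (suc s + (2 + suc s)) → Fin 2
      colour₁ v = isLarge (Vec.take (suc s) v) (Vec.drop (suc s) v)

      colour₁-++ : ∀ (I : Vec (Fin t) (suc s)) q → colour₁ (I Vec.++ q) ≡ isLarge I q
      colour₁-++ I q with Vecₚ.++-injective (Vec.take (suc s) (I Vec.++ q)) I (Vecₚ.take++drop≡id (suc s) (I Vec.++ q))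
      ... | eq₁ , eq₂ = cong₂ isLarge eq₁ eq₂

      level : ∀ p → ∃ λ b → b ≤ L × b * vol (headBox p) ≤ L * goodPairs p × L * goodPairs p ≤ suc b * vol (headBox p)
      level p = roundDown L (*-monoʳ-≤ L (Sum-≤vol (headBox p) (λ v → 𝟙≤1 (pairs (good p) v))))

      colour₂ : Vec (Fin t) (2 + suc s) → Fin (suc L)
      colour₂ p = Fin.fromℕ< (s≤s (proj₁ (proj₂ (level p))))

      colour₂≡ : ∀ p → Fin.toℕ (colour₂ p) ≡ proj₁ (level p)
      colour₂≡ p = Finₚ.toℕ-fromℕ< _

      module _ {ps : List (Fin t)} {κ : Fin 2} (hom : Homogeneous colour₁ κ ps) where

        at-colour : ∀ I q → toList I ++ toList q ⊆ ps → isLarge I q ≡ κ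
        at-colour I q sub = trans (sym (colour₁-++ I q)) (hom (I Vec.++ q) (subst (_⊆ ps) (sym (Vecₚ.toList-++ I q)) sub))

        all-large : κ ≡ suc zero → ∀ I j₁ j₂ K → toList I ++ toList (j₁ ∷ j₂ ∷ K) ⊆ ps →
          vol (headBox (j₁ ∷ j₂ ∷ K)) ≤ L * commonPairs (j₁ ∷ j₂ ∷ I) (j₁ ∷ j₂ ∷ K)
        all-large refl I j₁ j₂ K sub with at-colour I (j₁ ∷ j₂ ∷ K) sub
        ... | eq with L * commonPairs (j₁ ∷ j₂ ∷ I) (j₁ ∷ j₂ ∷ K) ≤? vol (headBox (j₁ ∷ j₂ ∷ K))
        ...   | no ¬le = <⇒≤ (≰⇒> ¬le)

        all-small : κ ≡ zero → ∀ I j₁ j₂ K → toList I ++ toList (j₁ ∷ j₂ ∷ K) ⊆ ps →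
          L * commonPairs (j₁ ∷ j₂ ∷ I) (j₁ ∷ j₂ ∷ K) ≤ vol (headBox (j₁ ∷ j₂ ∷ K))
        all-small refl I j₁ j₂ K sub with at-colour I (j₁ ∷ j₂ ∷ K) sub
        ... | eq with L * commonPairs (j₁ ∷ j₂ ∷ I) (j₁ ∷ j₂ ∷ K) ≤? vol (headBox (j₁ ∷ j₂ ∷ K))
        ...   | yes le = le

      sparse : ∀ {ps} → Uniqueˡ ps → t₂ ≤ length ps →
        (∀ I j₁ j₂ K → toList I ++ toList (j₁ ∷ j₂ ∷ K) ⊆ ps →
          L * commonPairs (j₁ ∷ j₂ ∷ I) (j₁ ∷ j₂ ∷ K) ≤ vol (headBox (j₁ ∷ j₂ ∷ K))) →
        (∀ {m} (P : Vec (Fin t) m) → toList P ⊆ ps → concat (toList (Vec.map (lookup V) P)) ⊆ allFin n) →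
        ∀ q .{{_ : NonZero q}} → (∀ i → q ≤ length (lookup V i)) →
        ∃ λ S → ∣ S ∣ ≡ m * q ×
          4 * L * edgesIn H S ≤ (L + 28) * ((m C r) * q ^ r) + 4 * L * ((2 + s) * (q * (m * q) ^ (2 + s)))
      sparse {ps} un le small fits q q≤ with ramsey (2 + suc s) L (m + suc s) colour₂ ps (≤-trans t₂≥ le)
      ... | zs , zs⊆ , long , b , hom = build (toVec _ len₁) (toVec _ len₂)
        where
        len₁ : length (List.take m zs) ≡ m
        len₁ = trans (Listₚ.length-take m zs) (m≤n⇒m⊓n≡m (≤-trans (m≤m+n m (suc s)) long))
        rest = List.drop m zs
        len₂ : length (List.take (suc s) rest) ≡ suc s
        len₂ = trans (Listₚ.length-take (suc s) rest) (m≤n⇒m⊓n≡m (≤-trans (≤-reflexive (sym (m+n∸m≡n m (suc s))))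
          (≤-trans (∸-monoˡ-≤ m long) (≤-reflexive (sym (Listₚ.length-drop m zs))))))
        inside : List.take m zs ++ List.take (suc s) rest ⊆ zs
        inside = subst (List.take m zs ++ List.take (suc s) rest ⊆_) (Listₚ.take++drop≡id m zs)
          (Sublistₚ.++⁺ (⊆-refl {x = List.take m zs}) (Sublistₚ.take-⊆ (suc s) rest))
        build : (∃ λ (P : Vec (Fin t) m) → toList P ≡ List.take m zs) →
                (∃ λ (end : Vec (Fin t) (suc s)) → toList end ≡ List.take (suc s) rest) → _
        build (P , eqP) (end , eqEnd) = sparse-set {L = L} {M} M≥2L² R P end un′
          (λ I j₁ j₂ K sub → small I j₁ j₂ K (⊆-trans sub sub-ps))
          {b = Fin.toℕ b} {L ∸ Fin.toℕ b} (m+[n∸m]≡n (≤-pred (Finₚ.toℕ<n b)))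
          (λ p sub → subst (λ x → x * vol (headBox p) ≤ L * goodPairs p) (level≡ p sub) (proj₁ (proj₂ (proj₂ (level p)))))
          (λ p sub → subst (λ x → L * goodPairs p ≤ suc x * vol (headBox p)) (level≡ p sub) (proj₂ (proj₂ (proj₂ (level p)))))
          q q≤ (fits P (⊆-trans (Sublistₚ.++⁺ʳ (toList end) ⊆-refl) sub-ps))
          where
          sub-zs : toList P ++ toList end ⊆ zs
          sub-zs = subst (_⊆ zs) (sym (cong₂ _++_ eqP eqEnd)) inside
          sub-ps : toList P ++ toList end ⊆ ps
          sub-ps = ⊆-trans sub-zs zs⊆
          un′ : Uniqueˡ (toList P ++ toList end)
          un′ = uniqueˡ-⊆ sub-ps un
          level≡ : ∀ p → toList p ⊆ toList P ++ toList end → proj₁ (level p) ≡ Fin.toℕ b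
          level≡ p sub = trans (sym (colour₂≡ p)) (cong Fin.toℕ (hom p (⊆-trans sub sub-zs)))

  -- The coefficients L + 36 and L + 28 differ by 8, while the sets with two vertices in one part
  -- contribute 4 L (r-1) m^(r-1) q^r. For m = r c and c = L (r-1) r^(r-1) this is 4 c^r q^r, and
  -- `m C r` is at least c^r.
  too-sparse : ∀ {n} (H : Hypergraph n r) q .{{_ : NonZero q}} {S} → ∣ S ∣ ≡ m * q →
    4 * L * edgesIn H S ≤ (L + 28) * ((m C r) * q ^ r) + 4 * L * ((2 + s) * (q * (m * q) ^ (2 + s))) →
    (L + 36) * (∣ S ∣ C r) ≤ 4 * L * edgesIn H S → ⊥
  too-sparse H q {S} size upper lower = <⇒≱ excess (*-cancelʳ-≤ _ _ (q ^ r) {{m^n≢0 q r}} combined)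
    where
    open ≤-Reasoning
    instance _ = c≢0
    p = 2 + s
    A = (m C r) * q ^ r
    err = 4 * L * (p * (q * (m * q) ^ p))
    combined : 8 * (m C r) * q ^ r ≤ 4 * L * (p * m ^ p) * q ^ r
    combined = +-cancelˡ-≤ ((L + 28) * A) _ _ (begin
      (L + 28) * A + 8 * (m C r) * q ^ r        ≡⟨ lem₁ L (m C r) (q ^ r) ⟩
      (L + 36) * A                              ≤⟨ *-monoʳ-≤ (L + 36) (C-* m q r) ⟩
      (L + 36) * ((m * q) C r)                  ≡⟨ cong (λ z → (L + 36) * (z C r)) size ⟨
      (L + 36) * (∣ S ∣ C r)                    ≤⟨ lower ⟩
      4 * L * edgesIn H S                       ≤⟨ upper ⟩
      (L + 28) * A + err                        ≡⟨ cong (λ z → (L + 28) * A + 4 * L * (p * (q * z))) (^-* p m q) ⟩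
      (L + 28) * A + 4 * L * (p * (q * (m ^ p * q ^ p))) ≡⟨ cong (λ z → (L + 28) * A + z) (lem₂ L p q (m ^ p) (q ^ p)) ⟩
      (L + 28) * A + 4 * L * (p * m ^ p) * q ^ r ∎)
      where
      lem₁ : ∀ l c q → (l + 28) * (c * q) + 8 * c * q ≡ (l + 36) * (c * q)
      lem₁ = solve-∀
      lem₂ : ∀ l p q a b → 4 * l * (p * (q * (a * b))) ≡ 4 * l * (p * a) * (q * b)
      lem₂ = solve-∀
    excess : 4 * L * (p * m ^ p) < 8 * (m C r)
    excess = begin-strict
      4 * L * (p * m ^ p)                  ≡⟨ cong (λ z → 4 * L * (p * z)) (trans (cong (_^ p) m≡) (^-* p r c)) ⟩
      4 * L * (p * (r ^ p * c ^ p))        ≡⟨ lem₃ L p (r ^ p) (c ^ p) ⟩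
      4 * (L * (p * r ^ p) * c ^ p)        ≡⟨ cong (λ z → 4 * (z * c ^ p)) c≡ ⟨
      4 * (c * c ^ p)                      <⟨ *-monoˡ-< (c ^ r) {{m^n≢0 c r}} {4} {8} (s≤s (s≤s (s≤s (s≤s (s≤s z≤n))))) ⟩
      8 * c ^ r                            ≤⟨ *-monoʳ-≤ 8 (≤-trans (^≤C r c) (≤-reflexive (cong (_C r) (sym m≡)))) ⟩
      8 * (m C r)                          ∎
      where
      lem₃ : ∀ l p a b → 4 * l * (p * (a * b)) ≡ 4 * (l * (p * a) * b)
      lem₃ = solve-∀

  not-free : ∀ K .{{_ : NonZero K}} →
    (∀ n (E : Fin n → Fin n → Vec (Fin n) (suc s) → Bool) (V : Vec (List (Fin n)) t) →
      ¬ ¬ (∃ λ V′ → V′ ≼[ K ] V × Regularised D M E V′)) →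
    ∀ {n} (H : Hypergraph n r) → t * K ≤ n →
    (∀ S → n ≤ 2 * K * t * ∣ S ∣ → (L + 36) * (∣ S ∣ C r) ≤ 4 * L * edgesIn H S) → ¬ ¬ (F ⊑ H)
  not-free K reach {n} H n≥ dense free = reach n (link E E-↭) V₀ λ (V , V≼ , R) → finish V V≼ R
    where
    open Sparse {n} {s} {t} H using (E; E-↭)
    open ≤-Reasoning
    a = n ℕDiv./ t
    V₀ = chunks t a (allFin n)
    ta≤n : t * a ≤ n
    ta≤n = ≤-trans (≤-reflexive (*-comm t a)) (ℕDiv.m/n*n≤m n t)
    a≥K : K ≤ a
    a≥K = ≤-trans (≤-reflexive (sym (ℕDiv.m*n/n≡m K t))) (ℕDiv./-mono-≤ {o = t} {t} (≤-trans (≤-reflexive (*-comm K t)) n≥) ≤-refl)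
    q = a ℕDiv./ K
    instance
      q≢0 : NonZero q
      q≢0 = >-nonZero (ℕDiv.m≥n⇒m/n>0 a≥K)
    length₀ : ∀ i → length (lookup V₀ i) ≡ a
    length₀ = length-chunks t a (allFin n) (≤-trans ta≤n (≤-reflexive (sym (Listₚ.length-tabulate {n = n} (λ i → i)))))
    -- Rounding down twice, to a = n/t and to q = a/K, loses at most a factor 2 because q ≥ 1.
    size : n ≤ 2 * K * t * (m * q)
    size = begin
      n                        ≡⟨ ℕDiv.m≡m%n+[m/n]*n n t ⟩
      n ℕDiv.% t + a * t            ≤⟨ +-monoˡ-≤ (a * t) (<⇒≤ (ℕDiv.m%n<n n t)) ⟩
      t + a * t                ≡⟨⟩
      suc a * t                ≤⟨ *-monoˡ-≤ t (begin
        suc a                    ≡⟨ cong suc (ℕDiv.m≡m%n+[m/n]*n a K) ⟩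
        suc (a ℕDiv.% K + q * K)      ≤⟨ +-monoˡ-≤ (q * K) (ℕDiv.m%n<n a K) ⟩
        K + q * K                ≤⟨ +-monoˡ-≤ (q * K) (m≤n*m K q) ⟩
        q * K + q * K            ∎) ⟩
      (q * K + q * K) * t      ≡⟨ lem q K t ⟩
      2 * K * t * q            ≤⟨ *-monoʳ-≤ (2 * K * t) (m≤n*m q m {{m≢0}}) ⟩
      2 * K * t * (m * q)      ∎
      where
      lem : ∀ q k t → (q * k + q * k) * t ≡ 2 * k * t * q
      lem = solve-∀
    finish : ∀ V → V ≼[ K ] V₀ → Regularised {s = suc s} D M (link E E-↭) V → ⊥
    finish V V≼ R = decide (ramsey (suc s + (2 + suc s)) 1 (k + t₂) colour₁ (allFin t)
        (≤-trans t≥ (≤-reflexive (sym (Listₚ.length-tabulate {n = t} (λ i → i))))))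
      where
      open Ramseyed H R
      q≤ : ∀ i → q ≤ length (lookup V i)
      q≤ i = *-cancelʳ-≤ q _ K (begin
        q * K                      ≤⟨ ℕDiv.m/n*n≤m a K ⟩
        a                          ≡⟨ length₀ i ⟨
        length (lookup V₀ i)       ≤⟨ proj₂ (≼-lookup V≼ i) ⟩
        K * length (lookup V i)    ≡⟨ *-comm K _ ⟩
        length (lookup V i) * K    ∎)
      V⊆ : concat (toList V) ⊆ allFin n
      V⊆ = ⊆-trans (concat-⊆ (≼⇒pointwise-⊆ V≼)) (concat-chunks t a (allFin n))
      fits : ∀ {ps : List (Fin t)} → ps ⊆ allFin t → concat (map (lookup V) ps) ⊆ allFin n
      fits sub = ⊆-trans (concat-mono-⊆ (Sublistₚ.map⁺ (lookup V) sub)) (subst (λ Ls → concat Ls ⊆ allFin n) (sym (entries V)) V⊆)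
        where
        entries : ∀ {t} (V : Vec (List (Fin n)) t) → map (lookup V) (allFin t) ≡ toList V
        entries []      = refl
        entries (W ∷ V) = cong (W ∷_) (trans (Listₚ.map-tabulate suc (lookup (W ∷ V))) (trans (sym (Listₚ.map-tabulate (λ i → i) (lookup V))) (entries V)))
      any-part : Fin t
      any-part = Fin.fromℕ< (>-nonZero⁻¹ t)
      decide : (∃ λ ps → ps ⊆ allFin t × k + t₂ ≤ length ps × ∃ λ κ → Homogeneous colour₁ κ ps) → ⊥
      uniqueₚ : ∀ {ps : List (Fin t)} → ps ⊆ allFin t → Uniqueˡ ps
      uniqueₚ ps⊆ = uniqueˡ-⊆ ps⊆ (Uniqueₚ.allFin⁺ t)
      decide (ps , ps⊆ , long , suc zero , hom) = embed (assign vs vs-unique ps fitting (λ _ → any-part))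
        where
        fitting : length vs ≤ length ps
        fitting = ≤-trans (≤-reflexive (trans (Permₚ.↭-length vs-↭) (Listₚ.length-tabulate {n = k} (λ i → i)))) (≤-trans (m≤m+n k t₂) long)
        nonempty : ∀ i → NonZero (length (lookup V i))
        nonempty i = >-nonZero (<-≤-trans (>-nonZero⁻¹ q) (q≤ i))
        disjoint : ∀ i j {x} → x ∈ lookup V i → x ∈ lookup V j → i ≡ j
        disjoint = parts-disjoint V (uniqueˡ-⊆ V⊆ (Uniqueₚ.allFin⁺ n))
        embed : (∃ λ p → map p vs ⊆ ps) → ⊥
        embed (p , p⊆) = free (Large.embedded M≥ M′≤M M′> H R nonempty disjoint (uniqueₚ ps⊆) (all-large hom refl) p p⊆)
      decide (ps , ps⊆ , long , zero , hom) = contradict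
        (sparse (uniqueₚ ps⊆) (≤-trans (m≤n+m t₂ k) long) (all-small hom refl) fitsᵛ q q≤)
        where
        fitsᵛ : ∀ {m} (P : Vec (Fin t) m) → toList P ⊆ ps → concat (toList (Vec.map (lookup V) P)) ⊆ allFin n
        fitsᵛ P P⊆ = subst (λ Ls → concat Ls ⊆ allFin n) (sym (toList-map (lookup V) P)) (fits (⊆-trans P⊆ ps⊆))
        contradict : (∃ λ S → ∣ S ∣ ≡ m * q ×
          4 * L * edgesIn H S ≤ (L + 28) * ((m C r) * q ^ r) + 4 * L * ((2 + s) * (q * (m * q) ^ (2 + s)))) → ⊥
        contradict (S , sizeS , upper) = too-sparse H q {S} sizeS upper
          (dense S (≤-trans size (*-monoʳ-≤ (2 * K * t) (≤-reflexive (sym sizeS)))))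

-- The upper bound

ℕ→ℚᵘ : ∀ m → toℚᵘ (ℕ→ℚ m) ℚᵘ.≃ ℚᵘ.mkℚᵘ (+ m) 0
ℕ→ℚᵘ m = ℚₚ.toℚᵘ-fromℚᵘ (ℚᵘ.mkℚᵘ (+ m) 0)

ℕ→ℚ-+ : ∀ a b → ℕ→ℚ (a + b) ≡ ℕ→ℚ a ℚ.+ ℕ→ℚ b
ℕ→ℚ-+ a b = ℚₚ.toℚᵘ-injective (begin
  toℚᵘ (ℕ→ℚ (a + b))                             ≈⟨ ℕ→ℚᵘ (a + b) ⟩
  ℚᵘ.mkℚᵘ (+ (a + b)) 0                          ≈⟨ ℚᵘ.*≡* (cong (ℤ._* + 1) (cong₂ ℤ._+_ (sym (ℤₚ.*-identityʳ (+ a))) (sym (ℤₚ.*-identityʳ (+ b))))) ⟩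
  ℚᵘ.mkℚᵘ (+ a) 0 ℚᵘ.+ ℚᵘ.mkℚᵘ (+ b) 0           ≈⟨ ℚᵘₚ.+-cong (ℕ→ℚᵘ a) (ℕ→ℚᵘ b) ⟨
  toℚᵘ (ℕ→ℚ a) ℚᵘ.+ toℚᵘ (ℕ→ℚ b)                 ≈⟨ ℚₚ.toℚᵘ-homo-+ (ℕ→ℚ a) (ℕ→ℚ b) ⟨
  toℚᵘ (ℕ→ℚ a ℚ.+ ℕ→ℚ b)                         ∎)
  where open ℚᵘₚ.≃-Reasoning

ℕ→ℚ-* : ∀ a b → ℕ→ℚ (a * b) ≡ ℕ→ℚ a ℚ.* ℕ→ℚ b
ℕ→ℚ-* a b = ℚₚ.toℚᵘ-injective (begin
  toℚᵘ (ℕ→ℚ (a * b))                             ≈⟨ ℕ→ℚᵘ (a * b) ⟩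
  ℚᵘ.mkℚᵘ (+ (a * b)) 0                          ≈⟨ ℚᵘ.*≡* (cong (ℤ._* + 1) (ℤₚ.pos-* a b)) ⟩
  ℚᵘ.mkℚᵘ (+ a) 0 ℚᵘ.* ℚᵘ.mkℚᵘ (+ b) 0           ≈⟨ ℚᵘₚ.*-cong (ℕ→ℚᵘ a) (ℕ→ℚᵘ b) ⟨
  toℚᵘ (ℕ→ℚ a) ℚᵘ.* toℚᵘ (ℕ→ℚ b)                 ≈⟨ ℚₚ.toℚᵘ-homo-* (ℕ→ℚ a) (ℕ→ℚ b) ⟨
  toℚᵘ (ℕ→ℚ a ℚ.* ℕ→ℚ b)                         ∎)
  where open ℚᵘₚ.≃-Reasoning

ℕ→ℚ-mono : ∀ {a b} → a ≤ b → ℕ→ℚ a ≤ℚ ℕ→ℚ b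
ℕ→ℚ-mono {a} {b} a≤b = ℚₚ.toℚᵘ-cancel-≤ (begin
  toℚᵘ (ℕ→ℚ a)      ≃⟨ ℕ→ℚᵘ a ⟩
  ℚᵘ.mkℚᵘ (+ a) 0   ≤⟨ ℚᵘ.*≤* (ℤₚ.*-monoʳ-≤-nonNeg (+ 1) (ℤ.+≤+ a≤b)) ⟩
  ℚᵘ.mkℚᵘ (+ b) 0   ≃⟨ ℕ→ℚᵘ b ⟨
  toℚᵘ (ℕ→ℚ b)      ∎)
  where open ℚᵘₚ.≤-Reasoning

ℕ→ℚ-cancel : ∀ {a b} → ℕ→ℚ a ≤ℚ ℕ→ℚ b → a ≤ b
ℕ→ℚ-cancel {a} {b} h with below-ᵘ
  where
  open ℚᵘₚ.≤-Reasoning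
  below-ᵘ : ℚᵘ.mkℚᵘ (+ a) 0 ℚᵘ.≤ ℚᵘ.mkℚᵘ (+ b) 0
  below-ᵘ = begin
    ℚᵘ.mkℚᵘ (+ a) 0   ≃⟨ ℕ→ℚᵘ a ⟨
    toℚᵘ (ℕ→ℚ a)      ≤⟨ ℚₚ.toℚᵘ-mono-≤ h ⟩
    toℚᵘ (ℕ→ℚ b)      ≃⟨ ℕ→ℚᵘ b ⟩
    ℚᵘ.mkℚᵘ (+ b) 0   ∎
... | ℚᵘ.*≤* le = ℤₚ.drop‿+≤+ (ℤₚ.*-cancelʳ-≤-pos (+ a) (+ b) (+ 1) le)

ℕ→ℚ-nonNeg : ∀ m → ℚ.NonNegative (ℕ→ℚ m)
ℕ→ℚ-nonNeg m = ℚ.nonNegative (ℕ→ℚ-mono {0} {m} z≤n)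

ℕ→ℚ-*-monoˡ : ∀ m {p q} → p ≤ℚ q → ℕ→ℚ m ℚ.* p ≤ℚ ℕ→ℚ m ℚ.* q
ℕ→ℚ-*-monoˡ m = ℚₚ.*-monoˡ-≤-nonNeg (ℕ→ℚ m) {{ℕ→ℚ-nonNeg m}}

ℕ→ℚ-*-monoʳ : ∀ m {p q} → p ≤ℚ q → p ℚ.* ℕ→ℚ m ≤ℚ q ℚ.* ℕ→ℚ m
ℕ→ℚ-*-monoʳ m = ℚₚ.*-monoʳ-≤-nonNeg (ℕ→ℚ m) {{ℕ→ℚ-nonNeg m}}

reciprocal : ∀ q .{{_ : NonZero q}} → (+ 1 / q) ℚ.* ℕ→ℚ q ≡ 1ℚ
reciprocal (suc q) = ℚₚ.toℚᵘ-injective (begin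
  toℚᵘ ((+ 1 / suc q) ℚ.* ℕ→ℚ (suc q))              ≈⟨ ℚₚ.toℚᵘ-homo-* (+ 1 / suc q) (ℕ→ℚ (suc q)) ⟩
  toℚᵘ (+ 1 / suc q) ℚᵘ.* toℚᵘ (ℕ→ℚ (suc q))        ≈⟨ ℚᵘₚ.*-cong (ℚₚ.toℚᵘ-fromℚᵘ (ℚᵘ.mkℚᵘ (+ 1) q)) (ℕ→ℚᵘ (suc q)) ⟩
  ℚᵘ.mkℚᵘ (+ 1) q ℚᵘ.* ℚᵘ.mkℚᵘ (+ suc q) 0           ≈⟨ ℚᵘ.*≡* (cong +_ (lem q)) ⟩
  ℚᵘ.mkℚᵘ (+ 1) 0                                    ∎)
  where
  open ℚᵘₚ.≃-Reasoning
  lem : ∀ q → (suc q + 0) * 1 ≡ suc (q * 1) + 0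
  lem = solve-∀

reciprocal-positive : ∀ q .{{_ : NonZero q}} → 0ℚ <ℚ + 1 / q
reciprocal-positive (suc q) = ℚₚ.toℚᵘ-cancel-< (ℚᵘₚ.<-respʳ-≃ (ℚᵘₚ.≃-sym (ℚₚ.toℚᵘ-fromℚᵘ (ℚᵘ.mkℚᵘ (+ 1) q)))
  (ℚᵘ.*<* (ℤ.+<+ (s≤s z≤n))))

-- A positive fraction has numerator at least 1, so its denominator is a witness.
archimedean : ∀ {δ} → 0ℚ <ℚ δ → ∃ λ q → NonZero q × 1ℚ ≤ℚ δ ℚ.* ℕ→ℚ q
archimedean {mkℚ (+ zero) d _}      (ℚ.*<* (ℤ.+<+ ()))
archimedean {δ@(mkℚ (+ suc p) d c)} pos = suc d , _ , ℚₚ.toℚᵘ-cancel-≤ (begin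
  ℚᵘ.mkℚᵘ (+ 1) 0                                     ≤⟨ ℚᵘ.*≤* (ℤ.+≤+ (≤-trans (≤-reflexive (lem₁ d)) (≤-trans (m≤m+n _ (p * suc d)) (≤-reflexive (lem₂ p d))))) ⟩
  ℚᵘ.mkℚᵘ (+ suc p) d ℚᵘ.* ℚᵘ.mkℚᵘ (+ suc d) 0        ≃⟨ ℚᵘₚ.*-cong (ℚᵘₚ.≃-refl {toℚᵘ δ}) (ℕ→ℚᵘ (suc d)) ⟨
  toℚᵘ δ ℚᵘ.* toℚᵘ (ℕ→ℚ (suc d))                      ≃⟨ ℚₚ.toℚᵘ-homo-* δ (ℕ→ℚ (suc d)) ⟨
  toℚᵘ (δ ℚ.* ℕ→ℚ (suc d))                            ∎)
  where
  open ℚᵘₚ.≤-Reasoning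
  lem₁ : ∀ d → suc (d * 1) + 0 ≡ suc d
  lem₁ = solve-∀
  lem₂ : ∀ p d → suc d + p * suc d ≡ suc p * suc d * 1
  lem₂ = solve-∀

p≤∣p∣ : ∀ p → p ≤ℚ ∣ p ∣ℚ
p≤∣p∣ (mkℚ (+ _)      _ _) = ℚₚ.≤-refl
p≤∣p∣ (mkℚ ℤ.-[1+ _ ] _ _) = ℚ.*≤* ℤ.-≤+

quarter : ℚ
quarter = + 1 / 4

-- The constants 40 and 36 encode d ≥ 1/4 + 10/L and d − ε ≥ 1/4 + 9/L.
dense⇒count : ∀ {n r} (H : Hypergraph n r) {d ε L K K′} .{{_ : NonZero K}} →
  ℕ→ℚ (L + 40) ≤ℚ ℕ→ℚ (4 * L) ℚ.* d → ε ≤ℚ + 1 / K → L ≤ K → K′ ≤ K → Dense H d ε →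
  ∀ S → n ≤ K′ * ∣ S ∣ → (L + 36) * (∣ S ∣ C r) ≤ 4 * L * edgesIn H S
dense⇒count {n} {r} H {d} {ε} {L} {K} {K′} hd hε L≤K K′≤K dense S size = ℕ→ℚ-cancel (begin
  ℕ→ℚ ((L + 36) * (∣ S ∣ C r))                        ≡⟨ ℕ→ℚ-* (L + 36) (∣ S ∣ C r) ⟩
  ℕ→ℚ (L + 36) ℚ.* ℕ→ℚ (∣ S ∣ C r)                    ≤⟨ ℕ→ℚ-*-monoʳ (∣ S ∣ C r) coefficient ⟩
  ℕ→ℚ (4 * L) ℚ.* (d ℚ.- ε) ℚ.* ℕ→ℚ (∣ S ∣ C r)       ≡⟨ ℚₚ.*-assoc (ℕ→ℚ (4 * L)) (d ℚ.- ε) (ℕ→ℚ (∣ S ∣ C r)) ⟩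
  ℕ→ℚ (4 * L) ℚ.* ((d ℚ.- ε) ℚ.* ℕ→ℚ (∣ S ∣ C r))     ≤⟨ ℕ→ℚ-*-monoˡ (4 * L) (dense S large) ⟩
  ℕ→ℚ (4 * L) ℚ.* ℕ→ℚ (edgesIn H S)                   ≡⟨ ℕ→ℚ-* (4 * L) (edgesIn H S) ⟨
  ℕ→ℚ (4 * L * edgesIn H S)                           ∎)
  where
  open ℚₚ.≤-Reasoning
  scaled : ∀ {x} → x ≤ K → ℕ→ℚ x ℚ.* ε ≤ℚ 1ℚ
  scaled {x} x≤K = begin
    ℕ→ℚ x ℚ.* ε               ≤⟨ ℕ→ℚ-*-monoˡ x hε ⟩
    ℕ→ℚ x ℚ.* (+ 1 / K)      ≤⟨ ℚₚ.*-monoʳ-≤-nonNeg (+ 1 / K) {{ℚ.nonNegative (ℚₚ.<⇒≤ (reciprocal-positive K))}} (ℕ→ℚ-mono x≤K) ⟩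
    ℕ→ℚ K ℚ.* (+ 1 / K)      ≡⟨ trans (ℚₚ.*-comm (ℕ→ℚ K) (+ 1 / K)) (reciprocal K) ⟩
    1ℚ                        ∎
  small : ℕ→ℚ (4 * L) ℚ.* ε ≤ℚ ℕ→ℚ 4
  small = begin
    ℕ→ℚ (4 * L) ℚ.* ε          ≡⟨ trans (cong (ℚ._* ε) (ℕ→ℚ-* 4 L)) (ℚₚ.*-assoc (ℕ→ℚ 4) (ℕ→ℚ L) ε) ⟩
    ℕ→ℚ 4 ℚ.* (ℕ→ℚ L ℚ.* ε)    ≤⟨ ℕ→ℚ-*-monoˡ 4 (scaled L≤K) ⟩
    ℕ→ℚ 4 ℚ.* 1ℚ               ≡⟨ ℚₚ.*-identityʳ (ℕ→ℚ 4) ⟩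
    ℕ→ℚ 4                      ∎
  coefficient : ℕ→ℚ (L + 36) ≤ℚ ℕ→ℚ (4 * L) ℚ.* (d ℚ.- ε)
  coefficient = begin
    ℕ→ℚ (L + 36)                                       ≡⟨ trans (sym (ℚₚ.+-identityʳ (ℕ→ℚ (L + 36)))) (cong (ℕ→ℚ (L + 36) ℚ.+_) (sym (ℚₚ.+-inverseʳ E))) ⟩
    ℕ→ℚ (L + 36) ℚ.+ (E ℚ.- E)                         ≡⟨ ℚₚ.+-assoc (ℕ→ℚ (L + 36)) E (ℚ.- E) ⟨
    ℕ→ℚ (L + 36) ℚ.+ E ℚ.- E                           ≤⟨ ℚₚ.+-monoˡ-≤ (ℚ.- E) (ℚₚ.+-monoʳ-≤ (ℕ→ℚ (L + 36)) small) ⟩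
    ℕ→ℚ (L + 36) ℚ.+ ℕ→ℚ 4 ℚ.- E                       ≡⟨ cong (ℚ._- E) (trans (sym (ℕ→ℚ-+ (L + 36) 4)) (cong ℕ→ℚ (+-assoc L 36 4))) ⟩
    ℕ→ℚ (L + 40) ℚ.- E                                 ≤⟨ ℚₚ.+-monoˡ-≤ (ℚ.- E) hd ⟩
    ℕ→ℚ (4 * L) ℚ.* d ℚ.- E                            ≡⟨ cong (ℕ→ℚ (4 * L) ℚ.* d ℚ.+_) (ℚₚ.neg-distribʳ-* (ℕ→ℚ (4 * L)) ε) ⟩
    ℕ→ℚ (4 * L) ℚ.* d ℚ.+ ℕ→ℚ (4 * L) ℚ.* (ℚ.- ε)      ≡⟨ ℚₚ.*-distribˡ-+ (ℕ→ℚ (4 * L)) d (ℚ.- ε) ⟨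
    ℕ→ℚ (4 * L) ℚ.* (d ℚ.- ε)                          ∎
    where E = ℕ→ℚ (4 * L) ℚ.* ε
  large : ε ℚ.* ℕ→ℚ n ≤ℚ ℕ→ℚ ∣ S ∣
  large = begin
    ε ℚ.* ℕ→ℚ n                               ≤⟨ ℕ→ℚ-*-monoʳ n hε ⟩
    (+ 1 / K) ℚ.* ℕ→ℚ n                      ≤⟨ ℚₚ.*-monoˡ-≤-nonNeg (+ 1 / K) {{ℚ.nonNegative (ℚₚ.<⇒≤ (reciprocal-positive K))}} (ℕ→ℚ-mono (≤-trans size (*-monoˡ-≤ ∣ S ∣ K′≤K))) ⟩
    (+ 1 / K) ℚ.* ℕ→ℚ (K * ∣ S ∣)            ≡⟨ cong ((+ 1 / K) ℚ.*_) (ℕ→ℚ-* K ∣ S ∣) ⟩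
    (+ 1 / K) ℚ.* (ℕ→ℚ K ℚ.* ℕ→ℚ ∣ S ∣)      ≡⟨ ℚₚ.*-assoc (+ 1 / K) (ℕ→ℚ K) (ℕ→ℚ ∣ S ∣) ⟨
    (+ 1 / K) ℚ.* ℕ→ℚ K ℚ.* ℕ→ℚ ∣ S ∣        ≡⟨ cong (ℚ._* ℕ→ℚ ∣ S ∣) (reciprocal K) ⟩
    1ℚ ℚ.* ℕ→ℚ ∣ S ∣                          ≡⟨ ℚₚ.*-identityˡ (ℕ→ℚ ∣ S ∣) ⟩
    ℕ→ℚ ∣ S ∣                                 ∎

-- If 1 ≤ (d - 1/4) q, then L = 10 q works: 4 L d = L + 4 L (d - 1/4), and the last term is 40 (d -
-- 1/4) q.
excess-over-quarter : ∀ {d} → quarter <ℚ d → ∃ λ L → NonZero L × ℕ→ℚ (L + 40) ≤ℚ ℕ→ℚ (4 * L) ℚ.* d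
excess-over-quarter {d} lt = 10 * q , m*n≢0 10 q , (begin
    ℕ→ℚ (10 * q + 40)                                ≡⟨ trans (cong ℕ→ℚ (+-comm (10 * q) 40)) (ℕ→ℚ-+ 40 (10 * q)) ⟩
    ℕ→ℚ 40 ℚ.+ ℕ→ℚ (10 * q)                          ≡⟨ cong₂ ℚ._+_ (sym (ℚₚ.*-identityʳ (ℕ→ℚ 40))) (sym part) ⟩
    ℕ→ℚ 40 ℚ.* 1ℚ ℚ.+ ℕ→ℚ (4 * (10 * q)) ℚ.* quarter ≤⟨ ℚₚ.+-monoˡ-≤ (ℕ→ℚ (4 * (10 * q)) ℚ.* quarter) (ℕ→ℚ-*-monoˡ 40 big) ⟩
    ℕ→ℚ 40 ℚ.* (δ ℚ.* ℕ→ℚ q) ℚ.+ ℕ→ℚ (4 * (10 * q)) ℚ.* quarter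
      ≡⟨ cong (ℚ._+ ℕ→ℚ (4 * (10 * q)) ℚ.* quarter) shuffle ⟩
    ℕ→ℚ (4 * (10 * q)) ℚ.* δ ℚ.+ ℕ→ℚ (4 * (10 * q)) ℚ.* quarter ≡⟨ ℚₚ.*-distribˡ-+ (ℕ→ℚ (4 * (10 * q))) δ quarter ⟨
    ℕ→ℚ (4 * (10 * q)) ℚ.* (δ ℚ.+ quarter)           ≡⟨ cong (ℕ→ℚ (4 * (10 * q)) ℚ.*_) restore ⟩
    ℕ→ℚ (4 * (10 * q)) ℚ.* d                         ∎)
  where
  open ℚₚ.≤-Reasoning
  δ = d ℚ.- quarter
  δ>0 : 0ℚ <ℚ δ
  δ>0 = subst (_<ℚ δ) (ℚₚ.+-inverseʳ quarter) (ℚₚ.+-monoˡ-< (ℚ.- quarter) lt)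
  arch = archimedean δ>0
  q = proj₁ arch
  big : 1ℚ ≤ℚ δ ℚ.* ℕ→ℚ q
  big = proj₂ (proj₂ arch)
  instance _ = proj₁ (proj₂ arch)
  restore : δ ℚ.+ quarter ≡ d
  restore = trans (ℚₚ.+-assoc d (ℚ.- quarter) quarter) (trans (cong (d ℚ.+_) (ℚₚ.+-inverseˡ quarter)) (ℚₚ.+-identityʳ d))
  shuffle : ℕ→ℚ 40 ℚ.* (δ ℚ.* ℕ→ℚ q) ≡ ℕ→ℚ (4 * (10 * q)) ℚ.* δ
  shuffle = trans (cong (ℕ→ℚ 40 ℚ.*_) (ℚₚ.*-comm δ (ℕ→ℚ q))) (trans (sym (ℚₚ.*-assoc (ℕ→ℚ 40) (ℕ→ℚ q) δ))
    (cong (ℚ._* δ) (trans (sym (ℕ→ℚ-* 40 q)) (cong ℕ→ℚ (*-assoc 4 10 q)))))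
  part : ℕ→ℚ (4 * (10 * q)) ℚ.* quarter ≡ ℕ→ℚ (10 * q)
  part = trans (ℚₚ.*-comm (ℕ→ℚ (4 * (10 * q))) quarter) (trans (cong (quarter ℚ.*_) (ℕ→ℚ-* 4 (10 * q)))
    (trans (sym (ℚₚ.*-assoc quarter (ℕ→ℚ 4) (ℕ→ℚ (10 * q)))) (trans (cong (ℚ._* ℕ→ℚ (10 * q)) (reciprocal 4)) (ℚₚ.*-identityˡ (ℕ→ℚ (10 * q))))))

module _ {k s : ℕ} (F : Hypergraph k (3 + s)) (ql : QuasiLinear F) (o : LinearOrder k)
         (adm : ∀ e f → TwinPair F e f → Describes o (XZZY (3 + s)) e f) where

  private
    n₀ = Upper.steps F o ql adm

    contradiction-with : ∀ L M M′ c m t₂ t .{{_ : NonZero L}} .{{_ : NonZero M}} .{{_ : NonZero M′}} .{{_ : NonZero t}} →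
      2 * L * M′ ≤ M → M′ ≤ M → (L * L) ^ n₀ * n₀ < M′ → 2 * (L * L) ≤ M →
      c ≡ L * ((2 + s) * (3 + s) ^ (2 + s)) → m ≡ (3 + s) * c →
      ramseyBound (2 + suc s) L (m + suc s) ≤ t₂ → ramseyBound (suc s + (2 + suc s)) 1 (k + t₂) ≤ t →
      ∀ d → ℕ→ℚ (L + 40) ≤ℚ ℕ→ℚ (4 * L) ℚ.* d → ¬ LocallyDenseFree (3 + s) d F
    contradiction-with L M M′ c m t₂ t M≥ M′≤M M′> M≥2L² c≡ m≡ t₂≥ t≥ d hd ldf = conclude (regularise t (suc s) (L * L) M)
      where
      open LocallyDenseFree ldf
      conclude : (∃ λ K → NonZero K × (∀ n (E : Fin n → Fin n → Vec (Fin n) (suc s) → Bool) (V : Vec (List (Fin n)) t) →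
        ¬ ¬ (∃ λ V′ → V′ ≼[ K ] V × Regularised (L * L) M E V′))) → ⊥
      conclude (K , nz , reach) = UpperBound.not-free F o ql adm M≥ M′≤M M′> M≥2L² c≡ m≡ t₂≥ t≥ K {{nz}} reach (graph i)
          (proj₂ late i (m≤n+m _ _))
          (dense⇒count (graph i) hd (ℚₚ.≤-trans (p≤∣p∣ (eps i)) (proj₂ precise i (m≤m+n _ _))) (m≤m+n L _) (m≤n+m _ L) (dense i))
          (free i)
        where
        -- The bound 1/K′ on ε has two uses: the summand L limits the loss of density, and 2 K t
        -- makes the set found in the sparse case large enough to be tested.
        K′ = L + 2 * K * t
        instance
          K′≢0 : NonZero K′
          K′≢0 = >-nonZero (<-≤-trans (>-nonZero⁻¹ L) (m≤m+n L _))
        precise = eps→0 (+ 1 / K′) (reciprocal-positive K′)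
        late = size→∞ (t * K)
        i = proj₁ precise + proj₁ late

  upper-bound : ∀ d → quarter <ℚ d → ¬ LocallyDenseFree (3 + s) d F
  upper-bound d lt = from (excess-over-quarter lt)
    where
    from : (∃ λ L → NonZero L × ℕ→ℚ (L + 40) ≤ℚ ℕ→ℚ (4 * L) ℚ.* d) → ¬ LocallyDenseFree (3 + s) d F
    from (L , nz , hd) = contradiction-with L (2 * L * (L * M′)) M′ c ((3 + s) * c) t₂ t
      (*-monoʳ-≤ (2 * L) (m≤n*m M′ L)) (≤-trans (m≤n*m M′ L) (m≤n*m (L * M′) (2 * L))) ≤-refl
      (≤-trans (≤-reflexive (sym (*-assoc 2 L L))) (*-monoʳ-≤ (2 * L) (m≤m*n L M′)))
      refl refl ≤-refl (n≤1+n _) d hd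
      where
      -- For D = L · L and J = `n₀` conditions this makes D^(-J) - J/M′ positive.
      M′ = suc ((L * L) ^ n₀ * n₀)
      c = L * ((2 + s) * (3 + s) ^ (2 + s))
      t₂ = ramseyBound (2 + suc s) L ((3 + s) * c + suc s)
      -- The successor makes t nonzero, since the vertices are divided into t parts.
      t = suc (ramseyBound (suc s + (2 + suc s)) 1 (k + t₂))
      instance
        _ = nz
        2L≢0 : NonZero (2 * L)
        2L≢0 = m*n≢0 2 L
        LM′≢0 : NonZero (L * M′)
        LM′≢0 = m*n≢0 L M′
        M≢0 : NonZero (2 * L * (L * M′))
        M≢0 = m*n≢0 (2 * L) (L * M′)

-- Hadamard matrices

Σℤ : ∀ n → (Fin n → ℤ) → ℤ
Σℤ zero    f = + 0
Σℤ (suc n) f = f zero ℤ.+ Σℤ n (f ∘ suc)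

Σℕ : ∀ n → (Fin n → ℕ) → ℕ
Σℕ zero    f = 0
Σℕ (suc n) f = f zero + Σℕ n (f ∘ suc)

Σℤ-cong : ∀ n {f g} → (∀ i → f i ≡ g i) → Σℤ n f ≡ Σℤ n g
Σℤ-cong zero    e = refl
Σℤ-cong (suc n) e = cong₂ ℤ._+_ (e zero) (Σℤ-cong n (e ∘ suc))

Σℤ-+ : ∀ n f g → Σℤ n (λ i → f i ℤ.+ g i) ≡ Σℤ n f ℤ.+ Σℤ n g
Σℤ-+ zero    f g = refl
Σℤ-+ (suc n) f g = trans (cong (λ z → (f zero ℤ.+ g zero) ℤ.+ z) (Σℤ-+ n (f ∘ suc) (g ∘ suc)))
  (lem (f zero) (g zero) (Σℤ n (f ∘ suc)) (Σℤ n (g ∘ suc)))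
  where
  lem : ∀ a b c d → (a ℤ.+ b) ℤ.+ (c ℤ.+ d) ≡ (a ℤ.+ c) ℤ.+ (b ℤ.+ d)
  lem = ℤSolver.solve-∀

Σℤ-*ˡ : ∀ n c f → Σℤ n (λ i → c ℤ.* f i) ≡ c ℤ.* Σℤ n f
Σℤ-*ˡ zero    c f = sym (ℤₚ.*-zeroʳ c)
Σℤ-*ˡ (suc n) c f = trans (cong (λ z → c ℤ.* f zero ℤ.+ z) (Σℤ-*ˡ n c (f ∘ suc))) (sym (ℤₚ.*-distribˡ-+ c (f zero) _))

Σℤ-split : ∀ m n f → Σℤ (m + n) f ≡ Σℤ m (λ i → f (i ↑ˡ n)) ℤ.+ Σℤ n (λ i → f (m ↑ʳ i))
Σℤ-split zero    n f = sym (ℤₚ.+-identityˡ _)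
Σℤ-split (suc m) n f = trans (cong (λ z → f zero ℤ.+ z) (Σℤ-split m n (f ∘ suc))) (sym (ℤₚ.+-assoc (f zero) _ _))

Σℤ-pos : ∀ n f → Σℤ n (λ i → + f i) ≡ + Σℕ n f
Σℤ-pos zero    f = refl
Σℤ-pos (suc n) f = cong (λ z → + f zero ℤ.+ z) (Σℤ-pos n (f ∘ suc))

Σℕ-mono : ∀ n {f g} → (∀ i → f i ≤ g i) → Σℕ n f ≤ Σℕ n g
Σℕ-mono zero    e = z≤n
Σℕ-mono (suc n) e = +-mono-≤ (e zero) (Σℕ-mono n (e ∘ suc))

Σℕ-const : ∀ n c → Σℕ n (λ _ → c) ≡ n * c
Σℕ-const zero    c = refl
Σℕ-const (suc n) c = cong (λ z → c + z) (Σℕ-const n c)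

Σℕ-+ : ∀ n f g → Σℕ n (λ i → f i + g i) ≡ Σℕ n f + Σℕ n g
Σℕ-+ zero    f g = refl
Σℕ-+ (suc n) f g = trans (cong (λ z → f zero + g zero + z) (Σℕ-+ n (f ∘ suc) (g ∘ suc)))
  (lem (f zero) (g zero) (Σℕ n (f ∘ suc)) (Σℕ n (g ∘ suc)))
  where
  lem : ∀ a b c d → a + b + (c + d) ≡ a + c + (b + d)
  lem = solve-∀

Σℕ-*ˡ : ∀ n c f → Σℕ n (λ i → c * f i) ≡ c * Σℕ n f
Σℕ-*ˡ zero    c f = sym (*-zeroʳ c)
Σℕ-*ˡ (suc n) c f = trans (cong (λ z → c * f zero + z) (Σℕ-*ˡ n c (f ∘ suc))) (sym (*-distribˡ-+ c (f zero) _))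

sgn : Bool → ℤ
sgn true  = + 1
sgn false = ℤ.- (+ 1)

transform : ∀ {b} → (Fin b → Fin b → Bool) → (Fin b → ℤ) → Fin b → ℤ
transform {b} χ f c = Σℤ b (λ a → f a ℤ.* sgn (χ a c))

-- Orthogonality of a sign matrix, expressed as Parseval's identity for integer functions: in this
-- form it bounds deviations and passes directly to the doubled matrix.
Hadamard : ∀ b → (Fin b → Fin b → Bool) → Set
Hadamard b χ = ∀ f → Σℤ b (λ c → transform χ f c ℤ.* transform χ f c) ≡ + b ℤ.* Σℤ b (λ a → f a ℤ.* f a)

-- Sylvester's construction: four copies of the matrix, the last one negated.
double : ∀ {b} → (Fin b → Fin b → Bool) → Fin (b + b) → Fin (b + b) → Bool
double {b} χ i j with splitAt b i | splitAt b j
... | inj₁ a | inj₁ c = χ a c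
... | inj₁ a | inj₂ c = χ a c
... | inj₂ a | inj₁ c = χ a c
... | inj₂ a | inj₂ c = not (χ a c)

-- The transforms P and Q of the two halves of `f` are combined to P + Q and P - Q, whose squares
-- add up to 2 (P² + Q²).
hadamard-double : ∀ {b χ} → Hadamard b χ → Hadamard (b + b) (double χ)
hadamard-double {b} {χ} had f = begin
  Σℤ (b + b) (λ c → G c ℤ.* G c)
    ≡⟨ Σℤ-split b b (λ c → G c ℤ.* G c) ⟩
  Σℤ b (λ c → G (c ↑ˡ b) ℤ.* G (c ↑ˡ b)) ℤ.+ Σℤ b (λ c → G (b ↑ʳ c) ℤ.* G (b ↑ʳ c))
    ≡⟨ cong₂ ℤ._+_ (Σℤ-cong b (λ c → cong (λ z → z ℤ.* z) (left c))) (Σℤ-cong b (λ c → cong (λ z → z ℤ.* z) (right c))) ⟩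
  Σℤ b (λ c → (P c ℤ.+ Q c) ℤ.* (P c ℤ.+ Q c)) ℤ.+ Σℤ b (λ c → (P c ℤ.+ ℤ.- (+ 1) ℤ.* Q c) ℤ.* (P c ℤ.+ ℤ.- (+ 1) ℤ.* Q c))
    ≡⟨ Σℤ-+ b _ _ ⟨
  Σℤ b (λ c → (P c ℤ.+ Q c) ℤ.* (P c ℤ.+ Q c) ℤ.+ (P c ℤ.+ ℤ.- (+ 1) ℤ.* Q c) ℤ.* (P c ℤ.+ ℤ.- (+ 1) ℤ.* Q c))
    ≡⟨ Σℤ-cong b (λ c → parallelogram (P c) (Q c)) ⟩
  Σℤ b (λ c → + 2 ℤ.* (P c ℤ.* P c ℤ.+ Q c ℤ.* Q c))
    ≡⟨ trans (Σℤ-*ˡ b (+ 2) _) (cong (+ 2 ℤ.*_) (Σℤ-+ b _ _)) ⟩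
  + 2 ℤ.* (Σℤ b (λ c → P c ℤ.* P c) ℤ.+ Σℤ b (λ c → Q c ℤ.* Q c))
    ≡⟨ cong (+ 2 ℤ.*_) (cong₂ ℤ._+_ (had f₁) (had f₂)) ⟩
  + 2 ℤ.* (+ b ℤ.* Σℤ b (λ a → f₁ a ℤ.* f₁ a) ℤ.+ + b ℤ.* Σℤ b (λ a → f₂ a ℤ.* f₂ a))
    ≡⟨ collect (+ b) _ _ ⟩
  (+ b ℤ.+ + b) ℤ.* (Σℤ b (λ a → f₁ a ℤ.* f₁ a) ℤ.+ Σℤ b (λ a → f₂ a ℤ.* f₂ a))
    ≡⟨ cong (+ (b + b) ℤ.*_) (Σℤ-split b b (λ a → f a ℤ.* f a)) ⟨
  + (b + b) ℤ.* Σℤ (b + b) (λ a → f a ℤ.* f a) ∎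
  where
  open ≡-Reasoning
  G = transform (double χ) f
  f₁ f₂ P Q : Fin b → ℤ
  f₁ a = f (a ↑ˡ b)
  f₂ a = f (b ↑ʳ a)
  P = transform χ f₁
  Q = transform χ f₂
  ll : ∀ a c → double χ (a ↑ˡ b) (c ↑ˡ b) ≡ χ a c
  ll a c rewrite Finₚ.splitAt-↑ˡ b a b | Finₚ.splitAt-↑ˡ b c b = refl
  lr : ∀ a c → double χ (a ↑ˡ b) (b ↑ʳ c) ≡ χ a c
  lr a c rewrite Finₚ.splitAt-↑ˡ b a b | Finₚ.splitAt-↑ʳ b b c = refl
  rl : ∀ a c → double χ (b ↑ʳ a) (c ↑ˡ b) ≡ χ a c
  rl a c rewrite Finₚ.splitAt-↑ʳ b b a | Finₚ.splitAt-↑ˡ b c b = refl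
  rr : ∀ a c → double χ (b ↑ʳ a) (b ↑ʳ c) ≡ not (χ a c)
  rr a c rewrite Finₚ.splitAt-↑ʳ b b a | Finₚ.splitAt-↑ʳ b b c = refl
  sgn-not : ∀ x → sgn (not x) ≡ ℤ.- (+ 1) ℤ.* sgn x
  sgn-not true  = refl
  sgn-not false = refl
  left : ∀ c → G (c ↑ˡ b) ≡ P c ℤ.+ Q c
  left c = trans (Σℤ-split b b _) (cong₂ ℤ._+_
    (Σℤ-cong b (λ a → cong (λ z → f₁ a ℤ.* sgn z) (ll a c))) (Σℤ-cong b (λ a → cong (λ z → f₂ a ℤ.* sgn z) (rl a c))))
  right : ∀ c → G (b ↑ʳ c) ≡ P c ℤ.+ ℤ.- (+ 1) ℤ.* Q c
  right c = trans (Σℤ-split b b _) (cong₂ ℤ._+_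
    (Σℤ-cong b (λ a → cong (λ z → f₁ a ℤ.* sgn z) (lr a c)))
    (trans (Σℤ-cong b (λ a → trans (cong (f₂ a ℤ.*_) (trans (cong sgn (rr a c)) (sgn-not (χ a c)))) (pull (f₂ a) (sgn (χ a c)))))
      (Σℤ-*ˡ b (ℤ.- (+ 1)) _)))
    where
    pull : ∀ x y → x ℤ.* (ℤ.- (+ 1) ℤ.* y) ≡ ℤ.- (+ 1) ℤ.* (x ℤ.* y)
    pull = ℤSolver.solve-∀
  parallelogram : ∀ p q → (p ℤ.+ q) ℤ.* (p ℤ.+ q) ℤ.+ (p ℤ.+ ℤ.- (+ 1) ℤ.* q) ℤ.* (p ℤ.+ ℤ.- (+ 1) ℤ.* q) ≡ + 2 ℤ.* (p ℤ.* p ℤ.+ q ℤ.* q)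
  parallelogram = ℤSolver.solve-∀
  collect : ∀ b x y → + 2 ℤ.* (b ℤ.* x ℤ.+ b ℤ.* y) ≡ (b ℤ.+ b) ℤ.* (x ℤ.+ y)
  collect = ℤSolver.solve-∀

-- Two doublings at a time keep the order a perfect square, so that 2^μ serves as its square root in
-- the bound for the deviations.
hadamard-exists : ∀ μ → ∃ (Hadamard (2 ^ μ * 2 ^ μ))
hadamard-exists zero    = (λ _ _ → true) , λ f → lem (f zero)
  where
  lem : ∀ x → (x ℤ.* + 1 ℤ.+ + 0) ℤ.* (x ℤ.* + 1 ℤ.+ + 0) ℤ.+ + 0 ≡ + 1 ℤ.* (x ℤ.* x ℤ.+ + 0)
  lem = ℤSolver.solve-∀
hadamard-exists (suc μ) with hadamard-exists μ
... | χ , had = subst (∃ ∘ Hadamard) (quadruple (2 ^ μ)) (double (double χ) , hadamard-double {χ = double χ} (hadamard-double {χ = χ} had))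
  where
  quadruple : ∀ h → h * h + h * h + (h * h + h * h) ≡ 2 * h * (2 * h)
  quadruple = solve-∀

Σˡ-elems : ∀ {n} (S : Subset n) g → Σˡ (elems S) g ≡ Σℕ n (λ a → 𝟙 (lookup S a) * g a)
Σˡ-elems []          g = refl
Σˡ-elems (true  ∷ S) g = cong₂ _+_ (sym (+-identityʳ (g zero))) (trans (Σˡ-map suc (elems S) g) (Σˡ-elems S (g ∘ suc)))
Σˡ-elems (false ∷ S) g = trans (Σˡ-map suc (elems S) g) (Σˡ-elems S (g ∘ suc))

module Discrepancy {b h : ℕ} .{{_ : NonZero h}} (b≡ : h * h ≡ b) (χ : Fin b → Fin b → Bool) (had : Hadamard b χ) where

  degree : List (Fin b) → Fin b → ℕ
  degree A c = Σˡ A (λ a → 𝟙 (χ a c))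

  module _ (S : Subset b) where

    private
      f : Fin b → ℤ
      f a = + 𝟙 (lookup S a)
      A = elems S

    -- The imbalance between the red and the blue pairs that join `S` to c, that is, the distance
    -- between |S| and twice the red degree.
    deviation : Fin b → ℕ
    deviation c = ℤ.∣ transform χ f c ∣

    private
      signed-sum : ∀ c → transform χ f c ℤ.+ + length A ≡ + (2 * degree A c)
      signed-sum c = begin
        transform χ f c ℤ.+ + length A
          ≡⟨ cong (λ z → transform χ f c ℤ.+ + z) (trans (sym (*-identityʳ _)) (trans (sym (Σˡ-const A 1)) (Σˡ-elems S (λ _ → 1)))) ⟩
        transform χ f c ℤ.+ + Σℕ b (λ a → 𝟙 (lookup S a) * 1)
          ≡⟨ cong (λ z → transform χ f c ℤ.+ z) (Σℤ-pos b _) ⟨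
        transform χ f c ℤ.+ Σℤ b (λ a → + (𝟙 (lookup S a) * 1))
          ≡⟨ Σℤ-+ b _ _ ⟨
        Σℤ b (λ a → f a ℤ.* sgn (χ a c) ℤ.+ + (𝟙 (lookup S a) * 1))
          ≡⟨ Σℤ-cong b (λ a → pointwise (lookup S a) (χ a c)) ⟩
        Σℤ b (λ a → + (2 * (𝟙 (lookup S a) * 𝟙 (χ a c))))
          ≡⟨ Σℤ-pos b _ ⟩
        + Σℕ b (λ a → 2 * (𝟙 (lookup S a) * 𝟙 (χ a c)))
          ≡⟨ cong (λ z → + z) (trans (Σℕ-*ˡ b 2 _) (cong (2 *_) (sym (Σˡ-elems S (λ a → 𝟙 (χ a c)))))) ⟩
        + (2 * degree A c) ∎
        where
        open ≡-Reasoning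
        pointwise : ∀ x y → + 𝟙 x ℤ.* sgn y ℤ.+ + (𝟙 x * 1) ≡ + (2 * (𝟙 x * 𝟙 y))
        pointwise true  true  = refl
        pointwise true  false = refl
        pointwise false true  = refl
        pointwise false false = refl

    degree-upper : ∀ c → 2 * degree A c ≤ length A + deviation c
    degree-upper c = begin
      2 * degree A c                              ≡⟨ cong ℤ.∣_∣ (signed-sum c) ⟨
      ℤ.∣ transform χ f c ℤ.+ + length A ∣        ≤⟨ ℤₚ.∣i+j∣≤∣i∣+∣j∣ (transform χ f c) (+ length A) ⟩
      deviation c + length A                      ≡⟨ +-comm (deviation c) (length A) ⟩
      length A + deviation c                      ∎
      where open ≤-Reasoning

    degree-lower : ∀ c → length A ≤ 2 * degree A c + deviation c
    degree-lower c = begin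
      length A                                             ≡⟨ cong ℤ.∣_∣ (cancel (transform χ f c) (+ length A)) ⟩
      ℤ.∣ x ℤ.+ + length A ℤ.+ ℤ.- x ∣                     ≡⟨ cong (λ z → ℤ.∣ z ℤ.+ ℤ.- x ∣) (signed-sum c) ⟩
      ℤ.∣ + (2 * degree A c) ℤ.+ ℤ.- x ∣                   ≤⟨ ℤₚ.∣i+j∣≤∣i∣+∣j∣ (+ (2 * degree A c)) (ℤ.- x) ⟩
      2 * degree A c + ℤ.∣ ℤ.- x ∣                         ≡⟨ cong (λ z → 2 * degree A c + z) (ℤₚ.∣-i∣≡∣i∣ x) ⟩
      2 * degree A c + deviation c                         ∎
      where
      open ≤-Reasoning
      x = transform χ f c
      cancel : ∀ x y → y ≡ x ℤ.+ y ℤ.+ ℤ.- x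
      cancel = ℤSolver.solve-∀

    private
      square : ∀ x → + (ℤ.∣ x ∣ * ℤ.∣ x ∣) ≡ x ℤ.* x
      square (+ n)        = ℤₚ.pos-* n n
      square ℤ.-[1+ n ]   = refl

      square-sum : Σℕ b (λ c → deviation c * deviation c) ≤ b * b
      square-sum = begin
        Σℕ b (λ c → deviation c * deviation c)   ≡⟨ ℤₚ.+-injective parseval ⟩
        b * Σℕ b (λ a → 𝟙 (lookup S a))          ≤⟨ *-monoʳ-≤ b (≤-trans (Σℕ-mono b (λ a → 𝟙≤1 (lookup S a))) (≤-reflexive (trans (Σℕ-const b 1) (*-identityʳ b)))) ⟩
        b * b                                    ∎
        where
        open ≤-Reasoning
        parseval : + Σℕ b (λ c → deviation c * deviation c) ≡ + (b * Σℕ b (λ a → 𝟙 (lookup S a)))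
        parseval = trans (sym (Σℤ-pos b _)) (trans (Σℤ-cong b (λ c → square (transform χ f c))) (trans (had f)
          (trans (cong (+ b ℤ.*_) (trans (Σℤ-cong b (λ a → idempotent (lookup S a))) (Σℤ-pos b _))) (sym (ℤₚ.pos-* b _)))))
          where
          idempotent : ∀ x → + 𝟙 x ℤ.* + 𝟙 x ≡ + 𝟙 x
          idempotent true  = refl
          idempotent false = refl

    -- From Parseval's identity via 2 h x ≤ x² + h², which avoids square roots.
    total-deviation : Σℕ b deviation ≤ h * b
    total-deviation = *-cancelˡ-≤ (2 * h) {{m*n≢0 2 h}} (begin
      2 * h * Σℕ b deviation                                    ≡⟨ Σℕ-*ˡ b (2 * h) deviation ⟨
      Σℕ b (λ c → 2 * h * deviation c)                          ≤⟨ Σℕ-mono b (λ c → amgm (deviation c)) ⟩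
      Σℕ b (λ c → deviation c * deviation c + h * h)            ≡⟨ Σℕ-+ b _ _ ⟩
      Σℕ b (λ c → deviation c * deviation c) + Σℕ b (λ _ → h * h) ≤⟨ +-mono-≤ square-sum (≤-reflexive (Σℕ-const b (h * h))) ⟩
      b * b + b * (h * h)                                       ≡⟨ cong (λ z → z * b + b * (h * h)) b≡ ⟨
      h * h * b + b * (h * h)                                   ≡⟨ lem h b ⟩
      2 * h * (h * b)                                           ∎)
      where
      open ≤-Reasoning
      lem : ∀ h b → h * h * b + b * (h * h) ≡ 2 * h * (h * b)
      lem = solve-∀
      amgm : ∀ x → 2 * h * x ≤ x * x + h * h
      amgm x = *-cancelˡ-≤ 2 (begin
        2 * (2 * h * x)            ≡⟨ lem₁ h x ⟩
        4 * (x * h)                ≤⟨ 4xy≤[x+y]²-half x h ⟩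
        2 * (x * x + h * h)        ∎)
        where
        lem₁ : ∀ h x → 2 * (2 * h * x) ≡ 4 * (x * h)
        lem₁ = solve-∀
        4xy≤[x+y]²-half : ∀ x y → 4 * (x * y) ≤ 2 * (x * x + y * y)
        4xy≤[x+y]²-half x y = lin≤ 0 (*-monoʳ-≤ 2 (4xy≤[x+y]² x y)) (lem₂ x y)
          where
          lem₂ : ∀ x y → 4 * (x * y) + 2 * ((x + y) * (x + y)) + 0 ≡ 2 * (x * x + y * y) + 2 * (4 * (x * y))
          lem₂ = solve-∀

-- Density of the head-tail construction

-- The vertices form k consecutive intervals of length b, and the residue is the position inside the
-- interval; thus any two intervals are joined by a copy of the same matrix.
residue : ∀ {b} k → Fin (k * b) → Fin b
residue {b} (suc k) i with splitAt b i
... | inj₁ a = a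
... | inj₂ j = residue k j

residue-↑ˡ : ∀ {b} k (a : Fin b) → residue (suc k) (a ↑ˡ (k * b)) ≡ a
residue-↑ˡ {b} k a rewrite Finₚ.splitAt-↑ˡ b a (k * b) = refl

residue-↑ʳ : ∀ {b} k (j : Fin (k * b)) → residue (suc k) (b ↑ʳ j) ≡ residue k j
residue-↑ʳ {b} k j rewrite Finₚ.splitAt-↑ʳ b (k * b) j = refl

elems-++ : ∀ {m n} (S : Subset m) (T : Subset n) → elems (S Vec.++ T) ≡ map (_↑ˡ n) (elems S) ++ map (m ↑ʳ_) (elems T)
elems-++ []          T = sym (Listₚ.map-id (elems T))
elems-++ {suc m} {n} (b ∷ S) T = shifted b
  where
  tail-part : map suc (elems (S Vec.++ T)) ≡ map (_↑ˡ n) (map suc (elems S)) ++ map (suc m ↑ʳ_) (elems T)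
  tail-part = trans (cong (map suc) (elems-++ S T)) (trans (Listₚ.map-++ suc (map (_↑ˡ n) (elems S)) _)
    (cong₂ _++_ (trans (sym (Listₚ.map-∘ (elems S))) (Listₚ.map-∘ (elems S))) (sym (Listₚ.map-∘ (elems T)))))
  shifted : ∀ b → elems ((b ∷ S) Vec.++ T) ≡ map (_↑ˡ n) (elems (b ∷ S)) ++ map (suc m ↑ʳ_) (elems T)
  shifted true  = cong (zero ∷_) tail-part
  shifted false = tail-part

-- Models the part of a vertex set inside one interval. The colouring sees only residues, so the
-- interval itself is not recorded.
IsBlock : ∀ {b} k → List (Fin (k * b)) → Set
IsBlock {b} k L = ∃ λ (S : Subset b) → map (residue k) L ≡ elems S

blocks : ∀ {b} k (S : Subset (k * b)) → ∃ λ Ls → concat Ls ≡ elems S × length Ls ≡ k × All (IsBlock k) Ls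
blocks zero    []  = [] , refl , refl , []
blocks {b} (suc k) S with Vec.splitAt b S
... | S₁ , S₂ , refl with blocks k S₂
... | Ls , eq , len , bl = map (_↑ˡ (k * b)) (elems S₁) ∷ map (map (b ↑ʳ_)) Ls ,
      trans (cong (map (_↑ˡ (k * b)) (elems S₁) ++_) (trans (Listₚ.concat-map Ls) (cong (map (b ↑ʳ_)) eq))) (sym (elems-++ S₁ S₂)) ,
      cong suc (trans (Listₚ.length-map (map (b ↑ʳ_)) Ls) len) ,
      (S₁ , trans (sym (Listₚ.map-∘ (elems S₁))) (trans (Listₚ.map-cong (residue-↑ˡ k) (elems S₁)) (Listₚ.map-id (elems S₁)))) ∷
      AllLₚ.map⁺ (AllL.map (λ {L} (T , e) → T , trans (sym (Listₚ.map-∘ L)) (trans (Listₚ.map-cong (residue-↑ʳ k) L) e)) bl)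

onFirstTwo : ∀ {A : Set} → (A → A → Bool) → List A → Bool
onFirstTwo g (x ∷ y ∷ _) = g x y
onFirstTwo g _           = false

lastTwo : ∀ {A : Set} → List A → List A
lastTwo l = List.drop (length l ∸ 2) l

onFirstTwo-toList : ∀ {A : Set} {s} (g : A → A → Bool) (v : Vec A (2 + s)) → onFirstTwo g (toList v) ≡ firstPair g v
onFirstTwo-toList g (x ∷ y ∷ v) = refl

onLastTwo-toList : ∀ {A : Set} {s} (g : A → A → Bool) (v : Vec A (2 + s)) → onFirstTwo g (lastTwo (toList v)) ≡ firstPair g (rotate v)
onLastTwo-toList {s = s} g v = trans (cong (λ l → onFirstTwo g (List.drop (l ∸ 2) (toList v))) (Vecₚ.length-toList v)) (go v)
  where
  go : ∀ {s} (v : Vec _ (2 + s)) → onFirstTwo g (List.drop s (toList v)) ≡ firstPair g (rotate v)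
  go (a ∷ b ∷ [])    = refl
  go (a ∷ b ∷ c ∷ v) = trans (go (b ∷ c ∷ v)) (sym (firstPair-insert g a (rotate (b ∷ c ∷ v))))

headTailEdge : ∀ {n} → (Fin n → Fin n → Bool) → List (Fin n) → Bool
headTailEdge g l = onFirstTwo g l ∧ not (onFirstTwo g (lastTwo l))

headTailGraph : ∀ {n} → (Fin n → Fin n → Bool) → ∀ r → Hypergraph n r
headTailGraph g r = record
  { edge    = λ T → (∣ T ∣ ≡ᵇ r) ∧ headTailEdge g (elems T)
  ; uniform = λ T e → ≡ᵇ-true ∣ T ∣ r (proj₁ (∧-true e)) }
  where
  ≡ᵇ-true : ∀ a b → (a ≡ᵇ b) ≡ true → a ≡ b
  ≡ᵇ-true zero    zero    e = refl
  ≡ᵇ-true (suc a) (suc b) e = cong suc (≡ᵇ-true a b e)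

≡ᵇ-refl : ∀ n → (n ≡ᵇ n) ≡ true
≡ᵇ-refl zero    = refl
≡ᵇ-refl (suc n) = ≡ᵇ-refl n

edgesIn-headTail : ∀ {n s} (g : Fin n → Fin n → Bool) (S : Subset n) → edgesIn (headTailGraph g (3 + s)) S ≡
  pick (3 + s) (elems S) (λ v → 𝟙 (firstPair g v ∧ not (firstPair g (rotate v))))
edgesIn-headTail {s = s} g S = trans (edgesIn-pick (headTailGraph g (3 + s)) S) (pick-cong-⊆ (3 + s) (elems S) λ v v⊆ → cong 𝟙 (same v (elems-setOf S v⊆)))
  where
  same : ∀ v → elems (setOf (toList v)) ≡ toList v → edge (headTailGraph g (3 + s)) (setOf (toList v)) ≡ firstPair g v ∧ not (firstPair g (rotate v))
  same v eq = cong₂ _∧_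
    (trans (cong (_≡ᵇ (3 + s)) (trans (sym (length-elems (setOf (toList v)))) (trans (cong length eq) (Vecₚ.length-toList v)))) (≡ᵇ-refl s))
    (trans (cong (headTailEdge g) eq) (cong₂ (λ x y → x ∧ not y) (onFirstTwo-toList g v) (onLastTwo-toList g v)))

module BlockDensity {b h : ℕ} .{{_ : NonZero h}} (b≡ : h * h ≡ b) (χ : Fin b → Fin b → Bool) (had : Hadamard b χ) (k : ℕ) where

  open Discrepancy b≡ χ had

  χᵥ : Fin (k * b) → Fin (k * b) → Bool
  χᵥ u v = χ (residue k u) (residue k v)

  private
    A = Fin (k * b)

  module _ {L₁ L₂ : List A} (block₁ : IsBlock k L₁) (block₂ : IsBlock k L₂) where

    private
      S₁ S₂ : Subset b
      S₁ = proj₁ block₁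
      S₂ = proj₁ block₂
      eq₁ = proj₂ block₁
      eq₂ = proj₂ block₂

      deg dev : A → ℕ
      deg c = Σˡ L₁ (λ a → 𝟙 (χᵥ a c))
      dev c = deviation S₁ (residue k c)

      deg≡ : ∀ c → deg c ≡ degree (elems S₁) (residue k c)
      deg≡ c = trans (sym (Σˡ-map (residue k) L₁ (λ a → 𝟙 (χ a (residue k c))))) (cong (λ L → degree L (residue k c)) eq₁)

      len≡ : length L₁ ≡ length (elems S₁)
      len≡ = trans (sym (Listₚ.length-map (residue k) L₁)) (cong length eq₁)

      deg-upper : ∀ c → 2 * deg c ≤ length L₁ + dev c
      deg-upper c = subst₂ (λ x y → 2 * x ≤ y + dev c) (sym (deg≡ c)) (sym len≡) (degree-upper S₁ (residue k c))

      deg-lower : ∀ c → length L₁ ≤ 2 * deg c + dev c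
      deg-lower c = subst₂ (λ x y → y ≤ 2 * x + dev c) (sym (deg≡ c)) (sym len≡) (degree-lower S₁ (residue k c))

      dev-total : Σˡ L₂ dev ≤ h * b
      dev-total = begin
        Σˡ L₂ dev                                            ≡⟨ Σˡ-map (residue k) L₂ (deviation S₁) ⟨
        Σˡ (map (residue k) L₂) (deviation S₁)               ≡⟨ cong (λ L → Σˡ L (deviation S₁)) eq₂ ⟩
        Σˡ (elems S₂) (deviation S₁)                         ≡⟨ Σˡ-elems S₂ (deviation S₁) ⟩
        Σℕ b (λ c → 𝟙 (lookup S₂ c) * deviation S₁ c)        ≤⟨ Σℕ-mono b (λ c → ≤-trans (*-monoˡ-≤ (deviation S₁ c) (𝟙≤1 (lookup S₂ c))) (≤-reflexive (*-identityˡ _))) ⟩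
        Σℕ b (deviation S₁)                                  ≤⟨ total-deviation S₁ ⟩
        h * b                                                ∎
        where open ≤-Reasoning

    -- The deviations are summed in absolute value, so the bound h b is inherited by every set of
    -- second vertices: nearly half of the pairs are red even when `late` restricts the second
    -- vertex.
    pairs-lower : ∀ (late : A → Bool) →
      length L₁ * Σˡ L₂ (𝟙 ∘ late) ≤ 2 * Σˡ L₁ (λ a → Σˡ L₂ (λ c → 𝟙 (χᵥ a c ∧ late c))) + h * b
    pairs-lower late = begin
      length L₁ * Σˡ L₂ (𝟙 ∘ late)                         ≡⟨ Σˡ-*ˡ L₂ (length L₁) (𝟙 ∘ late) ⟨
      Σˡ L₂ (λ c → length L₁ * 𝟙 (late c))                 ≤⟨ Σˡ-mono L₂ (λ c → step {d = deg c} {dev c} (late c) (deg-lower c)) ⟩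
      Σˡ L₂ (λ c → 2 * (deg c * 𝟙 (late c)) + dev c)       ≡⟨ trans (Σˡ-+ L₂ _ dev) (cong (_+ Σˡ L₂ dev) (Σˡ-*ˡ L₂ 2 _)) ⟩
      2 * Σˡ L₂ (λ c → deg c * 𝟙 (late c)) + Σˡ L₂ dev     ≤⟨ +-monoʳ-≤ _ dev-total ⟩
      2 * Σˡ L₂ (λ c → deg c * 𝟙 (late c)) + h * b         ≡⟨ cong (λ z → 2 * z + h * b) (trans (Σˡ-cong L₂ (λ c → trans (sym (Σˡ-*ʳ L₁ (𝟙 (late c)) _)) (Σˡ-cong L₁ (λ a → sym (𝟙-∧ (χᵥ a c) (late c)))))) (sym (Σˡ-swap L₁ L₂ _))) ⟩
      2 * Σˡ L₁ (λ a → Σˡ L₂ (λ c → 𝟙 (χᵥ a c ∧ late c))) + h * b ∎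
      where
      open ≤-Reasoning
      step : ∀ {l d e} x → l ≤ 2 * d + e → l * 𝟙 x ≤ 2 * (d * 𝟙 x) + e
      step {l} {d} {e} true  p = ≤-trans (≤-reflexive (*-identityʳ l)) (≤-trans p (≤-reflexive (cong (λ z → 2 * z + e) (sym (*-identityʳ d)))))
      step {l} {d} {e} false p = ≤-trans (≤-reflexive (*-zeroʳ l)) z≤n

    nonpairs-lower : length L₁ * length L₂ ≤ 2 * Σˡ L₁ (λ a → Σˡ L₂ (λ c → 𝟙 (not (χᵥ a c)))) + h * b
    nonpairs-lower = begin
      length L₁ * length L₂                                ≡⟨ trans (*-comm (length L₁) _) (sym (Σˡ-const L₂ (length L₁))) ⟩
      Σˡ L₂ (λ _ → length L₁)                              ≤⟨ Σˡ-mono L₂ step ⟩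
      Σˡ L₂ (λ c → 2 * codeg c + dev c)                    ≡⟨ trans (Σˡ-+ L₂ _ dev) (cong (_+ Σˡ L₂ dev) (Σˡ-*ˡ L₂ 2 codeg)) ⟩
      2 * Σˡ L₂ codeg + Σˡ L₂ dev                          ≤⟨ +-monoʳ-≤ _ dev-total ⟩
      2 * Σˡ L₂ codeg + h * b                              ≡⟨ cong (λ z → 2 * z + h * b) (sym (Σˡ-swap L₁ L₂ _)) ⟩
      2 * Σˡ L₁ (λ a → Σˡ L₂ (λ c → 𝟙 (not (χᵥ a c)))) + h * b ∎
      where
      open ≤-Reasoning
      codeg : A → ℕ
      codeg c = Σˡ L₁ (λ a → 𝟙 (not (χᵥ a c)))
      total : ∀ c → deg c + codeg c ≡ length L₁
      total c = trans (sym (Σˡ-+ L₁ _ _)) (trans (Σˡ-cong L₁ (λ a → one (χᵥ a c))) (trans (Σˡ-const L₁ 1) (*-identityʳ _)))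
        where
        one : ∀ x → 𝟙 x + 𝟙 (not x) ≡ 1
        one true  = refl
        one false = refl
      step : ∀ c → length L₁ ≤ 2 * codeg c + dev c
      step c = lin≤ 0 (subst (λ l → 2 * deg c ≤ l + dev c) (sym (total c)) (deg-upper c))
        (trans (cong (λ l → l + (deg c + codeg c + dev c) + 0) (sym (total c))) (lem (deg c) (codeg c) (dev c)))
        where
        lem : ∀ d e v → d + e + (d + e + v) + 0 ≡ 2 * e + v + 2 * d
        lem = solve-∀

  block-length : ∀ {L} → IsBlock k L → length L ≤ b
  block-length {L} (S , eq) = begin
    length L                       ≡⟨ Listₚ.length-map (residue k) L ⟨
    length (map (residue k) L)     ≡⟨ trans (cong length eq) (length-elems S) ⟩
    ∣ S ∣                          ≤⟨ Subsetₚ.∣p∣≤n S ⟩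
    b                              ∎
    where open ≤-Reasoning

  vol-blocks : ∀ {q} (V : Vec (List A) q) → All (IsBlock k) (toList V) → vol V ≤ b ^ q
  vol-blocks []      []       = ≤-refl
  vol-blocks (L ∷ V) (p ∷ ps) = *-mono-≤ (block-length p) (vol-blocks V ps)

  module _ {s : ℕ} where

    isEdge : Vec A (3 + s) → Bool
    isEdge v = firstPair χᵥ v ∧ not (firstPair χᵥ (rotate v))

    private
      err = h * b * b ^ suc s
      early : Vec A (3 + s) → Bool
      early v = not (firstPair χᵥ (rotate v))

      tails-lower : ∀ (V : Vec (List A) (3 + s)) → All (IsBlock k) (toList V) →
        vol V ≤ 2 * Sum V (λ v → 𝟙 (firstPair (λ a c → not (χᵥ a c)) v)) + err
      tails-lower (L₁ ∷ L₂ ∷ K) (p₁ ∷ p₂ ∷ ps) = begin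
        vol (L₁ ∷ L₂ ∷ K)                          ≡⟨ lem₁ (length L₁) (length L₂) (vol K) ⟩
        vol K * (length L₁ * length L₂)            ≤⟨ *-monoʳ-≤ (vol K) (nonpairs-lower p₁ p₂) ⟩
        vol K * (2 * N + h * b)                    ≡⟨ lem₂ (vol K) N (h * b) ⟩
        2 * (vol K * N) + h * b * vol K            ≤⟨ +-mono-≤ (≤-reflexive (cong (2 *_) (sym (Sum-firstPair (λ a c → not (χᵥ a c)) (L₁ ∷ L₂ ∷ K))))) (*-monoʳ-≤ (h * b) (vol-blocks K ps)) ⟩
        2 * Sum (L₁ ∷ L₂ ∷ K) (λ v → 𝟙 (firstPair (λ a c → not (χᵥ a c)) v)) + err ∎
        where
        open ≤-Reasoning
        N = Σˡ L₁ (λ a → Σˡ L₂ (λ c → 𝟙 (not (χᵥ a c))))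
        lem₁ : ∀ a b c → a * (b * c) ≡ c * (a * b)
        lem₁ = solve-∀
        lem₂ : ∀ v n e → v * (2 * n + e) ≡ 2 * (v * n) + e * v
        lem₂ = solve-∀

      -- Since r ≥ 3, the tail does not contain the first vertex. With all vertices but the first
      -- two fixed, the tail condition is therefore a restriction `late` on the second vertex alone.
      heads-lower : ∀ (V : Vec (List A) (3 + s)) → All (IsBlock k) (toList V) →
        Sum V (𝟙 ∘ early) ≤ 2 * Sum V (𝟙 ∘ isEdge) + err
      heads-lower (L₁ ∷ L₂ ∷ K) (p₁ ∷ p₂ ∷ ps) = begin
        Sum (L₁ ∷ L₂ ∷ K) (𝟙 ∘ early)                                        ≡⟨ Sum-Σ₂ L₁ L₂ K (λ a c w → 𝟙 (early (a ∷ c ∷ w))) ⟨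
        Sum K (λ w → Σˡ L₁ λ a → Σˡ L₂ λ c → 𝟙 (early (a ∷ c ∷ w)))          ≡⟨ Sum-cong K (λ w → trans (Σˡ-cong L₁ (λ a → Σˡ-cong L₂ (λ c → cong 𝟙 (indep a c w)))) (Σˡ-const L₁ _)) ⟩
        Sum K (λ w → length L₁ * Σˡ L₂ (λ c → 𝟙 (late c w)))                 ≤⟨ Sum-mono K (λ w → pairs-lower p₁ p₂ (λ c → late c w)) ⟩
        Sum K (λ w → 2 * Σˡ L₁ (λ a → Σˡ L₂ (λ c → 𝟙 (χᵥ a c ∧ late c w))) + h * b) ≡⟨ trans (Sum-+ K _ _) (cong₂ _+_ (Sum-*ˡ K 2 _) (trans (Sum-const K (h * b)) (*-comm (vol K) (h * b)))) ⟩
        2 * Sum K (λ w → Σˡ L₁ λ a → Σˡ L₂ λ c → 𝟙 (χᵥ a c ∧ late c w)) + h * b * vol K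
          ≤⟨ +-mono-≤ (≤-reflexive (cong (2 *_) (trans (Sum-cong K (λ w → Σˡ-cong L₁ (λ a → Σˡ-cong L₂ (λ c → cong (λ z → 𝟙 (χᵥ a c ∧ z)) (sym (indep a c w)))))) (Sum-Σ₂ L₁ L₂ K (λ a c w → 𝟙 (isEdge (a ∷ c ∷ w)))))))
                      (*-monoʳ-≤ (h * b) (vol-blocks K ps)) ⟩
        2 * Sum (L₁ ∷ L₂ ∷ K) (𝟙 ∘ isEdge) + err                             ∎
        where
        open ≤-Reasoning
        late : A → Vec A (1 + s) → Bool
        late c w = not (firstPair χᵥ (rotate (c ∷ w)))
        indep : ∀ a c w → early (a ∷ c ∷ w) ≡ late c w
        indep a c (d ∷ w) = cong not (firstPair-insert χᵥ a (rotate (c ∷ d ∷ w)))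

    -- The tail condition and then the head condition each cost a factor 2 and an error `err`; the
    -- second error is doubled by the first factor, which makes three.
    box-dense : ∀ (V : Vec (List A) (3 + s)) → All (IsBlock k) (toList V) → vol V ≤ 4 * Sum V (𝟙 ∘ isEdge) + 3 * err
    box-dense V bl = begin
      vol V                                            ≡⟨ vol-rotate V ⟨
      vol (rotate V)                                   ≤⟨ tails-lower (rotate V) (Permₚ.All-resp-↭ (Perm.↭-sym (rotate-↭ V)) bl) ⟩
      2 * Sum (rotate V) (λ v → 𝟙 (firstPair (λ a c → not (χᵥ a c)) v)) + err ≡⟨ cong (λ z → 2 * z + err) (trans (Sum-rotate V _) (Sum-cong V (λ v → cong 𝟙 (complement (rotate v))))) ⟩
      2 * Sum V (𝟙 ∘ early) + err                      ≤⟨ +-monoˡ-≤ err (*-monoʳ-≤ 2 (heads-lower V bl)) ⟩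
      2 * (2 * Sum V (𝟙 ∘ isEdge) + err) + err         ≡⟨ lem (Sum V (𝟙 ∘ isEdge)) err ⟩
      4 * Sum V (𝟙 ∘ isEdge) + 3 * err                 ∎
      where
      open ≤-Reasoning
      lem : ∀ x e → 2 * (2 * x + e) + e ≡ 4 * x + 3 * e
      lem = solve-∀
      complement : ∀ (v : Vec A (3 + s)) → firstPair (λ a c → not (χᵥ a c)) v ≡ not (firstPair χᵥ v)
      complement (a ∷ c ∷ v) = refl

    -- A vertex set is cut into its intersections with the intervals. The first error adds up the
    -- discrepancies of at most k^r tuples of blocks, the second counts the sets with two vertices
    -- in one block.
    graph-dense : ∀ S → ∣ S ∣ C (3 + s) ≤
      4 * edgesIn (headTailGraph χᵥ (3 + s)) S + k ^ (3 + s) * (3 * err) + (2 + s) * (b * (k * b) ^ (2 + s))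
    graph-dense S = fromBlocks (blocks k S)
      where
      open ≤-Reasoning
      r = 3 + s
      fromBlocks : (∃ λ Ls → concat Ls ≡ elems S × length Ls ≡ k × All (IsBlock k) Ls) → _
      fromBlocks (Ls , eq , len , bl) = begin
        ∣ S ∣ C r                                                  ≡⟨ trans (cong (_C r) (sym (length-elems S))) (sym (trans (pick-const r (elems S) 1) (*-identityʳ _))) ⟩
        pick r (elems S) (λ _ → 1)                                 ≡⟨ cong (λ xs → pick r xs (λ _ → 1)) eq ⟨
        pick r (concat Ls) (λ _ → 1)                               ≤⟨ pick≤Trans (2 + s) b Ls (λ _ → ≤-refl) (AllL.map block-length bl) ⟩
        Trans r Ls (λ _ → 1) + (2 + s) * (b * length (concat Ls) ^ (2 + s)) ≤⟨ +-mono-≤ transversals (*-monoʳ-≤ (2 + s) (*-monoʳ-≤ b (^-monoˡ-≤ (2 + s) size))) ⟩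
        4 * Trans r Ls (𝟙 ∘ isEdge) + k ^ r * (3 * err) + (2 + s) * (b * (k * b) ^ (2 + s))
          ≤⟨ +-monoˡ-≤ _ (+-monoˡ-≤ _ (*-monoʳ-≤ 4 (≤-trans (Trans≤pick r Ls (𝟙 ∘ isEdge)) (≤-reflexive (trans (cong (λ xs → pick r xs (𝟙 ∘ isEdge)) eq) (sym (edgesIn-headTail χᵥ S))))))) ⟩
        4 * edgesIn (headTailGraph χᵥ r) S + k ^ r * (3 * err) + (2 + s) * (b * (k * b) ^ (2 + s)) ∎
        where
        size : length (concat Ls) ≤ k * b
        size = ≤-trans (≤-reflexive (trans (cong length eq) (length-elems S))) (Subsetₚ.∣p∣≤n S)
        choose≤ : length Ls C r ≤ k ^ r
        choose≤ = begin
          length Ls C r              ≡⟨ trans (pick-const r Ls 1) (*-identityʳ _) ⟨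
          pick r Ls (λ _ → 1)        ≤⟨ pick-≤^ r Ls (λ _ → ≤-refl) ⟩
          length Ls ^ r              ≡⟨ cong (_^ r) len ⟩
          k ^ r                      ∎
        transversals : Trans r Ls (λ _ → 1) ≤ 4 * Trans r Ls (𝟙 ∘ isEdge) + k ^ r * (3 * err)
        transversals = begin
          Trans r Ls (λ _ → 1)                                              ≤⟨ pick-mono-⊆ r Ls (λ Us Us⊆ → ≤-trans (≤-reflexive (Sum-1 Us)) (box-dense Us (Sublistₚ.All-resp-⊆ Us⊆ bl))) ⟩
          pick r Ls (λ Us → 4 * Sum Us (𝟙 ∘ isEdge) + 3 * err)              ≡⟨ trans (pick-+ r Ls _ _) (cong₂ _+_ (pick-*ˡ r Ls 4 _) (pick-const r Ls (3 * err))) ⟩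
          4 * Trans r Ls (𝟙 ∘ isEdge) + (length Ls C r) * (3 * err)         ≤⟨ +-monoʳ-≤ _ (*-monoˡ-≤ (3 * err) choose≤) ⟩
          4 * Trans r Ls (𝟙 ∘ isEdge) + k ^ r * (3 * err)                   ∎

-- The head-tail construction avoids head-tail-mixing hypergraphs

<ᵇ-true⁺ : ∀ {a b} → a < b → (a <ᵇ b) ≡ true
<ᵇ-true⁺ {zero}  {suc b} (s≤s p) = refl
<ᵇ-true⁺ {suc a} {suc b} (s≤s p) = <ᵇ-true⁺ p

<ᵇ-true⁻ : ∀ {a b} → (a <ᵇ b) ≡ true → a < b
<ᵇ-true⁻ {zero}  {suc b} e = s≤s z≤n
<ᵇ-true⁻ {suc a} {suc b} e = s≤s (<ᵇ-true⁻ e)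

earlier later : ∀ {n} → Fin n → Subset n
earlier v = Vec.tabulate (λ u → Fin.toℕ u <ᵇ Fin.toℕ v)
later v   = Vec.tabulate (λ u → Fin.toℕ v <ᵇ Fin.toℕ u)

-- Recursive forms of head and tail for the natural order. They connect the definition by counting
-- predecessors or successors with the first and last entries of `elems`.
firsts lasts : ∀ {n} → ℕ → Subset n → Subset n
firsts j       []          = []
firsts zero    (b ∷ T)     = false ∷ firsts zero T
firsts (suc j) (true ∷ T)  = true ∷ firsts j T
firsts (suc j) (false ∷ T) = false ∷ firsts (suc j) T
lasts j []      = []
lasts j (b ∷ T) = (b ∧ (∣ T ∣ <ᵇ j)) ∷ lasts j T

elems-firsts : ∀ {n} j (T : Subset n) → elems (firsts j T) ≡ List.take j (elems T)
elems-firsts zero    []          = refl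
elems-firsts (suc j) []          = refl
elems-firsts zero    (b ∷ T)     rewrite elems-firsts zero T = refl
elems-firsts (suc j) (true ∷ T)  = cong (zero ∷_) (trans (cong (map suc) (elems-firsts j T)) (sym (Listₚ.take-map j (elems T))))
elems-firsts (suc j) (false ∷ T) = trans (cong (map suc) (elems-firsts (suc j) T)) (sym (Listₚ.take-map (suc j) (elems T)))

elems-lasts : ∀ {n} j (T : Subset n) → elems (lasts j T) ≡ List.drop (∣ T ∣ ∸ j) (elems T)
elems-lasts j []          = sym (Listₚ.drop-[] (0 ∸ j))
elems-lasts j (false ∷ T) = trans (cong (map suc) (elems-lasts j T)) (sym (Listₚ.drop-map (∣ T ∣ ∸ j) (elems T)))
elems-lasts j (true ∷ T) with ∣ T ∣ <ᵇ j in eq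
... | true  = trans (cong (λ l → zero ∷ map suc l) (trans (elems-lasts j T) (cong (λ m → List.drop m (elems T)) (m≤n⇒m∸n≡0 (<⇒≤ le)))))
                (cong (λ m → List.drop m (zero ∷ map suc (elems T))) (sym (m≤n⇒m∸n≡0 le)))
  where
  le : ∣ T ∣ < j
  le = <ᵇ-true⁻ eq
... | false = trans (cong (map suc) (elems-lasts j T)) (trans (sym (Listₚ.drop-map (∣ T ∣ ∸ j) (elems T)))
                (cong (λ m → List.drop m (zero ∷ map suc (elems T))) (sym (+-∸-assoc 1 ge))))
  where
  ge : j ≤ ∣ T ∣
  ge = ≮⇒≥ (λ lt → false≢true (trans (sym eq) (<ᵇ-true⁺ lt)))
    where
    false≢true : false ≢ true
    false≢true ()

∣none∩∣ : ∀ {n} (T : Subset n) → ∣ Vec.tabulate (λ _ → false) ∩ T ∣ ≡ 0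
∣none∩∣ []      = refl
∣none∩∣ (b ∷ T) = ∣none∩∣ T

all∩ : ∀ {n} (T : Subset n) → Vec.tabulate (λ _ → true) ∩ T ≡ T
all∩ []      = refl
all∩ (b ∷ T) = cong (b ∷_) (all∩ T)

lookup-firsts : ∀ {n} j (T : Subset n) v → lookup (firsts j T) v ≡ lookup T v ∧ (∣ earlier v ∩ T ∣ <ᵇ j)
lookup-firsts zero    (b ∷ T)     zero    = sym (trans (cong (λ c → b ∧ (c <ᵇ 0)) (∣none∩∣ T)) (Boolₚ.∧-zeroʳ b))
lookup-firsts (suc j) (true ∷ T)  zero    = cong (_<ᵇ suc j) (sym (∣none∩∣ T))
lookup-firsts (suc j) (false ∷ T) zero    = refl
lookup-firsts zero    (true ∷ T)  (suc v) = trans (lookup-firsts zero T v) (cong (lookup T v ∧_) (zeroᵇ ∣ earlier v ∩ T ∣))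
  where
  zeroᵇ : ∀ c → (c <ᵇ 0) ≡ false
  zeroᵇ zero    = refl
  zeroᵇ (suc c) = refl
lookup-firsts zero    (false ∷ T) (suc v) = lookup-firsts zero T v
lookup-firsts (suc j) (true ∷ T)  (suc v) = lookup-firsts j T v
lookup-firsts (suc j) (false ∷ T) (suc v) = lookup-firsts (suc j) T v

lookup-lasts : ∀ {n} j (T : Subset n) v → lookup (lasts j T) v ≡ lookup T v ∧ (∣ later v ∩ T ∣ <ᵇ j)
lookup-lasts j (b ∷ T) zero    = cong (λ U → b ∧ (∣ U ∣ <ᵇ j)) (sym (all∩ T))
lookup-lasts j (b ∷ T) (suc v) = lookup-lasts j T v

∈-elems⁺ : ∀ {n} {p : Subset n} {v} → lookup p v ≡ true → v ∈ elems p
∈-elems⁺ {p = p} {v} e = lookup-setOf⁻ (elems p) (subst (λ q → lookup q v ≡ true) (sym (setOf-elems p)) e)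

∈-elems⁻ : ∀ {n} {p : Subset n} {v} → v ∈ elems p → lookup p v ≡ true
∈-elems⁻ {p = p} {v} m = subst (λ q → lookup q v ≡ true) (setOf-elems p) (lookup-setOf⁺ m)

elems⊆allFin : ∀ {n} (p : Subset n) → elems p ⊆ allFin n
elems⊆allFin []          = []
elems⊆allFin {suc n} (true  ∷ p) = refl ∷ subst (map suc (elems p) ⊆_) (Listₚ.map-tabulate (λ i → i) suc) (Sublistₚ.map⁺ suc (elems⊆allFin p))
elems⊆allFin {suc n} (false ∷ p) = zero ∷ʳ subst (map suc (elems p) ⊆_) (Listₚ.map-tabulate (λ i → i) suc) (Sublistₚ.map⁺ suc (elems⊆allFin p))

∣update∣ : ∀ {n} (T : Subset n) x → lookup T x ≡ false → ∣ T [ x ]≔ true ∣ ≡ suc ∣ T ∣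
∣update∣ (false ∷ T) zero    e = refl
∣update∣ (true  ∷ T) (suc x) e = cong suc (∣update∣ T x e)
∣update∣ (false ∷ T) (suc x) e = ∣update∣ T x e

∣setOf∣ : ∀ {n} {xs : List (Fin n)} → Uniqueˡ xs → ∣ setOf xs ∣ ≡ length xs
∣setOf∣ {n} {[]}     []       = Subsetₚ.∣⊥∣≡0 n
∣setOf∣ {n} {x ∷ xs} (u ∷ us) = trans (∣update∣ (setOf xs) x absent) (cong suc (∣setOf∣ us))
  where
  absent : lookup (setOf xs) x ≡ false
  absent with lookup (setOf xs) x in eq
  ... | false = refl
  ... | true  = ⊥-elim (AllL.lookup u (lookup-setOf⁻ xs eq) refl)

-- Pulling back the vertex order along an embedding

module _ {k n : ℕ} (φ : Fin k → Fin n) (inj : Injective _≡_ _≡_ φ) where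

  ∣image∣ : ∀ p → ∣ image φ p ∣ ≡ ∣ p ∣
  ∣image∣ p = begin
    ∣ image φ p ∣                   ≡⟨ cong ∣_∣ (image-setOf φ p (elems p) (∈-elems⁻ {p = p}) (∈-elems⁺ {p = p})) ⟩
    ∣ setOf (map φ (elems p)) ∣     ≡⟨ ∣setOf∣ (Uniqueₚ.map⁺ inj (uniqueˡ-⊆ (elems⊆allFin p) (Uniqueₚ.allFin⁺ k))) ⟩
    length (map φ (elems p))        ≡⟨ trans (Listₚ.length-map φ (elems p)) (length-elems p) ⟩
    ∣ p ∣                           ∎
    where open ≡-Reasoning

  private
    pos : Fin k → ℕ
    pos v = Fin.toℕ (φ v)

    predecessors : Fin k → Subset k
    predecessors v = Vec.tabulate (λ u → pos u <ᵇ pos v)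

    predecessor⁺ : ∀ {u v} → pos u < pos v → u Subset.∈ predecessors v
    predecessor⁺ {u} {v} lt = Vecₚ.lookup⇒[]= u _ (trans (Vecₚ.lookup∘tabulate (λ u → pos u <ᵇ pos v) u) (<ᵇ-true⁺ lt))

    predecessor⁻ : ∀ {u v} → u Subset.∈ predecessors v → pos u < pos v
    predecessor⁻ {u} {v} m = <ᵇ-true⁻ (trans (sym (Vecₚ.lookup∘tabulate (λ u → pos u <ᵇ pos v) u)) (Vecₚ.[]=⇒lookup m))

    index< : ∀ v → ∣ predecessors v ∣ < k
    index< v = subst (∣ predecessors v ∣ <_) (Subsetₚ.∣⊤∣≡n k)
      (Subsetₚ.p⊂q⇒∣p∣<∣q∣ ((λ _ → Subsetₚ.∈⊤) , v , Subsetₚ.∈⊤ , λ m → <-irrefl refl (predecessor⁻ {v} {v} m)))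

    index-mono : ∀ {u v} → pos u < pos v → ∣ predecessors u ∣ < ∣ predecessors v ∣
    index-mono {u} {v} lt = Subsetₚ.p⊂q⇒∣p∣<∣q∣
      ((λ {x} m → predecessor⁺ {x} {v} (<-trans (predecessor⁻ {x} {u} m) lt)) , u , predecessor⁺ lt , λ m → <-irrefl refl (predecessor⁻ {u} {u} m))

    index-reflects : ∀ {u v} → ∣ predecessors u ∣ < ∣ predecessors v ∣ → pos u < pos v
    index-reflects {u} {v} lt with <-cmp (pos u) (pos v)
    ... | tri< p _ _ = p
    ... | tri≈ _ e _ = ⊥-elim (<-irrefl (cong (∣_∣ ∘ predecessors) (inj (Finₚ.toℕ-injective e))) lt)
    ... | tri> _ _ p = ⊥-elim (<-asym lt (index-mono p))

  -- An order is an injection into `Fin k`, whereas φ takes values in `Fin n`; so a vertex is ranked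
  -- by the number of vertices that φ maps before its image.
  pullback : LinearOrder k
  pullback = (λ v → Fin.fromℕ< (index< v)) , λ {u} {v} e → same u v (trans (sym (Finₚ.toℕ-fromℕ< (index< u))) (trans (cong Fin.toℕ e) (Finₚ.toℕ-fromℕ< (index< v))))
    where
    same : ∀ u v → ∣ predecessors u ∣ ≡ ∣ predecessors v ∣ → u ≡ v
    same u v e with <-cmp (pos u) (pos v)
    ... | tri< p _ _ = ⊥-elim (<-irrefl e (index-mono p))
    ... | tri≈ _ q _ = inj (Finₚ.toℕ-injective q)
    ... | tri> _ _ p = ⊥-elim (<-irrefl (sym e) (index-mono p))

  private
    o = pullback

    order : ∀ u v → (Fin.toℕ (proj₁ o u) <ᵇ Fin.toℕ (proj₁ o v)) ≡ (pos u <ᵇ pos v)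
    order u v = trans (cong₂ _<ᵇ_ (Finₚ.toℕ-fromℕ< (index< u)) (Finₚ.toℕ-fromℕ< (index< v)))
      (true-ext (λ e → <ᵇ-true⁺ (index-reflects {u} {v} (<ᵇ-true⁻ e))) (λ e → <ᵇ-true⁺ (index-mono {u} {v} (<ᵇ-true⁻ e))))

  image-∩ : ∀ (R : Subset n) (R′ e : Subset k) → (∀ u → lookup R (φ u) ≡ lookup R′ u) → image φ (R′ ∩ e) ≡ R ∩ image φ e
  image-∩ R R′ e same = subset-ext
    (λ v m → let u , q , eq = lookup-image⁻ φ (R′ ∩ e) m
                 q₁ , q₂ = ∧-true (trans (sym (lookup-∩ R′ e u)) q) in
      subst (λ z → lookup (R ∩ image φ e) z ≡ true) eq (trans (lookup-∩ R (image φ e) (φ u)) (cong₂ _∧_ (trans (same u) q₁) (lookup-image⁺ φ e q₂))))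
    (λ v m → let m₁ , m₂ = ∧-true {lookup R v} (trans (sym (lookup-∩ R (image φ e) v)) m)
                 u , q , eq = lookup-image⁻ φ e m₂ in
      subst (λ z → lookup (image φ (R′ ∩ e)) z ≡ true) eq
        (lookup-image⁺ φ (R′ ∩ e) (trans (lookup-∩ R′ e u) (cong₂ _∧_ (trans (sym (same u)) (subst (λ z → lookup R z ≡ true) (sym eq) m₁)) q))))

  private
    -- One argument for heads and tails: `R` and `R′` are initial or final segments that correspond
    -- under φ, so an injective φ preserves the numbers of elements counted.
    image-part : ∀ (part : Subset k) (R : Fin n → Subset n) (R′ : Fin k → Subset k) (e : Subset k) (T : Subset n) →
      (∀ u → lookup part u ≡ lookup e u ∧ (∣ R′ u ∩ e ∣ <ᵇ 2)) →
      (∀ v → lookup T v ≡ lookup (image φ e) v ∧ (∣ R v ∩ image φ e ∣ <ᵇ 2)) →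
      (∀ u w → lookup (R (φ u)) (φ w) ≡ lookup (R′ u) w) → image φ part ≡ T
    image-part part R R′ e T lp lT same = subset-ext
      (λ v m → let u , q , eq = lookup-image⁻ φ part m
                   q₁ , q₂ = ∧-true (trans (sym (lp u)) q) in
        subst (λ z → lookup T z ≡ true) eq (trans (lT (φ u)) (cong₂ _∧_ (lookup-image⁺ φ e q₁) (trans (cong (_<ᵇ 2) (card u)) q₂))))
      (λ v m → let m₁ , m₂ = ∧-true {lookup (image φ e) v} (trans (sym (lT v)) m)
                   u , q , eq = lookup-image⁻ φ e m₁ in
        subst (λ z → lookup (image φ part) z ≡ true) eq (lookup-image⁺ φ part (trans (lp u) (cong₂ _∧_ q
          (trans (cong (_<ᵇ 2) (sym (card u))) (subst (λ z → (∣ R z ∩ image φ e ∣ <ᵇ 2) ≡ true) (sym eq) m₂))))))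
      where
      card : ∀ u → ∣ R (φ u) ∩ image φ e ∣ ≡ ∣ R′ u ∩ e ∣
      card u = trans (cong ∣_∣ (sym (image-∩ (R (φ u)) (R′ u) e (same u)))) (∣image∣ (R′ u ∩ e))

  image-head : ∀ e → image φ (head o e) ≡ firsts 2 (image φ e)
  image-head e = image-part (head o e) earlier (below o) e (firsts 2 (image φ e))
    (Vecₚ.lookup∘tabulate (λ v → lookup e v ∧ (∣ below o v ∩ e ∣ <ᵇ 2))) (lookup-firsts 2 (image φ e))
    (λ u w → trans (Vecₚ.lookup∘tabulate (λ x → Fin.toℕ x <ᵇ pos u) (φ w))
      (trans (sym (order w u)) (sym (Vecₚ.lookup∘tabulate (λ x → Fin.toℕ (proj₁ o x) <ᵇ Fin.toℕ (proj₁ o u)) w))))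

  image-tail : ∀ e → image φ (tail o e) ≡ lasts 2 (image φ e)
  image-tail e = image-part (tail o e) later (above o) e (lasts 2 (image φ e))
    (Vecₚ.lookup∘tabulate (λ v → lookup e v ∧ (∣ above o v ∩ e ∣ <ᵇ 2))) (lookup-lasts 2 (image φ e))
    (λ u w → trans (Vecₚ.lookup∘tabulate (λ x → pos u <ᵇ Fin.toℕ x) (φ w))
      (trans (sym (order u w)) (sym (Vecₚ.lookup∘tabulate (λ x → Fin.toℕ (proj₁ o u) <ᵇ Fin.toℕ (proj₁ o x)) w))))

headTailGraph-free : ∀ {k n r} (F : Hypergraph k r) → HeadTailMixing F → (g : Fin n → Fin n → Bool) → ¬ (F ⊑ headTailGraph g r)
headTailGraph-free {r = r} F mix g (φ , inj , edges) with mix (pullback φ inj)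
... | e , f , e∈ , f∈ , eq = true≢false (trans (sym headRed) tailBlue)
  where
  T = image φ e
  T′ = image φ f
  true≢false : true ≢ false
  true≢false ()
  not-true : ∀ {a} → not a ≡ true → a ≡ false
  not-true {false} _ = refl
  take-two : ∀ l → onFirstTwo g (List.take 2 l) ≡ onFirstTwo g l
  take-two []          = refl
  take-two (x ∷ [])    = refl
  take-two (x ∷ y ∷ l) = refl
  common : elems (image φ (head (pullback φ inj) e)) ≡ lastTwo (elems T′)
  common = trans (cong (elems ∘ image φ) eq) (trans (cong elems (image-tail φ inj f))
    (trans (elems-lasts 2 T′) (cong (λ m → List.drop (m ∸ 2) (elems T′)) (sym (length-elems T′)))))
  headRed : onFirstTwo g (lastTwo (elems T′)) ≡ true
  headRed = trans (cong (onFirstTwo g) (trans (sym common) (trans (cong elems (image-head φ inj e)) (elems-firsts 2 T))))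
    (trans (take-two (elems T)) (proj₁ (∧-true (proj₂ (∧-true {∣ T ∣ ≡ᵇ r} (edges e e∈))))))
  tailBlue : onFirstTwo g (lastTwo (elems T′)) ≡ false
  tailBlue = not-true (proj₂ (∧-true {onFirstTwo g (elems T′)} (proj₂ (∧-true {∣ T′ ∣ ≡ᵇ r} (edges f f∈)))))

-- The lower bound

n≤2^n : ∀ n → n ≤ 2 ^ n
n≤2^n zero    = z≤n
n≤2^n (suc n) = begin
  suc n             ≤⟨ s≤s (n≤2^n n) ⟩
  1 + 2 ^ n         ≤⟨ +-monoˡ-≤ (2 ^ n) (>-nonZero⁻¹ (2 ^ n) {{m^n≢0 2 n}}) ⟩
  2 ^ n + 2 ^ n     ≡⟨ cong (λ z → 2 ^ n + z) (+-identityʳ (2 ^ n)) ⟨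
  2 * 2 ^ n         ∎
  where open ≤-Reasoning

-- The number of blocks k and their size b = h² are chosen so that both error terms of graph-dense are at most C(|S|, r) / J.
module _ (s J : ℕ) .{{_ : NonZero J}} where

  private
    r = 3 + s
    G = (r * J) ^ r

  module _ (h κ : ℕ) .{{_ : NonZero h}} (h≥ : 3 * J * G ≤ h) (κ≡ : J * ((2 + s) * G) ≡ κ) .{{_ : NonZero κ}} where

    private
      b = h * h
      k = r * J * κ
      n = k * b
      instance
        rJ≢0 : NonZero (r * J)
        rJ≢0 = m*n≢0 r J
        k≢0 : NonZero k
        k≢0 = m*n≢0 (r * J) κ

    open ≤-Reasoning

    private
      power : (k * b) ^ r ≡ G * (κ * b) ^ r
      power = trans (cong (_^ r) (*-assoc (r * J) κ b)) (^-* r (r * J) (κ * b))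

    -- As b = h², the factor `h * b * b ^ suc s` is b^r / h, and k^r b^r = G (κ b)^r; the gain h ≥ 3
    -- J G absorbs the constants.
    block-error : J * (k ^ r * (3 * (h * b * b ^ suc s))) ≤ (κ * b) ^ r
    block-error = *-cancelˡ-≤ h (begin
      h * (J * (k ^ r * (3 * (h * b * b ^ suc s))))    ≡⟨ lem₁ h J (k ^ r) (b ^ suc s) ⟩
      3 * J * (k ^ r * b ^ r)                          ≡⟨ cong (3 * J *_) (trans (sym (^-* r k b)) power) ⟩
      3 * J * (G * (κ * b) ^ r)                        ≡⟨ *-assoc (3 * J) G _ ⟨
      3 * J * G * (κ * b) ^ r                          ≤⟨ *-monoˡ-≤ ((κ * b) ^ r) h≥ ⟩
      h * (κ * b) ^ r                                  ∎)
      where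
      lem₁ : ∀ h j k p → h * (j * (k * (3 * (h * (h * h) * p)))) ≡ 3 * j * (k * (h * h * (h * h * p)))
      lem₁ = solve-∀

    -- The error is (r-1)/k times (k b)^r = G (κ b)^r; the factor κ of k absorbs J (r-1) G.
    transversal-error : J * ((2 + s) * (b * (k * b) ^ (2 + s))) ≤ (κ * b) ^ r
    transversal-error = *-cancelˡ-≤ k (begin
      k * (J * ((2 + s) * (b * (k * b) ^ (2 + s))))    ≡⟨ lem₁ k J (2 + s) b ((k * b) ^ (2 + s)) ⟩
      J * ((2 + s) * (k * b) ^ r)                      ≡⟨ cong (λ z → J * ((2 + s) * z)) power ⟩
      J * ((2 + s) * (G * (κ * b) ^ r))                ≡⟨ lem₂ J (2 + s) G ((κ * b) ^ r) ⟩
      J * ((2 + s) * G) * (κ * b) ^ r                  ≡⟨ cong (_* (κ * b) ^ r) κ≡ ⟩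
      κ * (κ * b) ^ r                                  ≤⟨ *-monoˡ-≤ ((κ * b) ^ r) (m≤n*m κ (r * J)) ⟩
      k * (κ * b) ^ r                                  ∎)
      where
      lem₁ : ∀ k j t b p → k * (j * (t * (b * p))) ≡ j * (t * (k * b * p))
      lem₁ = solve-∀
      lem₂ : ∀ j t g p → j * (t * (g * p)) ≡ j * (t * g) * p
      lem₂ = solve-∀

    -- As n = r J κ b, a set of at least n/J vertices has at least r κ b of them.
    binomial-lower : ∀ {m} → n ≤ J * m → (κ * b) ^ r ≤ m C r
    binomial-lower {m} le = ≤-trans (^≤C r (κ * b)) (C-mono r (*-cancelˡ-≤ J (≤-trans (≤-reflexive (lem r J κ b)) le)))
      where
      lem : ∀ r j κ b → j * (r * (κ * b)) ≡ r * j * κ * b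
      lem = solve-∀

    count-lower : ∀ {χ} (had : Hadamard b χ) (S : Subset n) → n ≤ J * ∣ S ∣ →
      J * (∣ S ∣ C r) ≤ 4 * J * edgesIn (headTailGraph (BlockDensity.χᵥ {b} {h} refl χ had k) r) S + 4 * (∣ S ∣ C r)
    count-lower {χ} had S le = begin
      J * N                             ≤⟨ *-monoʳ-≤ J (BlockDensity.graph-dense refl χ had k S) ⟩
      J * (4 * e + E₁ + E₂)             ≡⟨ lem J e E₁ E₂ ⟩
      4 * J * e + (J * E₁ + J * E₂)     ≤⟨ +-monoʳ-≤ (4 * J * e) (+-mono-≤ (≤-trans block-error (binomial-lower le)) (≤-trans transversal-error (binomial-lower le))) ⟩
      -- The two errors amount to 2 N, while ε = 1/J allows 4 N after multiplication by 4 J.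
      4 * J * e + (N + N)               ≤⟨ +-monoʳ-≤ (4 * J * e) (≤-trans (m≤m+n (N + N) (N + N)) (≤-reflexive (lem₂ N))) ⟩
      4 * J * e + 4 * N                 ∎
      where
      N = ∣ S ∣ C r
      e = edgesIn (headTailGraph (BlockDensity.χᵥ {b} {h} refl χ had k) r) S
      E₁ = k ^ r * (3 * (h * b * b ^ suc s))
      E₂ = (2 + s) * (b * (k * b) ^ (2 + s))
      lem : ∀ j e x y → j * (4 * e + x + y) ≡ 4 * j * e + (j * x + j * y)
      lem = solve-∀
      lem₂ : ∀ c → c + c + (c + c) ≡ 4 * c
      lem₂ = solve-∀

-- After multiplication by 4 J the coefficient 1/4 - 1/J becomes J - 4, possibly negative; hence the
-- summand `4 * (∣ S ∣ C r)` on the right of the hypothesis.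
count⇒dense : ∀ {n r} (H : Hypergraph n r) J .{{_ : NonZero J}} →
  (∀ S → n ≤ J * ∣ S ∣ → J * (∣ S ∣ C r) ≤ 4 * J * edgesIn H S + 4 * (∣ S ∣ C r)) → Dense H quarter (+ 1 / J)
count⇒dense {n} {r} H J h S large = ℚₚ.*-cancelˡ-≤-pos (ℕ→ℚ (4 * J)) {{positive}} (begin
    ℕ→ℚ (4 * J) ℚ.* ((quarter ℚ.- ε) ℚ.* ℕ→ℚ c)                    ≡⟨ ℚₚ.*-assoc (ℕ→ℚ (4 * J)) (quarter ℚ.- ε) (ℕ→ℚ c) ⟨
    ℕ→ℚ (4 * J) ℚ.* (quarter ℚ.- ε) ℚ.* ℕ→ℚ c                      ≡⟨ cong (ℚ._* ℕ→ℚ c) coefficient ⟩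
    (ℕ→ℚ J ℚ.+ ℚ.- ℕ→ℚ 4) ℚ.* ℕ→ℚ c                               ≡⟨ ℚₚ.*-distribʳ-+ (ℕ→ℚ c) (ℕ→ℚ J) (ℚ.- ℕ→ℚ 4) ⟩
    ℕ→ℚ J ℚ.* ℕ→ℚ c ℚ.+ (ℚ.- ℕ→ℚ 4) ℚ.* ℕ→ℚ c                     ≡⟨ cong₂ ℚ._+_ (sym (ℕ→ℚ-* J c)) (trans (sym (ℚₚ.neg-distribˡ-* (ℕ→ℚ 4) (ℕ→ℚ c))) (cong ℚ.-_ (sym (ℕ→ℚ-* 4 c)))) ⟩
    ℕ→ℚ (J * c) ℚ.- ℕ→ℚ (4 * c)                                    ≤⟨ ℚₚ.+-monoˡ-≤ (ℚ.- ℕ→ℚ (4 * c)) (ℕ→ℚ-mono (h S size)) ⟩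
    ℕ→ℚ (4 * J * e + 4 * c) ℚ.- ℕ→ℚ (4 * c)                        ≡⟨ cong (ℚ._- ℕ→ℚ (4 * c)) (ℕ→ℚ-+ (4 * J * e) (4 * c)) ⟩
    ℕ→ℚ (4 * J * e) ℚ.+ ℕ→ℚ (4 * c) ℚ.- ℕ→ℚ (4 * c)                ≡⟨ trans (ℚₚ.+-assoc (ℕ→ℚ (4 * J * e)) (ℕ→ℚ (4 * c)) (ℚ.- ℕ→ℚ (4 * c))) (trans (cong (ℕ→ℚ (4 * J * e) ℚ.+_) (ℚₚ.+-inverseʳ (ℕ→ℚ (4 * c)))) (ℚₚ.+-identityʳ (ℕ→ℚ (4 * J * e)))) ⟩
    ℕ→ℚ (4 * J * e)                                                ≡⟨ ℕ→ℚ-* (4 * J) e ⟩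
    ℕ→ℚ (4 * J) ℚ.* ℕ→ℚ e                                          ∎)
  where
  open ℚₚ.≤-Reasoning
  ε = + 1 / J
  c = ∣ S ∣ C r
  e = edgesIn H S
  positive : ℚ.Positive (ℕ→ℚ (4 * J))
  positive = ℚ.positive (ℚₚ.<-≤-trans (reciprocal-positive 1) (ℕ→ℚ-mono {1} {4 * J} (≤-trans (>-nonZero⁻¹ J) (m≤n*m J 4))))
  times-ε : ℕ→ℚ J ℚ.* ε ≡ 1ℚ
  times-ε = trans (ℚₚ.*-comm (ℕ→ℚ J) ε) (reciprocal J)
  coefficient : ℕ→ℚ (4 * J) ℚ.* (quarter ℚ.- ε) ≡ ℕ→ℚ J ℚ.+ ℚ.- ℕ→ℚ 4
  coefficient = trans (ℚₚ.*-distribˡ-+ (ℕ→ℚ (4 * J)) quarter (ℚ.- ε)) (cong₂ ℚ._+_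
    (trans (cong (ℚ._* quarter) (trans (cong ℕ→ℚ (*-comm 4 J)) (ℕ→ℚ-* J 4))) (trans (ℚₚ.*-assoc (ℕ→ℚ J) (ℕ→ℚ 4) quarter)
      (trans (cong (ℕ→ℚ J ℚ.*_) (trans (ℚₚ.*-comm (ℕ→ℚ 4) quarter) (reciprocal 4))) (ℚₚ.*-identityʳ (ℕ→ℚ J)))))
    (trans (sym (ℚₚ.neg-distribʳ-* (ℕ→ℚ (4 * J)) ε)) (cong ℚ.-_ (trans (cong (ℚ._* ε) (ℕ→ℚ-* 4 J))
      (trans (ℚₚ.*-assoc (ℕ→ℚ 4) (ℕ→ℚ J) ε) (trans (cong (ℕ→ℚ 4 ℚ.*_) times-ε) (ℚₚ.*-identityʳ (ℕ→ℚ 4))))))))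
  size : n ≤ J * ∣ S ∣
  size = ℕ→ℚ-cancel (begin
    ℕ→ℚ n                        ≡⟨ trans (sym (ℚₚ.*-identityˡ (ℕ→ℚ n))) (cong (ℚ._* ℕ→ℚ n) (sym times-ε)) ⟩
    ℕ→ℚ J ℚ.* ε ℚ.* ℕ→ℚ n        ≡⟨ ℚₚ.*-assoc (ℕ→ℚ J) ε (ℕ→ℚ n) ⟩
    ℕ→ℚ J ℚ.* (ε ℚ.* ℕ→ℚ n)      ≤⟨ ℕ→ℚ-*-monoˡ J large ⟩
    ℕ→ℚ J ℚ.* ℕ→ℚ ∣ S ∣          ≡⟨ ℕ→ℚ-* J ∣ S ∣ ⟨
    ℕ→ℚ (J * ∣ S ∣)              ∎)

reciprocals→0 : ∀ δ → 0ℚ <ℚ δ → ∃ λ N → ∀ m → N ≤ m → ∣ + 1 / suc m ∣ℚ ≤ℚ δ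
reciprocals→0 δ δ>0 with archimedean δ>0
... | q , _ , big = q , λ m q≤m → begin
    ∣ + 1 / suc m ∣ℚ                         ≡⟨ ℚₚ.0≤p⇒∣p∣≡p (ℚₚ.<⇒≤ (reciprocal-positive (suc m))) ⟩
    + 1 / suc m                              ≡⟨ ℚₚ.*-identityˡ (+ 1 / suc m) ⟨
    1ℚ ℚ.* (+ 1 / suc m)                     ≤⟨ ℚₚ.*-monoʳ-≤-nonNeg (+ 1 / suc m) {{nonNeg m}} (ℚₚ.≤-trans big (ℚₚ.*-monoˡ-≤-nonNeg δ {{ℚ.nonNegative (ℚₚ.<⇒≤ δ>0)}} (ℕ→ℚ-mono (m≤n⇒m≤1+n q≤m)))) ⟩
    δ ℚ.* ℕ→ℚ (suc m) ℚ.* (+ 1 / suc m)      ≡⟨ trans (ℚₚ.*-assoc δ (ℕ→ℚ (suc m)) (+ 1 / suc m)) (cong (δ ℚ.*_) (trans (ℚₚ.*-comm (ℕ→ℚ (suc m)) (+ 1 / suc m)) (reciprocal (suc m)))) ⟩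
    δ ℚ.* 1ℚ                                  ≡⟨ ℚₚ.*-identityʳ δ ⟩
    δ                                         ∎
  where
  open ℚₚ.≤-Reasoning
  nonNeg : ∀ m → ℚ.NonNegative (+ 1 / suc m)
  nonNeg m = ℚ.nonNegative (ℚₚ.<⇒≤ (reciprocal-positive (suc m)))

record DenseFree {k s} (F : Hypergraph k (3 + s)) (J : ℕ) .{{_ : NonZero J}} : Set where
  field
    order : ℕ
    order≥ : J ≤ order
    host  : Hypergraph order (3 + s)
    dense : Dense host quarter (+ 1 / J)
    free  : ¬ (F ⊑ host)

dense-free : ∀ {k s} (F : Hypergraph k (3 + s)) → HeadTailMixing F → ∀ J .{{_ : NonZero J}} → DenseFree F J
dense-free {s = s} F mix J = build (hadamard-exists μ)
  where
  G = ((3 + s) * J) ^ (3 + s)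
  -- As 2^μ ≥ μ, the square root 2^μ of the order of the matrix is as large as the error bound
  -- requires.
  μ = 3 * J * G
  build : ∃ (Hadamard (2 ^ μ * 2 ^ μ)) → DenseFree F J
  build (χ , had) = choose (2 ^ μ) {{m^n≢0 2 μ}} (n≤2^n μ) χ had
    where
    choose : ∀ h .{{_ : NonZero h}} → μ ≤ h → ∀ χ → Hadamard (h * h) χ → DenseFree F J
    choose h μ≤h χ had = record
      { order  = (3 + s) * J * κ * (h * h)
      ; order≥ = ≤-trans (m≤n*m J (3 + s)) (≤-trans (m≤m*n ((3 + s) * J) κ) (m≤m*n ((3 + s) * J * κ) (h * h)))
      ; host   = headTailGraph χᵥ (3 + s)
      ; dense  = count⇒dense (headTailGraph χᵥ (3 + s)) J (count-lower s J h κ μ≤h refl {χ} had)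
      ; free   = headTailGraph-free F mix χᵥ }
      where
      κ = J * ((2 + s) * G)
      instance
        G≢0 : NonZero G
        G≢0 = m^n≢0 ((3 + s) * J) (3 + s) {{m*n≢0 (3 + s) J}}
        SG≢0 : NonZero ((2 + s) * G)
        SG≢0 = m*n≢0 (2 + s) G
        κ≢0 : NonZero κ
        κ≢0 = m*n≢0 J ((2 + s) * G)
        hh≢0 : NonZero (h * h)
        hh≢0 = m*n≢0 h h
      χᵥ = BlockDensity.χᵥ {h * h} {h} refl χ had ((3 + s) * J * κ)

lower-bound : ∀ {k s} (F : Hypergraph k (3 + s)) → HeadTailMixing F → LocallyDenseFree (3 + s) quarter F
lower-bound F mix = record
  { size   = λ m → order (host-at m)
  ; graph  = λ m → host (host-at m)
  ; eps    = λ m → + 1 / suc m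
  ; eps→0  = reciprocals→0
  ; size→∞ = λ M → M , λ m M≤m → ≤-trans (m≤n⇒m≤1+n M≤m) (order≥ (host-at m))
  ; dense  = λ m → dense (host-at m)
  ; free   = λ m → free (host-at m) }
  where
  open DenseFree
  host-at : ∀ m → DenseFree F (suc m)
  host-at m = dense-free F mix (suc m)

theorem3p1 : ∀ (r : ℕ) → 3 ≤ r → ∀ {k : ℕ} (F : Hypergraph k r) →
    QuasiLinear F → HeadTailMixing F → Admits F (XZZY r) →
    UniformTuranDensityIs r F (+ 1 / 4)
theorem3p1 (suc (suc (suc s))) (s≤s (s≤s (s≤s _))) F ql mix (o , adm) = lower-bound F mix , upper-bound F ql o adm
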